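{- Let $K$ be a quadratic field and $c \in K$. Then the directed graph $G(f_c,K)$ does not contain a subgraph isomorphic to the graph $G_8$.
   Context: For $f_c(z) = z^2 + c$ and a number field $K$, $G(f_c,K)$ is the directed graph whose vertices are the points of $K$ (the point at infinity excluded) that are preperiodic for $f_c$, with an edge $x \to y$ iff $f_c(x) = y$. The graph $G_8$ has twelve vertices $a, a', b, b', s, \bar s, p_1, p_2, p_3, \bar p_1, \bar p_2, \bar p_3$ and edges $a \to a$, $b \to a$, $a' \to a'$, $b' \to a'$, $s \to b$, $\bar s \to b$, $p_1 \to p_2$, $p_2 \to p_3$, $p_3 \to p_1$, $\bar p_1 \to p_2$, $\bar p_2 \to p_3$, $\bar p_3 \to p_1$ (equivalently: two distinct fixed points, a point of preperiodic type $1_2$, and a point of period $3$, together with the preimages these force). -}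

module Defs where

open import Data.Nat using (ℕ; zero; suc; _<_)
open import Data.Integer using (ℤ)
open import Data.Rational using (ℚ; _/_)
import Data.Rational as Q
open import Data.Product using (_×_; _,_; ∃; ∃-syntax; Σ-syntax)
open import Relation.Binary.PropositionalEquality using (_≡_)
open import Relation.Nullary using (¬_)

-- The quadratic field Q(√d), for an integer d that is not a square in ℚ.
-- Every quadratic field is isomorphic to one of these.
IsQuadraticParam : ℤ → Set
IsQuadraticParam d = ¬ (∃[ q ] (q Q.* q ≡ d / 1))

-- Elements a + b√d represented as pairs (a , b) of rationals
-- (ℚ is normalised, so _≡_ is the field equality).
QF : ℤ → Set
QF d = ℚ × ℚ

module _ {d : ℤ} where
  infixl 6 _⊕_
  infixl 7 _⊗_

  _⊕_ : QF d → QF d → QF d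
  (a , b) ⊕ (a' , b') = (a Q.+ a') , (b Q.+ b')

  _⊗_ : QF d → QF d → QF d
  (a , b) ⊗ (a' , b') = ((a Q.* a') Q.+ ((d / 1) Q.* (b Q.* b'))) , ((a Q.* b') Q.+ (b Q.* a'))

f : (d : ℤ) → QF d → QF d → QF d
f d c z = _⊕_ {d} (_⊗_ {d} z z) c

iter : {A : Set} → (A → A) → ℕ → A → A
iter g zero x = x
iter g (suc n) x = g (iter g n x)

Preperiodic : {A : Set} → (A → A) → A → Set
Preperiodic g x = ∃[ m ] ∃[ n ] (0 < n × iter g (m Data.Nat.+ n) x ≡ iter g m x)

data V8 : Set where
  a a' b b' s s̄ p₁ p₂ p₃ p̄₁ p̄₂ p̄₃ : V8

data Edge8 : V8 → V8 → Set where
  e1 : Edge8 a a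
  e2 : Edge8 b a
  e3 : Edge8 a' a'
  e4 : Edge8 b' a'
  e5 : Edge8 s b
  e6 : Edge8 s̄ b
  e7 : Edge8 p₁ p₂
  e8 : Edge8 p₂ p₃
  e9 : Edge8 p₃ p₁
  e10 : Edge8 p̄₁ p₂
  e11 : Edge8 p̄₂ p₃
  e12 : Edge8 p̄₃ p₁

ContainsG8 : (d : ℤ) → QF d → Set
ContainsG8 d c = Σ[ φ ∈ (V8 → QF d) ]
  ( (∀ u v → φ u ≡ φ v → u ≡ v)
  × (∀ v → Preperiodic (f d c) (φ v))
  × (∀ u v → Edge8 u v → f d c (φ u) ≡ φ v) )

module Submission where

open import Data.Integer as _ using (ℤ)
open import Relation.Nullary as _ using (¬_)
open import Algebra.Structures as _ using (IsCommutativeRing)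
open import Data.Bool.Base as _ using (Bool; true; false; _∧_; if_then_else_)
open import Data.Empty as _ using (⊥; ⊥-elim)
open import Data.Fin.Base as _ using (Fin; zero; suc)
open import Data.Integer as _ using (ℤ; +_; -[1+_]; +0; 0ℤ; 1ℤ; -1ℤ; ∣_∣; _+_; _*_; _-_; -_)
import Data.Integer as ℤ using (_^_; _≟_; _⊖_)
import Data.Integer.Properties as ℤ using (*-assoc; *-cancelˡ-≡; *-comm; *-distribˡ-+; *-identityʳ; *-identityˡ; *-zeroʳ; +-*-isCommutativeRing; +-assoc; +-comm; +-identityʳ; +-identityˡ; +-injective; +-inverseʳ; +-inverseˡ; +∣i∣≡i⊎+∣i∣≡-i; [+m]-[+n]≡m⊖n; abs-*; i*j≡0⇒i≡0∨j≡0; m-n≡m⊖n; neg-distribʳ-*; neg-involutive; pos-*; pos-+; ∣-i∣≡∣i∣; ∣i+j∣≤∣i∣+∣j∣; ∣i-j∣≤∣i∣+∣j∣; ∣i∣≡0⇒i≡0; ∣m⊖n∣≡∣n⊖m∣; ∣⊖∣-≤; ⊖-≥)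
open import Data.List.Base as _ using (List; []; _∷_)
open import Data.Nat.Base as _ using (ℕ; zero; suc)
import Data.Nat.Base as ℕ using (>-nonZero⁻¹; NonZero; _%_; _*_; _+_; _<_; _∸_; _≡ᵇ_; _≤_; s≤s; z≤n; ≢-nonZero)
import Data.Nat.Properties as ℕ using (*-assoc; *-cancelʳ-<; *-cancelˡ-<; *-cancelˡ-≡; *-comm; *-distribʳ-+; *-identityʳ; *-identityˡ; *-mono-<; *-mono-≤; *-monoʳ-≤; *-monoˡ-<; *-suc; *-zeroʳ; +-assoc; +-cancelˡ-≡; +-cancelˡ-≤; +-comm; +-identityʳ; +-mono-<-≤; +-mono-≤; +-monoʳ-<; +-monoʳ-≤; +-monoˡ-<; +-monoˡ-≤; +-suc; 1+n≰n; <-cmp; <-irrefl; <-≤-connex; <⇒≤; <⇒≱; _≟_; _≤?_; m*n≡0⇒m≡0∨n≡0; m*n≡1⇒m≡1; m*n≢0; m+[n∸m]≡n; m+n≡0⇒m≡0; m+n≡0⇒n≡0; m<m*n; m∸n+n≡m; m∸n≡0⇒m≤n; m∸n≤m; m≤m*n; m≤m+n; m≤n+m; m≤n+o⇒m∸n≤o; m≤n⇒m<n∨m≡n; n<1+n; n≤1+n; suc-injective; ≡ᵇ⇒≡; ≤-<-trans; ≤-antisym; ≤-refl; ≤-reflexive; ≤-total; ≤-trans; ≤∧≢⇒<; ≮⇒≥; ≰⇒>; module ≤-Reasoning)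
import Data.Nat.Induction as ℕ using (<-rec; <-wellFounded; Acc; acc)
open import Data.Product as _ using (_×_; _,_; proj₁; proj₂; ∃; ∃-syntax; Σ-syntax)
open import Data.Sum as _ using (_⊎_; inj₁; inj₂; [_,_]′)
open import Data.Vec.Base as _ using (Vec; []; _∷_; lookup; map; tabulate)
open import Data.Vec.Properties as _ using (lookup-map)
open import Data.Vec.N-ary as _ using (N-ary; _$ⁿ_; ∀ⁿ; curryⁿ)
open import Function.Base as _ using (_∘_; case_of_)
open import Relation.Binary.PropositionalEquality as _ using (_≡_; _≢_; refl; sym; trans; cong; cong₂; subst; subst₂; isEquivalence; module ≡-Reasoning)
open import Relation.Nullary as _ using (¬_; Dec; yes; no)
open import Data.Integer.DivMod as _ using (_/ℕ_; _%ℕ_; a≡a%ℕn+[a/ℕn]*n; n%ℕd<d)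
open import Data.Nat.Divisibility as _ using (_∣_; divides; ∣-refl; ∣m+n∣m⇒∣n; ∣m∣n⇒∣m+n; n∣m*n; m∣m*n)
open import Relation.Binary.Definitions as _ using (tri<; tri≈; tri>)
open import Data.Bool.Base as _ using () renaming (T to True)
open import Data.Nat.Divisibility as _ using (m%n≡0⇒n∣m)
open import Data.Nat.DivMod as _ using (m*n%n≡0)
open import Data.Nat.Base as _ using () renaming (_+_ to infixl 6 _∔_; _*_ to infixl 7 _∙_)
open import Data.Nat.Coprimality as _ using (Coprime; coprime-divisor; coprime-factors)
import Data.Nat.Coprimality as Coprimality using (sym)
open import Data.Nat.Divisibility as _ using (∣-trans; ∣-antisym; ∣1⇒≡1; ∣m⇒∣m*n; ∣n⇒∣m*n; *-cancelʳ-∣; ∣⇒≤)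
open import Data.Nat.GCD as _ using (gcd; gcd[m,n]∣m; gcd[m,n]∣n; gcd-greatest; gcd[m,n]≢0)
open import Data.List.Relation.Unary.All as _ using (All; []; _∷_)
import Data.List.Relation.Unary.All as All using (map)
open import Data.Rational.Base as _ using (ℚ; 0ℚ; 1ℚ; 1/_; toℚᵘ; ↥_; ↧_)
import Data.Rational.Base as ℚ using (_*_; _+_; _/_; ↧ₙ_; ≢-nonZero)
open import Data.Rational.Literals as _ using (fromℤ)
import Data.Rational.Properties as ℚ using (*-assoc; *-identityʳ; *-inverseʳ; +-*-isCommutativeRing; toℚᵘ-fromℚᵘ; toℚᵘ-homo-*; toℚᵘ-homo-+; toℚᵘ-injective; ↥p≡0⇒p≡0)
open import Data.Rational.Unnormalised.Base as _ using (mkℚᵘ; *≡*)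
import Data.Rational.Unnormalised.Properties as ℚᵘ using (≃-sym; ≃-trans)

-- Let a be the fixed point below `b`, so that b = -a and s² + c = -a, and let z₁ → z₂ → z₃ → z₁ be
-- the 3-cycle. Put x = z₁ + z₂, h = x² + x, A = x³ + x² - 2x - 1 and y = h(2a - 1). Then y² = F(x)
-- with F = A² + 8h², a genus 2 curve that is a model of X₁(18), and (2hs)² = (y + h)(y - 3h). The
-- points with h = 0 and the two points at infinity are cusps and do not come from a 3-cycle. So it
-- suffices that no point over a quadratic field with h ≠ 0 makes (y + h)(y - 3h) a square in that
-- field. Rotating the cycle acts through the automorphism σ of order 3 given by x ↦ -1/(x + 1),
-- which fixes A/h and y/h.
--
-- Suppose x is rational. If y is rational too, a 3-adic argument applies: either x is congruent to
-- the abscissa of a cusp, or x ≡ 1 and F(x) is exactly divisible by 3 (`rational-point`). If y is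
-- irrational, taking norms makes (A² + 7h²)(A² - h²) a rational square, which a Fermat descent
-- excludes (`no-solution`, `rational-twist`).
--
-- Suppose x is irrational, with tx² + px + q = 0 and t²wy = ux + v over ℤ. The pair of conjugate
-- points is then a rational point of the Jacobian J in Mumford's representation, and after rotating
-- the cycle 3 does not divide t. The key fact is `point-integral`: a power of 3 dividing w divides
-- u and v as well, for otherwise J would have a nonzero rational point 3-adically close to 0. So w
-- may be taken prime to 3, and an enumeration modulo 3 (`classify`) leaves two cases. Either the
-- pair reduces to a pair of cusps; then its difference with those cusps is nonzero and close to 0,
-- which is excluded by integrality again (`Subtract.absurd`). Or x ≡ 1 is a root modulo 3; then the
-- norm of (y + h)(y - 3h) is, up to squares, 3 times a number prime to 3, hence not a square
-- (`near-one`).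
--
-- That J has no nonzero rational point close to 0 is proved by descent along the isogeny 1 - σ.
-- With T = (x - ω)/(x - ω̄) the curve becomes Y² = ω²T⁶ + 10T³ + ω̄², and σ multiplies T by a cube
-- root of unity. A point of J is encoded by a curve eY = βT³ + β̄ through it, whose other
-- intersections are its σ-conjugates; this is a `Datum`, and it contains the equation (β - ωe)(β +
-- ωe) = Λa₀³. Valuations at the primes not dividing 6, together with separate arguments at 2 and
-- √-3, show that Λ(β ± ωe) are cubes in ℤ[ω] (`CubeRoot.cube-root`). From the cube roots, `Descent`
-- writes down a datum for a preimage under 1 - σ. The distance from 0 is measured by k = v(e) -
-- v(β) - 2, with v the order at √-3. Each division lowers k by exactly one, and k = 0 is impossible
-- (`no-datum`).
--
-- Prime divisors and cube roots are only shown to exist up to double negation, which is enough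
-- because every goal they serve is a contradiction.

-- Identities in commutative rings by normalisation.

module PolynomialSolver {R : Set} {_+′_ _*′_ : R → R → R} { -′_ : R → R} {0′ 1′ : R}
  (isCR : IsCommutativeRing _≡_ _+′_ _*′_ -′_ 0′ 1′) (isZero : R → Bool)
  (isZero-sound : ∀ x → isZero x ≡ true → x ≡ 0′) where

  open IsCommutativeRing isCR using
    (+-assoc; +-comm; +-identityˡ; +-identityʳ; -‿inverseʳ; *-assoc; *-comm; *-identityˡ; distribˡ; distribʳ; zeroˡ; zeroʳ)

  infixl 6 _:+_ _:-_
  infixl 7 _:*_
  infix 8 :-_
  infix 4 _:=_

  data Expr (n : ℕ) : Set where
    var : Fin n → Expr n
    κ : R → Expr n
    _:+_ _:*_ : Expr n → Expr n → Expr n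
    :-_ : Expr n → Expr n

  _:-_ : ∀ {n} → Expr n → Expr n → Expr n
  a :- b = a :+ (:- b)

  _:=_ : ∀ {n} → Expr n → Expr n → Expr n × Expr n
  _:=_ = _,_

  ⟦_⟧ : ∀ {n} → Expr n → Vec R n → R
  ⟦ var i ⟧ ρ = lookup ρ i
  ⟦ κ c ⟧ ρ = c
  ⟦ a :+ b ⟧ ρ = ⟦ a ⟧ ρ +′ ⟦ b ⟧ ρ
  ⟦ a :* b ⟧ ρ = ⟦ a ⟧ ρ *′ ⟦ b ⟧ ρ
  ⟦ :- a ⟧ ρ = -′ ⟦ a ⟧ ρ

  private
    -- Recursive Horner form: a polynomial in n + 1 variables is the list, constant term first, of
    -- its coefficients with respect to the first variable, which are polynomials in the others.
    Poly : ℕ → Set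
    Poly zero = R
    Poly (suc n) = List (Poly n)

    eval : ∀ n → Poly n → Vec R n → R
    eval zero c [] = c
    eval (suc n) [] (x ∷ ρ) = 0′
    eval (suc n) (p ∷ ps) (x ∷ ρ) = eval n p ρ +′ (x *′ eval (suc n) ps (x ∷ ρ))

    const : ∀ n → R → Poly n
    const zero c = c
    const (suc n) c = const n c ∷ []

    null : ∀ n → Poly n → Bool
    null zero c = isZero c
    null (suc n) [] = true
    null (suc n) (p ∷ ps) = null n p ∧ null (suc n) ps

    add : ∀ n → Poly n → Poly n → Poly n
    add zero a b = a +′ b
    add (suc n) [] q = q
    add (suc n) (p ∷ ps) [] = p ∷ ps
    add (suc n) (p ∷ ps) (q ∷ qs) = add n p q ∷ add (suc n) ps qs

    shift : ∀ n → Poly (suc n) → Poly (suc n)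
    shift n [] = []
    shift n (p ∷ ps) = const n 0′ ∷ p ∷ ps

    mutual
      mul : ∀ n → Poly n → Poly n → Poly n
      mul zero a b = a *′ b
      mul (suc n) [] q = []
      mul (suc n) (p ∷ ps) q =
        -- Dropping the row of a zero coefficient keeps the normal forms of sparse polynomials
        -- short.
        add (suc n) (if null n p then [] else scale n p q) (shift n (mul (suc n) ps q))

      scale : ∀ n → Poly n → Poly (suc n) → Poly (suc n)
      scale n p [] = []
      scale n p (q ∷ qs) = mul n p q ∷ scale n p qs

    variable′ : ∀ n → Fin n → Poly n
    variable′ (suc n) zero = const n 0′ ∷ const n 1′ ∷ []
    variable′ (suc n) (suc i) = variable′ n i ∷ []

    norm : ∀ {n} → Expr n → Poly n
    norm {n} (var i) = variable′ n i
    norm {n} (κ c) = const n c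
    norm {n} (a :+ b) = add n (norm a) (norm b)
    norm {n} (a :* b) = mul n (norm a) (norm b)
    norm {n} (:- a) = mul n (const n (-′ 1′)) (norm a)

    x+y*0 : ∀ x y → x +′ (y *′ 0′) ≡ x
    x+y*0 x y = trans (cong (x +′_) (zeroʳ y)) (+-identityʳ x)

    interchange : ∀ a b c d → (a +′ b) +′ (c +′ d) ≡ (a +′ c) +′ (b +′ d)
    interchange a b c d = begin
      (a +′ b) +′ (c +′ d)  ≡⟨ +-assoc a b (c +′ d) ⟩
      a +′ (b +′ (c +′ d))  ≡⟨ cong (a +′_) (sym (+-assoc b c d)) ⟩
      a +′ ((b +′ c) +′ d)  ≡⟨ cong (λ t → a +′ (t +′ d)) (+-comm b c) ⟩
      a +′ ((c +′ b) +′ d)  ≡⟨ cong (a +′_) (+-assoc c b d) ⟩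
      a +′ (c +′ (b +′ d))  ≡⟨ sym (+-assoc a c (b +′ d)) ⟩
      (a +′ c) +′ (b +′ d)  ∎
      where open ≡-Reasoning

    left-comm : ∀ a b c → a *′ (b *′ c) ≡ b *′ (a *′ c)
    left-comm a b c = trans (sym (*-assoc a b c)) (trans (cong (_*′ c) (*-comm a b)) (*-assoc b a c))

    eval-const : ∀ n c ρ → eval n (const n c) ρ ≡ c
    eval-const zero c [] = refl
    eval-const (suc n) c (x ∷ ρ) = trans (x+y*0 _ x) (eval-const n c ρ)

    eval-null : ∀ n p ρ → null n p ≡ true → eval n p ρ ≡ 0′
    eval-null zero c [] e = isZero-sound c e
    eval-null (suc n) [] (x ∷ ρ) e = refl
    eval-null (suc n) (p ∷ ps) (x ∷ ρ) e with null n p in e₁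
    ... | true = trans (cong₂ (λ s t → s +′ (x *′ t)) (eval-null n p ρ e₁) (eval-null (suc n) ps (x ∷ ρ) e)) (x+y*0 0′ x)

    eval-add : ∀ n p q ρ → eval n (add n p q) ρ ≡ eval n p ρ +′ eval n q ρ
    eval-add zero a b [] = refl
    eval-add (suc n) [] q (x ∷ ρ) = sym (+-identityˡ _)
    eval-add (suc n) (p ∷ ps) [] (x ∷ ρ) = sym (+-identityʳ _)
    eval-add (suc n) (p ∷ ps) (q ∷ qs) (x ∷ ρ) =
      trans (cong₂ (λ s t → s +′ (x *′ t)) (eval-add n p q ρ) (eval-add (suc n) ps qs (x ∷ ρ)))
        (trans (cong₂ _+′_ refl (distribˡ x _ _)) (interchange _ _ _ _))

    eval-shift : ∀ n p x ρ → eval (suc n) (shift n p) (x ∷ ρ) ≡ x *′ eval (suc n) p (x ∷ ρ)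
    eval-shift n [] x ρ = sym (zeroʳ x)
    eval-shift n (p ∷ ps) x ρ = trans (cong₂ _+′_ (eval-const n 0′ ρ) refl) (+-identityˡ _)

    mutual
      eval-mul : ∀ n p q ρ → eval n (mul n p q) ρ ≡ eval n p ρ *′ eval n q ρ
      eval-mul zero a b [] = refl
      eval-mul (suc n) [] q (x ∷ ρ) = sym (zeroˡ _)
      eval-mul (suc n) (p ∷ ps) q (x ∷ ρ) =
        trans (eval-add (suc n) (if null n p then [] else scale n p q) _ (x ∷ ρ))
          (trans (cong₂ _+′_ head tail) (sym (distribʳ (eval (suc n) q (x ∷ ρ)) (eval n p ρ) _)))
        where
        tail = trans (eval-shift n (mul (suc n) ps q) x ρ)
                 (trans (cong (x *′_) (eval-mul (suc n) ps q (x ∷ ρ))) (sym (*-assoc x _ _)))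
        head : eval (suc n) (if null n p then [] else scale n p q) (x ∷ ρ) ≡ eval n p ρ *′ eval (suc n) q (x ∷ ρ)
        head with null n p in e
        ... | true = sym (trans (cong (_*′ _) (eval-null n p ρ e)) (zeroˡ _))
        ... | false = eval-scale n p q x ρ

      eval-scale : ∀ n p q x ρ → eval (suc n) (scale n p q) (x ∷ ρ) ≡ eval n p ρ *′ eval (suc n) q (x ∷ ρ)
      eval-scale n p [] x ρ = sym (zeroʳ _)
      eval-scale n p (q ∷ qs) x ρ =
        trans (cong₂ (λ s t → s +′ (x *′ t)) (eval-mul n p q ρ) (eval-scale n p qs x ρ))
          (trans (cong₂ _+′_ refl (left-comm x _ _)) (sym (distribˡ (eval n p ρ) _ _)))

    eval-var : ∀ n i ρ → eval n (variable′ n i) ρ ≡ lookup ρ i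
    eval-var (suc n) zero (x ∷ ρ) =
      trans (cong₂ _+′_ (eval-const n 0′ ρ) (cong (x *′_) (trans (x+y*0 _ x) (eval-const n 1′ ρ))))
        (trans (+-identityˡ _) (trans (*-comm x 1′) (*-identityˡ x)))
    eval-var (suc n) (suc i) (x ∷ ρ) = trans (x+y*0 _ x) (eval-var n i ρ)

    neg : ∀ x → (-′ 1′) *′ x ≡ -′ x
    neg x = begin
      (-′ 1′) *′ x                       ≡⟨ sym (+-identityʳ _) ⟩
      ((-′ 1′) *′ x) +′ 0′               ≡⟨ cong₂ _+′_ refl (sym (-‿inverseʳ x)) ⟩
      ((-′ 1′) *′ x) +′ (x +′ (-′ x))    ≡⟨ sym (+-assoc _ x _) ⟩
      (((-′ 1′) *′ x) +′ x) +′ (-′ x)    ≡⟨ cong (λ t → (((-′ 1′) *′ x) +′ t) +′ (-′ x)) (sym (*-identityˡ x)) ⟩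
      (((-′ 1′) *′ x) +′ (1′ *′ x)) +′ (-′ x) ≡⟨ cong (_+′ (-′ x)) (sym (distribʳ x (-′ 1′) 1′)) ⟩
      (((-′ 1′) +′ 1′) *′ x) +′ (-′ x)   ≡⟨ cong (λ t → (t *′ x) +′ (-′ x)) (trans (+-comm _ _) (-‿inverseʳ 1′)) ⟩
      (0′ *′ x) +′ (-′ x)                ≡⟨ cong (_+′ (-′ x)) (zeroˡ x) ⟩
      0′ +′ (-′ x)                       ≡⟨ +-identityˡ _ ⟩
      -′ x ∎
      where open ≡-Reasoning

    correct : ∀ {n} (e : Expr n) ρ → eval n (norm e) ρ ≡ ⟦ e ⟧ ρ
    correct {n} (var i) ρ = eval-var n i ρ
    correct {n} (κ c) ρ = eval-const n c ρ
    correct {n} (a :+ b) ρ = trans (eval-add n (norm a) (norm b) ρ) (cong₂ _+′_ (correct a ρ) (correct b ρ))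
    correct {n} (a :* b) ρ = trans (eval-mul n (norm a) (norm b) ρ) (cong₂ _*′_ (correct a ρ) (correct b ρ))
    correct {n} (:- a) ρ = trans (eval-mul n (const n (-′ 1′)) (norm a) ρ)
      (trans (cong₂ _*′_ (eval-const n (-′ 1′) ρ) (correct a ρ)) (neg _))

    difference : ∀ a b → a +′ (-′ b) ≡ 0′ → a ≡ b
    difference a b e = begin
      a                       ≡⟨ sym (+-identityʳ a) ⟩
      a +′ 0′                 ≡⟨ cong (a +′_) (sym (trans (+-comm _ b) (-‿inverseʳ b))) ⟩
      a +′ ((-′ b) +′ b)      ≡⟨ sym (+-assoc a (-′ b) b) ⟩
      (a +′ (-′ b)) +′ b      ≡⟨ cong (_+′ b) e ⟩
      0′ +′ b                 ≡⟨ +-identityˡ b ⟩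
      b                       ∎
      where open ≡-Reasoning

  vars : ∀ n → Vec (Expr n) n
  vars n = tabulate var

  check : ∀ n → N-ary n (Expr n) (Expr n × Expr n) → Bool
  check n f = null n (norm (proj₁ (f $ⁿ vars n) :- proj₂ (f $ⁿ vars n)))

  abstract
    -- Two expressions agree as soon as the normal form of their difference has only zero
    -- coefficients. This test is a closed computation, so every use supplies `refl` for it.
    solve : ∀ n (f : N-ary n (Expr n) (Expr n × Expr n)) → check n f ≡ true →
      ∀ⁿ n (curryⁿ {n = n} (λ ρ → ⟦ proj₁ (f $ⁿ vars n) ⟧ ρ ≡ ⟦ proj₂ (f $ⁿ vars n) ⟧ ρ))
    solve n f e = close n _ λ ρ → difference _ _
      (trans (sym (correct (proj₁ (f $ⁿ vars n) :- proj₂ (f $ⁿ vars n)) ρ)) (eval-null n _ ρ e))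
      where
      close : ∀ n (P : Vec R n → Set) → (∀ ρ → P ρ) → ∀ⁿ n (curryⁿ {n = n} P)
      close zero P h = h []
      close (suc n) P h = λ x → close n (λ ρ → P (x ∷ ρ)) λ ρ → h (x ∷ ρ)

isZeroℤ : ℤ → Bool
isZeroℤ +0 = true
isZeroℤ _ = false

isZeroℤ-sound : ∀ x → isZeroℤ x ≡ true → x ≡ 0ℤ
isZeroℤ-sound +0 e = refl

module ℤS = PolynomialSolver ℤ.+-*-isCommutativeRing isZeroℤ isZeroℤ-sound

-- Eisenstein integers: norm, Euclidean division, prime divisors.

-- The Eisenstein integers; a +ω b stands for a + bω with ω² + ω + 1 = 0.
infix 5 _+ω_
record 𝔼 : Set where
  no-eta-equality
  pattern
  constructor _+ω_
  field re im : ℤ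


infixl 6 _⊹_ _⊖_
infixl 7 _·_
infix 8 ⊝_

_⊹_ _·_ _⊖_ : 𝔼 → 𝔼 → 𝔼
(a +ω b) ⊹ (c +ω d) = (a + c) +ω (b + d)
(a +ω b) · (c +ω d) = (a * c + - (b * d)) +ω (a * d + b * c + - (b * d))

⊝_ : 𝔼 → 𝔼
⊝ (a +ω b) = (- a) +ω (- b)

x ⊖ y = x ⊹ (⊝ y)

ι : ℤ → 𝔼
ι n = n +ω 0ℤ

-- `ϖ` is √-3 = ω - ω̄, a generator of the prime above 3: its square is -3 and conjugation negates
-- it.
0ᴱ 1ᴱ ω ϖ : 𝔼
0ᴱ = ι 0ℤ
1ᴱ = ι 1ℤ
ω = 0ℤ +ω 1ℤ
ϖ = 1ℤ +ω (+ 2)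

-- Complex conjugation: ω ↦ ω² = -1 - ω.
_ᶜ : 𝔼 → 𝔼
(a +ω b) ᶜ = (a + - b) +ω (- b)
infix 10 _ᶜ

𝔼-ext : ∀ {a b c d} → a ≡ c → b ≡ d → (a +ω b) ≡ (c +ω d)
𝔼-ext refl refl = refl

private
  ·-assoc : ∀ x y z → (x · y) · z ≡ x · (y · z)
  ·-assoc (a +ω b) (c +ω d) (e +ω f) = 𝔼-ext
    (solve 6 (λ a b c d e f → (a :* c :- b :* d) :* e :- (a :* d :+ b :* c :- b :* d) :* f
      := a :* (c :* e :- d :* f) :- b :* (c :* f :+ d :* e :- d :* f)) refl a b c d e f)
    (solve 6 (λ a b c d e f → (a :* c :- b :* d) :* f :+ (a :* d :+ b :* c :- b :* d) :* e :- (a :* d :+ b :* c :- b :* d) :* f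
      := a :* (c :* f :+ d :* e :- d :* f) :+ b :* (c :* e :- d :* f) :- b :* (c :* f :+ d :* e :- d :* f)) refl a b c d e f)
    where open ℤS

  ·-comm : ∀ x y → x · y ≡ y · x
  ·-comm (a +ω b) (c +ω d) = 𝔼-ext
    (solve 4 (λ a b c d → a :* c :- b :* d := c :* a :- d :* b) refl a b c d)
    (solve 4 (λ a b c d → a :* d :+ b :* c :- b :* d := c :* b :+ d :* a :- d :* b) refl a b c d)
    where open ℤS

  ·-identityˡ : ∀ x → 1ᴱ · x ≡ x
  ·-identityˡ (a +ω b) = 𝔼-ext
    (solve 2 (λ a b → κ 1ℤ :* a :- κ 0ℤ :* b := a) refl a b)
    (solve 2 (λ a b → κ 1ℤ :* b :+ κ 0ℤ :* a :- κ 0ℤ :* b := b) refl a b)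
    where open ℤS

  ·-distribˡ : ∀ x y z → x · (y ⊹ z) ≡ x · y ⊹ x · z
  ·-distribˡ (a +ω b) (c +ω d) (e +ω f) = 𝔼-ext
    (solve 6 (λ a b c d e f → a :* (c :+ e) :- b :* (d :+ f)
      := (a :* c :- b :* d) :+ (a :* e :- b :* f)) refl a b c d e f)
    (solve 6 (λ a b c d e f → a :* (d :+ f) :+ b :* (c :+ e) :- b :* (d :+ f)
      := (a :* d :+ b :* c :- b :* d) :+ (a :* f :+ b :* e :- b :* f)) refl a b c d e f)
    where open ℤS

𝔼-isCommutativeRing : IsCommutativeRing _≡_ _⊹_ _·_ ⊝_ 0ᴱ 1ᴱ
𝔼-isCommutativeRing = record
  { isRing = record
    { +-isAbelianGroup = record
      { isGroup = record
        { isMonoid = record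
          { isSemigroup = record
            { isMagma = record { isEquivalence = isEquivalence ; ∙-cong = cong₂ _⊹_ }
            ; assoc = λ { (a +ω b) (c +ω d) (e +ω f) → 𝔼-ext (ℤ.+-assoc a c e) (ℤ.+-assoc b d f) } }
          ; identity = (λ { (a +ω b) → 𝔼-ext (ℤ.+-identityˡ _) (ℤ.+-identityˡ _) }) , (λ { (a +ω b) → 𝔼-ext (ℤ.+-identityʳ _) (ℤ.+-identityʳ _) }) }
        ; inverse = (λ { (a +ω b) → 𝔼-ext (ℤ.+-inverseˡ a) (ℤ.+-inverseˡ b) }) , (λ { (a +ω b) → 𝔼-ext (ℤ.+-inverseʳ a) (ℤ.+-inverseʳ b) })
        ; ⁻¹-cong = cong ⊝_ }
      ; comm = λ { (a +ω b) (c +ω d) → 𝔼-ext (ℤ.+-comm a c) (ℤ.+-comm b d) } }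
    ; *-cong = cong₂ _·_
    ; *-assoc = ·-assoc
    ; *-identity = ·-identityˡ , λ x → trans (·-comm x _) (·-identityˡ x)
    ; distrib = ·-distribˡ , λ x y z → trans (·-comm (y ⊹ z) x) (trans (·-distribˡ x y z) (cong₂ _⊹_ (·-comm x y) (·-comm x z)))
    }
  ; *-comm = ·-comm }

isZero𝔼 : 𝔼 → Bool
isZero𝔼 (a +ω b) = isZeroℤ a ∧ isZeroℤ b

isZero𝔼-sound : ∀ x → isZero𝔼 x ≡ true → x ≡ 0ᴱ
isZero𝔼-sound (+0 +ω +0) e = refl

module 𝔼S = PolynomialSolver 𝔼-isCommutativeRing isZero𝔼 isZero𝔼-sound


conj-⊹ : ∀ x y → (x ⊹ y) ᶜ ≡ x ᶜ ⊹ y ᶜ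
conj-⊹ (a +ω b) (c +ω d) = 𝔼-ext
  (solve 4 (λ a b c d → a :+ c :- (b :+ d) := a :- b :+ (c :- d)) refl a b c d)
  (solve 2 (λ b d → :- (b :+ d) := :- b :- d) refl b d)
  where open ℤS

conj-· : ∀ x y → (x · y) ᶜ ≡ x ᶜ · y ᶜ
conj-· (a +ω b) (c +ω d) = 𝔼-ext
  (solve 4 (λ a b c d → a :* c :- b :* d :- (a :* d :+ b :* c :- b :* d)
     := (a :- b) :* (c :- d) :- (:- b) :* (:- d)) refl a b c d)
  (solve 4 (λ a b c d → :- (a :* d :+ b :* c :- b :* d)
     := (a :- b) :* (:- d) :+ (:- b) :* (c :- d) :- (:- b) :* (:- d)) refl a b c d)
  where open ℤS

conj-⊝ : ∀ x → (⊝ x) ᶜ ≡ ⊝ (x ᶜ)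
conj-⊝ (a +ω b) = 𝔼-ext (solve 2 (λ a b → :- a :- (:- b) := :- (a :- b)) refl a b) refl
  where open ℤS

conj-conj : ∀ x → x ᶜ ᶜ ≡ x
conj-conj (a +ω b) = 𝔼-ext
  (solve 2 (λ a b → a :- b :- (:- b) := a) refl a b) (ℤ.neg-involutive b)
  where open ℤS

conj-ι : ∀ n → (ι n) ᶜ ≡ ι n
conj-ι n = 𝔼-ext (ℤ.+-identityʳ n) refl

ι-* : ∀ m n → ι (m * n) ≡ ι m · ι n
ι-* m n = 𝔼-ext (solve 2 (λ m n → m :* n := m :* n :- κ 0ℤ :* κ 0ℤ) refl m n)
                (solve 2 (λ m n → κ 0ℤ := m :* κ 0ℤ :+ κ 0ℤ :* n :- κ 0ℤ :* κ 0ℤ) refl m n)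
  where open ℤS

ι-injective : ∀ {m n} → ι m ≡ ι n → m ≡ n
ι-injective refl = refl

N : 𝔼 → ℤ
N (a +ω b) = a * a - a * b + b * b

‖_‖ : 𝔼 → ℕ
‖ x ‖ = ∣ N x ∣

N-conj : ∀ x → x · x ᶜ ≡ ι (N x)
N-conj (a +ω b) = 𝔼-ext
  (solve 2 (λ a b → a :* (a :- b) :- b :* (:- b) := a :* a :- a :* b :+ b :* b) refl a b)
  (solve 2 (λ a b → a :* (:- b) :+ b :* (a :- b) :- b :* (:- b) := κ 0ℤ) refl a b)
  where open ℤS

N-· : ∀ x y → N (x · y) ≡ N x * N y
N-· (a +ω b) (c +ω d) = solve 4 (λ a b c d →
    let p = a :* c :- b :* d
        q = a :* d :+ b :* c :- b :* d in
    p :* p :- p :* q :+ q :* q := (a :* a :- a :* b :+ b :* b) :* (c :* c :- c :* d :+ d :* d)) refl a b c d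
  where open ℤS

‖‖-· : ∀ x y → ‖ x · y ‖ ≡ ‖ x ‖ ℕ.* ‖ y ‖
‖‖-· x y = trans (cong ∣_∣ (N-· x y)) (ℤ.abs-* (N x) (N y))

square-abs : ∀ a → a * a ≡ + (∣ a ∣ ℕ.* ∣ a ∣)
square-abs (+ n) = sym (ℤ.pos-* n n)
square-abs -[1+ n ] = refl

-- Completing the square shows the norm to be nonnegative and to bound both coordinates.
4N : ∀ a b → + 4 * N (a +ω b) ≡ + (∣ + 2 * a - b ∣ ℕ.* ∣ + 2 * a - b ∣ ℕ.+ 3 ℕ.* (∣ b ∣ ℕ.* ∣ b ∣))
4N a b = begin
  + 4 * N (a +ω b)                                     ≡⟨ solve 2 (λ a b → κ (+ 4) :* (a :* a :- a :* b :+ b :* b)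
     := (κ (+ 2) :* a :- b) :* (κ (+ 2) :* a :- b) :+ κ (+ 3) :* (b :* b)) refl a b ⟩
  (+ 2 * a - b) * (+ 2 * a - b) + + 3 * (b * b)        ≡⟨ cong₂ (λ s t → s + + 3 * t) (square-abs (+ 2 * a - b)) (square-abs b) ⟩
  + (X ℕ.* X) + + 3 * + (∣ b ∣ ℕ.* ∣ b ∣)              ≡⟨ cong (λ t → + (X ℕ.* X) + t) (sym (ℤ.pos-* 3 (∣ b ∣ ℕ.* ∣ b ∣))) ⟩
  + (X ℕ.* X) + + (3 ℕ.* (∣ b ∣ ℕ.* ∣ b ∣))            ≡⟨ sym (ℤ.pos-+ (X ℕ.* X) _) ⟩
  + (X ℕ.* X ℕ.+ 3 ℕ.* (∣ b ∣ ℕ.* ∣ b ∣))              ∎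
  where
  open ≡-Reasoning
  open ℤS
  X = ∣ + 2 * a - b ∣

4‖‖ : ∀ a b → 4 ℕ.* ‖ a +ω b ‖ ≡ ∣ + 2 * a - b ∣ ℕ.* ∣ + 2 * a - b ∣ ℕ.+ 3 ℕ.* (∣ b ∣ ℕ.* ∣ b ∣)
4‖‖ a b = trans (sym (ℤ.abs-* (+ 4) (N (a +ω b)))) (cong ∣_∣ (4N a b))

N-swap : ∀ a b → N (a +ω b) ≡ N (b +ω a)
N-swap a b = solve 2 (λ a b → a :* a :- a :* b :+ b :* b := b :* b :- b :* a :+ a :* a) refl a b
  where open ℤS

‖‖-bound : ∀ a b → 3 ℕ.* (∣ b ∣ ℕ.* ∣ b ∣) ℕ.≤ 4 ℕ.* ‖ a +ω b ‖
‖‖-bound a b = subst (3 ℕ.* (∣ b ∣ ℕ.* ∣ b ∣) ℕ.≤_) (sym (4‖‖ a b)) (ℕ.m≤n+m (3 ℕ.* (∣ b ∣ ℕ.* ∣ b ∣)) (∣ + 2 * a - b ∣ ℕ.* ∣ + 2 * a - b ∣))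

‖‖-bound′ : ∀ a b → 3 ℕ.* (∣ a ∣ ℕ.* ∣ a ∣) ℕ.≤ 4 ℕ.* ‖ a +ω b ‖
‖‖-bound′ a b = subst (λ t → 3 ℕ.* (∣ a ∣ ℕ.* ∣ a ∣) ℕ.≤ 4 ℕ.* ∣ t ∣) (N-swap b a) (‖‖-bound b a)

‖‖≡0 : ∀ x → ‖ x ‖ ≡ 0 → x ≡ 0ᴱ
‖‖≡0 (a +ω b) e = 𝔼-ext (zero-of a (subst (λ t → _ ℕ.≤ 4 ℕ.* t) e (‖‖-bound′ a b)))
                         (zero-of b (subst (λ t → _ ℕ.≤ 4 ℕ.* t) e (‖‖-bound a b)))
  where
  zero-of : ∀ a → 3 ℕ.* (∣ a ∣ ℕ.* ∣ a ∣) ℕ.≤ 0 → a ≡ 0ℤ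
  zero-of +0 h = refl
  zero-of (+ suc n) ()
  zero-of -[1+ n ] ()

_≟ᴱ_ : (x y : 𝔼) → Dec (x ≡ y)
(a +ω b) ≟ᴱ (c +ω d) with a ℤ.≟ c | b ℤ.≟ d
... | yes refl | yes refl = yes refl
... | no ne | _ = no λ { refl → ne refl }
... | yes _ | no ne = no λ { refl → ne refl }

·-zeroʳ : ∀ x → x · 0ᴱ ≡ 0ᴱ
·-zeroʳ x = 𝔼S.solve 1 (λ x → x 𝔼S.:* 𝔼S.κ 0ᴱ 𝔼S.:= 𝔼S.κ 0ᴱ) refl x

·-integral : ∀ x y → x · y ≡ 0ᴱ → x ≡ 0ᴱ ⊎ y ≡ 0ᴱ
·-integral x y e with ℕ.m*n≡0⇒m≡0∨n≡0 ‖ x ‖ (trans (sym (‖‖-· x y)) (cong ‖_‖ e))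
... | inj₁ h = inj₁ (‖‖≡0 x h)
... | inj₂ h = inj₂ (‖‖≡0 y h)

·-nonzero : ∀ {x y} → x ≢ 0ᴱ → y ≢ 0ᴱ → x · y ≢ 0ᴱ
·-nonzero {x} {y} nx ny e = [ nx , ny ]′ (·-integral x y e)

⊖≡0 : ∀ x y → x ⊖ y ≡ 0ᴱ → x ≡ y
⊖≡0 x y e = trans (solve 2 (λ x y → x := x :- y :+ y) refl x y)
  (trans (cong (_⊹ y) e) (solve 1 (λ y → κ 0ᴱ :+ y := y) refl y))
  where open 𝔼S

·-cancelˡ : ∀ x {y z} → x ≢ 0ᴱ → x · y ≡ x · z → y ≡ z
·-cancelˡ x {y} {z} nx e = [ (λ h → ⊥-elim (nx h)) , ⊖≡0 y z ]′ (·-integral x (y ⊖ z)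
  (trans (solve 3 (λ x y z → x :* (y :- z) := x :* y :- x :* z) refl x y z)
    (trans (cong (_⊖ x · z) e) (solve 1 (λ t → t :- t := κ 0ᴱ) refl (x · z)))))
  where open 𝔼S

infix 4 _∣ᴱ_
_∣ᴱ_ : 𝔼 → 𝔼 → Set
x ∣ᴱ y = ∃[ q ] y ≡ x · q

-- Rounding p/n to the nearest integer: dividing 2p + n by 2n leaves a remainder r below 2n, and 2(p
-- - qn) = r - n.
nearest : ∀ p n .{{_ : ℕ.NonZero n}} → ∃[ q ] ∣ + 2 * (p - q * + n) ∣ ℕ.≤ n
nearest p n@(suc n′) = q , subst (ℕ._≤ n) (cong ∣_∣ (sym eq)) small
  where
  d = 2 ℕ.* n
  a = + 2 * p + + n
  q = a /ℕ d
  r = a %ℕ d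
  eq : + 2 * (p - q * + n) ≡ r ℤ.⊖ n
  eq = begin
    + 2 * (p - q * + n)            ≡⟨ solve 3 (λ p q n → κ (+ 2) :* (p :- q :* n) := (κ (+ 2) :* p :+ n) :- q :* (κ (+ 2) :* n) :- n) refl p q (+ n) ⟩
    a - q * (+ 2 * + n) - + n      ≡⟨ cong (λ t → a - q * t - + n) (sym (ℤ.pos-* 2 n)) ⟩
    a - q * + d - + n              ≡⟨ cong (λ t → t - q * + d - + n) (a≡a%ℕn+[a/ℕn]*n a d) ⟩
    + r + q * + d - q * + d - + n  ≡⟨ solve 3 (λ r s n → r :+ s :- s :- n := r :- n) refl (+ r) (q * + d) (+ n) ⟩
    + r - + n                      ≡⟨ ℤ.[+m]-[+n]≡m⊖n r n ⟩
    r ℤ.⊖ n                        ∎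
    where
    open ≡-Reasoning
    open ℤS
  small : ∣ r ℤ.⊖ n ∣ ℕ.≤ n
  small with ℕ.≤-total r n
  ... | inj₁ r≤n = subst (ℕ._≤ n) (sym (ℤ.∣⊖∣-≤ r≤n)) (ℕ.m∸n≤m n r)
  ... | inj₂ n≤r = subst (ℕ._≤ n) (sym (trans (ℤ.∣m⊖n∣≡∣n⊖m∣ r n) (ℤ.∣⊖∣-≤ n≤r)))
    (ℕ.m≤n+o⇒m∸n≤o r n (subst (r ℕ.≤_) (cong (n ℕ.+_) (ℕ.+-identityʳ n)) (ℕ.<⇒≤ (n%ℕd<d a d))))

-- In s = 2a and t = 2b the left side is s² - st + t², at most 3n² by the triangle inequality. The
-- resulting factor 3/4 < 1 is what makes the division Euclidean.
‖‖-half-square : ∀ a b n → ∣ + 2 * a ∣ ℕ.≤ n → ∣ + 2 * b ∣ ℕ.≤ n → 4 ℕ.* ‖ a +ω b ‖ ℕ.≤ 3 ℕ.* (n ℕ.* n)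
‖‖-half-square a b n ha hb = begin
  4 ℕ.* ‖ a +ω b ‖  ≡⟨ sym (ℤ.abs-* (+ 4) (N (a +ω b))) ⟩
  ∣ + 4 * N (a +ω b) ∣  ≡⟨ cong ∣_∣ (solve 2 (λ a b → κ (+ 4) :* (a :* a :- a :* b :+ b :* b)
     := (κ (+ 2) :* a) :* (κ (+ 2) :* a) :- (κ (+ 2) :* a) :* (κ (+ 2) :* b) :+ (κ (+ 2) :* b) :* (κ (+ 2) :* b)) refl a b) ⟩
  ∣ s * s - s * t + t * t ∣                 ≤⟨ ℤ.∣i+j∣≤∣i∣+∣j∣ (s * s - s * t) (t * t) ⟩
  ∣ s * s - s * t ∣ ℕ.+ ∣ t * t ∣           ≤⟨ ℕ.+-monoˡ-≤ _ (ℤ.∣i-j∣≤∣i∣+∣j∣ (s * s) (s * t)) ⟩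
  ∣ s * s ∣ ℕ.+ ∣ s * t ∣ ℕ.+ ∣ t * t ∣     ≡⟨ cong₂ ℕ._+_ (cong₂ ℕ._+_ (ℤ.abs-* s s) (ℤ.abs-* s t)) (ℤ.abs-* t t) ⟩
  ∣ s ∣ ℕ.* ∣ s ∣ ℕ.+ ∣ s ∣ ℕ.* ∣ t ∣ ℕ.+ ∣ t ∣ ℕ.* ∣ t ∣
    ≤⟨ ℕ.+-mono-≤ (ℕ.+-mono-≤ (ℕ.*-mono-≤ ha ha) (ℕ.*-mono-≤ ha hb)) (ℕ.*-mono-≤ hb hb) ⟩
  n ℕ.* n ℕ.+ n ℕ.* n ℕ.+ n ℕ.* n           ≡⟨ trans (ℕ.+-assoc (n ℕ.* n) _ _) (cong (λ t → n ℕ.* n ℕ.+ (n ℕ.* n ℕ.+ t)) (sym (ℕ.+-identityʳ _))) ⟩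
  3 ℕ.* (n ℕ.* n)                           ∎
  where
  open ℕ.≤-Reasoning
  open ℤS
  s = + 2 * a
  t = + 2 * b

‖‖-nonzero : ∀ {x} → x ≢ 0ᴱ → ℕ.NonZero ‖ x ‖
‖‖-nonzero {x} nx = ℕ.≢-nonZero λ e → nx (‖‖≡0 x e)

-- The norm on ℤ[ω] is Euclidean: round the coordinates of x/y to nearest integers.
divide : ∀ x y → y ≢ 0ᴱ → ∃[ q ] ‖ x ⊖ y · q ‖ ℕ.< ‖ y ‖
divide x y ny = go (x · y ᶜ) refl
  where
  instance _ = ‖‖-nonzero ny
  n = ‖ y ‖
  Ny : N y ≡ + n
  Ny = nonneg y
    where
    nonneg : ∀ y → N y ≡ + ‖ y ‖
    nonneg (a +ω b) with N (a +ω b) | 4N a b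
    ... | + m | _ = refl
    ... | -[1+ m ] | ()
  go : ∀ z → x · y ᶜ ≡ z → ∃[ q ] ‖ x ⊖ y · q ‖ ℕ.< n
  go (u +ω v) e with nearest u n | nearest v n
  ... | q₁ , h₁ | q₂ , h₂ = q , ℕ.*-cancelʳ-< n _ _ (ℕ.*-cancelˡ-< 4 _ _ (begin-strict
    4 ℕ.* (‖ r ‖ ℕ.* n)   ≡⟨ cong (4 ℕ.*_) (trans (cong (‖ r ‖ ℕ.*_) (sym ‖yᶜ‖)) (sym (‖‖-· r (y ᶜ)))) ⟩
    4 ℕ.* ‖ r · y ᶜ ‖     ≡⟨ cong (λ t → 4 ℕ.* ‖ t ‖) eq ⟩
    4 ℕ.* ‖ (u - q₁ * + n) +ω (v - q₂ * + n) ‖ ≤⟨ ‖‖-half-square (u - q₁ * + n) (v - q₂ * + n) n h₁ h₂ ⟩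
    3 ℕ.* (n ℕ.* n)       <⟨ ℕ.*-monoˡ-< (n ℕ.* n) {{ℕ.m*n≢0 n n}} (ℕ.n<1+n 3) ⟩
    4 ℕ.* (n ℕ.* n)       ∎))
    where
    open ℕ.≤-Reasoning
    q = q₁ +ω q₂
    r = x ⊖ y · q
    ‖yᶜ‖ : ‖ y ᶜ ‖ ≡ ‖ y ‖
    ‖yᶜ‖ = cong ∣_∣ (ι-injective (trans (sym (N-conj (y ᶜ))) (trans (cong (y ᶜ ·_) (conj-conj y))
      (trans (𝔼S.solve 2 (λ a b → a 𝔼S.:* b 𝔼S.:= b 𝔼S.:* a) refl (y ᶜ) y) (N-conj y)))))
    eq : r · y ᶜ ≡ (u - q₁ * + n) +ω (v - q₂ * + n)
    eq = trans (𝔼S.solve 4 (λ x y q z → (x 𝔼S.:- y 𝔼S.:* q) 𝔼S.:* z 𝔼S.:= x 𝔼S.:* z 𝔼S.:- q 𝔼S.:* (y 𝔼S.:* z)) refl x y q (y ᶜ))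
      (trans (cong₂ (λ s t → s ⊖ q · t) e (trans (N-conj y) (cong ι Ny)))
        (𝔼-ext (ℤS.solve 4 (λ u p q n → u ℤS.:- (p ℤS.:* n ℤS.:- q ℤS.:* ℤS.κ 0ℤ) ℤS.:= u ℤS.:- p ℤS.:* n) refl u q₁ q₂ (+ n))
               (ℤS.solve 4 (λ v p q n → v ℤS.:- (p ℤS.:* ℤS.κ 0ℤ ℤS.:+ q ℤS.:* n ℤS.:- q ℤS.:* ℤS.κ 0ℤ) ℤS.:= v ℤS.:- q ℤS.:* n) refl v q₁ q₂ (+ n))))

N≥0 : ∀ y → N y ≡ + ‖ y ‖
N≥0 (a +ω b) with N (a +ω b) | 4N a b
... | + m | _ = refl
... | -[1+ m ] | ()

∣ᴱ-refl : ∀ {x} → x ∣ᴱ x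
∣ᴱ-refl {x} = 1ᴱ , solve 1 (λ x → x := x :* κ 1ᴱ) refl x
  where open 𝔼S

∣ᴱ-trans : ∀ {x y z} → x ∣ᴱ y → y ∣ᴱ z → x ∣ᴱ z
∣ᴱ-trans {x} (q , refl) (r , refl) = q · r , solve 3 (λ x q r → x :* q :* r := x :* (q :* r)) refl x q r
  where open 𝔼S

∣ᴱ-⊹ : ∀ {x y z} → x ∣ᴱ y → x ∣ᴱ z → x ∣ᴱ y ⊹ z
∣ᴱ-⊹ {x} (q , refl) (r , refl) = q ⊹ r , solve 3 (λ x q r → x :* q :+ x :* r := x :* (q :+ r)) refl x q r
  where open 𝔼S

∣ᴱ-·ʳ : ∀ {x y} z → x ∣ᴱ y → x ∣ᴱ y · z
∣ᴱ-·ʳ {x} z (q , refl) = q · z , solve 3 (λ x q z → x :* q :* z := x :* (q :* z)) refl x q z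
  where open 𝔼S

∣ᴱ-·ˡ : ∀ {x y} z → x ∣ᴱ y → x ∣ᴱ z · y
∣ᴱ-·ˡ {x} z (q , refl) = q · z , solve 3 (λ x q z → z :* (x :* q) := x :* (q :* z)) refl x q z
  where open 𝔼S

∣ᴱ-⊝ : ∀ {x y} → x ∣ᴱ y → x ∣ᴱ ⊝ y
∣ᴱ-⊝ {x} (q , refl) = ⊝ q , solve 2 (λ x q → :- (x :* q) := x :* (:- q)) refl x q
  where open 𝔼S

∣ᴱ-zero : ∀ x → x ∣ᴱ 0ᴱ
∣ᴱ-zero x = 0ᴱ , sym (·-zeroʳ x)

∣ᴱ-‖‖ : ∀ {x y} → x ∣ᴱ y → y ≢ 0ᴱ → ‖ x ‖ ℕ.≤ ‖ y ‖
∣ᴱ-‖‖ {x} {y} (q , e) ny = subst (‖ x ‖ ℕ.≤_) (sym (trans (cong ‖_‖ e) (‖‖-· x q)))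
  (ℕ.m≤m*n ‖ x ‖ ‖ q ‖ {{‖‖-nonzero λ q≡0 → ny (trans e (trans (cong (x ·_) q≡0) (·-zeroʳ x)))}})

norm-one-unit : ∀ {x} → ‖ x ‖ ≡ 1 → x ∣ᴱ 1ᴱ
norm-one-unit {x} e = x ᶜ , sym (trans (N-conj x) (cong ι (trans (N≥0 x) (cong +_ e))))

unit-norm-one : ∀ {x} → x ∣ᴱ 1ᴱ → ‖ x ‖ ≡ 1
unit-norm-one {x} (q , e) = ℕ.m*n≡1⇒m≡1 ‖ x ‖ ‖ q ‖ (sym (trans (cong ‖_‖ e) (‖‖-· x q)))

bézout : ∀ x y → ∃[ d ] (d ∣ᴱ x × d ∣ᴱ y × ∃[ s ] ∃[ t ] d ≡ x · s ⊹ y · t)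
bézout x y = go x y (ℕ.<-wellFounded ‖ y ‖)
  where
  open 𝔼S
  go : ∀ x y → ℕ.Acc ℕ._<_ ‖ y ‖ → ∃[ d ] (d ∣ᴱ x × d ∣ᴱ y × ∃[ s ] ∃[ t ] d ≡ x · s ⊹ y · t)
  go x y (ℕ.acc rs) with y ≟ᴱ 0ᴱ
  ... | yes refl = x , ∣ᴱ-refl , ∣ᴱ-zero x , 1ᴱ , 0ᴱ , solve 1 (λ x → x := x :* κ 1ᴱ :+ κ 0ᴱ :* κ 0ᴱ) refl x
  ... | no ny with divide x y ny
  ... | q , lt with go y (x ⊖ y · q) (rs lt)
  ... | d , d∣y , d∣r , s , t , e = d ,
    subst (d ∣ᴱ_) (solve 3 (λ x y q → (x :- y :* q) :+ y :* q := x) refl x y q) (∣ᴱ-⊹ d∣r (∣ᴱ-·ʳ q d∣y)) ,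
    d∣y , t , s ⊖ q · t ,
    trans e (solve 5 (λ x y q s t → y :* s :+ (x :- y :* q) :* t := x :* t :+ y :* (s :- q :* t)) refl x y q s t)

-- Euclidean division decides: a nonzero remainder has smaller norm than the divisor, so it is not a
-- multiple of it.
_∣ᴱ?_ : ∀ x y → Dec (x ∣ᴱ y)
x ∣ᴱ? y with x ≟ᴱ 0ᴱ
... | yes refl with y ≟ᴱ 0ᴱ
...   | yes refl = yes ∣ᴱ-refl
...   | no ny = no λ { (q , e) → ny (trans e (𝔼S.solve 1 (λ q → 𝔼S.κ 0ᴱ 𝔼S.:* q 𝔼S.:= 𝔼S.κ 0ᴱ) refl q)) }
x ∣ᴱ? y | no nx with divide y x nx
... | q , lt with (y ⊖ x · q) ≟ᴱ 0ᴱ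
...   | yes e = yes (q , ⊖≡0 y (x · q) e)
...   | no ne = no λ h → ℕ.<⇒≱ lt (∣ᴱ-‖‖ (∣ᴱ-⊹ h (∣ᴱ-⊝ (∣ᴱ-·ʳ q ∣ᴱ-refl))) ne)

record Prime (p : 𝔼) : Set where
  field
    nonzero : p ≢ 0ᴱ
    nonunit : ¬ p ∣ᴱ 1ᴱ
    split   : ∀ x y → p ∣ᴱ x · y → p ∣ᴱ x ⊎ p ∣ᴱ y

-- If x had no prime divisor it would be prime itself. Indeed, when x divides yz, let g be a gcd of
-- x and y: if g is a unit, x divides z; if the cofactor of g in x is a unit, x divides y; otherwise
-- g is a proper divisor of x and has a prime divisor by induction. The double negation replaces a
-- search through divisors.
prime-divisor : ∀ x → x ≢ 0ᴱ → ‖ x ‖ ≢ 1 → ¬ ¬ (∃[ p ] (Prime p × p ∣ᴱ x))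
prime-divisor x = go x (ℕ.<-wellFounded ‖ x ‖)
  where
  open 𝔼S
  go : ∀ x → ℕ.Acc ℕ._<_ ‖ x ‖ → x ≢ 0ᴱ → ‖ x ‖ ≢ 1 → ¬ ¬ (∃[ p ] (Prime p × p ∣ᴱ x))
  go x (ℕ.acc rs) nx nu none = none (x , record { nonzero = nx ; nonunit = nu ∘ unit-norm-one ; split = split } , ∣ᴱ-refl)
    where
    split : ∀ y z → x ∣ᴱ y · z → x ∣ᴱ y ⊎ x ∣ᴱ z
    split y z (w , yz≡xw) with bézout x y
    ... | g , (h , x≡gh) , (k , y≡gk) , s , t , g≡ with ‖ g ‖ ℕ.≟ 1 | ‖ h ‖ ℕ.≟ 1
    ... | yes g1 | _ = let (u , 1≡gu) = norm-one-unit g1 in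
      inj₂ ((z · s ⊹ w · t) · u , (begin
        z ≡⟨ solve 1 (λ z → z := z :* κ 1ᴱ) refl z ⟩
        z · 1ᴱ ≡⟨ cong (z ·_) 1≡gu ⟩
        z · (g · u) ≡⟨ cong (λ a → z · (a · u)) g≡ ⟩
        z · ((x · s ⊹ y · t) · u) ≡⟨ solve 6 (λ x y z s t u → z :* ((x :* s :+ y :* t) :* u) := x :* (z :* s) :* u :+ (y :* z) :* t :* u) refl x y z s t u ⟩
        x · (z · s) · u ⊹ (y · z) · t · u ≡⟨ cong (λ a → x · (z · s) · u ⊹ a · t · u) yz≡xw ⟩
        x · (z · s) · u ⊹ (x · w) · t · u ≡⟨ solve 6 (λ x z s t u w → x :* (z :* s) :* u :+ (x :* w) :* t :* u := x :* ((z :* s :+ w :* t) :* u)) refl x z s t u w ⟩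
        x · ((z · s ⊹ w · t) · u) ∎))
      where open ≡-Reasoning
    ... | no _ | yes h1 = let (u , 1≡hu) = norm-one-unit h1 in
      inj₁ (u · k , (begin
        y ≡⟨ y≡gk ⟩
        g · k ≡⟨ solve 2 (λ g k → g :* k := g :* κ 1ᴱ :* k) refl g k ⟩
        g · 1ᴱ · k ≡⟨ cong (λ a → g · a · k) 1≡hu ⟩
        g · (h · u) · k ≡⟨ solve 4 (λ g h u k → g :* (h :* u) :* k := (g :* h) :* (u :* k)) refl g h u k ⟩
        (g · h) · (u · k) ≡⟨ cong (_· (u · k)) (sym x≡gh) ⟩
        x · (u · k) ∎))
      where open ≡-Reasoning
    ... | no ng | no nh = ⊥-elim (go g (rs lt) ng0 ng λ { (p , P , p∣g) → none (p , P , ∣ᴱ-trans p∣g (h , x≡gh)) })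
      where
      ng0 : g ≢ 0ᴱ
      ng0 e = nx (trans x≡gh (trans (cong (_· h) e) (solve 1 (λ h → κ 0ᴱ :* h := κ 0ᴱ) refl h)))
      nh0 : h ≢ 0ᴱ
      nh0 e = nx (trans x≡gh (trans (cong (g ·_) e) (·-zeroʳ g)))
      lt : ‖ g ‖ ℕ.< ‖ x ‖
      lt = subst (‖ g ‖ ℕ.<_) (sym (trans (cong ‖_‖ x≡gh) (‖‖-· g h)))
        (ℕ.m<m*n ‖ g ‖ ‖ h ‖ {{‖‖-nonzero ng0}} (ℕ.≤∧≢⇒< (ℕ.>-nonZero⁻¹ ‖ h ‖ {{‖‖-nonzero nh0}}) (nh ∘ sym)))

-- Valuations at a prime of ℤ[ω].

infixr 9 _^ᴱ_
_^ᴱ_ : 𝔼 → ℕ → 𝔼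
x ^ᴱ zero = 1ᴱ
x ^ᴱ suc n = x · x ^ᴱ n

^ᴱ-+ : ∀ x m n → x ^ᴱ (m ℕ.+ n) ≡ x ^ᴱ m · x ^ᴱ n
^ᴱ-+ x zero n = 𝔼S.solve 1 (λ t → t 𝔼S.:= 𝔼S.κ 1ᴱ 𝔼S.:* t) refl (x ^ᴱ n)
^ᴱ-+ x (suc m) n = trans (cong (x ·_) (^ᴱ-+ x m n))
  (𝔼S.solve 3 (λ x a b → x 𝔼S.:* (a 𝔼S.:* b) 𝔼S.:= x 𝔼S.:* a 𝔼S.:* b) refl x (x ^ᴱ m) (x ^ᴱ n))

^ᴱ-≢0 : ∀ {x} → x ≢ 0ᴱ → ∀ n → x ^ᴱ n ≢ 0ᴱ
^ᴱ-≢0 nx zero ()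
^ᴱ-≢0 nx (suc n) = ·-nonzero nx (^ᴱ-≢0 nx n)

-- O n x says v_p(x) ≥ n, and V n x says v_p(x) = n.
module Valuation {p : 𝔼} (prime : Prime p) where
  open Prime prime
  open 𝔼S using (solve; _:=_; _:+_; _:*_; :-_; κ)

  record O (n : ℕ) (x : 𝔼) : Set where
    constructor o
    field multiple : p ^ᴱ n ∣ᴱ x

  record V (n : ℕ) (x : 𝔼) : Set where
    constructor v
    field
      {cofactor} : 𝔼
      equation   : x ≡ p ^ᴱ n · cofactor
      coprime    : ¬ p ∣ᴱ cofactor

  O-zero : ∀ x → O 0 x
  O-zero x = o (x , solve 1 (λ x → x := κ 1ᴱ :* x) refl x)

  O-≤ : ∀ {m n x} → m ℕ.≤ n → O n x → O m x
  O-≤ {m} {n} m≤n (o d) = o (∣ᴱ-trans (p ^ᴱ (n ℕ.∸ m) , trans (cong (p ^ᴱ_) (sym (ℕ.m+[n∸m]≡n m≤n))) (^ᴱ-+ p m (n ℕ.∸ m))) d)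

  O-⊹ : ∀ {n x y} → O n x → O n y → O n (x ⊹ y)
  O-⊹ (o a) (o b) = o (∣ᴱ-⊹ a b)

  O-⊝ : ∀ {n x} → O n x → O n (⊝ x)
  O-⊝ (o a) = o (∣ᴱ-⊝ a)

  O-⊖ : ∀ {n x y} → O n x → O n y → O n (x ⊖ y)
  O-⊖ a b = O-⊹ a (O-⊝ b)

  O-·ʳ : ∀ {n x} y → O n x → O n (x · y)
  O-·ʳ y (o a) = o (∣ᴱ-·ʳ y a)

  O-·ˡ : ∀ {n y} x → O n y → O n (x · y)
  O-·ˡ x (o a) = o (∣ᴱ-·ˡ x a)

  O-· : ∀ {m n x y} → O m x → O n y → O (m ℕ.+ n) (x · y)
  O-· {m} {n} (o (q , refl)) (o (r , refl)) = o (q · r , trans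
    (solve 4 (λ a b q r → (a :* q) :* (b :* r) := (a :* b) :* (q :* r)) refl (p ^ᴱ m) (p ^ᴱ n) q r)
    (cong (_· (q · r)) (sym (^ᴱ-+ p m n))))

  V⇒O : ∀ {n x} → V n x → O n x
  V⇒O (v {u} e _) = o (u , e)

  V⇒≢0 : ∀ {n x} → V n x → x ≢ 0ᴱ
  V⇒≢0 {n} (v {u} e pu) x≡0 = [ ^ᴱ-≢0 nonzero n , (λ u≡0 → pu (subst (p ∣ᴱ_) (sym u≡0) (∣ᴱ-zero p))) ]′
    (·-integral (p ^ᴱ n) u (trans (sym e) x≡0))

  V-· : ∀ {m n x y} → V m x → V n y → V (m ℕ.+ n) (x · y)
  V-· {m} {n} (v {u} refl pu) (v {w} refl pw) = v {cofactor = u · w}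
    (trans (solve 4 (λ a b q r → (a :* q) :* (b :* r) := (a :* b) :* (q :* r)) refl (p ^ᴱ m) (p ^ᴱ n) u w)
      (cong (_· (u · w)) (sym (^ᴱ-+ p m n))))
    λ h → [ pu , pw ]′ (split u w h)

  V-O-≤ : ∀ {m n x} → V n x → O m x → m ℕ.≤ n
  V-O-≤ {m} {n} (v {u} e pu) om with m ℕ.≤? n
  ... | yes m≤n = m≤n
  ... | no m≰n with O-≤ (ℕ.≰⇒> m≰n) om
  ... | o (q , e′) = ⊥-elim (pu (q , ·-cancelˡ (p ^ᴱ n) (^ᴱ-≢0 nonzero n)
    (trans (sym e) (trans e′ (solve 3 (λ p a q → p :* a :* q := a :* (p :* q)) refl p (p ^ᴱ n) q)))))

  V-unique : ∀ {m n x} → V m x → V n x → m ≡ n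
  V-unique a b = ℕ.≤-antisym (V-O-≤ b (V⇒O a)) (V-O-≤ a (V⇒O b))

  V-⊹ : ∀ {n x y} → V n x → O (suc n) y → V n (x ⊹ y)
  V-⊹ {n} (v {u} refl pu) (o (q , refl)) = v {cofactor = u ⊹ p · q}
    (solve 4 (λ a u p q → a :* u :+ p :* a :* q := a :* (u :+ p :* q)) refl (p ^ᴱ n) u p q)
    λ h → pu (subst (p ∣ᴱ_) (solve 3 (λ u p q → u :+ p :* q :+ (:- (p :* q)) := u) refl u p q) (∣ᴱ-⊹ h (∣ᴱ-⊝ (q , refl))))

  V-⊝ : ∀ {n x} → V n x → V n (⊝ x)
  V-⊝ {n} (v {u} refl pu) = v {cofactor = ⊝ u} (solve 2 (λ a u → :- (a :* u) := a :* (:- u)) refl (p ^ᴱ n) u)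
    λ h → pu (subst (p ∣ᴱ_) (solve 1 (λ u → :- (:- u) := u) refl u) (∣ᴱ-⊝ h))

  V-unit : ∀ {u} → ¬ p ∣ᴱ u → V 0 u
  V-unit {u} pu = v {cofactor = u} (solve 1 (λ u → u := κ 1ᴱ :* u) refl u) pu

  V-p : V 1 p
  V-p = v {cofactor = 1ᴱ} (solve 1 (λ p → p := p :* κ 1ᴱ :* κ 1ᴱ) refl p) nonunit

  V-exists : ∀ {x} → x ≢ 0ᴱ → ∃[ n ] V n x
  V-exists {x} = go x (ℕ.<-wellFounded ‖ x ‖)
    where
    go : ∀ x → ℕ.Acc ℕ._<_ ‖ x ‖ → x ≢ 0ᴱ → ∃[ n ] V n x
    go x (ℕ.acc rs) nx with p ∣ᴱ? x
    ... | no pu = 0 , V-unit pu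
    ... | yes (q , refl) with go q (rs lt) nq
      where
      nq : q ≢ 0ᴱ
      nq e = nx (trans (cong (p ·_) e) (·-zeroʳ p))
      1<p : 1 ℕ.< ‖ p ‖
      1<p = ℕ.≤∧≢⇒< (ℕ.>-nonZero⁻¹ ‖ p ‖ {{‖‖-nonzero nonzero}}) (nonunit ∘ norm-one-unit ∘ sym)
      lt : ‖ q ‖ ℕ.< ‖ p · q ‖
      lt = subst (‖ q ‖ ℕ.<_) (sym (‖‖-· p q))
        (subst (‖ q ‖ ℕ.<_) (ℕ.*-comm ‖ q ‖ ‖ p ‖) (ℕ.m<m*n ‖ q ‖ ‖ p ‖ {{‖‖-nonzero nq}} 1<p))
    ... | n , v {u} e pu = suc n , v {cofactor = u} (trans (cong (p ·_) e)
      (solve 3 (λ p a u → p :* (a :* u) := p :* a :* u) refl p (p ^ᴱ n) u)) pu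

  V-cancel : ∀ {m n x y} → V (m ℕ.+ n) (x · y) → V m x → V n y
  V-cancel {m} {n} {x} {y} vxy vx with V-exists y≢0
    where
    y≢0 : y ≢ 0ᴱ
    y≢0 e = V⇒≢0 vxy (trans (cong (x ·_) e) (·-zeroʳ x))
  ... | k , vy = subst (λ t → V t y) (ℕ.+-cancelˡ-≡ m k n (V-unique (V-· vx vy) vxy)) vy

  V-or-O : ∀ {n x} → O n x → V n x ⊎ O (suc n) x
  V-or-O {n} {x} (o (q , e)) with p ∣ᴱ? q
  ... | no pq = inj₁ (v {cofactor = q} e pq)
  ... | yes (r , refl) = inj₂ (o (r , trans e (solve 3 (λ p a r → a :* (p :* r) := p :* a :* r) refl p (p ^ᴱ n) r)))


-- The primes 2 and √-3, units and cubes.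

2ᴱ 3ᴱ : 𝔼
2ᴱ = ι (+ 2)
3ᴱ = ι (+ 3)

infix 9 _³
_³ : 𝔼 → 𝔼
x ³ = x · x · x

mod2 : ∀ a → ∃[ k ] (a ≡ + 2 * k ⊎ a ≡ + 1 + + 2 * k)
mod2 a with a %ℕ 2 | n%ℕd<d a 2 | a≡a%ℕn+[a/ℕn]*n a 2
... | 0 | _ | e = a /ℕ 2 , inj₁ (trans e (solve 1 (λ k → κ 0ℤ :+ k :* κ (+ 2) := κ (+ 2) :* k) refl (a /ℕ 2)))
  where open ℤS
... | 1 | _ | e = a /ℕ 2 , inj₂ (trans e (solve 1 (λ k → κ 1ℤ :+ k :* κ (+ 2) := κ 1ℤ :+ κ (+ 2) :* k) refl (a /ℕ 2)))
  where open ℤS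
... | suc (suc r) | ℕ.s≤s (ℕ.s≤s ()) | e

mod3 : ∀ a → ∃[ k ] (a ≡ + 3 * k ⊎ a ≡ 1ℤ + + 3 * k ⊎ a ≡ -1ℤ + + 3 * k)
mod3 a with a %ℕ 3 | n%ℕd<d a 3 | a≡a%ℕn+[a/ℕn]*n a 3
... | 0 | _ | e = a /ℕ 3 , inj₁ (trans e (solve 1 (λ k → κ 0ℤ :+ k :* κ (+ 3) := κ (+ 3) :* k) refl (a /ℕ 3)))
  where open ℤS
... | 1 | _ | e = a /ℕ 3 , inj₂ (inj₁ (trans e (solve 1 (λ k → κ 1ℤ :+ k :* κ (+ 3) := κ 1ℤ :+ κ (+ 3) :* k) refl (a /ℕ 3))))
  where open ℤS
... | 2 | _ | e = a /ℕ 3 + 1ℤ , inj₂ (inj₂ (trans e (solve 1 (λ k → κ (+ 2) :+ k :* κ (+ 3) := κ -1ℤ :+ κ (+ 3) :* (k :+ κ 1ℤ)) refl (a /ℕ 3))))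
  where open ℤS
... | suc (suc (suc r)) | ℕ.s≤s (ℕ.s≤s (ℕ.s≤s ())) | e

ι-∣ : ∀ n {a b} → ι n ∣ᴱ (a +ω b) → ∃[ q ] a ≡ n * q × ∃[ r ] b ≡ n * r
ι-∣ n ((q +ω r) , refl) = q , solve 3 (λ n q r → n :* q :- κ 0ℤ :* r := n :* q) refl n q r ,
  r , solve 3 (λ n q r → n :* r :+ κ 0ℤ :* q :- κ 0ℤ :* r := n :* r) refl n q r
  where open ℤS

ι-∣ι : ∀ n {a} → ι n ∣ᴱ ι a → ∃[ q ] a ≡ n * q
ι-∣ι n h = let (q , e , _) = ι-∣ n h in q , e

∣-ι : ∀ n {a b} → (∃[ q ] a ≡ n * q) → (∃[ r ] b ≡ n * r) → ι n ∣ᴱ (a +ω b)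
∣-ι n (q , refl) (r , refl) = (q +ω r) , 𝔼-ext
  (solve 3 (λ n q r → n :* q := n :* q :- κ 0ℤ :* r) refl n q r)
  (solve 3 (λ n q r → n :* r := n :* r :+ κ 0ℤ :* q :- κ 0ℤ :* r) refl n q r)
  where open ℤS

-- ℤ[ω]/2 is the field of four elements, whose nonzero classes are those of the cube roots of unity
-- 1, ω and ω².
residue4 : ∀ x → 2ᴱ ∣ᴱ x ⊎ ∃[ u ] (u ³ ≡ 1ᴱ × 2ᴱ ∣ᴱ x ⊖ u)
residue4 (a +ω b) with mod2 a | mod2 b
... | k , inj₁ refl | l , inj₁ refl = inj₁ (∣-ι (+ 2) (k , refl) (l , refl))
... | k , inj₁ refl | l , inj₂ refl = inj₂ (ω , refl ,
  ∣-ι (+ 2) (k , solve 1 (λ k → κ (+ 2) :* k :- κ 0ℤ := κ (+ 2) :* k) refl k) (l , solve 1 (λ k → κ (+ 1) :+ κ (+ 2) :* k :- κ 1ℤ := κ (+ 2) :* k) refl l))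
  where open ℤS
... | k , inj₂ refl | l , inj₁ refl = inj₂ (1ᴱ , refl ,
  ∣-ι (+ 2) (k , solve 1 (λ k → κ (+ 1) :+ κ (+ 2) :* k :- κ 1ℤ := κ (+ 2) :* k) refl k) (l , solve 1 (λ k → κ (+ 2) :* k :- κ 0ℤ := κ (+ 2) :* k) refl l))
  where open ℤS
... | k , inj₂ refl | l , inj₂ refl = inj₂ (ω · ω , refl ,
  ∣-ι (+ 2) (k + 1ℤ , solve 1 (λ k → κ (+ 1) :+ κ (+ 2) :* k :- κ -1ℤ := κ (+ 2) :* (k :+ κ 1ℤ)) refl k) (l + 1ℤ , solve 1 (λ k → κ (+ 1) :+ κ (+ 2) :* k :- κ -1ℤ := κ (+ 2) :* (k :+ κ 1ℤ)) refl l))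
  where open ℤS

-- Modulo ϖ every Eisenstein integer a + bω is congruent to a + b.
residue3 : ∀ x → ∃[ k ] (x ≡ ϖ · k ⊎ x ≡ 1ᴱ ⊹ ϖ · k ⊎ x ≡ ⊝ 1ᴱ ⊹ ϖ · k)
residue3 (a +ω b) with mod3 (a + b)
... | k , e = q , [ (λ e₁ → inj₁ (at 0ℤ (trans e₁ (sym (ℤ.+-identityˡ _))) (solve 1 (λ t → κ (0ᴱ) :+ t := t) refl _)))
                  , [ (λ e₁ → inj₂ (inj₁ (at 1ℤ e₁ refl))) , (λ e₁ → inj₂ (inj₂ (at -1ℤ e₁ refl))) ]′ ]′ e
  where
  open 𝔼S
  q = ⊝ ϖ · ι k ⊹ (1ᴱ ⊹ ω) · ι b
  at : ∀ c {y} → a + b ≡ c + + 3 * k → ι c ⊹ ϖ · q ≡ y → (a +ω b) ≡ y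
  at c e₁ e₂ = trans (𝔼-ext
    (trans (ℤS.solve 2 (λ a b → a ℤS.:= a ℤS.:+ b ℤS.:- b) refl a b) (trans (cong (_- b) e₁)
      (ℤS.solve 3 (λ c k b → let kb = ℤS.κ 1ℤ ℤS.:* b in c ℤS.:+ ℤS.κ (+ 3) ℤS.:* k ℤS.:- b ℤS.:= c ℤS.:+ ℤS.κ (+ 3) ℤS.:* k ℤS.:- kb) refl c k b)))
    refl)
    (trans (lemma c k b) e₂)
    where
    lemma : ∀ c k b → ((c + + 3 * k - 1ℤ * b) +ω b) ≡ ι c ⊹ ϖ · (⊝ ϖ · ι k ⊹ (1ᴱ ⊹ ω) · ι b)
    lemma c k b = trans (𝔼-ext
      (ℤS.solve 3 (λ c k b → c ℤS.:+ ℤS.κ (+ 3) ℤS.:* k ℤS.:- ℤS.κ 1ℤ ℤS.:* b ℤS.:= c ℤS.:+ (ℤS.κ (+ 3) ℤS.:* k ℤS.:- ℤS.κ 0ℤ ℤS.:* ℤS.κ 0ℤ) ℤS.:+ (ℤS.κ -1ℤ ℤS.:* b ℤS.:- ℤS.κ 1ℤ ℤS.:* ℤS.κ 0ℤ)) refl c k b)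
      (ℤS.solve 3 (λ c k b → b ℤS.:= ℤS.κ 0ℤ ℤS.:+ (ℤS.κ (+ 3) ℤS.:* ℤS.κ 0ℤ ℤS.:+ ℤS.κ 0ℤ ℤS.:* k ℤS.:- ℤS.κ 0ℤ ℤS.:* ℤS.κ 0ℤ) ℤS.:+ (ℤS.κ -1ℤ ℤS.:* ℤS.κ 0ℤ ℤS.:+ ℤS.κ 1ℤ ℤS.:* b ℤS.:- ℤS.κ 1ℤ ℤS.:* ℤS.κ 0ℤ)) refl c k b))
      (solve 3 (λ c k b → c :+ κ 3ᴱ :* k :+ κ (-1ℤ +ω 1ℤ) :* b := c :+ κ ϖ :* (:- κ ϖ :* k :+ (κ 1ᴱ :+ κ ω) :* b)) refl (ι c) (ι k) (ι b))

¬3∣1 : ∀ {x} → x ≢ + 0 → ∣ x ∣ ℕ.< 3 → ¬ (∃[ q ] x ≡ + 3 * q)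
¬3∣1 {x} nx lt (q , e) = ℕ.<⇒≱ lt (subst (3 ℕ.≤_) (sym (trans (cong ∣_∣ e) (ℤ.abs-* (+ 3) q)))
  (ℕ.m≤m*n 3 ∣ q ∣ {{ℕ.≢-nonZero λ q≡0 → nx (trans e (cong (+ 3 *_) (ℤ.∣i∣≡0⇒i≡0 {q} q≡0)))}}))

ϖ-nonunit : ¬ ϖ ∣ᴱ 1ᴱ
ϖ-nonunit h with unit-norm-one h
... | ()

2ᴱ-nonunit : ¬ 2ᴱ ∣ᴱ 1ᴱ
2ᴱ-nonunit h with unit-norm-one h
... | ()

-- If neither factor vanishes modulo 2, the product is congruent to a cube root of unity uv, and 2
-- would divide (uv)³ = 1.
2-prime : Prime 2ᴱ
2-prime = record { nonzero = λ () ; nonunit = 2ᴱ-nonunit ; split = split }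
  where
  open 𝔼S
  split : ∀ x y → 2ᴱ ∣ᴱ x · y → 2ᴱ ∣ᴱ x ⊎ 2ᴱ ∣ᴱ y
  split x y h with residue4 x | residue4 y
  ... | inj₁ a | _ = inj₁ a
  ... | inj₂ _ | inj₁ b = inj₂ b
  ... | inj₂ (u , u3 , a) | inj₂ (v , v3 , b) = ⊥-elim (2ᴱ-nonunit (subst (2ᴱ ∣ᴱ_)
    (trans (solve 2 (λ u v → (u :* v) :* ((u :* v) :* (u :* v)) := (u :* u :* u) :* (v :* v :* v)) refl u v) (cong₂ _·_ u3 v3))
    (∣ᴱ-·ʳ ((u · v) · (u · v)) uv)))
    where
    uv : 2ᴱ ∣ᴱ u · v
    uv = subst (2ᴱ ∣ᴱ_) (solve 4 (λ x y u v → x :* y :- ((x :- u) :* y :+ u :* (y :- v)) := u :* v) refl x y u v)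
      (∣ᴱ-⊹ h (∣ᴱ-⊝ (∣ᴱ-⊹ (∣ᴱ-·ʳ y a) (∣ᴱ-·ˡ u b))))

residue3′ : ∀ x → ϖ ∣ᴱ x ⊎ ∃[ u ] (u · u ≡ 1ᴱ × ϖ ∣ᴱ x ⊖ u)
residue3′ x with residue3 x
... | k , inj₁ e = inj₁ (k , e)
... | k , inj₂ (inj₁ e) = inj₂ (1ᴱ , refl , k , trans (cong (_⊖ 1ᴱ) e) (solve 2 (λ u t → u :+ t :- u := t) refl 1ᴱ (ϖ · k)))
  where open 𝔼S
... | k , inj₂ (inj₂ e) = inj₂ (⊝ 1ᴱ , refl , k , trans (cong (_⊖ ⊝ 1ᴱ) e) (solve 2 (λ u t → u :+ t :- u := t) refl (⊝ 1ᴱ) (ϖ · k)))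
  where open 𝔼S

ϖ-prime : Prime ϖ
ϖ-prime = record { nonzero = λ () ; nonunit = ϖ-nonunit ; split = split }
  where
  open 𝔼S
  split : ∀ x y → ϖ ∣ᴱ x · y → ϖ ∣ᴱ x ⊎ ϖ ∣ᴱ y
  split x y h with residue3′ x | residue3′ y
  ... | inj₁ a | _ = inj₁ a
  ... | inj₂ _ | inj₁ b = inj₂ b
  ... | inj₂ (u , u2 , a) | inj₂ (v , v2 , b) = ⊥-elim (ϖ-nonunit (subst (ϖ ∣ᴱ_)
    (trans (solve 2 (λ u v → (u :* v) :* (u :* v) := (u :* u) :* (v :* v)) refl u v) (cong₂ _·_ u2 v2))
    (∣ᴱ-·ʳ (u · v) uv)))
    where
    uv : ϖ ∣ᴱ u · v
    uv = subst (ϖ ∣ᴱ_) (solve 4 (λ x y u v → x :* y :- ((x :- u) :* y :+ u :* (y :- v)) := u :* v) refl x y u v)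
      (∣ᴱ-⊹ h (∣ᴱ-⊝ (∣ᴱ-⊹ (∣ᴱ-·ʳ y a) (∣ᴱ-·ˡ u b))))

-- The only units that are ±1 modulo 3 after squaring are ±1.
unit-square : ∀ u → u ∣ᴱ 1ᴱ → (3ᴱ ∣ᴱ u · u ⊖ 1ᴱ ⊎ 3ᴱ ∣ᴱ u · u ⊹ 1ᴱ) → u ≡ 1ᴱ ⊎ u ≡ ⊝ 1ᴱ
unit-square (a +ω b) h s = cases a b (small a (‖‖-bound′ a b)) (small b (‖‖-bound a b)) (unit-norm-one h) s
  where
  small : ∀ c → 3 ℕ.* (∣ c ∣ ℕ.* ∣ c ∣) ℕ.≤ 4 ℕ.* ‖ a +ω b ‖ → ∣ c ∣ ℕ.≤ 1
  small c le with ∣ c ∣ | subst (λ t → 3 ℕ.* (∣ c ∣ ℕ.* ∣ c ∣) ℕ.≤ 4 ℕ.* t) (unit-norm-one h) le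
  ... | 0 | _ = ℕ.z≤n
  ... | 1 | _ = ℕ.≤-refl
  ... | suc (suc n) | le′ = ⊥-elim (ℕ.<⇒≱ {4} {12} (ℕ.s≤s (ℕ.s≤s (ℕ.s≤s (ℕ.s≤s (ℕ.s≤s ℕ.z≤n)))))
    (ℕ.≤-trans (ℕ.*-monoʳ-≤ 3 (ℕ.*-mono-≤ {2} {suc (suc n)} {2} {suc (suc n)} (ℕ.s≤s (ℕ.s≤s ℕ.z≤n)) (ℕ.s≤s (ℕ.s≤s ℕ.z≤n)))) le′))
  bad : ∀ {x y} → y ≢ + 0 → ∣ y ∣ ℕ.< 3 → ¬ 3ᴱ ∣ᴱ (x +ω y)
  bad ny lt d = let (_ , _ , r , e) = ι-∣ (+ 3) d in ¬3∣1 ny lt (r , e)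
  cases : ∀ a b → ∣ a ∣ ℕ.≤ 1 → ∣ b ∣ ℕ.≤ 1 → ‖ a +ω b ‖ ≡ 1 →
    (3ᴱ ∣ᴱ (a +ω b) · (a +ω b) ⊖ 1ᴱ ⊎ 3ᴱ ∣ᴱ (a +ω b) · (a +ω b) ⊹ 1ᴱ) → (a +ω b) ≡ 1ᴱ ⊎ (a +ω b) ≡ ⊝ 1ᴱ
  cases (+ 0) (+ 0) _ _ () _
  cases (+ 1) (+ 0) _ _ _ _ = inj₁ refl
  cases -[1+ 0 ] (+ 0) _ _ _ _ = inj₂ refl
  cases (+ 0) (+ 1) _ _ _ s = ⊥-elim ([ bad (λ ()) (ℕ.s≤s (ℕ.s≤s ℕ.z≤n)) , bad (λ ()) (ℕ.s≤s (ℕ.s≤s ℕ.z≤n)) ]′ s)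
  cases (+ 0) -[1+ 0 ] _ _ _ s = ⊥-elim ([ bad (λ ()) (ℕ.s≤s (ℕ.s≤s ℕ.z≤n)) , bad (λ ()) (ℕ.s≤s (ℕ.s≤s ℕ.z≤n)) ]′ s)
  cases (+ 1) (+ 1) _ _ _ s = ⊥-elim ([ bad (λ ()) (ℕ.s≤s (ℕ.s≤s ℕ.z≤n)) , bad (λ ()) (ℕ.s≤s (ℕ.s≤s ℕ.z≤n)) ]′ s)
  cases -[1+ 0 ] -[1+ 0 ] _ _ _ s = ⊥-elim ([ bad (λ ()) (ℕ.s≤s (ℕ.s≤s ℕ.z≤n)) , bad (λ ()) (ℕ.s≤s (ℕ.s≤s ℕ.z≤n)) ]′ s)
  cases (+ 1) -[1+ 0 ] _ _ () _
  cases -[1+ 0 ] (+ 1) _ _ () _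
  cases (+ suc (suc n)) _ (ℕ.s≤s ()) _ _ _
  cases -[1+ suc n ] _ (ℕ.s≤s ()) _ _ _
  cases (+ 0) (+ suc (suc n)) _ (ℕ.s≤s ()) _ _
  cases (+ 1) (+ suc (suc n)) _ (ℕ.s≤s ()) _ _
  cases -[1+ 0 ] (+ suc (suc n)) _ (ℕ.s≤s ()) _ _
  cases (+ 0) -[1+ suc n ] _ (ℕ.s≤s ()) _ _
  cases (+ 1) -[1+ suc n ] _ (ℕ.s≤s ()) _ _
  cases -[1+ 0 ] -[1+ suc n ] _ (ℕ.s≤s ()) _ _

module V₂ = Valuation 2-prime
module V₃ = Valuation ϖ-prime

-- Induction on the norm: a prime divisor p of x does not divide 2 because x is odd, its order in x
-- is a positive multiple of 3, and dividing x by p³ preserves the hypotheses.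
unit-times-cube : ∀ x → x ≢ 0ᴱ → ¬ 2ᴱ ∣ᴱ x →
  (∀ {p} (P : Prime p) → ¬ p ∣ᴱ 2ᴱ → ∀ n → Valuation.V P n x → 3 ∣ n) →
  ¬ ¬ (∃[ u ] ∃[ c ] (u ∣ᴱ 1ᴱ × x ≡ u · c ³))
unit-times-cube x = go x (ℕ.<-wellFounded ‖ x ‖)
  where
  open 𝔼S
  go : ∀ x → ℕ.Acc ℕ._<_ ‖ x ‖ → x ≢ 0ᴱ → ¬ 2ᴱ ∣ᴱ x →
    (∀ {p} (P : Prime p) → ¬ p ∣ᴱ 2ᴱ → ∀ n → Valuation.V P n x → 3 ∣ n) →
    ¬ ¬ (∃[ u ] ∃[ c ] (u ∣ᴱ 1ᴱ × x ≡ u · c ³))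
  go x (ℕ.acc rs) nx odd div3 none with ‖ x ‖ ℕ.≟ 1
  ... | yes e = none (x , 1ᴱ , norm-one-unit e , solve 1 (λ x → x := x :* (κ 1ᴱ :* κ 1ᴱ :* κ 1ᴱ)) refl x)
  ... | no ne = prime-divisor x nx ne step
    where
    step : ¬ (∃[ p ] (Prime p × p ∣ᴱ x))
    step (p , P , p∣x) with Valuation.V-exists P nx
    ... | n , vn with div3 P p∤2 n vn
      where
      p∤2 : ¬ p ∣ᴱ 2ᴱ
      p∤2 (h , 2≡ph) = [ (λ 2∣p → odd (∣ᴱ-trans 2∣p p∣x)) , 2∤h ]′ (Prime.split 2-prime p h (1ᴱ , sym 2≡ph))
        where
        2∤h : ¬ 2ᴱ ∣ᴱ h
        2∤h (k , h≡2k) = Prime.nonunit P (k , ·-cancelˡ 2ᴱ (λ ()) (trans 2≡ph (trans (cong (p ·_) h≡2k)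
          (solve 2 (λ p k → p :* (κ 2ᴱ :* k) := κ 2ᴱ :* (p :* k)) refl p k))))
    step (p , P , p∣x) | n , vn | divides zero refl =
      ℕ.<⇒≱ {0} {1} (ℕ.s≤s ℕ.z≤n) (Valuation.V-O-≤ P vn (Valuation.o (subst (_∣ᴱ x) (solve 1 (λ p → p := p :* κ 1ᴱ) refl p) p∣x)))
    step (p , P , p∣x) | n , Valuation.v {u} x≡ _ | divides (suc k) refl =
      go y (rs lt) ny (λ h → odd (subst (2ᴱ ∣ᴱ_) (sym x≡p³y) (∣ᴱ-·ˡ (p ³) h))) div3′
        λ { (w , c , wu , e) → none (w , p · c , wu , trans x≡p³y (trans (cong (p ³ ·_) e)
          (solve 3 (λ p w c → (p :* p :* p) :* (w :* (c :* c :* c)) := w :* ((p :* c) :* (p :* c) :* (p :* c))) refl p w c))) }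
      where
      y = p ^ᴱ (k ℕ.* 3) · u
      x≡p³y : x ≡ p ³ · y
      x≡p³y = trans x≡ (solve 3 (λ p a u → (p :* (p :* (p :* a))) :* u := (p :* p :* p) :* (a :* u)) refl p (p ^ᴱ (k ℕ.* 3)) u)
      ny : y ≢ 0ᴱ
      ny e = nx (trans x≡p³y (trans (cong (p ³ ·_) e) (·-zeroʳ (p ³))))
      np = Prime.nonzero P
      lt : ‖ y ‖ ℕ.< ‖ x ‖
      lt = subst (‖ y ‖ ℕ.<_) (sym (trans (cong ‖_‖ x≡p³y) (trans (‖‖-· (p ³) y) (ℕ.*-comm ‖ p ³ ‖ ‖ y ‖))))
        (ℕ.m<m*n ‖ y ‖ ‖ p ³ ‖ {{‖‖-nonzero ny}} (ℕ.≤∧≢⇒< (ℕ.>-nonZero⁻¹ _ {{‖‖-nonzero (·-nonzero (·-nonzero np np) np)}})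
          λ e → Prime.nonunit P (∣ᴱ-trans (p · p , solve 1 (λ p → p :* p :* p := p :* (p :* p)) refl p) (norm-one-unit (sym e)))))
      div3′ : ∀ {q} (Q : Prime q) → ¬ q ∣ᴱ 2ᴱ → ∀ n → Valuation.V Q n y → 3 ∣ n
      div3′ {q} Q q∤2 n vy with Valuation.V-exists Q np
      ... | m , vp = ∣m+n∣m⇒∣n
        (div3 Q q∤2 (m ℕ.+ m ℕ.+ m ℕ.+ n) (subst (Valuation.V Q _) (sym x≡p³y)
          (Valuation.V-· Q (Valuation.V-· Q (Valuation.V-· Q vp vp) vp) vy)))
        (divides m (trans (ℕ.+-assoc m m m) (trans (cong (λ t → m ℕ.+ (m ℕ.+ t)) (sym (ℕ.+-identityʳ m))) (ℕ.*-comm 3 m))))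

-- Orders of the descent factors at primes not dividing 6.

ω̄ : 𝔼
ω̄ = ω ᶜ

3∣-double : ∀ {n} → 3 ∣ n ℕ.+ n → 3 ∣ n
3∣-double {n} h = ∣m+n∣m⇒∣n (divides n (trans (ℕ.+-assoc n n n) (trans (cong (λ t → n ℕ.+ (n ℕ.+ t)) (sym (ℕ.+-identityʳ n))) (ℕ.*-comm 3 n)))) h

triple : ∀ n → 3 ∣ n ℕ.+ n ℕ.+ n
triple n = divides n (trans (ℕ.+-assoc n n n) (trans (cong (λ t → n ℕ.+ (n ℕ.+ t)) (sym (ℕ.+-identityʳ n))) (ℕ.*-comm 3 n)))

3∣-drop : ∀ m n → 3 ∣ m ℕ.+ n → 3 ∣ m → 3 ∣ n
3∣-drop m n = ∣m+n∣m⇒∣n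

module ℕS where
  open import Data.Nat.Solver as _ using (module +-*-Solver)
  open +-*-Solver public using (solve; _:=_; _:+_; _:*_; con)

module CubeValuation {p : 𝔼} (P : Prime p) (p∤2 : ¬ p ∣ᴱ 2ᴱ) where
  open Valuation P
  open 𝔼S using (solve; _:=_; _:+_; _:-_; _:*_; :-_; κ)

  V-2 : V 0 2ᴱ
  V-2 = V-unit p∤2

  unit-V : ∀ {u} → u ∣ᴱ 1ᴱ → V 0 u
  unit-V h = V-unit λ d → Prime.nonunit P (∣ᴱ-trans d h)

  -- The ultrametric cases for the orders x of β - z and y of β + z, where β has order b and z has
  -- order f. Cancellation can raise the order of at most one of the two, since their difference is
  -- 2z and 2 is a unit at p.
  data Split (b f x y : ℕ) (β z : 𝔼) : Set where
    low   : b ℕ.< f → x ≡ b → y ≡ b → Split b f x y β z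
    high  : x ≡ f → y ≡ f → Split b f x y β z
    plus  : b ≡ f → x ≡ f → f ℕ.< y → O (suc f) (β ⊹ z) → Split b f x y β z
    minus : b ≡ f → y ≡ f → f ℕ.< x → O (suc f) (β ⊖ z) → Split b f x y β z

  V-3-cube : ∀ {n x} → V n x → V (n ℕ.+ n ℕ.+ n) (x ³)
  V-3-cube a = V-· (V-· a a) a

  split-values : ∀ {b f x y β z} → V b β → V f z → V x (β ⊖ z) → V y (β ⊹ z) → Split b f x y β z
  split-values {b} {f} {x} {y} {β} {z} vb vf vx vy with ℕ.<-cmp b f
  ... | tri< b<f _ _ = low b<f (V-unique vx (V-⊹ vb (O-⊝ (O-≤ b<f (V⇒O vf))))) (V-unique vy (V-⊹ vb (O-≤ b<f (V⇒O vf))))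
  ... | tri> _ _ f<b = high
    (V-unique vx (subst (V f) (solve 2 (λ b z → :- z :+ b := b :- z) refl β z) (V-⊹ (V-⊝ vf) (O-≤ f<b (V⇒O vb)))))
    (V-unique vy (subst (V f) (solve 2 (λ b z → z :+ b := b :+ z) refl β z) (V-⊹ vf (O-≤ f<b (V⇒O vb)))))
  ... | tri≈ _ refl _ with V-or-O {f} (O-⊖ (V⇒O vb) (V⇒O vf)) | V-or-O {f} (O-⊹ (V⇒O vb) (V⇒O vf))
  ...   | inj₁ a | inj₁ c = high (V-unique vx a) (V-unique vy c)
  ...   | inj₁ a | inj₂ c = plus refl (V-unique vx a) (V-O-≤ vy c) c
  ...   | inj₂ a | inj₁ c = minus refl (V-unique vy c) (V-O-≤ vx a) a
  ...   | inj₂ a | inj₂ c = ⊥-elim (ℕ.1+n≰n (V-O-≤ (V-· V-2 vf)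
    (subst (O (suc f)) (solve 2 (λ b z → b :+ z :- (b :- z) := κ 2ᴱ :* z) refl β z) (O-⊖ c a))))

  -- Here l, α, b and f are the orders of Λ, a₀, β and e, and x and y those of the factors β - ωe
  -- and β + ωe; bars mark the orders of the conjugates. Since x + y = l + 3α, the congruence l + x
  -- ≡ 0 modulo 3 is immediate when x = y. Only the case of a cancellation needs the middle equation
  -- `D2`.
  module _ (p∤3 : ¬ p ∣ᴱ 3ᴱ) {β e Λ a₀ a₁ : 𝔼} (e-real : e ᶜ ≡ e)
    (D1 : β · β ⊖ ω · ω · e · e ≡ Λ · a₀ ³)
    (D1ᶜ : β ᶜ · β ᶜ ⊖ ω̄ · ω̄ · e · e ≡ Λ · a₀ ᶜ ³)
    (D2 : 2ᴱ · β · β ᶜ ⊖ ι (+ 10) · e · e ≡ Λ · (a₁ ³ ⊖ 3ᴱ · a₀ · a₀ ᶜ · a₁))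
    {b b̄ f l α ᾱ x y x̄ ȳ : ℕ} (vb : V b β) (vb̄ : V b̄ (β ᶜ)) (vf : V f e) (vl : V l Λ) (vα : V α a₀) (vᾱ : V ᾱ (a₀ ᶜ))
    (vx : V x (β ⊖ ω · e)) (vy : V y (β ⊹ ω · e)) (vx̄ : V x̄ (β ᶜ ⊖ ω̄ · e)) (vȳ : V ȳ (β ᶜ ⊹ ω̄ · e)) where

    val-product : x ℕ.+ y ≡ l ℕ.+ (α ℕ.+ α ℕ.+ α)
    val-product = V-unique (V-· vx vy) (subst (V _) (trans (sym D1) (solve 2 (λ β e → β :* β :- κ ω :* κ ω :* e :* e := (β :- κ ω :* e) :* (β :+ κ ω :* e)) refl β e)) (V-· vl (V-3-cube vα)))

    val-product̄ : x̄ ℕ.+ ȳ ≡ l ℕ.+ (ᾱ ℕ.+ ᾱ ℕ.+ ᾱ)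
    val-product̄ = V-unique (V-· vx̄ vȳ) (subst (V _) (trans (sym D1ᶜ) (solve 2 (λ β e → β :* β :- κ ω̄ :* κ ω̄ :* e :* e := (β :- κ ω̄ :* e) :* (β :+ κ ω̄ :* e)) refl (β ᶜ) e)) (V-· vl (V-3-cube vᾱ)))

    private
      Q = 2ᴱ · β · β ᶜ ⊖ ι (+ 10) · e · e

      ω-unit : ω ∣ᴱ 1ᴱ
      ω-unit = ω̄ , refl

      ω̄-unit : ω̄ ∣ᴱ 1ᴱ
      ω̄-unit = ω , refl

      -- The middle coefficient forces 3 v(a₁) + v(Λ) = v(Q), as 2 v(a₁) ≥ v(a₀ ā₀) would make v(Q) too large.
      middle : V (f ℕ.+ b̄) Q → f ℕ.+ f ℕ.< x ℕ.+ y → b̄ ℕ.+ b̄ ℕ.≤ x̄ ℕ.+ ȳ → ∃[ ε ] l ℕ.+ (ε ℕ.+ (ε ℕ.+ ε)) ≡ f ℕ.+ b̄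
      middle vQ lt le with V-exists a₁≢0 | V-exists s≢0
        where
        Q≡ : Q ≡ Λ · (a₁ · (a₁ · a₁ ⊖ 3ᴱ · a₀ · a₀ ᶜ))
        Q≡ = trans D2 (solve 4 (λ Λ a b c → Λ :* (a :* a :* a :- κ 3ᴱ :* b :* c :* a) := Λ :* (a :* (a :* a :- κ 3ᴱ :* b :* c))) refl Λ a₁ a₀ (a₀ ᶜ))
        a₁≢0 : a₁ ≢ 0ᴱ
        a₁≢0 h = V⇒≢0 vQ (trans Q≡ (trans (cong (λ t → Λ · (t · (a₁ · a₁ ⊖ 3ᴱ · a₀ · a₀ ᶜ))) h) (solve 2 (λ Λ t → Λ :* (κ 0ᴱ :* t) := κ 0ᴱ) refl Λ (a₁ · a₁ ⊖ 3ᴱ · a₀ · a₀ ᶜ))))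
        s≢0 : a₁ · a₁ ⊖ 3ᴱ · a₀ · a₀ ᶜ ≢ 0ᴱ
        s≢0 h = V⇒≢0 vQ (trans Q≡ (trans (cong (λ t → Λ · (a₁ · t)) h) (solve 2 (λ Λ t → Λ :* (t :* κ 0ᴱ) := κ 0ᴱ) refl Λ a₁)))
      ... | ε , vε | σ , vσ = go (ℕ.<-≤-connex (ε ℕ.+ ε) (α ℕ.+ ᾱ))
        where
        total : l ℕ.+ (ε ℕ.+ σ) ≡ f ℕ.+ b̄
        total = V-unique (V-· vl (V-· vε vσ)) (subst (V _)
          (trans D2 (solve 4 (λ Λ a b c → Λ :* (a :* a :* a :- κ 3ᴱ :* b :* c :* a) := Λ :* (a :* (a :* a :- κ 3ᴱ :* b :* c))) refl Λ a₁ a₀ (a₀ ᶜ))) vQ)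
        Oaa : O (α ℕ.+ ᾱ) (3ᴱ · a₀ · a₀ ᶜ)
        Oaa = subst (O (α ℕ.+ ᾱ)) (solve 2 (λ a b → κ 3ᴱ :* (a :* b) := κ 3ᴱ :* a :* b) refl a₀ (a₀ ᶜ)) (O-·ˡ 3ᴱ (V⇒O (V-· vα vᾱ)))
        go : ε ℕ.+ ε ℕ.< α ℕ.+ ᾱ ⊎ α ℕ.+ ᾱ ℕ.≤ ε ℕ.+ ε → ∃[ ε ] l ℕ.+ (ε ℕ.+ (ε ℕ.+ ε)) ≡ f ℕ.+ b̄
        go (inj₁ ε<) = ε , trans (cong (λ t → l ℕ.+ (ε ℕ.+ t)) (V-unique (V-⊹ (V-· vε vε) (O-⊝ (O-≤ ε< Oaa))) vσ)) total
        go (inj₂ ε≥) = ⊥-elim (ℕ.<-irrefl refl (begin-strict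
          (f ℕ.+ f) ℕ.+ (b̄ ℕ.+ b̄)   <⟨ ℕ.+-mono-<-≤ lt le ⟩
          (x ℕ.+ y) ℕ.+ (x̄ ℕ.+ ȳ)   ≡⟨ cong₂ ℕ._+_ val-product val-product̄ ⟩
          (l ℕ.+ (α ℕ.+ α ℕ.+ α)) ℕ.+ (l ℕ.+ (ᾱ ℕ.+ ᾱ ℕ.+ ᾱ))
            ≡⟨ ℕS.solve 3 (λ l a b → (l ℕS.:+ (a ℕS.:+ a ℕS.:+ a)) ℕS.:+ (l ℕS.:+ (b ℕS.:+ b ℕS.:+ b)) ℕS.:= (l ℕS.:+ l) ℕS.:+ ((a ℕS.:+ b) ℕS.:+ ((a ℕS.:+ b) ℕS.:+ (a ℕS.:+ b)))) refl l α ᾱ ⟩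
          (l ℕ.+ l) ℕ.+ ((α ℕ.+ ᾱ) ℕ.+ ((α ℕ.+ ᾱ) ℕ.+ (α ℕ.+ ᾱ)))
            ≤⟨ ℕ.+-monoʳ-≤ (l ℕ.+ l) (ℕ.+-mono-≤ ε≥ (ℕ.+-mono-≤ σ≥ σ≥)) ⟩
          (l ℕ.+ l) ℕ.+ ((ε ℕ.+ ε) ℕ.+ (σ ℕ.+ σ))
            ≡⟨ ℕS.solve 3 (λ l a b → (l ℕS.:+ l) ℕS.:+ ((a ℕS.:+ a) ℕS.:+ (b ℕS.:+ b)) ℕS.:= (l ℕS.:+ (a ℕS.:+ b)) ℕS.:+ (l ℕS.:+ (a ℕS.:+ b))) refl l ε σ ⟩
          (l ℕ.+ (ε ℕ.+ σ)) ℕ.+ (l ℕ.+ (ε ℕ.+ σ)) ≡⟨ cong₂ ℕ._+_ total total ⟩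
          (f ℕ.+ b̄) ℕ.+ (f ℕ.+ b̄)
            ≡⟨ ℕS.solve 2 (λ f b → (f ℕS.:+ b) ℕS.:+ (f ℕS.:+ b) ℕS.:= (f ℕS.:+ f) ℕS.:+ (b ℕS.:+ b)) refl f b̄ ⟩
          (f ℕ.+ f) ℕ.+ (b̄ ℕ.+ b̄)   ∎))
          where
          open ℕ.≤-Reasoning
          σ≥ : α ℕ.+ ᾱ ℕ.≤ σ
          σ≥ = V-O-≤ vσ (O-⊖ (O-≤ ε≥ (V⇒O (V-· vε vε))) Oaa)

      -- If β and β̄ agree with τωe and τ̄ω̄e up to terms of higher order, then Q agrees with (2ττ̄
      -- - 10)e². For signs τ and τ̄ the constant is -8 or -12, a unit at primes not dividing 6.
      near : ∀ τ τ̄ c → V 0 c → c ≡ 2ᴱ · (τ · τ̄) ⊖ ι (+ 10) → b ≡ f → b̄ ≡ f →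
        O (suc f) (β ⊖ τ · (ω · e)) → O (suc f) (β ᶜ ⊖ τ̄ · (ω̄ · e)) → V (f ℕ.+ b̄) Q
      near τ τ̄ c vc c≡ refl refl h h̄ = subst (V (f ℕ.+ f)) eq
        (V-⊹ (V-· vc (V-· vf vf)) (O-·ˡ 2ᴱ (O-⊹ (O-· h (V⇒O vb̄)) (O-·ˡ τ (subst (λ t → O t (ω · e · (β ᶜ ⊖ τ̄ · (ω̄ · e)))) (ℕ.+-comm f (suc f)) (O-· (V⇒O (V-· (unit-V ω-unit) vf)) h̄))))))
        where
        eq = trans (cong (λ t → t · (e · e) ⊹ 2ᴱ · ((β ⊖ τ · (ω · e)) · β ᶜ ⊹ τ · (ω · e · (β ᶜ ⊖ τ̄ · (ω̄ · e))))) c≡)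
          (solve 5 (λ τ τ̄ β β̄ e → (κ 2ᴱ :* (τ :* τ̄) :- κ (ι (+ 10))) :* (e :* e)
              :+ κ 2ᴱ :* ((β :- τ :* (κ ω :* e)) :* β̄ :+ τ :* (κ ω :* e :* (β̄ :- τ̄ :* (κ ω̄ :* e))))
              := κ 2ᴱ :* β :* β̄ :- κ (ι (+ 10)) :* e :* e) refl τ τ̄ β (β ᶜ) e)

      V-8 : V 0 (⊝ ι (+ 8))
      V-8 = V-⊝ (V-· (V-· V-2 V-2) V-2)

      V-12 : V 0 (⊝ ι (+ 12))
      V-12 = V-⊝ (V-· (V-· V-2 V-2) (V-unit p∤3))

      flip : ∀ {n z} → O n (β ⊹ z) → O n (β ⊖ ⊝ 1ᴱ · z)
      flip {n} {z} = subst (O n) (solve 2 (λ β z → β :+ z := β :- (:- κ 1ᴱ) :* z) refl β z)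

      flipᶜ : ∀ {n z} → O n (β ᶜ ⊹ z) → O n (β ᶜ ⊖ ⊝ 1ᴱ · z)
      flipᶜ {n} {z} = subst (O n) (solve 2 (λ β z → β :+ z := β :- (:- κ 1ᴱ) :* z) refl (β ᶜ) z)

      keep : ∀ {n z} → O n (β ⊖ z) → O n (β ⊖ 1ᴱ · z)
      keep {n} {z} = subst (O n) (solve 2 (λ β z → β :- z := β :- κ 1ᴱ :* z) refl β z)

      keepᶜ : ∀ {n z} → O n (β ᶜ ⊖ z) → O n (β ᶜ ⊖ 1ᴱ · z)
      keepᶜ {n} {z} = subst (O n) (solve 2 (λ β z → β :- z := β :- κ 1ᴱ :* z) refl (β ᶜ) z)

      -- In the remaining cases v(β) = v(e) = f and it suffices to show 3 ∣ v(Λ) + f.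
      unequal : b ≡ f → f ℕ.+ f ℕ.< x ℕ.+ y →
        (O (suc f) (β ⊖ ⊝ 1ᴱ · (ω · e)) ⊎ O (suc f) (β ⊖ 1ᴱ · (ω · e))) → 3 ∣ l ℕ.+ f
      unequal b≡f lt h with split-values vb̄ (V-· (unit-V ω̄-unit) vf) vx̄ vȳ
      ... | high refl refl = 3∣-drop (ᾱ ℕ.+ ᾱ ℕ.+ ᾱ) _ (subst (3 ∣_)
            (trans (cong (ℕ._+ f) val-product̄) (ℕS.solve 3 (λ l a f → l ℕS.:+ (a ℕS.:+ a ℕS.:+ a) ℕS.:+ f ℕS.:= (a ℕS.:+ a ℕS.:+ a) ℕS.:+ (l ℕS.:+ f)) refl l ᾱ f)) (triple f)) (triple ᾱ)
      -- Now Q has the order f + b̄ of 2ββ̄. From l + 3ε = f + b̄ and 2b̄ = l + 3ᾱ one gets 2(l +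
      -- 3ε) = 2f + l + 3ᾱ, hence l + f ≡ 0 modulo 3.
      ... | low b̄<f refl refl with middle (subst (V (f ℕ.+ b̄)) refl (V-⊹ {f ℕ.+ b̄} (subst (λ t → V (t ℕ.+ b̄) _) b≡f (V-· (V-· V-2 vb) vb̄))
              (O-⊝ (O-≤ {suc (f ℕ.+ b̄)} {f ℕ.+ f} (ℕ.+-monoʳ-< f b̄<f) (O-· (O-·ˡ (ι (+ 10)) (V⇒O vf)) (V⇒O vf)))))) lt ℕ.≤-refl
      ...   | ε , total = 3∣-drop ((ε ℕ.+ ε ℕ.+ ε) ℕ.+ (ε ℕ.+ ε ℕ.+ ε)) (l ℕ.+ f) (subst (3 ∣_) eq (∣m∣n⇒∣m+n (triple ᾱ) (triple f))) (∣m∣n⇒∣m+n (triple ε) (triple ε))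
        where
        eq : (ᾱ ℕ.+ ᾱ ℕ.+ ᾱ) ℕ.+ (f ℕ.+ f ℕ.+ f) ≡ ((ε ℕ.+ ε ℕ.+ ε) ℕ.+ (ε ℕ.+ ε ℕ.+ ε)) ℕ.+ (l ℕ.+ f)
        eq = ℕ.+-cancelˡ-≡ l _ _ (begin
          l ℕ.+ ((ᾱ ℕ.+ ᾱ ℕ.+ ᾱ) ℕ.+ (f ℕ.+ f ℕ.+ f)) ≡⟨ ℕS.solve 3 (λ l a f → l ℕS.:+ ((a ℕS.:+ a ℕS.:+ a) ℕS.:+ (f ℕS.:+ f ℕS.:+ f)) ℕS.:= (l ℕS.:+ (a ℕS.:+ a ℕS.:+ a)) ℕS.:+ (f ℕS.:+ f ℕS.:+ f)) refl l ᾱ f ⟩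
          (l ℕ.+ (ᾱ ℕ.+ ᾱ ℕ.+ ᾱ)) ℕ.+ (f ℕ.+ f ℕ.+ f) ≡⟨ cong (ℕ._+ (f ℕ.+ f ℕ.+ f)) (sym val-product̄) ⟩
          (b̄ ℕ.+ b̄) ℕ.+ (f ℕ.+ f ℕ.+ f) ≡⟨ ℕS.solve 2 (λ b f → (b ℕS.:+ b) ℕS.:+ (f ℕS.:+ f ℕS.:+ f) ℕS.:= (f ℕS.:+ b) ℕS.:+ (f ℕS.:+ b) ℕS.:+ f) refl b̄ f ⟩
          (f ℕ.+ b̄) ℕ.+ (f ℕ.+ b̄) ℕ.+ f ≡⟨ cong (λ t → t ℕ.+ t ℕ.+ f) (sym total) ⟩
          (l ℕ.+ (ε ℕ.+ (ε ℕ.+ ε))) ℕ.+ (l ℕ.+ (ε ℕ.+ (ε ℕ.+ ε))) ℕ.+ f ≡⟨ ℕS.solve 3 (λ l a f → (l ℕS.:+ (a ℕS.:+ (a ℕS.:+ a))) ℕS.:+ (l ℕS.:+ (a ℕS.:+ (a ℕS.:+ a))) ℕS.:+ f ℕS.:= l ℕS.:+ (((a ℕS.:+ a ℕS.:+ a) ℕS.:+ (a ℕS.:+ a ℕS.:+ a)) ℕS.:+ (l ℕS.:+ f))) refl l ε f ⟩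
          l ℕ.+ (((ε ℕ.+ ε ℕ.+ ε) ℕ.+ (ε ℕ.+ ε ℕ.+ ε)) ℕ.+ (l ℕ.+ f)) ∎)
          where open ≡-Reasoning
      unequal b≡f lt h | plus b̄≡f refl f<ȳ h̄ with middle (combine h) lt (ℕ.+-mono-≤ (ℕ.≤-reflexive b̄≡f) (ℕ.≤-trans (ℕ.≤-reflexive b̄≡f) (ℕ.<⇒≤ f<ȳ)))
        where
        combine : (O (suc f) (β ⊖ ⊝ 1ᴱ · (ω · e)) ⊎ O (suc f) (β ⊖ 1ᴱ · (ω · e))) → V (f ℕ.+ b̄) Q
        combine (inj₁ g) = near (⊝ 1ᴱ) (⊝ 1ᴱ) _ V-8 refl b≡f b̄≡f g (flipᶜ h̄)
        combine (inj₂ g) = near 1ᴱ (⊝ 1ᴱ) _ V-12 refl b≡f b̄≡f g (flipᶜ h̄)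
      ... | ε , total = conclude b̄≡f ε total
        where
        conclude : b̄ ≡ f → ∀ ε → l ℕ.+ (ε ℕ.+ (ε ℕ.+ ε)) ≡ f ℕ.+ b̄ → 3 ∣ l ℕ.+ f
        conclude refl ε total = 3∣-drop (ε ℕ.+ ε ℕ.+ ε) _ (subst (3 ∣_) (trans (cong (ℕ._+ f) (sym total))
          (ℕS.solve 3 (λ l a f → (l ℕS.:+ (a ℕS.:+ (a ℕS.:+ a))) ℕS.:+ f ℕS.:= (a ℕS.:+ a ℕS.:+ a) ℕS.:+ (l ℕS.:+ f)) refl l ε f)) (triple f)) (triple ε)
      unequal b≡f lt h | minus b̄≡f refl f<x̄ h̄ with middle (combine h) lt (ℕ.+-mono-≤ (ℕ.≤-trans (ℕ.≤-reflexive b̄≡f) (ℕ.<⇒≤ f<x̄)) (ℕ.≤-reflexive b̄≡f))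
        where
        combine : (O (suc f) (β ⊖ ⊝ 1ᴱ · (ω · e)) ⊎ O (suc f) (β ⊖ 1ᴱ · (ω · e))) → V (f ℕ.+ b̄) Q
        combine (inj₁ g) = near (⊝ 1ᴱ) 1ᴱ _ V-12 refl b≡f b̄≡f g (keepᶜ h̄)
        combine (inj₂ g) = near 1ᴱ 1ᴱ _ V-8 refl b≡f b̄≡f g (keepᶜ h̄)
      ... | ε , total = conclude b̄≡f ε total
        where
        conclude : b̄ ≡ f → ∀ ε → l ℕ.+ (ε ℕ.+ (ε ℕ.+ ε)) ≡ f ℕ.+ b̄ → 3 ∣ l ℕ.+ f
        conclude refl ε total = 3∣-drop (ε ℕ.+ ε ℕ.+ ε) _ (subst (3 ∣_) (trans (cong (ℕ._+ f) (sym total))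
          (ℕS.solve 3 (λ l a f → (l ℕS.:+ (a ℕS.:+ (a ℕS.:+ a))) ℕS.:+ f ℕS.:= (a ℕS.:+ a ℕS.:+ a) ℕS.:+ (l ℕS.:+ f)) refl l ε f)) (triple f)) (triple ε)

    -- 2x = l + 3α gives 3x = (l + x) + 3α.
    equal⇒3∣ : x ≡ y → 3 ∣ l ℕ.+ x
    equal⇒3∣ refl = 3∣-drop (α ℕ.+ α ℕ.+ α) _ (subst (3 ∣_) (trans (cong (ℕ._+ x) val-product)
      (ℕS.solve 3 (λ l a x → (l ℕS.:+ (a ℕS.:+ a ℕS.:+ a)) ℕS.:+ x ℕS.:= (a ℕS.:+ a ℕS.:+ a) ℕS.:+ (l ℕS.:+ x)) refl l α x)) (triple x)) (triple α)

    -- Without cancellation x = y. With cancellation in β + ωe, x is f and `unequal` applies. With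
    -- cancellation in β - ωe, y is f and x = l + 3α - f, so l + x ≡ 2(l + f) modulo 3.
    3∣valuation : 3 ∣ l ℕ.+ x
    3∣valuation with split-values vb (V-· (unit-V ω-unit) vf) vx vy
    ... | low _ x≡b y≡b = equal⇒3∣ (trans x≡b (sym y≡b))
    ... | high x≡f y≡f = equal⇒3∣ (trans x≡f (sym y≡f))
    ... | plus b≡f refl f<y h = unequal b≡f (ℕ.+-monoʳ-< f f<y) (inj₁ (flip h))
    ... | minus b≡f refl f<x h = 3∣-drop ((l ℕ.+ f) ℕ.+ (l ℕ.+ f)) (l ℕ.+ x) (subst (3 ∣_) (begin
          (l ℕ.+ f) ℕ.+ ((l ℕ.+ l ℕ.+ l) ℕ.+ (α ℕ.+ α ℕ.+ α)) ≡⟨ ℕS.solve 3 (λ l a f → (l ℕS.:+ f) ℕS.:+ ((l ℕS.:+ l ℕS.:+ l) ℕS.:+ (a ℕS.:+ a ℕS.:+ a)) ℕS.:= (l ℕS.:+ (a ℕS.:+ a ℕS.:+ a)) ℕS.:+ (l ℕS.:+ l ℕS.:+ l) ℕS.:+ f) refl l α f ⟩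
          (l ℕ.+ (α ℕ.+ α ℕ.+ α)) ℕ.+ (l ℕ.+ l ℕ.+ l) ℕ.+ f ≡⟨ cong (λ t → t ℕ.+ (l ℕ.+ l ℕ.+ l) ℕ.+ f) (sym val-product) ⟩
          (x ℕ.+ f) ℕ.+ (l ℕ.+ l ℕ.+ l) ℕ.+ f ≡⟨ ℕS.solve 3 (λ l x f → (x ℕS.:+ f) ℕS.:+ (l ℕS.:+ l ℕS.:+ l) ℕS.:+ f ℕS.:= (l ℕS.:+ f) ℕS.:+ (l ℕS.:+ f) ℕS.:+ (l ℕS.:+ x)) refl l x f ⟩
          (l ℕ.+ f) ℕ.+ (l ℕ.+ f) ℕ.+ (l ℕ.+ x) ∎) (∣m∣n⇒∣m+n 3∣lf (∣m∣n⇒∣m+n (triple l) (triple α)))) (∣m∣n⇒∣m+n 3∣lf 3∣lf)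
      where
      open ≡-Reasoning
      3∣lf = unequal b≡f (ℕ.+-monoˡ-< f f<x) (inj₂ (keep h))

-- Descent data, and the local conditions at 2 and √-3.

-- On Y² = ω²T⁶ + 10T³ + ω̄² let the divisor with abscissae a₀T² + a₁T + ā₀ = 0 lie on eY = βT³ +
-- β̄. Then (βT³ + β̄)² - e²(ω²T⁶ + 10T³ + ω̄²) is Λ times the product of that quadratic over T, ωT
-- and ω²T, namely a₀³T⁶ + (a₁³ - 3a₀ā₀a₁)T³ + ā₀³. The fields compare the coefficients of T⁶ and
-- T³; the constant terms give the conjugate of the first equation.
record Datum (β : 𝔼) (e Λ : ℤ) (a₀ : 𝔼) (a₁ : ℤ) : Set where
  constructor datum
  field
    outer  : β · β ⊖ ω · ω · ι e · ι e ≡ ι Λ · a₀ ³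
    middle : 2ᴱ · β · β ᶜ ⊖ ι (+ 10) · ι e · ι e ≡ ι Λ · (ι a₁ ³ ⊖ 3ᴱ · a₀ · a₀ ᶜ · ι a₁)

real : ∀ w → w ᶜ ≡ w → ∃[ a ] w ≡ ι a
real (a +ω b) e = a , cong (a +ω_) (trans (ℤS.solve 2 (λ a b → b ℤS.:= a ℤS.:- (a ℤS.:- b)) refl a b)
  (trans (cong (λ t → a - 𝔼.re t) e) (ℤ.+-inverseʳ a)))

^ᴱ-conj : ∀ a n → (ι a ^ᴱ n) ᶜ ≡ ι a ^ᴱ n
^ᴱ-conj a zero = refl
^ᴱ-conj a (suc n) = trans (conj-· (ι a) (ι a ^ᴱ n)) (cong₂ _·_ (conj-ι a) (^ᴱ-conj a n))

-- The cofactor is fixed by conjugation, hence a rational integer, and an odd rational integer is 1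
-- modulo 2, whereas an odd Eisenstein integer can also be ω or ω̄.
odd-part : ∀ {k n w} → ι n ≡ 2ᴱ ^ᴱ k · w → ¬ 2ᴱ ∣ᴱ w → 2ᴱ ∣ᴱ w ⊖ 1ᴱ
odd-part {k} {n} {w} e odd with real w w-real
  where
  w-real : w ᶜ ≡ w
  w-real = ·-cancelˡ (2ᴱ ^ᴱ k) (^ᴱ-≢0 (λ ()) k) (trans (cong (_· w ᶜ) (sym (^ᴱ-conj (+ 2) k)))
    (trans (sym (conj-· (2ᴱ ^ᴱ k) w)) (trans (cong _ᶜ (sym e)) (trans (conj-ι n) e))))
... | a , refl with mod2 a
... | q , inj₁ refl = ⊥-elim (odd (∣-ι (+ 2) (q , refl) (0ℤ , refl)))
... | q , inj₂ refl = ∣-ι (+ 2) (q , ℤS.solve 1 (λ q → ℤS.κ 1ℤ ℤS.:+ ℤS.κ (+ 2) ℤS.:* q ℤS.:- ℤS.κ 1ℤ ℤS.:= ℤS.κ (+ 2) ℤS.:* q) refl q) (0ℤ , refl)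

odd-cube : ∀ c → ¬ 2ᴱ ∣ᴱ c → 2ᴱ ∣ᴱ c ³ ⊖ 1ᴱ
odd-cube c odd with residue4 c
... | inj₁ h = ⊥-elim (odd h)
... | inj₂ (u , u³ , q , e) = (q · (c · c ⊹ c · u ⊹ u · u)) , (begin
    c ³ ⊖ 1ᴱ                                      ≡⟨ cong (c ³ ⊖_) (sym u³) ⟩
    c ³ ⊖ u ³                                     ≡⟨ solve 2 (λ c u → c :* c :* c :- u :* u :* u := (c :- u) :* (c :* c :+ c :* u :+ u :* u)) refl c u ⟩
    (c ⊖ u) · (c · c ⊹ c · u ⊹ u · u)             ≡⟨ cong (_· (c · c ⊹ c · u ⊹ u · u)) e ⟩
    2ᴱ · q · (c · c ⊹ c · u ⊹ u · u)              ≡⟨ solve 3 (λ t q r → t :* q :* r := t :* (q :* r)) refl 2ᴱ q (c · c ⊹ c · u ⊹ u · u) ⟩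
    2ᴱ · (q · (c · c ⊹ c · u ⊹ u · u))            ∎)
  where
  open 𝔼S
  open ≡-Reasoning

-- A cube prime to ϖ is ±1 modulo 3 = -ϖ².
cube-mod3 : ∀ c → ¬ ϖ ∣ᴱ c → 3ᴱ ∣ᴱ c ³ ⊖ 1ᴱ ⊎ 3ᴱ ∣ᴱ c ³ ⊹ 1ᴱ
cube-mod3 c h with residue3 c
... | k , inj₁ e = ⊥-elim (h (k , e))
... | k , inj₂ (inj₁ refl) = inj₁ ((ϖ · k ⊹ ϖ · ϖ · k · k ⊖ ϖ · k · k · k) ,
  solve 1 (λ k → let x = κ 1ᴱ :+ κ ϖ :* k in x :* x :* x :- κ 1ᴱ := κ 3ᴱ :* (κ ϖ :* k :+ κ ϖ :* κ ϖ :* k :* k :- κ ϖ :* k :* k :* k)) refl k)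
  where open 𝔼S
... | k , inj₂ (inj₂ refl) = inj₂ ((ϖ · k ⊖ ϖ · ϖ · k · k ⊖ ϖ · k · k · k) ,
  solve 1 (λ k → let x = :- κ 1ᴱ :+ κ ϖ :* k in x :* x :* x :+ κ 1ᴱ := κ 3ᴱ :* (κ ϖ :* k :- κ ϖ :* κ ϖ :* k :* k :- κ ϖ :* k :* k :* k)) refl k)
  where open 𝔼S

square-of-cube-mod3 : ∀ c → ¬ ϖ ∣ᴱ c → 3ᴱ ∣ᴱ c ³ · c ³ ⊖ 1ᴱ
square-of-cube-mod3 c h = [ (λ d → subst (3ᴱ ∣ᴱ_) eq (∣ᴱ-·ʳ (c ³ ⊹ 1ᴱ) d)) , (λ d → subst (3ᴱ ∣ᴱ_) eq (∣ᴱ-·ˡ (c ³ ⊖ 1ᴱ) d)) ]′ (cube-mod3 c h)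
  where
  eq = 𝔼S.solve 1 (λ t → (t 𝔼S.:- 𝔼S.κ 1ᴱ) 𝔼S.:* (t 𝔼S.:+ 𝔼S.κ 1ᴱ) 𝔼S.:= t 𝔼S.:* t 𝔼S.:- 𝔼S.κ 1ᴱ) refl (c ³)

square-of-power-mod3 : ∀ j → 3ᴱ ∣ᴱ 2ᴱ ^ᴱ j · 2ᴱ ^ᴱ j ⊖ 1ᴱ
square-of-power-mod3 zero = 0ᴱ , refl
square-of-power-mod3 (suc j) = subst (3ᴱ ∣ᴱ_)
  (solve 1 (λ t → κ (ι (+ 4)) :* (t :* t :- κ 1ᴱ) :+ κ 3ᴱ :* κ 1ᴱ := κ 2ᴱ :* t :* (κ 2ᴱ :* t) :- κ 1ᴱ) refl (2ᴱ ^ᴱ j))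
  (∣ᴱ-⊹ (∣ᴱ-·ˡ (ι (+ 4)) (square-of-power-mod3 j)) (1ᴱ , refl))
  where open 𝔼S

V₃-2 : V₃.V 0 2ᴱ
V₃-2 = V₃.V-unit λ h → ϖ-nonunit (subst (ϖ ∣ᴱ_) (𝔼S.solve 0 (𝔼S.κ 3ᴱ 𝔼S.:- 𝔼S.κ 2ᴱ 𝔼S.:= 𝔼S.κ 1ᴱ) refl) (∣ᴱ-⊹ (⊝ ϖ , refl) (∣ᴱ-⊝ h)))

V₃-unit : ∀ {u} → u ∣ᴱ 1ᴱ → V₃.V 0 u
V₃-unit h = V₃.V-unit λ d → ϖ-nonunit (∣ᴱ-trans d h)

V₃-2^ : ∀ j → V₃.V 0 (2ᴱ ^ᴱ j)
V₃-2^ zero = V₃-unit ∣ᴱ-refl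
V₃-2^ (suc j) = V₃.V-· V₃-2 (V₃-2^ j)

-- As 3 = -ϖ², the prime p divides ϖ. Since ϖ is itself prime it divides p or the cofactor, and the
-- latter would make p a unit.
associate : ∀ {p} (P : Prime p) → p ∣ᴱ 3ᴱ → p ∣ᴱ ϖ × V₃.V 1 p
associate {p} P h = p∣ϖ , vp
  where
  p∣ϖ : p ∣ᴱ ϖ
  p∣ϖ = [ (λ d → d) , (λ d → d) ]′ (Prime.split P ϖ ϖ (∣ᴱ-trans h (⊝ 1ᴱ , refl)))
  vp : V₃.V 1 p
  vp with p∣ϖ
  ... | q , ϖ≡pq with Prime.split ϖ-prime p q (1ᴱ , trans (sym ϖ≡pq) refl)
  ... | inj₁ (t , p≡ϖt) = V₃.v {cofactor = t} (trans p≡ϖt (cong (_· t) {x = ϖ} {y = ϖ · 1ᴱ} refl))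
          λ ϖ∣t → ϖ-nonunit (∣ᴱ-trans ϖ∣t (q , ·-cancelˡ ϖ (λ ()) (trans refl (trans ϖ≡pq (trans (cong (_· q) p≡ϖt)
            (𝔼S.solve 3 (λ a b c → a 𝔼S.:* b 𝔼S.:* c 𝔼S.:= a 𝔼S.:* (b 𝔼S.:* c)) refl ϖ t q))))))
  ... | inj₂ (t , q≡ϖt) = ⊥-elim (Prime.nonunit P (t , ·-cancelˡ ϖ (λ ()) (trans refl (trans ϖ≡pq (trans (cong (p ·_) q≡ϖt)
            (𝔼S.solve 3 (λ a b c → b 𝔼S.:* (a 𝔼S.:* c) 𝔼S.:= a 𝔼S.:* (b 𝔼S.:* c)) refl ϖ p t))))))

associate-V : ∀ {p n x} (P : Prime p) → p ∣ᴱ 3ᴱ → Valuation.V P n x → V₃.V n x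
associate-V {p} {n} P h (Valuation.v {w} refl pw) = subst (λ t → V₃.V t (p ^ᴱ n · w)) (ℕ.+-identityʳ n) (V₃.V-· (power n) (V₃.V-unit λ ϖ∣w → pw (∣ᴱ-trans (proj₁ (associate P h)) ϖ∣w)))
  where
  power : ∀ n → V₃.V n (p ^ᴱ n)
  power zero = V₃-unit ∣ᴱ-refl
  power (suc n) = V₃.V-· (proj₂ (associate P h)) (power n)

^ᴱ-mul3 : ∀ x q → x ^ᴱ (q ℕ.* 3) ≡ (x ^ᴱ q) ³
^ᴱ-mul3 x zero = refl
^ᴱ-mul3 x (suc q) = trans (cong (λ t → x · (x · (x · t))) (^ᴱ-mul3 x q))
  (𝔼S.solve 2 (λ x a → x 𝔼S.:* (x 𝔼S.:* (x 𝔼S.:* (a 𝔼S.:* a 𝔼S.:* a))) 𝔼S.:= (x 𝔼S.:* a) 𝔼S.:* (x 𝔼S.:* a) 𝔼S.:* (x 𝔼S.:* a)) refl x (x ^ᴱ q))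

outer-conj : ∀ {β e Λ a₀} → β · β ⊖ ω · ω · ι e · ι e ≡ ι Λ · a₀ ³ → β ᶜ · β ᶜ ⊖ ω̄ · ω̄ · ι e · ι e ≡ ι Λ · a₀ ᶜ ³
outer-conj {β} {e} {Λ} {a₀} h = begin
  β ᶜ · β ᶜ ⊖ ω̄ · ω̄ · ι e · ι e        ≡⟨ sym lhs ⟩
  (β · β ⊖ ω · ω · ι e · ι e) ᶜ        ≡⟨ cong _ᶜ h ⟩
  (ι Λ · a₀ ³) ᶜ                       ≡⟨ trans (conj-· (ι Λ) (a₀ ³)) (cong₂ _·_ (conj-ι Λ) (trans (conj-· (a₀ · a₀) a₀) (cong (_· a₀ ᶜ) (conj-· a₀ a₀)))) ⟩
  ι Λ · a₀ ᶜ ³                         ∎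
  where
  open ≡-Reasoning
  lhs : (β · β ⊖ ω · ω · ι e · ι e) ᶜ ≡ β ᶜ · β ᶜ ⊖ ω̄ · ω̄ · ι e · ι e
  lhs = trans (conj-⊹ (β · β) _) (cong₂ _⊹_ (conj-· β β) (trans (conj-⊝ (ω · ω · ι e · ι e)) (cong ⊝_
    (trans (conj-· (ω · ω · ι e) (ι e)) (cong₂ _·_ (trans (conj-· (ω · ω) (ι e)) (cong (ω̄ · ω̄ ·_) (conj-ι e))) (conj-ι e))))))

¬ω≡1 : ¬ 2ᴱ ∣ᴱ ω ⊖ 1ᴱ
¬ω≡1 h with ι-∣ (+ 2) h
... | _ , _ , q , e with trans (cong ∣_∣ e) (ℤ.abs-* (+ 2) q)
... | e′ with ℕ.m*n≡1⇒m≡1 2 ∣ q ∣ (sym e′)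
... | ()

-- As ω ≢ 1 modulo 2, a difference 2Λeω cannot have odd part 1, so the two factors have equal valuation at 2.
two-adic : ∀ {x₁ x₂ y c : 𝔼} {n : ℤ} {j} → x₁ ≡ 2ᴱ ^ᴱ j · c ³ → ¬ 2ᴱ ∣ᴱ c → x₁ · x₂ ≡ y ³ → y ≢ 0ᴱ →
  x₂ ⊖ x₁ ≡ ω · ι n → n ≢ 0ℤ → 3 ∣ j
two-adic {x₁} {x₂} {y} {c} {n} {j} x₁≡ odd x₁x₂ y≢0 diff n≢0
  with V₂.V-exists y≢0 | V₂.V-exists {ι n} (n≢0 ∘ ι-injective) | V₂.V-exists x₂≢0
  where
  x₂≢0 : x₂ ≢ 0ᴱ
  x₂≢0 e = ·-nonzero (·-nonzero y≢0 y≢0) y≢0 (trans (sym x₁x₂) (trans (cong (x₁ ·_) e) (·-zeroʳ x₁)))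
... | vy , V₂.v {y′} y≡ y′odd | k , V₂.v {w} n≡ wodd | v₂ , V₂.v {x₂′} x₂≡ x₂′odd = go (ℕ.<-cmp j v₂)
  where
  open 𝔼S
  c³odd : ¬ 2ᴱ ∣ᴱ c ³
  c³odd h = [ [ odd , odd ]′ ∘ V₂split c c , odd ]′ (V₂split (c · c) c h)
    where V₂split = Prime.split 2-prime
  V₁ : V₂.V j x₁
  V₁ = V₂.v x₁≡ c³odd
  Vy : V₂.V vy y
  Vy = V₂.v y≡ y′odd
  sum : j ℕ.+ v₂ ≡ vy ℕ.+ vy ℕ.+ vy
  sum = V₂.V-unique (V₂.V-· V₁ (V₂.v x₂≡ x₂′odd)) (subst (V₂.V _) (sym x₁x₂) (V₂.V-· (V₂.V-· Vy Vy) Vy))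
  ω-odd : ¬ 2ᴱ ∣ᴱ ω
  ω-odd h = 2ᴱ-nonunit (∣ᴱ-trans h (ω̄ , refl))
  Vn : V₂.V k (ι n)
  Vn = V₂.v n≡ wodd
  Vdiff : V₂.V k (x₂ ⊖ x₁)
  Vdiff = subst (V₂.V k) (sym diff) (V₂.V-· (V₂.V-unit ω-odd) Vn)
  contra : ∀ {z m} → x₂ ⊖ x₁ ≡ 2ᴱ ^ᴱ m · z → 2ᴱ ∣ᴱ z ⊖ 1ᴱ → V₂.V m (x₂ ⊖ x₁) → ⊥
  contra {z} {m} e z1 vm with V₂.V-unique Vdiff vm
  ... | refl = ¬ω≡1 (subst (2ᴱ ∣ᴱ_)
    (trans (cong (λ t → t ⊖ ω · (w ⊖ 1ᴱ) ⊹ (z ⊖ 1ᴱ) ⊖ z) (sym ωw≡z)) (trans (cong (λ t → ω · w ⊖ ω · (w ⊖ 1ᴱ) ⊹ (t ⊖ 1ᴱ) ⊖ z) refl) (solve 2 (λ w z → κ ω :* w :- κ ω :* (w :- κ 1ᴱ) :+ (z :- κ 1ᴱ) :- z := κ ω :- κ 1ᴱ) refl w z)))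
    (subst (2ᴱ ∣ᴱ_) (solve 2 (λ w z → :- (κ ω :* (w :- κ 1ᴱ)) :+ (z :- κ 1ᴱ) := z :- κ ω :* (w :- κ 1ᴱ) :+ (z :- κ 1ᴱ) :- z) refl w z)
      (∣ᴱ-⊹ (∣ᴱ-⊝ (∣ᴱ-·ˡ ω (odd-part {k} {n} n≡ wodd))) z1)))
    where
    ωw≡z : ω · w ≡ z
    ωw≡z = ·-cancelˡ (2ᴱ ^ᴱ m) (^ᴱ-≢0 (λ ()) m) (trans (solve 2 (λ a w → a :* (κ ω :* w) := κ ω :* (a :* w)) refl (2ᴱ ^ᴱ m) w)
      (trans (cong (ω ·_) (sym n≡)) (trans (sym diff) e)))
  suc-odd : ∀ {z q} → 2ᴱ ∣ᴱ z ⊖ 1ᴱ → 2ᴱ ∣ᴱ z ⊹ 2ᴱ · q ⊖ 1ᴱ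
  suc-odd {z} {q} h = subst (2ᴱ ∣ᴱ_) (solve 2 (λ z q → z :- κ 1ᴱ :+ κ 2ᴱ :* q := z :+ κ 2ᴱ :* q :- κ 1ᴱ) refl z q) (∣ᴱ-⊹ h (q , refl))
  neg-odd : ∀ {z} → 2ᴱ ∣ᴱ z ⊖ 1ᴱ → 2ᴱ ∣ᴱ ⊝ z ⊖ 1ᴱ
  neg-odd {z} h = subst (2ᴱ ∣ᴱ_) (solve 1 (λ z → :- (z :- κ 1ᴱ) :+ κ 2ᴱ :* (:- κ 1ᴱ) := :- z :- κ 1ᴱ) refl z) (∣ᴱ-⊹ (∣ᴱ-⊝ h) (⊝ 1ᴱ , refl))
  -- the odd parts of x₁ and of x₁x₂ are odd cubes
  x₂′-odd : 2ᴱ ∣ᴱ x₂′ ⊖ 1ᴱ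
  x₂′-odd = subst (2ᴱ ∣ᴱ_) (trans (cong (λ t → t ⊖ 1ᴱ ⊖ x₂′ · (c ³ ⊖ 1ᴱ)) (sym cube)) (solve 2 (λ c x → c :* x :- κ 1ᴱ :- x :* (c :- κ 1ᴱ) := x :- κ 1ᴱ) refl (c ³) x₂′))
    (∣ᴱ-⊹ (odd-cube y′ y′odd) (∣ᴱ-⊝ (∣ᴱ-·ˡ x₂′ (odd-cube c odd))))
    where
    cube : c ³ · x₂′ ≡ y′ ³
    cube = ·-cancelˡ (2ᴱ ^ᴱ (j ℕ.+ v₂)) (^ᴱ-≢0 (λ ()) (j ℕ.+ v₂)) (begin
      2ᴱ ^ᴱ (j ℕ.+ v₂) · (c ³ · x₂′)        ≡⟨ cong (_· (c ³ · x₂′)) (^ᴱ-+ 2ᴱ j v₂) ⟩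
      2ᴱ ^ᴱ j · 2ᴱ ^ᴱ v₂ · (c ³ · x₂′)      ≡⟨ solve 4 (λ a b c d → a :* b :* (c :* d) := (a :* c) :* (b :* d)) refl (2ᴱ ^ᴱ j) (2ᴱ ^ᴱ v₂) (c ³) x₂′ ⟩
      (2ᴱ ^ᴱ j · c ³) · (2ᴱ ^ᴱ v₂ · x₂′)    ≡⟨ cong₂ _·_ (sym x₁≡) (sym x₂≡) ⟩
      x₁ · x₂                                ≡⟨ x₁x₂ ⟩
      y ³                                    ≡⟨ cong _³ y≡ ⟩
      (2ᴱ ^ᴱ vy · y′) ³                      ≡⟨ solve 2 (λ a b → (a :* b) :* (a :* b) :* (a :* b) := a :* a :* a :* (b :* b :* b)) refl (2ᴱ ^ᴱ vy) y′ ⟩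
      2ᴱ ^ᴱ vy · 2ᴱ ^ᴱ vy · 2ᴱ ^ᴱ vy · y′ ³  ≡⟨ cong (_· y′ ³) (trans (cong (_· 2ᴱ ^ᴱ vy) (sym (^ᴱ-+ 2ᴱ vy vy))) (trans (sym (^ᴱ-+ 2ᴱ (vy ℕ.+ vy) vy)) (cong (2ᴱ ^ᴱ_) (sym sum)))) ⟩
      2ᴱ ^ᴱ (j ℕ.+ v₂) · y′ ³                ∎)
      where open ≡-Reasoning
  factor : ∀ {m d} → m ℕ.+ suc d ≡ v₂ → x₂ ≡ 2ᴱ ^ᴱ m · (2ᴱ · (2ᴱ ^ᴱ d · x₂′))
  factor {m} {d} refl = trans x₂≡ (trans (cong (_· x₂′) (^ᴱ-+ 2ᴱ m (suc d))) (solve 4 (λ a t b x → a :* (t :* b) :* x := a :* (t :* (b :* x))) refl (2ᴱ ^ᴱ m) 2ᴱ (2ᴱ ^ᴱ d) x₂′))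
  factor₁ : ∀ {m d} → m ℕ.+ suc d ≡ j → x₁ ≡ 2ᴱ ^ᴱ m · (2ᴱ · (2ᴱ ^ᴱ d · c ³))
  factor₁ {m} {d} refl = trans x₁≡ (trans (cong (_· c ³) (^ᴱ-+ 2ᴱ m (suc d))) (solve 4 (λ a t b x → a :* (t :* b) :* x := a :* (t :* (b :* x))) refl (2ᴱ ^ᴱ m) 2ᴱ (2ᴱ ^ᴱ d) (c ³)))
  odd-from : ∀ {z} → 2ᴱ ∣ᴱ z ⊖ 1ᴱ → ¬ 2ᴱ ∣ᴱ z
  odd-from {z} h g = 2ᴱ-nonunit (subst (2ᴱ ∣ᴱ_) (solve 1 (λ z → z :- (z :- κ 1ᴱ) := κ 1ᴱ) refl z) (∣ᴱ-⊹ g (∣ᴱ-⊝ h)))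
  gap : ∀ {m n} → m ℕ.< n → m ℕ.+ suc (n ℕ.∸ suc m) ≡ n
  gap {m} {n} h = trans (ℕ.+-suc m _) (ℕ.m+[n∸m]≡n h)
  go : _ → 3 ∣ j
  go (tri≈ _ refl _) = 3∣-double (subst (3 ∣_) (sym sum) (triple vy))
  go (tri< j<v₂ _ _) = ⊥-elim (contra {m = j} e z1 (V₂.v e (odd-from z1)))
    where
    q = 2ᴱ ^ᴱ (v₂ ℕ.∸ suc j) · x₂′
    e : x₂ ⊖ x₁ ≡ 2ᴱ ^ᴱ j · (⊝ c ³ ⊹ 2ᴱ · q)
    e = trans (cong₂ _⊖_ (factor (gap j<v₂)) x₁≡) (solve 3 (λ a q c → a :* (κ 2ᴱ :* q) :- a :* c := a :* (:- c :+ κ 2ᴱ :* q)) refl (2ᴱ ^ᴱ j) q (c ³))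
    z1 = suc-odd {⊝ c ³} {q} (neg-odd (odd-cube c odd))
  go (tri> _ _ v₂<j) = ⊥-elim (contra {m = v₂} e z1 (V₂.v e (odd-from z1)))
    where
    q = ⊝ (2ᴱ ^ᴱ (j ℕ.∸ suc v₂) · c ³)
    e : x₂ ⊖ x₁ ≡ 2ᴱ ^ᴱ v₂ · (x₂′ ⊹ 2ᴱ · q)
    e = trans (cong₂ _⊖_ x₂≡ (factor₁ (gap v₂<j))) (solve 3 (λ a q x → a :* x :- a :* (κ 2ᴱ :* q) := a :* (x :+ κ 2ᴱ :* (:- q))) refl (2ᴱ ^ᴱ v₂) (2ᴱ ^ᴱ (j ℕ.∸ suc v₂) · c ³) x₂′)
    z1 = suc-odd {x₂′} {q} x₂′-odd

conj-≢0 : ∀ {x} → x ≢ 0ᴱ → x ᶜ ≢ 0ᴱ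
conj-≢0 {x} nx e = nx (trans (sym (conj-conj x)) (cong _ᶜ e))

-- Because x₂ ≡ x₁ to two orders beyond t, dividing out powers of ϖ turns x₁x₂ = y³ into (2ʲ u c′³)²
-- ≡ y′³ modulo 3. There 4ʲ and c′⁶ are 1 and y′³ is ±1, so u² ≡ ±1, and only u = ±1 has this
-- property among the units.
three-adic : ∀ {x₁ x₂ y u c : 𝔼} {j t} → x₁ ≡ 2ᴱ ^ᴱ j · (u · c ³) → u ∣ᴱ 1ᴱ → x₁ · x₂ ≡ y ³ →
  V₃.V t x₁ → V₃.O (2 ℕ.+ t) (x₂ ⊖ x₁) → u ≡ 1ᴱ ⊎ u ≡ ⊝ 1ᴱ
three-adic {x₁} {x₂} {y} {u} {c} {j} {t} x₁≡ uu x₁x₂ vt (V₃.o (D , diff)) = go (V₃.V-exists c≢0) (V₃.V-exists y≢0)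
  where
  open 𝔼S
  c≢0 : c ≢ 0ᴱ
  c≢0 e = V₃.V⇒≢0 vt (trans x₁≡ (trans (cong (λ s → 2ᴱ ^ᴱ j · (u · s ³)) e) (solve 2 (λ a u → a :* (u :* (κ 0ᴱ :* κ 0ᴱ :* κ 0ᴱ)) := κ 0ᴱ) refl (2ᴱ ^ᴱ j) u)))
  vt₂ : V₃.V t x₂
  vt₂ = subst (V₃.V t) (solve 2 (λ a b → a :+ (b :- a) := b) refl x₁ x₂) (V₃.V-⊹ vt (V₃.O-≤ (ℕ.n≤1+n (suc t)) (V₃.o (D , diff))))
  y≢0 : y ≢ 0ᴱ
  y≢0 e = V₃.V⇒≢0 (V₃.V-· vt vt₂) (trans x₁x₂ (trans (cong _³ e) refl))
  go : ∃[ γ ] V₃.V γ c → ∃[ η ] V₃.V η y → u ≡ 1ᴱ ⊎ u ≡ ⊝ 1ᴱ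
  go (γ , vc@(V₃.v {c′} c≡ ϖ∤c′)) (η , vy@(V₃.v {y′} y≡ ϖ∤y′)) =
    unit-square u uu ([ (λ h → inj₁ (mod-u (⊝ 1ᴱ) h)) , (λ h → inj₂ (mod-u 1ᴱ h)) ]′ (cube-mod3 y′ ϖ∤y′))
    where
    T = γ ℕ.+ γ ℕ.+ γ
    t≡ : t ≡ T
    t≡ = V₃.V-unique vt (subst (V₃.V _) (sym x₁≡) (V₃.V-· (V₃-2^ j) (V₃.V-· (V₃-unit uu) (V₃.V-· (V₃.V-· vc vc) vc))))
    η≡ : t ℕ.+ t ≡ η ℕ.+ η ℕ.+ η
    η≡ = V₃.V-unique (V₃.V-· vt vt₂) (subst (V₃.V _) (sym x₁x₂) (V₃.V-· (V₃.V-· vy vy) vy))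
    power-cube : ∀ k z w → z ≡ ϖ ^ᴱ k · w → z ³ ≡ ϖ ^ᴱ (k ℕ.+ k ℕ.+ k) · w ³
    power-cube k z w e = trans (cong _³ e) (trans (solve 2 (λ a w → (a :* w) :* (a :* w) :* (a :* w) := a :* a :* a :* (w :* w :* w)) refl (ϖ ^ᴱ k) w)
      (cong (_· w ³) (sym (trans (^ᴱ-+ ϖ (k ℕ.+ k) k) (cong (_· ϖ ^ᴱ k) (^ᴱ-+ ϖ k k))))))
    X = 2ᴱ ^ᴱ j · (u · c′ ³)
    x₁≡X : x₁ ≡ ϖ ^ᴱ t · X
    x₁≡X = trans x₁≡ (trans (cong (λ s → 2ᴱ ^ᴱ j · (u · s)) (power-cube γ c c′ c≡))
      (trans (solve 4 (λ a u p c → a :* (u :* (p :* c)) := p :* (a :* (u :* c))) refl (2ᴱ ^ᴱ j) u (ϖ ^ᴱ T) (c′ ³)) (cong (λ s → ϖ ^ᴱ s · X) (sym t≡))))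
    main : X · X ≡ y′ ³ ⊖ X · (⊝ 3ᴱ · D)
    main = ·-cancelˡ (ϖ ^ᴱ t · ϖ ^ᴱ t) (·-nonzero (^ᴱ-≢0 (λ ()) t) (^ᴱ-≢0 (λ ()) t)) (begin
      ϖ ^ᴱ t · ϖ ^ᴱ t · (X · X) ≡⟨ solve 2 (λ p x → p :* p :* (x :* x) := (p :* x) :* (p :* x)) refl (ϖ ^ᴱ t) X ⟩
      (ϖ ^ᴱ t · X) · (ϖ ^ᴱ t · X) ≡⟨ cong₂ _·_ (sym x₁≡X) (sym x₁≡X) ⟩
      x₁ · x₁ ≡⟨ solve 2 (λ a b → a :* a := a :* b :- a :* (b :- a)) refl x₁ x₂ ⟩
      x₁ · x₂ ⊖ x₁ · (x₂ ⊖ x₁) ≡⟨ cong₂ _⊖_ (trans x₁x₂ (trans (power-cube η y y′ y≡) (cong (_· y′ ³) (trans (cong (ϖ ^ᴱ_) (sym η≡)) (^ᴱ-+ ϖ t t))))) (cong₂ _·_ x₁≡X diff) ⟩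
      ϖ ^ᴱ t · ϖ ^ᴱ t · y′ ³ ⊖ ϖ ^ᴱ t · X · (ϖ · (ϖ · ϖ ^ᴱ t) · D)
        ≡⟨ solve 4 (λ p x y d → p :* p :* y :- p :* x :* (κ ϖ :* (κ ϖ :* p) :* d) := p :* p :* (y :- x :* (:- κ 3ᴱ :* d))) refl (ϖ ^ᴱ t) X (y′ ³) D ⟩
      ϖ ^ᴱ t · ϖ ^ᴱ t · (y′ ³ ⊖ X · (⊝ 3ᴱ · D)) ∎)
      where open ≡-Reasoning
    A = 2ᴱ ^ᴱ j · 2ᴱ ^ᴱ j
    C = c′ ³ · c′ ³
    mod-u : ∀ s → 3ᴱ ∣ᴱ y′ ³ ⊹ s → 3ᴱ ∣ᴱ u · u ⊹ s
    mod-u s h = subst (3ᴱ ∣ᴱ_) (trans (cong (λ q → q ⊹ s ⊹ 3ᴱ · (X · D) ⊖ u · u · ((A ⊖ 1ᴱ) · C ⊹ (C ⊖ 1ᴱ))) y³≡)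
        (solve 6 (λ a u c x d s → let xx = a :* (u :* c) in xx :* xx :- κ 3ᴱ :* (x :* d) :+ s :+ κ 3ᴱ :* (x :* d) :- u :* u :* ((a :* a :- κ 1ᴱ) :* (c :* c) :+ (c :* c :- κ 1ᴱ)) := u :* u :+ s) refl (2ᴱ ^ᴱ j) u (c′ ³) X D s))
      (∣ᴱ-⊹ (∣ᴱ-⊹ h (X · D , refl)) (∣ᴱ-⊝ (∣ᴱ-·ˡ (u · u) (∣ᴱ-⊹ (∣ᴱ-·ʳ C (square-of-power-mod3 j)) (square-of-cube-mod3 c′ ϖ∤c′)))))
      where
      y³≡ : y′ ³ ≡ X · X ⊖ 3ᴱ · (X · D)
      y³≡ = trans (solve 3 (λ y x d → y := y :- x :* (:- κ 3ᴱ :* d) :- κ 3ᴱ :* (x :* d)) refl (y′ ³) X D) (cong (_⊖ 3ᴱ · (X · D)) (sym main))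

-- The descent factors are cubes.

-- The hypothesis `oe` makes e two orders smaller at ϖ than β, so that both factors β ± ωe have the
-- order b of β. Multiplying them by Λ makes their product the cube of Λa₀.
module CubeRoot {β e Λ a₀ a₁ b} (D : Datum β e Λ a₀ a₁) (vb : V₃.V b β) (oe : V₃.O (2 ℕ.+ b) (ι e)) (e≢0 : e ≢ 0ℤ) where
  open Datum D
  open 𝔼S using (solve; _:=_; _:+_; _:-_; _:*_; :-_; κ)

  ξ₋ ξ₊ : 𝔼
  ξ₋ = β ⊖ ω · ι e
  ξ₊ = β ⊹ ω · ι e

  oz : V₃.O (suc b) (ω · ι e)
  oz = V₃.O-·ˡ ω (V₃.O-≤ (ℕ.n≤1+n (suc b)) oe)

  V-ξ₋ : V₃.V b ξ₋
  V-ξ₋ = V₃.V-⊹ vb (V₃.O-⊝ oz)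

  V-ξ₊ : V₃.V b ξ₊
  V-ξ₊ = V₃.V-⊹ vb oz

  ξξ : ξ₋ · ξ₊ ≡ ι Λ · a₀ ³
  ξξ = trans (solve 2 (λ β e → (β :- κ ω :* e) :* (β :+ κ ω :* e) := β :* β :- κ ω :* κ ω :* e :* e) refl β (ι e)) outer

  Λa≢0 : ι Λ · a₀ ³ ≢ 0ᴱ
  Λa≢0 h = V₃.V⇒≢0 (V₃.V-· V-ξ₋ V-ξ₊) (trans ξξ h)

  Λ≢0 : ι Λ ≢ 0ᴱ
  Λ≢0 h = Λa≢0 (trans (cong (_· a₀ ³) h) (solve 1 (λ t → κ 0ᴱ :* t := κ 0ᴱ) refl (a₀ ³)))

  a₀≢0 : a₀ ≢ 0ᴱ
  a₀≢0 h = Λa≢0 (trans (cong (λ t → ι Λ · t ³) h) (·-zeroʳ (ι Λ)))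

  x₁ x₂ y : 𝔼
  x₁ = ι Λ · ξ₋
  x₂ = ι Λ · ξ₊
  y = ι Λ · a₀

  x₁x₂ : x₁ · x₂ ≡ y ³
  x₁x₂ = trans (solve 3 (λ l a b → (l :* a) :* (l :* b) := l :* l :* (a :* b)) refl (ι Λ) ξ₋ ξ₊)
    (trans (cong (ι Λ · ι Λ ·_) ξξ) (solve 2 (λ l a → l :* l :* (l :* (a :* a :* a)) := (l :* a) :* (l :* a) :* (l :* a)) refl (ι Λ) a₀))

  x₁≢0 : x₁ ≢ 0ᴱ
  x₁≢0 = ·-nonzero Λ≢0 (V₃.V⇒≢0 V-ξ₋)

  diff : x₂ ⊖ x₁ ≡ ω · ι (+ 2 * (Λ * e))
  diff = trans (solve 3 (λ l β e → l :* (β :+ κ ω :* e) :- l :* (β :- κ ω :* e) := κ ω :* (κ 2ᴱ :* (l :* e))) refl (ι Λ) β (ι e))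
    (cong (ω ·_) (sym (trans (ι-* (+ 2) (Λ * e)) (cong (2ᴱ ·_) (ι-* Λ e)))))

  2Λe≢0 : + 2 * (Λ * e) ≢ 0ℤ
  2Λe≢0 h = ·-nonzero {2ᴱ} (λ ()) (·-nonzero Λ≢0 (e≢0 ∘ ι-injective)) (trans (sym (trans (ι-* (+ 2) (Λ * e)) (cong (2ᴱ ·_) (ι-* Λ e)))) (cong ι h))

  -- At ϖ both factors have order b, so 2b = v(Λ) + 3v(a₀) and v(Λ) + b ≡ 0 modulo 3. The remaining
  -- primes do not divide 6 and are covered by `CubeValuation`.
  3∣valuations : ∀ {p} (P : Prime p) → ¬ p ∣ᴱ 2ᴱ → ∀ n → Valuation.V P n x₁ → 3 ∣ n
  3∣valuations {p} P p∤2 n vn with p ∣ᴱ? 3ᴱ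
  ... | yes p∣3 = go (V₃.V-exists Λ≢0) (V₃.V-exists a₀≢0)
    where
    go : ∃[ l ] V₃.V l (ι Λ) → ∃[ α ] V₃.V α a₀ → 3 ∣ n
    go (l , vl) (α , vα) = subst (3 ∣_) (V₃.V-unique (V₃.V-· vl V-ξ₋) (associate-V P p∣3 vn))
      (3∣-drop (α ℕ.+ α ℕ.+ α) _ (subst (3 ∣_) (trans (cong (ℕ._+ b) bb)
        (ℕS.solve 3 (λ l a b → l ℕS.:+ (a ℕS.:+ a ℕS.:+ a) ℕS.:+ b ℕS.:= (a ℕS.:+ a ℕS.:+ a) ℕS.:+ (l ℕS.:+ b)) refl l α b)) (triple b)) (triple α))
      where
      bb : b ℕ.+ b ≡ l ℕ.+ (α ℕ.+ α ℕ.+ α)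
      bb = V₃.V-unique (V₃.V-· V-ξ₋ V-ξ₊) (subst (V₃.V _) (sym ξξ) (V₃.V-· vl (V₃.V-· (V₃.V-· vα vα) vα)))
  ... | no p∤3 = subst (3 ∣_) (V.V-unique (V.V-· (proj₂ l) (proj₂ x)) vn)
      (CubeValuation.3∣valuation P p∤2 p∤3 {β} {ι e} {ι Λ} {a₀} {ι a₁} (conj-ι e) outer (outer-conj {β} {e} {Λ} {a₀} outer) middle
        (proj₂ (V.V-exists (V₃.V⇒≢0 vb))) (proj₂ (V.V-exists (conj-≢0 (V₃.V⇒≢0 vb)))) (proj₂ (V.V-exists (e≢0 ∘ ι-injective))) (proj₂ l)
        (proj₂ (V.V-exists a₀≢0)) (proj₂ (V.V-exists (conj-≢0 a₀≢0))) (proj₂ x) (proj₂ (V.V-exists (V₃.V⇒≢0 V-ξ₊)))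
        (proj₂ (V.V-exists ξ̄₋≢0)) (proj₂ (V.V-exists ξ̄₊≢0)))
    where
    module V = Valuation P
    l = V.V-exists Λ≢0
    x = V.V-exists (V₃.V⇒≢0 V-ξ₋)
    ξ̄₋≢0 : β ᶜ ⊖ ω̄ · ι e ≢ 0ᴱ
    ξ̄₋≢0 h = conj-≢0 (V₃.V⇒≢0 V-ξ₋) (trans (trans (conj-⊹ β (⊝ (ω · ι e))) (cong (β ᶜ ⊹_) (trans (conj-⊝ (ω · ι e)) (cong ⊝_ (trans (conj-· ω (ι e)) (cong (ω̄ ·_) (conj-ι e))))))) h)
    ξ̄₊≢0 : β ᶜ ⊹ ω̄ · ι e ≢ 0ᴱ
    ξ̄₊≢0 h = conj-≢0 (V₃.V⇒≢0 V-ξ₊) (trans (trans (conj-⊹ β (ω · ι e)) (cong (β ᶜ ⊹_) (trans (conj-· ω (ι e)) (cong (ω̄ ·_) (conj-ι e))))) h)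

  -- Write x₁ = 2ʲw with w odd. All orders of w are multiples of 3, so w is a unit times a cube. By
  -- `three-adic` the unit is ±1, itself a cube, and then `two-adic` makes j a multiple of 3.
  cube-root : ¬ ¬ (∃[ r ] x₁ ≡ r ³)
  cube-root none = go (V₂.V-exists x₁≢0)
    where
    go : ∃[ j ] V₂.V j x₁ → ⊥
    go (j , V₂.v {w} x₁≡ odd) = unit-times-cube w w≢0 odd
        (λ P p∤2 n vn → 3∣valuations P p∤2 n (subst (Valuation.V P n) (sym x₁≡) (Valuation.V-· P (power P p∤2 j) vn)))
        λ { (u , c , uu , w≡) → finish u c uu (trans x₁≡ (cong (2ᴱ ^ᴱ j ·_) w≡)) (subst (λ t → ¬ 2ᴱ ∣ᴱ t) w≡ odd) }
      where
      w≢0 : w ≢ 0ᴱ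
      w≢0 h = x₁≢0 (trans x₁≡ (trans (cong (2ᴱ ^ᴱ j ·_) h) (·-zeroʳ (2ᴱ ^ᴱ j))))
      power : ∀ {p} (P : Prime p) → ¬ p ∣ᴱ 2ᴱ → ∀ j → Valuation.V P 0 (2ᴱ ^ᴱ j)
      power P p∤2 zero = Valuation.V-unit P (Prime.nonunit P)
      power P p∤2 (suc j) = Valuation.V-· P (Valuation.V-unit P p∤2) (power P p∤2 j)
      cubed : ∀ c → x₁ ≡ 2ᴱ ^ᴱ j · c ³ → ¬ 2ᴱ ∣ᴱ c ³ → ⊥
      cubed c eq c³odd = third j refl (two-adic {x₁} {x₂} {y} {c} {+ 2 * (Λ * e)} {j} eq (λ h → c³odd (∣ᴱ-·ʳ c (∣ᴱ-·ʳ c h))) x₁x₂ (·-nonzero Λ≢0 a₀≢0) diff 2Λe≢0)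
        where
        third : ∀ k → k ≡ j → 3 ∣ k → ⊥
        third .(q ℕ.* 3) k≡ (divides q refl) = none (2ᴱ ^ᴱ q · c , trans eq (trans (cong (_· c ³) (trans (cong (2ᴱ ^ᴱ_) (sym k≡)) (^ᴱ-mul3 2ᴱ q)))
            (solve 2 (λ a c → a :* a :* a :* (c :* c :* c) := (a :* c) :* (a :* c) :* (a :* c)) refl (2ᴱ ^ᴱ q) c)))
      diff-small : ∀ {l} → V₃.V l (ι Λ) → V₃.O (2 ℕ.+ (l ℕ.+ b)) (x₂ ⊖ x₁)
      diff-small {l} vl = subst (V₃.O (2 ℕ.+ (l ℕ.+ b))) (sym (solve 3 (λ l β e → l :* (β :+ κ ω :* e) :- l :* (β :- κ ω :* e) := κ 2ᴱ :* κ ω :* (l :* e)) refl (ι Λ) β (ι e)))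
          (V₃.O-·ˡ (2ᴱ · ω) (subst (λ t → V₃.O t (ι Λ · ι e)) (trans (ℕ.+-suc l (suc b)) (cong suc (ℕ.+-suc l b))) (V₃.O-· (V₃.V⇒O vl) oe)))
      finish : ∀ u c → u ∣ᴱ 1ᴱ → x₁ ≡ 2ᴱ ^ᴱ j · (u · c ³) → ¬ 2ᴱ ∣ᴱ u · c ³ → ⊥
      finish u c uu eq odd′ = by-valuation (V₃.V-exists Λ≢0)
        where
        one : u ≡ 1ᴱ → ⊥
        one refl = cubed c (trans eq (cong (2ᴱ ^ᴱ j ·_) (solve 1 (λ t → κ 1ᴱ :* t := t) refl (c ³)))) (odd′ ∘ subst (2ᴱ ∣ᴱ_) (solve 1 (λ t → t := κ 1ᴱ :* t) refl (c ³)))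
        minus-one : u ≡ ⊝ 1ᴱ → ⊥
        minus-one refl = cubed (⊝ c) (trans eq (cong (2ᴱ ^ᴱ j ·_) (solve 1 (λ c → :- κ 1ᴱ :* (c :* c :* c) := (:- c) :* (:- c) :* (:- c)) refl c)))
            (odd′ ∘ subst (2ᴱ ∣ᴱ_) (solve 1 (λ c → (:- c) :* (:- c) :* (:- c) := :- κ 1ᴱ :* (c :* c :* c)) refl c))
        by-valuation : ∃[ l ] V₃.V l (ι Λ) → ⊥
        by-valuation (l , vl) = [ one , minus-one ]′ (three-adic {x₁} {x₂} {y} {u} {c} {j} eq uu x₁x₂ (V₃.V-· vl V-ξ₋) (diff-small vl))

cube-roots : ∀ {x y} → x ³ ≡ y ³ → ∃[ ζ ] (ζ ³ ≡ 1ᴱ × x ≡ ζ · y)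
cube-roots {x} {y} e = [ (λ h → 1ᴱ , refl , trans (⊖≡0 x y h) (solve 1 (λ y → y := κ 1ᴱ :* y) refl y))
                       , [ (λ h → ω , refl , ⊖≡0 x (ω · y) h) , (λ h → ω̄ , refl , ⊖≡0 x (ω̄ · y) h) ]′ ∘ ·-integral (x ⊖ ω · y) (x ⊖ ω̄ · y) ]′
  (·-integral (x ⊖ y) ((x ⊖ ω · y) · (x ⊖ ω̄ · y)) (trans
    (solve 2 (λ x y → (x :- y) :* ((x :- κ ω :* y) :* (x :- κ ω̄ :* y)) := x :* x :* x :- y :* y :* y) refl x y)
    (trans (cong (_⊖ y ³) e) (solve 1 (λ t → t :- t := κ 0ᴱ) refl (y ³)))))
  where open 𝔼S

V₃-cong : ∀ {n x y} → x ≡ y → V₃.V n x → V₃.V n y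
V₃-cong refl h = h

-- `cube-root` applied to e and to -e gives r and s. The product rs has the same cube as Λa₀, so it
-- equals ζΛa₀ with ζ³ = 1, and replacing s by ζ²s removes ζ.
paired-roots : ∀ {β e Λ a₀ a₁ b} → Datum β e Λ a₀ a₁ → V₃.V b β → V₃.O (2 ℕ.+ b) (ι e) → e ≢ 0ℤ →
  ¬ ¬ (∃[ r ] ∃[ s ] (r ³ ≡ ι Λ · (β ⊖ ω · ι e) × s ³ ≡ ι Λ · (β ⊹ ω · ι e) × r · s ≡ ι Λ · a₀))
paired-roots {β} {e} {Λ} {a₀} {a₁} {b} D vb oe ne none = CubeRoot.cube-root D vb oe ne λ { (r , r³) →
  CubeRoot.cube-root D′ vb (V₃.O-⊝ oe) (λ h → ne (trans (sym (ℤ.neg-involutive e)) (cong -_ h))) λ { (s , s³) → go r s r³ (trans (sym s³) s³≡) } }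
  where
  open 𝔼S
  s³≡ : ι Λ · (β ⊖ ω · (⊝ ι e)) ≡ ι Λ · (β ⊹ ω · ι e)
  s³≡ = solve 3 (λ l β e → l :* (β :- κ ω :* (:- e)) := l :* (β :+ κ ω :* e)) refl (ι Λ) β (ι e)
  D′ : Datum β (- e) Λ a₀ a₁
  D′ = datum (trans (solve 2 (λ β e → β :* β :- κ ω :* κ ω :* (:- e) :* (:- e) := β :* β :- κ ω :* κ ω :* e :* e) refl β (ι e)) (Datum.outer D))
             (trans (solve 3 (λ β c e → κ 2ᴱ :* β :* c :- κ (ι (+ 10)) :* (:- e) :* (:- e) := κ 2ᴱ :* β :* c :- κ (ι (+ 10)) :* e :* e) refl β (β ᶜ) (ι e)) (Datum.middle D))
  go : ∀ r s → ι Λ · (β ⊖ ω · ι e) ≡ r ³ → s ³ ≡ ι Λ · (β ⊹ ω · ι e) → ⊥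
  go r s r³ s³ = twist (cube-roots {r · s} {ι Λ · a₀} (begin
      (r · s) ³ ≡⟨ solve 2 (λ r s → (r :* s) :* (r :* s) :* (r :* s) := (r :* r :* r) :* (s :* s :* s)) refl r s ⟩
      r ³ · s ³ ≡⟨ cong₂ _·_ (sym r³) s³ ⟩
      ι Λ · (β ⊖ ω · ι e) · (ι Λ · (β ⊹ ω · ι e)) ≡⟨ CubeRoot.x₁x₂ D vb oe ne ⟩
      (ι Λ · a₀) ³ ∎))
    where
    open ≡-Reasoning
    twist : ∃[ ζ ] (ζ ³ ≡ 1ᴱ × r · s ≡ ζ · (ι Λ · a₀)) → ⊥
    twist (ζ , ζ³ , rs) = none (r , ζ · ζ · s , sym r³ ,
      trans (solve 2 (λ z s → (z :* z :* s) :* (z :* z :* s) :* (z :* z :* s) := (z :* z :* z) :* (z :* z :* z) :* (s :* s :* s)) refl ζ s)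
        (trans (cong (λ t → t · t · s ³) ζ³) (trans (solve 1 (λ t → κ 1ᴱ :* κ 1ᴱ :* t := t) refl (s ³)) s³)) ,
      trans (solve 3 (λ z r s → r :* (z :* z :* s) := z :* z :* (r :* s)) refl ζ r s)
        (trans (cong (ζ · ζ ·_) rs) (trans (solve 2 (λ z y → z :* z :* (z :* y) := (z :* z :* z) :* y) refl ζ (ι Λ · a₀))
          (trans (cong (_· (ι Λ · a₀)) ζ³) (solve 1 (λ t → κ 1ᴱ :* t := t) refl (ι Λ · a₀))))))

-- Division by 1 - σ and its effect on orders at √-3.

O₃-cast : ∀ {m n x} k → m ≡ k ℕ.+ n → V₃.O m x → V₃.O n x
O₃-cast {m} {n} k e = V₃.O-≤ (subst (n ℕ.≤_) (sym e) (ℕ.m≤n+m n k))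

V₃-cast : ∀ {m n x} → m ≡ n → V₃.V m x → V₃.V n x
V₃-cast refl h = h

ϖ^-conj : ∀ n → (ϖ ^ᴱ n) ᶜ ≡ (⊝ ϖ) ^ᴱ n
ϖ^-conj zero = refl
ϖ^-conj (suc n) = trans (conj-· ϖ (ϖ ^ᴱ n)) (cong (⊝ ϖ ·_) (ϖ^-conj n))

sign : ℕ → 𝔼
sign n = (⊝ 1ᴱ) ^ᴱ n

neg-power : ∀ n → (⊝ ϖ) ^ᴱ n ≡ ϖ ^ᴱ n · sign n
neg-power zero = refl
neg-power (suc n) = trans (cong (⊝ ϖ ·_) (neg-power n)) (𝔼S.solve 2 (λ a b → 𝔼S.:- 𝔼S.κ ϖ 𝔼S.:* (a 𝔼S.:* b) 𝔼S.:= 𝔼S.κ ϖ 𝔼S.:* a 𝔼S.:* (𝔼S.:- 𝔼S.κ 1ᴱ 𝔼S.:* b)) refl (ϖ ^ᴱ n) (sign n))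

sign-square : ∀ n → sign n · sign n ≡ 1ᴱ
sign-square zero = refl
sign-square (suc n) = trans (𝔼S.solve 1 (λ a → 𝔼S.:- 𝔼S.κ 1ᴱ 𝔼S.:* a 𝔼S.:* (𝔼S.:- 𝔼S.κ 1ᴱ 𝔼S.:* a) 𝔼S.:= a 𝔼S.:* a) refl (sign n)) (sign-square n)

O₃-conj : ∀ {n x} → V₃.O n x → V₃.O n (x ᶜ)
O₃-conj {n} (V₃.o (q , refl)) = V₃.o (sign n · q ᶜ , trans (conj-· (ϖ ^ᴱ n) q) (trans (cong (_· q ᶜ) (trans (ϖ^-conj n) (neg-power n)))
  (𝔼S.solve 3 (λ a b c → a 𝔼S.:* b 𝔼S.:* c 𝔼S.:= a 𝔼S.:* (b 𝔼S.:* c)) refl (ϖ ^ᴱ n) (sign n) (q ᶜ))))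

V₃-conj : ∀ {n x} → V₃.V n x → V₃.V n (x ᶜ)
V₃-conj {n} {x} h = [ (λ g → g) , (λ g → ⊥-elim (ℕ.1+n≰n (V₃.V-O-≤ h (subst (V₃.O (suc n)) (conj-conj x) (O₃-conj g))))) ]′ (V₃.V-or-O (O₃-conj (V₃.V⇒O h)))

-- The difference of x and its conjugate gains a factor ϖ when x has even order.
conj-difference : ∀ {n x} → V₃.O (n ℕ.+ n) x → V₃.O (suc (n ℕ.+ n)) (x ⊖ x ᶜ)
conj-difference {n} {x} (V₃.o (q , e)) = V₃.o (ι (𝔼.im q) , (begin
    x ⊖ x ᶜ ≡⟨ cong (λ t → t ⊖ t ᶜ) e ⟩
    ϖ ^ᴱ (n ℕ.+ n) · q ⊖ (ϖ ^ᴱ (n ℕ.+ n) · q) ᶜ ≡⟨ cong (ϖ ^ᴱ (n ℕ.+ n) · q ⊖_) (trans (conj-· (ϖ ^ᴱ (n ℕ.+ n)) q) (cong (_· q ᶜ) even)) ⟩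
    ϖ ^ᴱ (n ℕ.+ n) · q ⊖ ϖ ^ᴱ (n ℕ.+ n) · q ᶜ ≡⟨ solve 3 (λ a q c → a :* q :- a :* c := a :* (q :- c)) refl (ϖ ^ᴱ (n ℕ.+ n)) q (q ᶜ) ⟩
    ϖ ^ᴱ (n ℕ.+ n) · (q ⊖ q ᶜ) ≡⟨ cong (ϖ ^ᴱ (n ℕ.+ n) ·_) (imaginary q) ⟩
    ϖ ^ᴱ (n ℕ.+ n) · (ϖ · ι (𝔼.im q)) ≡⟨ solve 3 (λ p a c → a :* (p :* c) := p :* a :* c) refl ϖ (ϖ ^ᴱ (n ℕ.+ n)) (ι (𝔼.im q)) ⟩
    ϖ · ϖ ^ᴱ (n ℕ.+ n) · ι (𝔼.im q) ∎))
  where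
  open 𝔼S
  open ≡-Reasoning
  imaginary : ∀ q → q ⊖ q ᶜ ≡ ϖ · ι (𝔼.im q)
  imaginary (a +ω b) = 𝔼-ext
    (ℤS.solve 2 (λ a b → a ℤS.:- (a ℤS.:- b) ℤS.:= ℤS.κ 1ℤ ℤS.:* b ℤS.:- ℤS.κ (+ 2) ℤS.:* ℤS.κ 0ℤ) refl a b)
    (ℤS.solve 1 (λ b → b ℤS.:- (ℤS.:- b) ℤS.:= ℤS.κ 1ℤ ℤS.:* ℤS.κ 0ℤ ℤS.:+ ℤS.κ (+ 2) ℤS.:* b ℤS.:- ℤS.κ (+ 2) ℤS.:* ℤS.κ 0ℤ) refl b)
  even : (ϖ ^ᴱ (n ℕ.+ n)) ᶜ ≡ ϖ ^ᴱ (n ℕ.+ n)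
  even = trans (ϖ^-conj (n ℕ.+ n)) (trans (^ᴱ-+ (⊝ ϖ) n n) (trans (cong₂ _·_ (neg-power n) (neg-power n))
    (trans (solve 2 (λ a s → a :* s :* (a :* s) := a :* a :* (s :* s)) refl (ϖ ^ᴱ n) (sign n)) (trans (cong (ϖ ^ᴱ n · ϖ ^ᴱ n ·_) (sign-square n))
      (trans (solve 1 (λ a → a :* a :* κ 1ᴱ := a :* a) refl (ϖ ^ᴱ n)) (sym (^ᴱ-+ ϖ n n)))))))

V₃-3 : V₃.V 2 3ᴱ
V₃-3 = V₃.v {cofactor = ⊝ 1ᴱ} refl λ { h → ϖ-nonunit (∣ᴱ-trans h (⊝ 1ᴱ , refl)) }

O₃-3 : ∀ x → V₃.O 2 (3ᴱ · x)
O₃-3 x = V₃.O-·ʳ x (V₃.V⇒O V₃-3)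

O₃-cancel : ∀ {m n x y} → V₃.V m x → V₃.O (m ℕ.+ n) (x · y) → V₃.O n y
O₃-cancel {m} {n} {x} {y} vx h with y ≟ᴱ 0ᴱ
... | yes refl = V₃.o (∣ᴱ-zero _)
... | no ny = go (V₃.V-exists ny)
  where
  go : ∃[ k ] V₃.V k y → V₃.O n y
  go (k , vy) = V₃.O-≤ (ℕ.+-cancelˡ-≤ m n k (V₃.V-O-≤ (V₃.V-· vx vy) h)) (V₃.V⇒O vy)

fermat3 : ∀ x → ϖ ∣ᴱ x ³ ⊖ x
fermat3 x = go (residue3 x)
  where
  open 𝔼S
  go : ∃[ k ] (x ≡ ϖ · k ⊎ x ≡ 1ᴱ ⊹ ϖ · k ⊎ x ≡ ⊝ 1ᴱ ⊹ ϖ · k) → ϖ ∣ᴱ x ³ ⊖ x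
  go (k , inj₁ refl) = _ , solve 1 (λ k → let x = κ ϖ :* k in x :* x :* x :- x := κ ϖ :* (κ ϖ :* κ ϖ :* k :* k :* k :- k)) refl k
  go (k , inj₂ (inj₁ refl)) = _ , solve 1 (λ k → let x = κ 1ᴱ :+ κ ϖ :* k in x :* x :* x :- x := κ ϖ :* (κ 2ᴱ :* k :+ κ 3ᴱ :* κ ϖ :* k :* k :+ κ ϖ :* κ ϖ :* k :* k :* k)) refl k
  go (k , inj₂ (inj₂ refl)) = _ , solve 1 (λ k → let x = :- κ 1ᴱ :+ κ ϖ :* k in x :* x :* x :- x := κ ϖ :* (κ 2ᴱ :* k :- κ 3ᴱ :* κ ϖ :* k :* k :+ κ ϖ :* κ ϖ :* k :* k :* k)) refl k

-- Multiplying r and s by inverse cube roots of unity makes them congruent modulo ϖ^(μ+2).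
align : ∀ {r s μ} → V₃.V μ r → V₃.V μ s → V₃.O (μ ℕ.+ μ ℕ.+ μ ℕ.+ 1) (s ³ ⊖ r ³) →
  ∃[ r′ ] ∃[ s′ ] (r′ ³ ≡ r ³ × s′ ³ ≡ s ³ × r′ · s′ ≡ r · s × V₃.V μ r′ × V₃.O (2 ℕ.+ μ) (s′ ⊖ r′))
align {r} {s} {μ} vr@(V₃.v {r′} r≡ ϖ∤r′) (V₃.v {s′} s≡ ϖ∤s′) h = choose s′-r′
  where
  open 𝔼S
  T = μ ℕ.+ μ ℕ.+ μ
  power : ϖ ^ᴱ T ≡ ϖ ^ᴱ μ · ϖ ^ᴱ μ · ϖ ^ᴱ μ
  power = trans (^ᴱ-+ ϖ (μ ℕ.+ μ) μ) (cong (_· ϖ ^ᴱ μ) (^ᴱ-+ ϖ μ μ))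
  cubes : ϖ ^ᴱ T · (s′ ³ ⊖ r′ ³) ≡ s ³ ⊖ r ³
  cubes = trans (cong (_· (s′ ³ ⊖ r′ ³)) power) (trans (solve 3 (λ p r s → p :* p :* p :* (s :* s :* s :- r :* r :* r) := (p :* s) :* (p :* s) :* (p :* s) :- (p :* r) :* (p :* r) :* (p :* r)) refl (ϖ ^ᴱ μ) r′ s′)
    (cong₂ (λ a b → a ³ ⊖ b ³) (sym s≡) (sym r≡)))
  V-power : ∀ n → V₃.V n (ϖ ^ᴱ n)
  V-power n = V₃.v {cofactor = 1ᴱ} (solve 1 (λ t → t := t :* κ 1ᴱ) refl (ϖ ^ᴱ n)) ϖ-nonunit
  O1 : ∀ {x} → V₃.O 1 x → ϖ ∣ᴱ x
  O1 (V₃.o (q , e)) = q , trans e (solve 1 (λ q → κ ϖ :* κ 1ᴱ :* q := κ ϖ :* q) refl q)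
  -- Cubing is the identity on the residue field of three elements, so congruent cubes have
  -- congruent roots.
  s′-r′ : ϖ ∣ᴱ s′ ⊖ r′
  s′-r′ = subst (ϖ ∣ᴱ_) (solve 2 (λ r s → s :* s :* s :- r :* r :* r :- (s :* s :* s :- s) :+ (r :* r :* r :- r) := s :- r) refl r′ s′)
    (∣ᴱ-⊹ (∣ᴱ-⊹ (O1 (O₃-cancel (V-power T) (subst (V₃.O (T ℕ.+ 1)) (sym cubes) h))) (∣ᴱ-⊝ (fermat3 s′))) (fermat3 r′))
  scaled : ∀ {x y q} → x ⊖ y ≡ ϖ · (ϖ · q) → V₃.O (2 ℕ.+ μ) (ϖ ^ᴱ μ · x ⊖ ϖ ^ᴱ μ · y)
  scaled {x} {y} {q} e = V₃.o (q , trans (solve 3 (λ p x y → p :* x :- p :* y := p :* (x :- y)) refl (ϖ ^ᴱ μ) x y) (trans (cong (ϖ ^ᴱ μ ·_) e)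
    (solve 2 (λ p q → p :* (κ ϖ :* (κ ϖ :* q)) := κ ϖ :* (κ ϖ :* p) :* q) refl (ϖ ^ᴱ μ) q)))
  twisted : ∀ ζ ζ′ → ζ · ζ′ ≡ 1ᴱ → ζ ³ ≡ 1ᴱ → ζ′ ³ ≡ 1ᴱ → ∀ q → ζ′ · s′ ⊖ ζ · r′ ≡ ϖ · (ϖ · q) →
    ∃[ r₁ ] ∃[ s₁ ] (r₁ ³ ≡ r ³ × s₁ ³ ≡ s ³ × r₁ · s₁ ≡ r · s × V₃.V μ r₁ × V₃.O (2 ℕ.+ μ) (s₁ ⊖ r₁))
  twisted ζ ζ′ inv ζ³ ζ′³ q e = ζ · r , ζ′ · s , absorb ζ ζ³ r , absorb ζ′ ζ′³ s ,
    trans (solve 4 (λ z z′ r s → (z :* r) :* (z′ :* s) := (z :* z′) :* (r :* s)) refl ζ ζ′ r s) (trans (cong (_· (r · s)) inv) (solve 1 (λ t → κ 1ᴱ :* t := t) refl (r · s))) ,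
    V₃.V-· (V₃-unit (ζ · ζ , trans (sym ζ³) (solve 1 (λ z → z :* z :* z := z :* (z :* z)) refl ζ))) vr ,
    subst (V₃.O (2 ℕ.+ μ)) (cong₂ _⊖_ (trans (solve 3 (λ p z s → p :* (z :* s) := z :* (p :* s)) refl (ϖ ^ᴱ μ) ζ′ s′) (cong (ζ′ ·_) (sym s≡)))
        (trans (solve 3 (λ p z s → p :* (z :* s) := z :* (p :* s)) refl (ϖ ^ᴱ μ) ζ r′) (cong (ζ ·_) (sym r≡)))) (scaled e)
    where
    absorb : ∀ ζ → ζ ³ ≡ 1ᴱ → ∀ x → (ζ · x) ³ ≡ x ³
    absorb ζ ζ³ x = trans (solve 2 (λ z x → (z :* x) :* (z :* x) :* (z :* x) := (z :* z :* z) :* (x :* x :* x)) refl ζ x) (trans (cong (_· x ³) ζ³) (solve 1 (λ t → κ 1ᴱ :* t := t) refl (x ³)))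
  choose : ϖ ∣ᴱ s′ ⊖ r′ → _
  -- Modulo ϖ the unit r′ is ±1, so y is 0, r′ or -r′. Multiplying r′ by a cube root of unity and s′
  -- by its inverse adds a multiple of r′ to y modulo ϖ, which can be chosen to make it 0.
  choose (y , e) = by (residue3 y) (residue3 r′)
    where
    s≡y : s′ ≡ r′ ⊹ ϖ · y
    s≡y = trans (solve 2 (λ s r → s := r :+ (s :- r)) refl s′ r′) (cong (r′ ⊹_) e)
    first : ∀ k → y ≡ ϖ · k → _
    first k y≡ = twisted 1ᴱ 1ᴱ refl refl refl k (trans (solve 2 (λ s r → κ 1ᴱ :* s :- κ 1ᴱ :* r := s :- r) refl s′ r′) (trans e (cong (ϖ ·_) y≡)))
    -- ωs′ - ω²r′ = ω(s′ - ωr′) with s′ - ωr′ = ϖ(y + ω²r′), and ω² ≡ 1 modulo ϖ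
    second : ∀ k → y ⊹ r′ ≡ ϖ · k → _
    second k y≡ = twisted ω̄ ω refl refl refl (ω · (k ⊹ ω · ω · ω · ω · r′)) (trans (cong (λ t → ω · t ⊖ ω̄ · r′) s≡y)
      (trans (solve 2 (λ y r → κ ω :* (r :+ κ ϖ :* y) :- κ ω̄ :* r := κ ϖ :* κ ω :* ((y :+ r) :+ κ ϖ :* κ ω :* κ ω :* κ ω :* κ ω :* r)) refl y r′)
        (trans (cong (λ t → ϖ · ω · (t ⊹ ϖ · ω · ω · ω · ω · r′)) y≡) (solve 2 (λ k r → κ ϖ :* κ ω :* (κ ϖ :* k :+ κ ϖ :* κ ω :* κ ω :* κ ω :* κ ω :* r) := κ ϖ :* (κ ϖ :* (κ ω :* (k :+ κ ω :* κ ω :* κ ω :* κ ω :* r)))) refl k r′))))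
    third : ∀ k → y ⊖ r′ ≡ ϖ · k → _
    third k y≡ = twisted ω ω̄ refl refl refl (ω̄ · (k ⊹ ω̄ · r′)) (trans (cong (λ t → ω̄ · t ⊖ ω · r′) s≡y)
      (trans (solve 2 (λ y r → κ ω̄ :* (r :+ κ ϖ :* y) :- κ ω :* r := κ ϖ :* κ ω̄ :* ((y :- r) :+ κ ϖ :* κ ω̄ :* r)) refl y r′)
        (trans (cong (λ t → ϖ · ω̄ · (t ⊹ ϖ · ω̄ · r′)) y≡) (solve 2 (λ k r → κ ϖ :* κ ω̄ :* (κ ϖ :* k :+ κ ϖ :* κ ω̄ :* r) := κ ϖ :* (κ ϖ :* (κ ω̄ :* (k :+ κ ω̄ :* r)))) refl k r′))))
    by : _ → _ → _
    by (k , inj₁ y≡) _ = first k y≡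
    by _ (l , inj₁ r≡′) = ⊥-elim (ϖ∤r′ (l , r≡′))
    by (k , inj₂ (inj₁ y≡)) (l , inj₂ (inj₁ r≡′)) = third (k ⊖ l) (trans (cong₂ _⊖_ y≡ r≡′) (solve 2 (λ k l → κ 1ᴱ :+ κ ϖ :* k :- (κ 1ᴱ :+ κ ϖ :* l) := κ ϖ :* (k :- l)) refl k l))
    by (k , inj₂ (inj₂ y≡)) (l , inj₂ (inj₂ r≡′)) = third (k ⊖ l) (trans (cong₂ _⊖_ y≡ r≡′) (solve 2 (λ k l → :- κ 1ᴱ :+ κ ϖ :* k :- (:- κ 1ᴱ :+ κ ϖ :* l) := κ ϖ :* (k :- l)) refl k l))
    by (k , inj₂ (inj₁ y≡)) (l , inj₂ (inj₂ r≡′)) = second (k ⊹ l) (trans (cong₂ _⊹_ y≡ r≡′) (solve 2 (λ k l → κ 1ᴱ :+ κ ϖ :* k :+ (:- κ 1ᴱ :+ κ ϖ :* l) := κ ϖ :* (k :+ l)) refl k l))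
    by (k , inj₂ (inj₂ y≡)) (l , inj₂ (inj₁ r≡′)) = second (k ⊹ l) (trans (cong₂ _⊹_ y≡ r≡′) (solve 2 (λ k l → :- κ 1ᴱ :+ κ ϖ :* k :+ (κ 1ᴱ :+ κ ϖ :* l) := κ ϖ :* (k :+ l)) refl k l))

Tr : 𝔼 → ℤ
Tr (a +ω b) = + 2 * a - b

Tr-conj : ∀ x → x ⊹ x ᶜ ≡ ι (Tr x)
Tr-conj (a +ω b) = 𝔼-ext (ℤS.solve 2 (λ a b → a ℤS.:+ (a ℤS.:- b) ℤS.:= ℤS.κ (+ 2) ℤS.:* a ℤS.:- b) refl a b) (ℤ.+-inverseʳ b)

-- With M = r + s and δ = s - r the cube roots satisfy M(M² + 3δ²) = 8Λβ, δ(3M² + δ²) = 8Λωe and M²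
-- - δ² = 4Λa₀. The preimage under 1 - σ has the quadratic with coefficients `N₀` = 3M² + δ², -`A`
-- and the conjugate of `N₀`, where `A` = 4Λa₁ + 4MM̄; the curve through it is given by `β′` and gΔ.
module Descent {β e Λ a₀ a₁ b k ν} (D : Datum β e Λ a₀ a₁) (vb : V₃.V b β) (ve : V₃.V (2 ℕ.+ k ℕ.+ b) (ι e))
  (vν : V₃.V ν (a₀ · a₀ ᶜ)) (vν′ : V₃.V (2 ℕ.+ ν) (ι a₁ · ι a₁ ⊖ a₀ · a₀ ᶜ))
  {r s : 𝔼} (r³ : r ³ ≡ ι Λ · (β ⊖ ω · ι e)) (s³ : s ³ ≡ ι Λ · (β ⊹ ω · ι e)) (rs : r · s ≡ ι Λ · a₀)
  {μ : ℕ} (vr : V₃.V μ r) (oδ : V₃.O (2 ℕ.+ μ) (s ⊖ r)) where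

  open 𝔼S using (solve; _:=_; _:+_; _:-_; _:*_; :-_; κ)
  open ≡-Reasoning
  open V₃

  c : ℤ → 𝔼
  c = ι

  M δ M̄ δ̄ m d N₀ N̄₀ n T A Δ X X̄ : 𝔼
  M = r ⊹ s
  δ = s ⊖ r
  M̄ = M ᶜ
  δ̄ = δ ᶜ
  m = M · M̄
  d = δ · δ̄
  N₀ = 3ᴱ · M · M ⊹ δ · δ
  N̄₀ = 3ᴱ · M̄ · M̄ ⊹ δ̄ · δ̄
  n = N₀ · N̄₀
  T = M · M · N̄₀ ⊹ M̄ · M̄ · N₀
  A = ι (+ 4) · ι Λ · ι a₁ ⊹ ι (+ 4) · m
  Δ = A · A ⊖ n
  X = ⊝ (M · (A · A ⊹ n)) ⊹ 2ᴱ · A · M̄ · N₀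
  X̄ = ⊝ (M̄ · (A · A ⊹ n)) ⊹ 2ᴱ · A · M · N̄₀

  Nᶜ : N₀ ᶜ ≡ N̄₀
  Nᶜ = trans (conj-⊹ (3ᴱ · M · M) (δ · δ)) (cong₂ _⊹_ (trans (conj-· (3ᴱ · M) M) (cong (_· M̄) (conj-· 3ᴱ M))) (conj-· δ δ))

  mℤ nℤ Tℤ Aℤ Δℤ κℤ gℤ : ℤ
  mℤ = N M
  nℤ = N N₀
  Tℤ = Tr (M · M · N̄₀)
  Aℤ = + 4 * Λ * a₁ + + 4 * mℤ
  Δℤ = Aℤ * Aℤ - nℤ
  κℤ = - (Δℤ * Δℤ + + 12 * Aℤ * (Aℤ * Tℤ - mℤ * (Aℤ * Aℤ + nℤ)))
  gℤ = + 8 * Λ * e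

  m≡ : ι mℤ ≡ m
  m≡ = sym (N-conj M)

  n≡ : ι nℤ ≡ n
  n≡ = trans (sym (N-conj N₀)) (cong (N₀ ·_) Nᶜ)

  T≡ : ι Tℤ ≡ T
  T≡ = trans (sym (Tr-conj (M · M · N̄₀))) (cong (M · M · N̄₀ ⊹_) (trans (conj-· (M · M) N̄₀) (cong₂ _·_ (conj-· M M) (trans (cong _ᶜ (sym Nᶜ)) (conj-conj N₀)))))

  A≡ : ι Aℤ ≡ A
  A≡ = cong₂ _⊹_ (trans (ι-* (+ 4 * Λ) a₁) (cong (_· ι a₁) (ι-* (+ 4) Λ))) (trans (ι-* (+ 4) mℤ) (cong (ι (+ 4) ·_) m≡))

  ι-⊖ : ∀ x y → ι (x - y) ≡ ι x ⊖ ι y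
  ι-⊖ x y = refl

  Δ≡ : ι Δℤ ≡ Δ
  Δ≡ = cong₂ _⊖_ (trans (ι-* Aℤ Aℤ) (cong₂ _·_ A≡ A≡)) n≡

  κ₀ : 𝔼
  κ₀ = ⊝ (Δ · Δ ⊹ ι (+ 12) · A · (A · T ⊖ m · (A · A ⊹ n)))

  κ≡ : ι κℤ ≡ κ₀
  κ≡ = cong ⊝_ (cong₂ _⊹_ (trans (ι-* Δℤ Δℤ) (cong₂ _·_ Δ≡ Δ≡)) (trans (ι-* (+ 12 * Aℤ) _) (cong₂ _·_ (trans (ι-* (+ 12) Aℤ) (cong (ι (+ 12) ·_) A≡))
    (cong₂ _⊖_ (trans (ι-* Aℤ Tℤ) (cong₂ _·_ A≡ T≡)) (trans (ι-* mℤ _) (cong₂ _·_ m≡ (cong₂ _⊹_ (trans (ι-* Aℤ Aℤ) (cong₂ _·_ A≡ A≡)) n≡)))))))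

  δN : δ · N₀ ≡ ω · ι gℤ
  δN = begin
    δ · N₀ ≡⟨ solve 2 (λ r s → let M = r :+ s in (s :- r) :* (κ 3ᴱ :* M :* M :+ (s :- r) :* (s :- r)) := κ (c (+ 4)) :* (s :* s :* s :- r :* r :* r)) refl r s ⟩
    ι (+ 4) · (s ³ ⊖ r ³) ≡⟨ cong (ι (+ 4) ·_) (cong₂ _⊖_ s³ r³) ⟩
    ι (+ 4) · (ι Λ · (β ⊹ ω · ι e) ⊖ ι Λ · (β ⊖ ω · ι e)) ≡⟨ solve 3 (λ l β e → κ (c (+ 4)) :* (l :* (β :+ κ ω :* e) :- l :* (β :- κ ω :* e)) := κ ω :* (κ (c (+ 8)) :* l :* e)) refl (ι Λ) β (ι e) ⟩
    ω · (ι (+ 8) · ι Λ · ι e) ≡⟨ cong (ω ·_) (sym (trans (ι-* (+ 8 * Λ) e) (cong (_· ι e) (ι-* (+ 8) Λ)))) ⟩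
    ω · ι gℤ ∎

  δN̄ : δ̄ · N̄₀ ≡ ω̄ · ι gℤ
  δN̄ = trans (cong (δ̄ ·_) (sym Nᶜ)) (trans (sym (conj-· δ N₀)) (trans (cong _ᶜ δN) (trans (conj-· ω (ι gℤ)) (cong (ω̄ ·_) (conj-ι gℤ)))))

  g² : ι gℤ · ι gℤ ≡ d · n
  g² = trans (solve 1 (λ g → g :* g := (κ ω :* g) :* (κ ω̄ :* g)) refl (ι gℤ)) (trans (cong₂ _·_ (sym δN) (sym δN̄))
    (solve 4 (λ a b c d → a :* b :* (c :* d) := (a :* c) :* (b :* d)) refl δ N₀ δ̄ N̄₀))

  M²-δ² : M · M ⊖ δ · δ ≡ ι (+ 4) · ι Λ · a₀
  M²-δ² = trans (solve 2 (λ r s → (r :+ s) :* (r :+ s) :- (s :- r) :* (s :- r) := κ (c (+ 4)) :* (r :* s)) refl r s)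
    (trans (cong (ι (+ 4) ·_) rs) (solve 2 (λ l a → κ (c (+ 4)) :* (l :* a) := κ (c (+ 4)) :* l :* a) refl (ι Λ) a₀))

  M̄²-δ̄² : M̄ · M̄ ⊖ δ̄ · δ̄ ≡ ι (+ 4) · ι Λ · a₀ ᶜ
  M̄²-δ̄² = trans (sym (trans (conj-⊹ (M · M) (⊝ (δ · δ))) (cong₂ _⊹_ (conj-· M M) (trans (conj-⊝ (δ · δ)) (cong ⊝_ (conj-· δ δ))))))
    (trans (cong _ᶜ M²-δ²) (trans (conj-· (ι (+ 4) · ι Λ) a₀) (cong (_· a₀ ᶜ) (trans (conj-· (ι (+ 4)) (ι Λ)) (cong (ι (+ 4) ·_) (conj-ι Λ))))))

  8Λβ : M · (M · M ⊹ 3ᴱ · (δ · δ)) ≡ ι (+ 8) · ι Λ · β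
  8Λβ = trans (solve 2 (λ r s → (r :+ s) :* ((r :+ s) :* (r :+ s) :+ κ 3ᴱ :* ((s :- r) :* (s :- r))) := κ (c (+ 4)) :* (r :* r :* r :+ s :* s :* s)) refl r s)
    (trans (cong (ι (+ 4) ·_) (cong₂ _⊹_ r³ s³)) (solve 3 (λ l β e → κ (c (+ 4)) :* (l :* (β :- κ ω :* e) :+ l :* (β :+ κ ω :* e)) := κ (c (+ 8)) :* l :* β) refl (ι Λ) β (ι e)))

  8Λβ̄ : M̄ · (M̄ · M̄ ⊹ 3ᴱ · (δ̄ · δ̄)) ≡ ι (+ 8) · ι Λ · β ᶜ
  8Λβ̄ = trans (sym (trans (conj-· M (M · M ⊹ 3ᴱ · (δ · δ))) (cong (M̄ ·_) (trans (conj-⊹ (M · M) (3ᴱ · (δ · δ))) (cong₂ _⊹_ (conj-· M M) (trans (conj-· 3ᴱ (δ · δ)) (cong (3ᴱ ·_) (conj-· δ δ))))))))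
    (trans (cong _ᶜ 8Λβ) (trans (conj-· (ι (+ 8) · ι Λ) β) (cong (_· β ᶜ) (trans (conj-· (ι (+ 8)) (ι Λ)) (cong (ι (+ 8) ·_) (conj-ι Λ))))))

  P : 𝔼
  P = A ³ ⊖ ι (+ 12) · m · A · A ⊹ ι (+ 12) · T · A ⊖ 3ᴱ · n · A ⊖ ι (+ 6) · m · n ⊹ ι (+ 10) · d · n

  -- In terms of M, δ and their conjugates, 64Λ² times the difference of the two sides of the middle
  -- equation of the datum becomes this cubic in `A`.
  P≡0 : P ≡ 0ᴱ
  P≡0 = begin
    P ≡⟨ solve 5 (λ M M̄ δ δ̄ a →
           let m = M :* M̄
               A = a :+ κ (c (+ 4)) :* m
               N = κ 3ᴱ :* M :* M :+ δ :* δ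
               N̄ = κ 3ᴱ :* M̄ :* M̄ :+ δ̄ :* δ̄
               n = N :* N̄
               T = M :* M :* N̄ :+ M̄ :* M̄ :* N
           in A :* A :* A :- κ (c (+ 12)) :* m :* A :* A :+ κ (c (+ 12)) :* T :* A :- κ 3ᴱ :* n :* A :- κ (c (+ 6)) :* m :* n :+ κ (c (+ 10)) :* (δ :* δ̄) :* n
             := a :* a :* a :- κ 3ᴱ :* (M :* M :- δ :* δ) :* (M̄ :* M̄ :- δ̄ :* δ̄) :* a
                :- κ 2ᴱ :* (M :* (M :* M :+ κ 3ᴱ :* (δ :* δ))) :* (M̄ :* (M̄ :* M̄ :+ κ 3ᴱ :* (δ̄ :* δ̄))) :+ κ (c (+ 10)) :* ((δ :* N) :* (δ̄ :* N̄)))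
           refl M M̄ δ δ̄ a ⟩
    a ³ ⊖ 3ᴱ · (M · M ⊖ δ · δ) · (M̄ · M̄ ⊖ δ̄ · δ̄) · a ⊖ 2ᴱ · (M · (M · M ⊹ 3ᴱ · (δ · δ))) · (M̄ · (M̄ · M̄ ⊹ 3ᴱ · (δ̄ · δ̄))) ⊹ ι (+ 10) · ((δ · N₀) · (δ̄ · N̄₀))
      ≡⟨ cong₂ _⊹_ (cong₂ _⊖_ (cong₂ (λ p q → a ³ ⊖ 3ᴱ · p · q · a) M²-δ² M̄²-δ̄²) (cong₂ (λ p q → 2ᴱ · p · q) 8Λβ 8Λβ̄))
           (cong (ι (+ 10) ·_) (cong₂ _·_ (trans δN (cong (ω ·_) g≡)) (trans δN̄ (cong (ω̄ ·_) g≡)))) ⟩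
    a ³ ⊖ 3ᴱ · (ι (+ 4) · ι Λ · a₀) · (ι (+ 4) · ι Λ · a₀ ᶜ) · a ⊖ 2ᴱ · (ι (+ 8) · ι Λ · β) · (ι (+ 8) · ι Λ · β ᶜ) ⊹ ι (+ 10) · (ω · (ι (+ 8) · ι Λ · ι e) · (ω̄ · (ι (+ 8) · ι Λ · ι e)))
      ≡⟨ solve 7 (λ l a₁ a₀ ā₀ β β̄ e →
           let a = κ (c (+ 4)) :* l :* a₁
               g = κ (c (+ 8)) :* l :* e in
           a :* a :* a :- κ 3ᴱ :* (κ (c (+ 4)) :* l :* a₀) :* (κ (c (+ 4)) :* l :* ā₀) :* a :- κ 2ᴱ :* (κ (c (+ 8)) :* l :* β) :* (κ (c (+ 8)) :* l :* β̄) :+ κ (c (+ 10)) :* (κ ω :* g :* (κ ω̄ :* g))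
             := κ (c (+ 64)) :* l :* l :* (l :* (a₁ :* a₁ :* a₁ :- κ 3ᴱ :* a₀ :* ā₀ :* a₁) :- (κ 2ᴱ :* β :* β̄ :- κ (c (+ 10)) :* e :* e)))
           refl (ι Λ) (ι a₁) a₀ (a₀ ᶜ) β (β ᶜ) (ι e) ⟩
    ι (+ 64) · ι Λ · ι Λ · (ι Λ · (ι a₁ ³ ⊖ 3ᴱ · a₀ · a₀ ᶜ · ι a₁) ⊖ (2ᴱ · β · β ᶜ ⊖ ι (+ 10) · ι e · ι e))
      ≡⟨ cong (λ t → ι (+ 64) · ι Λ · ι Λ · (ι Λ · (ι a₁ ³ ⊖ 3ᴱ · a₀ · a₀ ᶜ · ι a₁) ⊖ t)) (Datum.middle D) ⟩
    ι (+ 64) · ι Λ · ι Λ · (ι Λ · (ι a₁ ³ ⊖ 3ᴱ · a₀ · a₀ ᶜ · ι a₁) ⊖ ι Λ · (ι a₁ ³ ⊖ 3ᴱ · a₀ · a₀ ᶜ · ι a₁))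
      ≡⟨ solve 2 (λ l t → κ (c (+ 64)) :* l :* l :* (t :- t) := κ 0ᴱ) refl (ι Λ) (ι Λ · (ι a₁ ³ ⊖ 3ᴱ · a₀ · a₀ ᶜ · ι a₁)) ⟩
    0ᴱ ∎
    where
    a = ι (+ 4) · ι Λ · ι a₁
    g≡ : ι gℤ ≡ ι (+ 8) · ι Λ · ι e
    g≡ = trans (ι-* (+ 8 * Λ) e) (cong (_· ι e) (ι-* (+ 8) Λ))

  β′ : 𝔼
  β′ = ϖ · N₀ · X

  Xᶜ : X ᶜ ≡ X̄
  Xᶜ = trans (conj-⊹ (⊝ (M · (A · A ⊹ n))) (2ᴱ · A · M̄ · N₀)) (cong₂ _⊹_
    (trans (conj-⊝ (M · (A · A ⊹ n))) (cong ⊝_ (trans (conj-· M (A · A ⊹ n)) (cong (M̄ ·_) (trans (conj-⊹ (A · A) n) (cong₂ _⊹_ (trans (conj-· A A) (cong₂ _·_ Aᶜ Aᶜ)) nᶜ))))))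
    (trans (conj-· (2ᴱ · A · M̄) N₀) (cong₂ _·_ (trans (conj-· (2ᴱ · A) M̄) (cong₂ _·_ (trans (conj-· 2ᴱ A) (cong (2ᴱ ·_) Aᶜ)) (conj-conj M))) Nᶜ)))
    where
    Aᶜ : A ᶜ ≡ A
    Aᶜ = trans (cong _ᶜ (sym A≡)) (trans (conj-ι Aℤ) A≡)
    nᶜ : n ᶜ ≡ n
    nᶜ = trans (cong _ᶜ (sym n≡)) (trans (conj-ι nℤ) n≡)

  -- Both equations are polynomial identities modulo the relations already found: the outer one uses
  -- δN₀ = ωg, and the two sides of the middle one differ by Δ²P, which vanishes.
  next : Datum β′ (gℤ * Δℤ) κℤ N₀ (- Aℤ)
  next = datum outer′ middle′
    where
    e′≡ : ι (gℤ * Δℤ) ≡ ι gℤ · Δ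
    e′≡ = trans (ι-* gℤ Δℤ) (cong (ι gℤ ·_) Δ≡)
    outer′ : β′ · β′ ⊖ ω · ω · ι (gℤ * Δℤ) · ι (gℤ * Δℤ) ≡ ι κℤ · N₀ ³
    outer′ = begin
      β′ · β′ ⊖ ω · ω · ι (gℤ * Δℤ) · ι (gℤ * Δℤ) ≡⟨ cong (λ t → β′ · β′ ⊖ ω · ω · t · t) e′≡ ⟩
      β′ · β′ ⊖ ω · ω · (ι gℤ · Δ) · (ι gℤ · Δ) ≡⟨ solve 3 (λ b g D → b :* b :- κ ω :* κ ω :* (g :* D) :* (g :* D) := b :* b :- (κ ω :* g) :* (κ ω :* g) :* (D :* D)) refl β′ (ι gℤ) Δ ⟩
      β′ · β′ ⊖ (ω · ι gℤ) · (ω · ι gℤ) · (Δ · Δ) ≡⟨ cong (λ t → β′ · β′ ⊖ t · t · (Δ · Δ)) (sym δN) ⟩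
      β′ · β′ ⊖ (δ · N₀) · (δ · N₀) · (Δ · Δ) ≡⟨ solve 5 (λ M M̄ δ N̄ A →
           let N = κ 3ᴱ :* M :* M :+ δ :* δ
               n = N :* N̄
               X = :- (M :* (A :* A :+ n)) :+ κ 2ᴱ :* A :* M̄ :* N
               D = A :* A :- n
               T = M :* M :* N̄ :+ M̄ :* M̄ :* N
               B = κ ϖ :* N :* X
           in B :* B :- (δ :* N) :* (δ :* N) :* (D :* D)
             := :- (D :* D :+ κ (c (+ 12)) :* A :* (A :* T :- M :* M̄ :* (A :* A :+ n))) :* (N :* N :* N)) refl M M̄ δ N̄₀ A ⟩
      κ₀ · N₀ ³ ≡⟨ cong (_· N₀ ³) (sym κ≡) ⟩
      ι κℤ · N₀ ³ ∎
    middle′ : 2ᴱ · β′ · β′ ᶜ ⊖ ι (+ 10) · ι (gℤ * Δℤ) · ι (gℤ * Δℤ) ≡ ι κℤ · (ι (- Aℤ) ³ ⊖ 3ᴱ · N₀ · N₀ ᶜ · ι (- Aℤ))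
    middle′ = begin
      2ᴱ · β′ · β′ ᶜ ⊖ ι (+ 10) · ι (gℤ * Δℤ) · ι (gℤ * Δℤ) ≡⟨ cong₂ (λ p t → 2ᴱ · β′ · p ⊖ ι (+ 10) · t · t)
          (trans (conj-· (ϖ · N₀) X) (cong₂ _·_ (trans (conj-· ϖ N₀) (cong (⊝ ϖ ·_) Nᶜ)) Xᶜ)) e′≡ ⟩
      2ᴱ · β′ · (⊝ ϖ · N̄₀ · X̄) ⊖ ι (+ 10) · (ι gℤ · Δ) · (ι gℤ · Δ)
        ≡⟨ solve 3 (λ b g D → b :- κ (c (+ 10)) :* (g :* D) :* (g :* D) := b :- κ (c (+ 10)) :* (g :* g) :* (D :* D)) refl (2ᴱ · β′ · (⊝ ϖ · N̄₀ · X̄)) (ι gℤ) Δ ⟩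
      2ᴱ · β′ · (⊝ ϖ · N̄₀ · X̄) ⊖ ι (+ 10) · (ι gℤ · ι gℤ) · (Δ · Δ) ≡⟨ cong (λ t → 2ᴱ · β′ · (⊝ ϖ · N̄₀ · X̄) ⊖ ι (+ 10) · t · (Δ · Δ)) g² ⟩
      2ᴱ · β′ · (⊝ ϖ · N̄₀ · X̄) ⊖ ι (+ 10) · (d · n) · (Δ · Δ) ≡⟨ solve 6 (λ M M̄ N N̄ A d →
           let n = N :* N̄
               m = M :* M̄
               X = :- (M :* (A :* A :+ n)) :+ κ 2ᴱ :* A :* M̄ :* N
               X̄ = :- (M̄ :* (A :* A :+ n)) :+ κ 2ᴱ :* A :* M :* N̄
               D = A :* A :- n
               T = M :* M :* N̄ :+ M̄ :* M̄ :* N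
               P = A :* A :* A :- κ (c (+ 12)) :* m :* A :* A :+ κ (c (+ 12)) :* T :* A :- κ 3ᴱ :* n :* A :- κ (c (+ 6)) :* m :* n :+ κ (c (+ 10)) :* d :* n
           in κ 2ᴱ :* (κ ϖ :* N :* X) :* (:- κ ϖ :* N̄ :* X̄) :- κ (c (+ 10)) :* (d :* n) :* (D :* D)
             := :- (D :* D :+ κ (c (+ 12)) :* A :* (A :* T :- m :* (A :* A :+ n))) :* ((:- A) :* (:- A) :* (:- A) :- κ 3ᴱ :* N :* N̄ :* (:- A)) :- D :* D :* P) refl M M̄ N₀ N̄₀ A d ⟩
      κ₀ · ((⊝ A) ³ ⊖ 3ᴱ · N₀ · N̄₀ · ⊝ A) ⊖ Δ · Δ · P ≡⟨ cong (λ t → κ₀ · ((⊝ A) ³ ⊖ 3ᴱ · N₀ · N̄₀ · ⊝ A) ⊖ Δ · Δ · t) P≡0 ⟩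
      κ₀ · ((⊝ A) ³ ⊖ 3ᴱ · N₀ · N̄₀ · ⊝ A) ⊖ Δ · Δ · 0ᴱ ≡⟨ solve 2 (λ x D → x :- D :* D :* κ 0ᴱ := x) refl (κ₀ · ((⊝ A) ³ ⊖ 3ᴱ · N₀ · N̄₀ · ⊝ A)) Δ ⟩
      κ₀ · ((⊝ A) ³ ⊖ 3ᴱ · N₀ · N̄₀ · ⊝ A) ≡⟨ cong₂ (λ k a → k · (a ³ ⊖ 3ᴱ · N₀ · N̄₀ · a)) (sym κ≡) (cong ⊝_ (sym A≡)) ⟩
      ι κℤ · (ι (- Aℤ) ³ ⊖ 3ᴱ · N₀ · N̄₀ · ι (- Aℤ)) ≡⟨ cong (λ t → ι κℤ · (ι (- Aℤ) ³ ⊖ 3ᴱ · N₀ · t · ι (- Aℤ))) (sym Nᶜ) ⟩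
      ι κℤ · (ι (- Aℤ) ³ ⊖ 3ᴱ · N₀ · N₀ ᶜ · ι (- Aℤ)) ∎

  open ℕS using () renaming (solve to solveℕ; _:=_ to _≈_; _:+_ to _⊕_; con to #)

  -- If δ is neglected, the cubic `P` becomes (A - 6m)(A - 3m)². The relevant root is near 6m, and
  -- `ε` is its deviation from there.
  ρ ε : 𝔼
  ρ = M · M · (δ̄ · δ̄) ⊹ M̄ · M̄ · (δ · δ)
  ε = A ⊖ ι (+ 6) · m

  oδ̄ : O (2 ℕ.+ μ) δ̄
  oδ̄ = O₃-conj oδ

  vM : V μ M
  vM = V₃-cong (solve 2 (λ r s → κ 2ᴱ :* r :+ (s :- r) := r :+ s) refl r s) (V-⊹ (V-· V₃-2 vr) (O-≤ (ℕ.n≤1+n (suc μ)) oδ))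

  vM̄ : V μ M̄
  vM̄ = V₃-conj vM

  vm : V (μ ℕ.+ μ) m
  vm = V-· vM vM̄

  od : O (4 ℕ.+ (μ ℕ.+ μ)) d
  od = O₃-cast 0 (solveℕ 1 (λ μ → (# 2 ⊕ μ) ⊕ (# 2 ⊕ μ) ≈ # 4 ⊕ (μ ⊕ μ)) refl μ) (O-· oδ oδ̄)

  oρ : O (4 ℕ.+ (μ ℕ.+ μ) ℕ.+ (μ ℕ.+ μ)) ρ
  oρ = O-⊹ (O₃-cast 0 eq (O-· (O-· (V⇒O vM) (V⇒O vM)) (O-· oδ̄ oδ̄))) (O₃-cast 0 eq (O-· (O-· (V⇒O vM̄) (V⇒O vM̄)) (O-· oδ oδ)))
    where
    eq : (μ ℕ.+ μ) ℕ.+ ((2 ℕ.+ μ) ℕ.+ (2 ℕ.+ μ)) ≡ 4 ℕ.+ (μ ℕ.+ μ) ℕ.+ (μ ℕ.+ μ)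
    eq = solveℕ 1 (λ μ → (μ ⊕ μ) ⊕ ((# 2 ⊕ μ) ⊕ (# 2 ⊕ μ)) ≈ # 4 ⊕ (μ ⊕ μ) ⊕ (μ ⊕ μ)) refl μ

  vN : V (2 ℕ.+ μ ℕ.+ μ) N₀
  vN = V-⊹ (V-· (V-· V₃-3 vM) vM) (O₃-cast 1 (solveℕ 1 (λ μ → (# 2 ⊕ μ) ⊕ (# 2 ⊕ μ) ≈ # 1 ⊕ (# 3 ⊕ μ ⊕ μ)) refl μ) (O-· oδ oδ))

  vN̄ : V (2 ℕ.+ μ ℕ.+ μ) N̄₀
  vN̄ = subst (V _) Nᶜ (V₃-conj vN)

  vn : V ((2 ℕ.+ μ ℕ.+ μ) ℕ.+ (2 ℕ.+ μ ℕ.+ μ)) n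
  vn = V-· vN vN̄

  vD : V (μ ℕ.+ μ) (M · M ⊖ δ · δ)
  vD = V-⊹ (V-· vM vM) (O-⊝ (O₃-cast 3 (solveℕ 1 (λ μ → (# 2 ⊕ μ) ⊕ (# 2 ⊕ μ) ≈ # 3 ⊕ (# 1 ⊕ (μ ⊕ μ))) refl μ) (O-· oδ oδ)))

  vD̄ : V (μ ℕ.+ μ) (M̄ · M̄ ⊖ δ̄ · δ̄)
  vD̄ = V-⊹ (V-· vM̄ vM̄) (O-⊝ (O₃-cast 3 (solveℕ 1 (λ μ → (# 2 ⊕ μ) ⊕ (# 2 ⊕ μ) ≈ # 3 ⊕ (# 1 ⊕ (μ ⊕ μ))) refl μ) (O-· oδ̄ oδ̄)))

  εm ε3m R K : 𝔼
  εm = ε ⊹ m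
  ε3m = ε ⊹ 3ᴱ · m
  R = ⊝ (3ᴱ · (3ᴱ · (ι (+ 10) · (d · (m · m))))) ⊖ 3ᴱ · (ι (+ 10) · (d · ρ)) ⊹ 3ᴱ · (ι (+ 8) · (m · (d · d))) ⊖ ι (+ 10) · (d · (d · d))
  K = ε3m · ε3m ⊹ (3ᴱ · ρ ⊖ 3ᴱ · (d · d))

  -- The cubic relation expanded around its approximate roots: `K` is close to (A - 3m)², and `R`
  -- collects the terms containing d.
  εK : ε · K ≡ R
  εK = trans (solve 5 (λ M M̄ δ δ̄ A →
           let m = M :* M̄
               d = δ :* δ̄
               N = κ 3ᴱ :* M :* M :+ δ :* δ
               N̄ = κ 3ᴱ :* M̄ :* M̄ :+ δ̄ :* δ̄
               n = N :* N̄
               T = M :* M :* N̄ :+ M̄ :* M̄ :* N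
               ρ = M :* M :* (δ̄ :* δ̄) :+ M̄ :* M̄ :* (δ :* δ)
               ε = A :- κ (c (+ 6)) :* m
               ε3m = ε :+ κ 3ᴱ :* m
               P = A :* A :* A :- κ (c (+ 12)) :* m :* A :* A :+ κ (c (+ 12)) :* T :* A :- κ 3ᴱ :* n :* A :- κ (c (+ 6)) :* m :* n :+ κ (c (+ 10)) :* d :* n
           in ε :* (ε3m :* ε3m :+ (κ 3ᴱ :* ρ :- κ 3ᴱ :* (d :* d)))
             := (:- (κ 3ᴱ :* (κ 3ᴱ :* (κ (c (+ 10)) :* (d :* (m :* m))))) :- κ 3ᴱ :* (κ (c (+ 10)) :* (d :* ρ)) :+ κ 3ᴱ :* (κ (c (+ 8)) :* (m :* (d :* d))) :- κ (c (+ 10)) :* (d :* (d :* d))) :+ P)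
           refl M M̄ δ δ̄ A)
    (trans (cong (R ⊹_) P≡0) (solve 1 (λ x → x :+ κ 0ᴱ := x) refl R))

  oR : O (8 ℕ.+ (μ ℕ.+ μ) ℕ.+ (μ ℕ.+ μ) ℕ.+ (μ ℕ.+ μ)) R
  oR = O-⊖ (O-⊹ (O-⊖ (O-⊝ (O₃-cast 0 (solveℕ 1 (λ μ → # 2 ⊕ (# 2 ⊕ ((# 4 ⊕ (μ ⊕ μ)) ⊕ ((μ ⊕ μ) ⊕ (μ ⊕ μ)))) ≈ # 0 ⊕ (# 8 ⊕ (μ ⊕ μ) ⊕ (μ ⊕ μ) ⊕ (μ ⊕ μ))) refl μ)
                (O-· (V⇒O V₃-3) (O-· (V⇒O V₃-3) (O-·ˡ (ι (+ 10)) (O-· od (O-· (V⇒O vm) (V⇒O vm))))))))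
              (O₃-cast 2 (solveℕ 1 (λ μ → # 2 ⊕ ((# 4 ⊕ (μ ⊕ μ)) ⊕ (# 4 ⊕ (μ ⊕ μ) ⊕ (μ ⊕ μ))) ≈ # 2 ⊕ (# 8 ⊕ (μ ⊕ μ) ⊕ (μ ⊕ μ) ⊕ (μ ⊕ μ))) refl μ)
                (O-· (V⇒O V₃-3) (O-·ˡ (ι (+ 10)) (O-· od oρ)))))
            (O₃-cast 2 (solveℕ 1 (λ μ → # 2 ⊕ ((μ ⊕ μ) ⊕ ((# 4 ⊕ (μ ⊕ μ)) ⊕ (# 4 ⊕ (μ ⊕ μ)))) ≈ # 2 ⊕ (# 8 ⊕ (μ ⊕ μ) ⊕ (μ ⊕ μ) ⊕ (μ ⊕ μ))) refl μ)
                (O-· (V⇒O V₃-3) (O-·ˡ (ι (+ 8)) (O-· (V⇒O vm) (O-· od od))))))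
            (O₃-cast 4 (solveℕ 1 (λ μ → (# 4 ⊕ (μ ⊕ μ)) ⊕ ((# 4 ⊕ (μ ⊕ μ)) ⊕ (# 4 ⊕ (μ ⊕ μ))) ≈ # 4 ⊕ (# 8 ⊕ (μ ⊕ μ) ⊕ (μ ⊕ μ) ⊕ (μ ⊕ μ))) refl μ)
                (O-·ˡ (ι (+ 10)) (O-· od (O-· od od))))

  oK : O (6 ℕ.+ (μ ℕ.+ μ) ℕ.+ (μ ℕ.+ μ)) (3ᴱ · ρ ⊖ 3ᴱ · (d · d))
  oK = O-⊖ (O-· (V⇒O V₃-3) oρ) (O₃-cast 4 (solveℕ 1 (λ μ → # 2 ⊕ ((# 4 ⊕ (μ ⊕ μ)) ⊕ (# 4 ⊕ (μ ⊕ μ))) ≈ # 4 ⊕ (# 6 ⊕ (μ ⊕ μ) ⊕ (μ ⊕ μ))) refl μ) (O-· (V⇒O V₃-3) (O-· od od)))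

  module _ {l} (vl : V l (ι Λ)) where

    -- With a = 4Λa₁ the product is a² - m². Since m² equals 16Λ²a₀ā₀ + ρ - d² and both ρ and d² are
    -- of higher order, the order is the one that `vν′` prescribes for a₁² - a₀ā₀.
    vprod : V (2 ℕ.+ ((μ ℕ.+ μ) ℕ.+ (μ ℕ.+ μ))) (εm · ε3m)
    vprod = V₃-cong (sym identity) (V-⊹ (V₃-cast index (V-· v16 vν′)) (O-⊖ (O₃-cast 5 (solveℕ 1 (λ μ → (# 4 ⊕ (μ ⊕ μ)) ⊕ (# 4 ⊕ (μ ⊕ μ)) ≈ # 5 ⊕ (# 3 ⊕ ((μ ⊕ μ) ⊕ (μ ⊕ μ)))) refl μ) (O-· od od))
        (O₃-cast 1 (solveℕ 1 (λ μ → # 4 ⊕ (μ ⊕ μ) ⊕ (μ ⊕ μ) ≈ # 1 ⊕ (# 3 ⊕ ((μ ⊕ μ) ⊕ (μ ⊕ μ)))) refl μ) oρ)))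
      where
      L4 = ι (+ 4) · ι Λ
      vL4 : V l L4
      vL4 = V-· (V-· V₃-2 V₃-2) vl
      v16 : V (l ℕ.+ l) (L4 · L4)
      v16 = V-· vL4 vL4
      base : (l ℕ.+ l) ℕ.+ ν ≡ (μ ℕ.+ μ) ℕ.+ (μ ℕ.+ μ)
      base = V-unique (V-· v16 vν) (V₃-cong (trans (cong₂ _·_ M²-δ² M̄²-δ̄²) (solve 3 (λ l a b → l :* a :* (l :* b) := l :* l :* (a :* b)) refl L4 a₀ (a₀ ᶜ))) (V-· vD vD̄))
      index : (l ℕ.+ l) ℕ.+ (2 ℕ.+ ν) ≡ 2 ℕ.+ ((μ ℕ.+ μ) ℕ.+ (μ ℕ.+ μ))
      index = trans (solveℕ 2 (λ l ν → (l ⊕ l) ⊕ (# 2 ⊕ ν) ≈ # 2 ⊕ ((l ⊕ l) ⊕ ν)) refl l ν) (cong (2 ℕ.+_) base)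
      identity : εm · ε3m ≡ L4 · L4 · (ι a₁ · ι a₁ ⊖ a₀ · a₀ ᶜ) ⊹ (d · d ⊖ ρ)
      identity = begin
        εm · ε3m ≡⟨ solve 5 (λ M M̄ δ δ̄ a →
          let m = M :* M̄
              ε = a :+ κ (c (+ 4)) :* m :- κ (c (+ 6)) :* m
          in (ε :+ m) :* (ε :+ κ 3ᴱ :* m) := a :* a :- (M :* M :- δ :* δ) :* (M̄ :* M̄ :- δ̄ :* δ̄) :+ ((δ :* δ̄) :* (δ :* δ̄) :- (M :* M :* (δ̄ :* δ̄) :+ M̄ :* M̄ :* (δ :* δ)))) refl M M̄ δ δ̄ (L4 · ι a₁) ⟩
        (L4 · ι a₁) · (L4 · ι a₁) ⊖ (M · M ⊖ δ · δ) · (M̄ · M̄ ⊖ δ̄ · δ̄) ⊹ (d · d ⊖ ρ)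
          ≡⟨ cong (λ t → (L4 · ι a₁) · (L4 · ι a₁) ⊖ t ⊹ (d · d ⊖ ρ)) (cong₂ _·_ M²-δ² M̄²-δ̄²) ⟩
        (L4 · ι a₁) · (L4 · ι a₁) ⊖ (L4 · a₀) · (L4 · a₀ ᶜ) ⊹ (d · d ⊖ ρ)
          ≡⟨ solve 5 (λ l a b c x → (l :* a) :* (l :* a) :- (l :* b) :* (l :* c) :+ x := l :* l :* (a :* a :- b :* c) :+ x) refl L4 (ι a₁) a₀ (a₀ ᶜ) (d · d ⊖ ρ) ⟩
        L4 · L4 · (ι a₁ · ι a₁ ⊖ a₀ · a₀ ᶜ) ⊹ (d · d ⊖ ρ) ∎

    private
      2m≡ : ε3m ⊖ εm ≡ 2ᴱ · m
      2m≡ = solve 2 (λ ε m → ε :+ κ 3ᴱ :* m :- (ε :+ m) := κ 2ᴱ :* m) refl ε m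

      v2m : V (μ ℕ.+ μ) (ε3m ⊖ εm)
      v2m = V₃-cong (sym 2m≡) (V-· V₃-2 vm)

    -- The alternative v(ε + m) > v(m) contradicts εK = R.
    vε3m : V (2 ℕ.+ (μ ℕ.+ μ)) ε3m
    vε3m = go (V-exists εm≢0) (V-exists ε3m≢0)
      where
      εm≢0 : εm ≢ 0ᴱ
      εm≢0 h = V⇒≢0 vprod (trans (cong (_· ε3m) h) (solve 1 (λ x → κ 0ᴱ :* x := κ 0ᴱ) refl ε3m))
      ε3m≢0 : ε3m ≢ 0ᴱ
      ε3m≢0 h = V⇒≢0 vprod (trans (cong (εm ·_) h) (·-zeroʳ εm))
      go : ∃[ q ] V q εm → ∃[ p ] V p ε3m → V (2 ℕ.+ (μ ℕ.+ μ)) ε3m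
      go (q , vq) (p , vp) = by (ℕ.<-cmp p q)
        where
        sum : q ℕ.+ p ≡ 2 ℕ.+ ((μ ℕ.+ μ) ℕ.+ (μ ℕ.+ μ))
        sum = V-unique (V-· vq vp) vprod
        by : _ → V (2 ℕ.+ (μ ℕ.+ μ)) ε3m
        by (tri> _ _ q<p) = V₃-cast p≡ vp
          where
          q≡ : q ≡ μ ℕ.+ μ
          q≡ = V-unique (V₃-cong (solve 2 (λ a b → :- a :+ b := b :- a) refl εm ε3m) (V-⊹ (V-⊝ vq) (O-≤ q<p (V⇒O vp)))) v2m
          p≡ : p ≡ 2 ℕ.+ (μ ℕ.+ μ)
          p≡ = ℕ.+-cancelˡ-≡ (μ ℕ.+ μ) p _ (trans (cong (ℕ._+ p) (sym q≡)) (trans sum (solveℕ 1 (λ μ → # 2 ⊕ ((μ ⊕ μ) ⊕ (μ ⊕ μ)) ≈ (μ ⊕ μ) ⊕ (# 2 ⊕ (μ ⊕ μ))) refl μ)))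
        by (tri≈ _ refl _) = ⊥-elim (ℕ.1+n≰n (ℕ.≤-trans (ℕ.≤-reflexive (sym sum)) (ℕ.≤-trans (ℕ.+-mono-≤ p≤ p≤) (ℕ.n≤1+n _))))
          where
          p≤ : p ℕ.≤ μ ℕ.+ μ
          p≤ = V-O-≤ v2m (O-⊖ (V⇒O vp) (V⇒O vq))
        by (tri< p<q _ _) = ⊥-elim (ℕ.1+n≰n bound)
          where
          p≡ : p ≡ μ ℕ.+ μ
          p≡ = V-unique (V-⊹ vp (O-⊝ (O-≤ p<q (V⇒O vq)))) v2m
          vε : V (μ ℕ.+ μ) ε
          vε = V₃-cong (solve 2 (λ ε m → :- m :+ (ε :+ m) := ε) refl ε m) (V-⊹ (V-⊝ vm) (O-≤ (subst (ℕ._< q) p≡ p<q) (V⇒O vq)))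
          vK : V (p ℕ.+ p) K
          vK = V-⊹ (V-· vp vp) (O₃-cast 5 (trans (solveℕ 1 (λ μ → # 6 ⊕ (μ ⊕ μ) ⊕ (μ ⊕ μ) ≈ # 5 ⊕ (# 1 ⊕ ((μ ⊕ μ) ⊕ (μ ⊕ μ)))) refl μ) (cong (λ t → 6 ℕ.+ (t ℕ.+ t)) (sym p≡))) oK)
          6μ = (μ ℕ.+ μ) ℕ.+ (p ℕ.+ p)
          bound : suc 6μ ℕ.≤ 6μ
          bound = V-O-≤ (V₃-cong εK (V-· vε vK)) (O₃-cast 7 (trans (solveℕ 1 (λ μ → # 8 ⊕ (μ ⊕ μ) ⊕ (μ ⊕ μ) ⊕ (μ ⊕ μ) ≈ # 8 ⊕ ((μ ⊕ μ) ⊕ ((μ ⊕ μ) ⊕ (μ ⊕ μ)))) refl μ) (cong (λ t → 8 ℕ.+ ((μ ℕ.+ μ) ℕ.+ (t ℕ.+ t))) (sym p≡))) oR)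

    oε : O (4 ℕ.+ (μ ℕ.+ μ)) ε
    oε = O₃-cancel vK (O₃-cast 0 (solveℕ 1 (λ μ → # 8 ⊕ (μ ⊕ μ) ⊕ (μ ⊕ μ) ⊕ (μ ⊕ μ) ≈ ((# 2 ⊕ (μ ⊕ μ)) ⊕ (# 2 ⊕ (μ ⊕ μ))) ⊕ (# 4 ⊕ (μ ⊕ μ))) refl μ)
        (subst (O _) (trans (sym εK) (solve 2 (λ a b → a :* b := b :* a) refl ε K)) oR))
      where
      vK : V ((2 ℕ.+ (μ ℕ.+ μ)) ℕ.+ (2 ℕ.+ (μ ℕ.+ μ))) K
      vK = V-⊹ (V-· vε3m vε3m) (O₃-cast 1 (solveℕ 1 (λ μ → # 6 ⊕ (μ ⊕ μ) ⊕ (μ ⊕ μ) ≈ # 1 ⊕ (# 1 ⊕ ((# 2 ⊕ (μ ⊕ μ)) ⊕ (# 2 ⊕ (μ ⊕ μ))))) refl μ) oK)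

    -- Second approximation to the root: to leading order εK = R reads 9m²ε = -90dm², that is ε =
    -- -10d. This extra precision is needed in `vΔ`.
    oεd : O (6 ℕ.+ (μ ℕ.+ μ)) (ε ⊹ ι (+ 10) · d)
    oεd = O₃-cancel (V-· (V-· V₃-3 V₃-3) (V-· vm vm)) (O₃-cast 0 (solveℕ 1 (λ μ → # 10 ⊕ (μ ⊕ μ) ⊕ (μ ⊕ μ) ⊕ (μ ⊕ μ) ≈ (# 4 ⊕ ((μ ⊕ μ) ⊕ (μ ⊕ μ))) ⊕ (# 6 ⊕ (μ ⊕ μ))) refl μ) (subst (O _) (sym identity) oR₂))
      where
      R₂ = ⊝ (3ᴱ · (2ᴱ · (m · (ε · ε)))) ⊖ ε · (ε · ε) ⊖ ε · (3ᴱ · ρ ⊖ 3ᴱ · (d · d)) ⊖ 3ᴱ · (ι (+ 10) · (d · ρ)) ⊹ 3ᴱ · (ι (+ 8) · (m · (d · d))) ⊖ ι (+ 10) · (d · (d · d))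
      identity : 3ᴱ · 3ᴱ · (m · m) · (ε ⊹ ι (+ 10) · d) ≡ R₂
      identity = begin
        3ᴱ · 3ᴱ · (m · m) · (ε ⊹ ι (+ 10) · d) ≡⟨ solve 4 (λ ε m d ρ → κ 3ᴱ :* κ 3ᴱ :* (m :* m) :* (ε :+ κ (c (+ 10)) :* d)
            := ε :* ((ε :+ κ 3ᴱ :* m) :* (ε :+ κ 3ᴱ :* m) :+ (κ 3ᴱ :* ρ :- κ 3ᴱ :* (d :* d))) :- κ 3ᴱ :* κ 2ᴱ :* m :* ε :* ε :- ε :* ε :* ε :- ε :* (κ 3ᴱ :* ρ :- κ 3ᴱ :* (d :* d)) :+ κ 3ᴱ :* κ 3ᴱ :* κ (c (+ 10)) :* d :* m :* m) refl ε m d ρ ⟩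
        ε · K ⊖ 3ᴱ · 2ᴱ · m · ε · ε ⊖ ε · ε · ε ⊖ ε · (3ᴱ · ρ ⊖ 3ᴱ · (d · d)) ⊹ 3ᴱ · 3ᴱ · ι (+ 10) · d · m · m
          ≡⟨ cong (λ t → t ⊖ 3ᴱ · 2ᴱ · m · ε · ε ⊖ ε · ε · ε ⊖ ε · (3ᴱ · ρ ⊖ 3ᴱ · (d · d)) ⊹ 3ᴱ · 3ᴱ · ι (+ 10) · d · m · m) εK ⟩
        R ⊖ 3ᴱ · 2ᴱ · m · ε · ε ⊖ ε · ε · ε ⊖ ε · (3ᴱ · ρ ⊖ 3ᴱ · (d · d)) ⊹ 3ᴱ · 3ᴱ · ι (+ 10) · d · m · m
          ≡⟨ solve 4 (λ ε m d ρ → (:- (κ 3ᴱ :* (κ 3ᴱ :* (κ (c (+ 10)) :* (d :* (m :* m))))) :- κ 3ᴱ :* (κ (c (+ 10)) :* (d :* ρ)) :+ κ 3ᴱ :* (κ (c (+ 8)) :* (m :* (d :* d))) :- κ (c (+ 10)) :* (d :* (d :* d)))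
               :- κ 3ᴱ :* κ 2ᴱ :* m :* ε :* ε :- ε :* ε :* ε :- ε :* (κ 3ᴱ :* ρ :- κ 3ᴱ :* (d :* d)) :+ κ 3ᴱ :* κ 3ᴱ :* κ (c (+ 10)) :* d :* m :* m
             := :- (κ 3ᴱ :* (κ 2ᴱ :* (m :* (ε :* ε)))) :- ε :* (ε :* ε) :- ε :* (κ 3ᴱ :* ρ :- κ 3ᴱ :* (d :* d)) :- κ 3ᴱ :* (κ (c (+ 10)) :* (d :* ρ)) :+ κ 3ᴱ :* (κ (c (+ 8)) :* (m :* (d :* d))) :- κ (c (+ 10)) :* (d :* (d :* d))) refl ε m d ρ ⟩
        R₂ ∎
      oR₂ : O (10 ℕ.+ (μ ℕ.+ μ) ℕ.+ (μ ℕ.+ μ) ℕ.+ (μ ℕ.+ μ)) R₂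
      oR₂ = O-⊖ (O-⊹ (O-⊖ (O-⊖ (O-⊖
          (O-⊝ (O₃-cast 0 (solveℕ 1 (λ μ → # 2 ⊕ ((μ ⊕ μ) ⊕ ((# 4 ⊕ (μ ⊕ μ)) ⊕ (# 4 ⊕ (μ ⊕ μ)))) ≈ # 10 ⊕ (μ ⊕ μ) ⊕ (μ ⊕ μ) ⊕ (μ ⊕ μ)) refl μ) (O-· (V⇒O V₃-3) (O-·ˡ 2ᴱ (O-· (V⇒O vm) (O-· oε oε))))))
          (O₃-cast 2 (solveℕ 1 (λ μ → (# 4 ⊕ (μ ⊕ μ)) ⊕ ((# 4 ⊕ (μ ⊕ μ)) ⊕ (# 4 ⊕ (μ ⊕ μ))) ≈ # 2 ⊕ (# 10 ⊕ (μ ⊕ μ) ⊕ (μ ⊕ μ) ⊕ (μ ⊕ μ))) refl μ) (O-· oε (O-· oε oε))))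
          (O₃-cast 0 (solveℕ 1 (λ μ → (# 4 ⊕ (μ ⊕ μ)) ⊕ (# 6 ⊕ (μ ⊕ μ) ⊕ (μ ⊕ μ)) ≈ # 10 ⊕ (μ ⊕ μ) ⊕ (μ ⊕ μ) ⊕ (μ ⊕ μ)) refl μ) (O-· oε oK)))
          (O₃-cast 0 (solveℕ 1 (λ μ → # 2 ⊕ ((# 4 ⊕ (μ ⊕ μ)) ⊕ (# 4 ⊕ (μ ⊕ μ) ⊕ (μ ⊕ μ))) ≈ # 10 ⊕ (μ ⊕ μ) ⊕ (μ ⊕ μ) ⊕ (μ ⊕ μ)) refl μ) (O-· (V⇒O V₃-3) (O-·ˡ (ι (+ 10)) (O-· od oρ)))))
          (O₃-cast 0 (solveℕ 1 (λ μ → # 2 ⊕ ((μ ⊕ μ) ⊕ ((# 4 ⊕ (μ ⊕ μ)) ⊕ (# 4 ⊕ (μ ⊕ μ)))) ≈ # 10 ⊕ (μ ⊕ μ) ⊕ (μ ⊕ μ) ⊕ (μ ⊕ μ)) refl μ) (O-· (V⇒O V₃-3) (O-·ˡ (ι (+ 8)) (O-· (V⇒O vm) (O-· od od))))))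
          (O₃-cast 2 (solveℕ 1 (λ μ → (# 4 ⊕ (μ ⊕ μ)) ⊕ ((# 4 ⊕ (μ ⊕ μ)) ⊕ (# 4 ⊕ (μ ⊕ μ))) ≈ # 2 ⊕ (# 10 ⊕ (μ ⊕ μ) ⊕ (μ ⊕ μ) ⊕ (μ ⊕ μ))) refl μ) (O-·ˡ (ι (+ 10)) (O-· od (O-· od od))))

    -- With A close to 6m and `N₀` close to 3M², the leading term is (-45 + 36)Mm² = -9Mm².
    vX : V (4 ℕ.+ (μ ℕ.+ ((μ ℕ.+ μ) ℕ.+ (μ ℕ.+ μ)))) X
    vX = V₃-cong (sym identity) (V-⊹ (V-⊝ (V-· (V-· V₃-3 V₃-3) (V-· vM (V-· vm vm)))) (O-⊖ (O-⊖ (O-⊹ (O-⊹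
        (O₃-cast 1 (solveℕ 1 (λ μ → # 2 ⊕ (μ ⊕ ((μ ⊕ μ) ⊕ (# 4 ⊕ (μ ⊕ μ)))) ≈ # 1 ⊕ (# 5 ⊕ (μ ⊕ ((μ ⊕ μ) ⊕ (μ ⊕ μ))))) refl μ) (O-· (V⇒O V₃-3) (O-·ˡ (⊝ 2ᴱ) (O-· (V⇒O vM) (O-· (V⇒O vm) oε)))))
        (O₃-cast 1 (solveℕ 1 (λ μ → # 2 ⊕ ((μ ⊕ μ) ⊕ (μ ⊕ ((# 2 ⊕ μ) ⊕ (# 2 ⊕ μ)))) ≈ # 1 ⊕ (# 5 ⊕ (μ ⊕ ((μ ⊕ μ) ⊕ (μ ⊕ μ))))) refl μ) (O-· (V⇒O V₃-3) (O-·ˡ (ι (+ 4)) (O-· (V⇒O vm) (O-· (V⇒O vM̄) (O-· oδ oδ)))))))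
        (O₃-cast 3 (solveℕ 1 (λ μ → (# 4 ⊕ (μ ⊕ μ)) ⊕ (μ ⊕ ((# 2 ⊕ μ) ⊕ (# 2 ⊕ μ))) ≈ # 3 ⊕ (# 5 ⊕ (μ ⊕ ((μ ⊕ μ) ⊕ (μ ⊕ μ))))) refl μ) (O-·ˡ 2ᴱ (O-· oε (O-· (V⇒O vM̄) (O-· oδ oδ))))))
        (O₃-cast 3 (solveℕ 1 (λ μ → μ ⊕ (# 8 ⊕ ((μ ⊕ μ) ⊕ (μ ⊕ μ))) ≈ # 3 ⊕ (# 5 ⊕ (μ ⊕ ((μ ⊕ μ) ⊕ (μ ⊕ μ))))) refl μ) (O-· (V⇒O vM) (O-⊹ (sq oε) (sq od)))))
        (O₃-cast 1 (solveℕ 1 (λ μ → # 2 ⊕ (μ ⊕ (# 4 ⊕ (μ ⊕ μ) ⊕ (μ ⊕ μ))) ≈ # 1 ⊕ (# 5 ⊕ (μ ⊕ ((μ ⊕ μ) ⊕ (μ ⊕ μ))))) refl μ) (O-· (V⇒O V₃-3) (O-· (V⇒O vM) oρ)))))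
      where
      sq : ∀ {x} → O (4 ℕ.+ (μ ℕ.+ μ)) x → O (8 ℕ.+ ((μ ℕ.+ μ) ℕ.+ (μ ℕ.+ μ))) (x · x)
      sq h = O₃-cast 0 (solveℕ 1 (λ μ → (# 4 ⊕ (μ ⊕ μ)) ⊕ (# 4 ⊕ (μ ⊕ μ)) ≈ # 8 ⊕ ((μ ⊕ μ) ⊕ (μ ⊕ μ))) refl μ) (O-· h h)
      identity : X ≡ ⊝ (3ᴱ · 3ᴱ · (M · (m · m))) ⊹ (3ᴱ · (⊝ 2ᴱ · (M · (m · ε))) ⊹ 3ᴱ · (ι (+ 4) · (m · (M̄ · (δ · δ)))) ⊹ 2ᴱ · (ε · (M̄ · (δ · δ))) ⊖ M · (ε · ε ⊹ d · d) ⊖ 3ᴱ · (M · ρ))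
      identity = solve 5 (λ M M̄ δ δ̄ A →
           let m = M :* M̄
               d = δ :* δ̄
               N = κ 3ᴱ :* M :* M :+ δ :* δ
               N̄ = κ 3ᴱ :* M̄ :* M̄ :+ δ̄ :* δ̄
               n = N :* N̄
               ρ = M :* M :* (δ̄ :* δ̄) :+ M̄ :* M̄ :* (δ :* δ)
               ε = A :- κ (c (+ 6)) :* m
           in :- (M :* (A :* A :+ n)) :+ κ 2ᴱ :* A :* M̄ :* N
             := :- (κ 3ᴱ :* κ 3ᴱ :* (M :* (m :* m))) :+ (κ 3ᴱ :* (:- κ 2ᴱ :* (M :* (m :* ε))) :+ κ 3ᴱ :* (κ (c (+ 4)) :* (m :* (M̄ :* (δ :* δ)))) :+ κ 2ᴱ :* (ε :* (M̄ :* (δ :* δ))) :- M :* (ε :* ε :+ d :* d) :- κ 3ᴱ :* (M :* ρ)))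
           refl M M̄ δ δ̄ A

    -- The leading term is 36m² - 9m² = 27m². Terms of the apparent order of 27m² occur in the
    -- error; they are controlled by `oεd` and by the additional factor ϖ in the difference of y and
    -- its conjugate.
    vΔ : V (6 ℕ.+ ((μ ℕ.+ μ) ℕ.+ (μ ℕ.+ μ))) Δ
    vΔ = V₃-cong (sym identity) (V-⊹ (V-· (V-· V₃-3 (V-· V₃-3 V₃-3)) (V-· vm vm)) (O-⊖ (O-⊖ (O-⊹ (O-⊖
        (O₃-cast 1 (solveℕ 1 (λ μ → # 2 ⊕ ((μ ⊕ μ) ⊕ (# 6 ⊕ (μ ⊕ μ))) ≈ # 1 ⊕ (# 7 ⊕ ((μ ⊕ μ) ⊕ (μ ⊕ μ)))) refl μ) (O-· (V⇒O V₃-3) (O-·ˡ (ι (+ 4)) (O-· (V⇒O vm) oεd))))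
        (O₃-cast 1 (solveℕ 1 (λ μ → # 2 ⊕ ((# 1 ⊕ ((# 1 ⊕ μ) ⊕ (# 1 ⊕ μ))) ⊕ (# 1 ⊕ ((# 1 ⊕ μ) ⊕ (# 1 ⊕ μ)))) ≈ # 1 ⊕ (# 7 ⊕ ((μ ⊕ μ) ⊕ (μ ⊕ μ)))) refl μ) (O-· (V⇒O V₃-3) (O-· oyȳ oyȳ))))
        (sq oε)) (sq od))
        (O₃-cast 1 (solveℕ 1 (λ μ → # 2 ⊕ (# 2 ⊕ (((# 1 ⊕ μ) ⊕ (# 1 ⊕ μ)) ⊕ ((# 1 ⊕ μ) ⊕ (# 1 ⊕ μ)))) ≈ # 1 ⊕ (# 7 ⊕ ((μ ⊕ μ) ⊕ (μ ⊕ μ)))) refl μ) (O-· (V⇒O V₃-3) (O-· (V⇒O V₃-3) (O-·ˡ (ι (+ 14)) (O-· oy (subst (O _) yᶜ (O₃-conj oy)))))))))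
      where
      y ȳ : 𝔼
      y = δ · M̄
      ȳ = δ̄ · M
      yᶜ : y ᶜ ≡ ȳ
      yᶜ = trans (conj-· δ M̄) (cong (δ̄ ·_) (conj-conj M))
      oy : O ((1 ℕ.+ μ) ℕ.+ (1 ℕ.+ μ)) y
      oy = O₃-cast 0 (solveℕ 1 (λ μ → (# 2 ⊕ μ) ⊕ μ ≈ (# 1 ⊕ μ) ⊕ (# 1 ⊕ μ)) refl μ) (O-· oδ (V⇒O vM̄))
      oyȳ : O (1 ℕ.+ ((1 ℕ.+ μ) ℕ.+ (1 ℕ.+ μ))) (y ⊖ ȳ)
      oyȳ = subst (λ t → O _ (y ⊖ t)) yᶜ (conj-difference {1 ℕ.+ μ} oy)
      sq : ∀ {x} → O (4 ℕ.+ (μ ℕ.+ μ)) x → O (7 ℕ.+ ((μ ℕ.+ μ) ℕ.+ (μ ℕ.+ μ))) (x · x)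
      sq h = O₃-cast 1 (solveℕ 1 (λ μ → (# 4 ⊕ (μ ⊕ μ)) ⊕ (# 4 ⊕ (μ ⊕ μ)) ≈ # 1 ⊕ (# 7 ⊕ ((μ ⊕ μ) ⊕ (μ ⊕ μ)))) refl μ) (O-· h h)
      identity : Δ ≡ 3ᴱ · (3ᴱ · 3ᴱ) · (m · m) ⊹ (3ᴱ · (ι (+ 4) · (m · (ε ⊹ ι (+ 10) · d))) ⊖ 3ᴱ · ((y ⊖ ȳ) · (y ⊖ ȳ)) ⊹ ε · ε ⊖ d · d ⊖ 3ᴱ · (3ᴱ · (ι (+ 14) · (y · ȳ))))
      identity = solve 5 (λ M M̄ δ δ̄ A →
           let m = M :* M̄
               d = δ :* δ̄
               N = κ 3ᴱ :* M :* M :+ δ :* δ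
               N̄ = κ 3ᴱ :* M̄ :* M̄ :+ δ̄ :* δ̄
               n = N :* N̄
               ε = A :- κ (c (+ 6)) :* m
               y = δ :* M̄
               ȳ = δ̄ :* M
           in A :* A :- n
             := κ 3ᴱ :* (κ 3ᴱ :* κ 3ᴱ) :* (m :* m) :+ (κ 3ᴱ :* (κ (c (+ 4)) :* (m :* (ε :+ κ (c (+ 10)) :* d))) :- κ 3ᴱ :* ((y :- ȳ) :* (y :- ȳ)) :+ ε :* ε :- d :* d :- κ 3ᴱ :* (κ 3ᴱ :* (κ (c (+ 14)) :* (y :* ȳ)))))
           refl M M̄ δ δ̄ A

triple-injective : ∀ {m n} → m ℕ.+ m ℕ.+ m ≡ n ℕ.+ n ℕ.+ n → m ≡ n
triple-injective {m} {n} e = ℕ.*-cancelˡ-≡ m n 3 (trans (sym (three m)) (trans e (three n)))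
  where
  three : ∀ m → m ℕ.+ m ℕ.+ m ≡ 3 ℕ.* m
  three m = ℕS.solve 1 (λ m → m ℕS.:+ m ℕS.:+ m ℕS.:= ℕS.con 3 ℕS.:* m) refl m

-- Dividing by 1 - σ lowers k = v(e) - v(β) - 2 by one.
no-datum : ∀ k {β e Λ a₀ a₁ b ν} → Datum β e Λ a₀ a₁ → V₃.V b β → V₃.V (2 ℕ.+ k ℕ.+ b) (ι e) →
  V₃.V ν (a₀ · a₀ ᶜ) → V₃.V (2 ℕ.+ ν) (ι a₁ · ι a₁ ⊖ a₀ · a₀ ᶜ) → ⊥
no-datum k {β} {e} {Λ} {a₀} {a₁} {b} {ν} D vb ve vν vν′ = paired-roots D vb oe e≢0 λ { (r , s , r³ , s³ , rs) →
    align-roots r s r³ s³ rs (V-exists Λ≢0) (V-exists (cube≢0 r r³ (·-nonzero Λ≢0 (V⇒≢0 V-ξ₋)))) (V-exists (cube≢0 s s³ (·-nonzero Λ≢0 (V⇒≢0 V-ξ₊)))) }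
  where
  open V₃
  open 𝔼S using (solve; _:=_; _:+_; _:-_; _:*_; :-_; κ)
  open ℕS using () renaming (solve to solveℕ; _:=_ to _≈_; _:+_ to _⊕_; con to #)
  e≢0 : e ≢ 0ℤ
  e≢0 h = V⇒≢0 ve (cong ι h)
  oe : O (2 ℕ.+ b) (ι e)
  oe = O₃-cast k (solveℕ 2 (λ k b → # 2 ⊕ k ⊕ b ≈ k ⊕ (# 2 ⊕ b)) refl k b) (V⇒O ve)
  open CubeRoot D vb oe e≢0 using (Λ≢0; V-ξ₋; V-ξ₊)
  cube≢0 : ∀ r {x} → r ³ ≡ x → x ≢ 0ᴱ → r ≢ 0ᴱ
  cube≢0 r refl nx refl = nx refl
  align-roots : ∀ r s → r ³ ≡ ι Λ · (β ⊖ ω · ι e) → s ³ ≡ ι Λ · (β ⊹ ω · ι e) → r · s ≡ ι Λ · a₀ →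
    ∃[ l ] V l (ι Λ) → ∃[ μ ] V μ r → ∃[ σ ] V σ s → ⊥
  align-roots r s r³ s³ rs (l , vl) (μ , vr) (σ , vs) = go (align vr (V₃-cast σ≡μ vs) oδ³)
    where
    lb≡ : l ℕ.+ b ≡ μ ℕ.+ μ ℕ.+ μ
    lb≡ = V-unique (V-· vl V-ξ₋) (V₃-cong r³ (V-· (V-· vr vr) vr))
    σ≡μ : σ ≡ μ
    σ≡μ = triple-injective (trans (V-unique (V-· (V-· vs vs) vs) (V₃-cong (sym s³) (V-· vl V-ξ₊))) lb≡)
    diff : s ³ ⊖ r ³ ≡ 2ᴱ · ω · (ι Λ · ι e)
    diff = trans (cong₂ _⊖_ s³ r³) (solve 3 (λ l β e → l :* (β :+ κ ω :* e) :- l :* (β :- κ ω :* e) := κ 2ᴱ :* κ ω :* (l :* e)) refl (ι Λ) β (ι e))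
    vdiff : V ((2 ℕ.+ (μ ℕ.+ μ)) ℕ.+ (μ ℕ.+ k)) (s ³ ⊖ r ³)
    vdiff = V₃-cong (sym diff) (V₃-cast (trans (solveℕ 3 (λ l b k → l ⊕ (# 2 ⊕ k ⊕ b) ≈ # 2 ⊕ k ⊕ (l ⊕ b)) refl l b k)
      (trans (cong (2 ℕ.+ k ℕ.+_) lb≡) (solveℕ 2 (λ μ k → # 2 ⊕ k ⊕ (μ ⊕ μ ⊕ μ) ≈ (# 2 ⊕ (μ ⊕ μ)) ⊕ (μ ⊕ k)) refl μ k)))
      (V-· {x = 2ᴱ · ω} {y = ι Λ · ι e} (V-· {x = 2ᴱ} {y = ω} V₃-2 (V₃-unit (ω̄ , refl))) (V-· {x = ι Λ} {y = ι e} vl ve)))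
    oδ³ : O (μ ℕ.+ μ ℕ.+ μ ℕ.+ 1) (s ³ ⊖ r ³)
    oδ³ = O₃-cast (suc k) (solveℕ 2 (λ μ k → (# 2 ⊕ (μ ⊕ μ)) ⊕ (μ ⊕ k) ≈ (# 1 ⊕ k) ⊕ (μ ⊕ μ ⊕ μ ⊕ # 1)) refl μ k) (V⇒O vdiff)
    go : ∃[ r′ ] ∃[ s′ ] (r′ ³ ≡ r ³ × s′ ³ ≡ s ³ × r′ · s′ ≡ r · s × V μ r′ × O (2 ℕ.+ μ) (s′ ⊖ r′)) → ⊥
    go (r , s , r³′ , s³′ , rs′ , vr , oδ) = descend k refl
      where
      δ = s ⊖ r
      module S = Descent {k = k} D vb ve vν vν′ (trans r³′ r³) (trans s³′ s³) (trans rs′ rs) vr oδ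
      vK : V (2 ℕ.+ (μ ℕ.+ μ)) (3ᴱ · (r · r) ⊹ (3ᴱ · (r · δ) ⊹ δ · δ))
      vK = V-⊹ (V-· V₃-3 (V-· vr vr)) (O-⊹
        (O₃-cast 1 (solveℕ 1 (λ μ → # 2 ⊕ (μ ⊕ (# 2 ⊕ μ)) ≈ # 1 ⊕ (# 3 ⊕ (μ ⊕ μ))) refl μ) (O-· (V⇒O V₃-3) (O-· (V⇒O vr) oδ)))
        (O₃-cast 1 (solveℕ 1 (λ μ → (# 2 ⊕ μ) ⊕ (# 2 ⊕ μ) ≈ # 1 ⊕ (# 3 ⊕ (μ ⊕ μ))) refl μ) (O-· oδ oδ)))
      vδ : V (μ ℕ.+ k) δ
      vδ = V-cancel (V₃-cong (trans (sym (cong₂ _⊖_ s³′ r³′)) (solve 2 (λ r s → let d = s :- r in s :* s :* s :- r :* r :* r := (κ 3ᴱ :* (r :* r) :+ (κ 3ᴱ :* (r :* d) :+ d :* d)) :* d) refl r s)) vdiff) vK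
      descend : ∀ k′ → k ≡ k′ → ⊥
      -- The order of δ is exactly μ + k, while the alignment made it at least μ + 2.
      descend zero refl = ℕ.1+n≰n (ℕ.≤-trans (ℕ.≤-trans (ℕ.n≤1+n (suc μ)) (V-O-≤ vδ oδ)) (ℕ.≤-reflexive (ℕ.+-identityʳ μ)))
      -- The new orders are 7μ + 7 for β′ and 7μ + 8 + k for gΔ, so their difference is 2 + (k - 1);
      -- and Δ has two orders more than N₀N̄₀, as the next step requires.
      descend (suc k′) refl = no-datum k′ S.next (V-· (V-· V-p S.vN) (S.vX vl)) ve′ vn′ vΔ′
        where
        vg : V ((μ ℕ.+ suc k′) ℕ.+ (2 ℕ.+ μ ℕ.+ μ)) (ι S.gℤ)
        vg = V₃-cong (trans (cong (ω̄ ·_) S.δN) (solve 1 (λ g → κ ω̄ :* (κ ω :* g) := g) refl (ι S.gℤ))) (V-· (V₃-unit (ω , refl)) (V-· vδ S.vN))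
        ve′ = V₃-cong (sym (ι-* S.gℤ S.Δℤ)) (V₃-cast (solveℕ 2 (λ μ k → ((μ ⊕ (# 1 ⊕ k)) ⊕ (# 2 ⊕ μ ⊕ μ)) ⊕ (# 6 ⊕ ((μ ⊕ μ) ⊕ (μ ⊕ μ)))
               ≈ # 2 ⊕ k ⊕ ((# 1 ⊕ (# 2 ⊕ μ ⊕ μ)) ⊕ (# 4 ⊕ (μ ⊕ ((μ ⊕ μ) ⊕ (μ ⊕ μ)))))) refl μ k′)
             (V-· {x = ι S.gℤ} {y = ι S.Δℤ} vg (V₃-cong (sym S.Δ≡) (S.vΔ vl))))
        vn′ = V₃-cong (cong (S.N₀ ·_) (sym S.Nᶜ)) S.vn
        vΔ′ = V₃-cong (trans (cong₂ _⊖_ (trans (solve 1 (λ a → a :* a := (:- a) :* (:- a)) refl S.A) (cong (λ t → ⊝ t · ⊝ t) (sym S.A≡))) (cong (S.N₀ ·_) (sym S.Nᶜ))) refl)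
          (V₃-cast (solveℕ 1 (λ μ → # 6 ⊕ ((μ ⊕ μ) ⊕ (μ ⊕ μ)) ≈ # 2 ⊕ ((# 2 ⊕ μ ⊕ μ) ⊕ (# 2 ⊕ μ ⊕ μ))) refl μ) (S.vΔ vl))

-- From points of the curve that are not integral at 3 to descent data.

-- ι as a homomorphism on polynomial expressions
ι-expr : ∀ {n} → ℤS.Expr n → 𝔼S.Expr n
ι-expr (ℤS.var i) = 𝔼S.var i
ι-expr (ℤS.κ c) = 𝔼S.κ (ι c)
ι-expr (a ℤS.:+ b) = ι-expr a 𝔼S.:+ ι-expr b
ι-expr (a ℤS.:* b) = ι-expr a 𝔼S.:* ι-expr b
ι-expr (ℤS.:- a) = 𝔼S.:- ι-expr a

ι-eval : ∀ {n} (e : ℤS.Expr n) ρ → ι (ℤS.⟦ e ⟧ ρ) ≡ 𝔼S.⟦ ι-expr e ⟧ (map ι ρ)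
ι-eval (ℤS.var i) ρ = sym (lookup-map i ι ρ)
ι-eval (ℤS.κ c) ρ = refl
ι-eval (a ℤS.:+ b) ρ = cong₂ _⊹_ (ι-eval a ρ) (ι-eval b ρ)
ι-eval (a ℤS.:* b) ρ = trans (ι-* (ℤS.⟦ a ⟧ ρ) (ℤS.⟦ b ⟧ ρ)) (cong₂ _·_ (ι-eval a ρ) (ι-eval b ρ))
ι-eval (ℤS.:- a) ρ = cong ⊝_ (ι-eval a ρ)

3∣ℤ : ℤ → Set
3∣ℤ x = ∃[ k ] x ≡ + 3 * k

O₃-ι : ∀ {x} → 3∣ℤ x → V₃.O 2 (ι x)
O₃-ι (k , refl) = subst (V₃.O 2) (sym (ι-* (+ 3) k)) (O₃-3 (ι k))

V₃-ι : ∀ {x} → ¬ 3∣ℤ x → V₃.V 0 (ι x)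
V₃-ι {x} h = V₃.V-unit (λ d → by d (mod3 x))
  where
  by : ϖ ∣ᴱ ι x → _ → ⊥
  by d (k , inj₁ e) = h (k , e)
  by d (k , inj₂ (inj₁ refl)) = ϖ-nonunit (subst (ϖ ∣ᴱ_) (trans (cong (λ t → 1ᴱ ⊹ t ⊖ t) (ι-* (+ 3) k)) (𝔼S.solve 1 (λ t → 𝔼S.κ 1ᴱ 𝔼S.:+ t 𝔼S.:- t 𝔼S.:= 𝔼S.κ 1ᴱ) refl (3ᴱ · ι k)))
    (∣ᴱ-⊹ d (∣ᴱ-⊝ (subst (ϖ ∣ᴱ_) (sym (ι-* (+ 3) k)) (∣ᴱ-·ʳ (ι k) (⊝ ϖ , refl))))))
  by d (k , inj₂ (inj₂ refl)) = ϖ-nonunit (subst (ϖ ∣ᴱ_) (trans (cong (λ t → ⊝ (⊝ 1ᴱ ⊹ t ⊖ t)) (ι-* (+ 3) k)) (𝔼S.solve 1 (λ t → 𝔼S.:- (𝔼S.:- 𝔼S.κ 1ᴱ 𝔼S.:+ t 𝔼S.:- t) 𝔼S.:= 𝔼S.κ 1ᴱ) refl (3ᴱ · ι k)))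
    (∣ᴱ-⊝ (∣ᴱ-⊹ d (∣ᴱ-⊝ (subst (ϖ ∣ᴱ_) (sym (ι-* (+ 3) k)) (∣ᴱ-·ʳ (ι k) (⊝ ϖ , refl)))))))

3∣ℤ? : ∀ x → 3∣ℤ x ⊎ ¬ 3∣ℤ x
3∣ℤ? x = by (mod3 x)
  where
  by : _ → 3∣ℤ x ⊎ ¬ 3∣ℤ x
  by (k , inj₁ e) = inj₁ (k , e)
  by (k , inj₂ (inj₁ refl)) = inj₂ λ { (l , e) → ¬3∣1 {1ℤ} (λ ()) (ℕ.s≤s (ℕ.s≤s ℕ.z≤n)) (l - k , (begin
      1ℤ ≡⟨ ℤS.solve 1 (λ k → ℤS.κ 1ℤ ℤS.:= ℤS.κ 1ℤ ℤS.:+ ℤS.κ (+ 3) ℤS.:* k ℤS.:- ℤS.κ (+ 3) ℤS.:* k) refl k ⟩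
      1ℤ + + 3 * k - + 3 * k ≡⟨ cong (_- + 3 * k) e ⟩
      + 3 * l - + 3 * k ≡⟨ ℤS.solve 2 (λ k l → ℤS.κ (+ 3) ℤS.:* l ℤS.:- ℤS.κ (+ 3) ℤS.:* k ℤS.:= ℤS.κ (+ 3) ℤS.:* (l ℤS.:- k)) refl k l ⟩
      + 3 * (l - k) ∎)) }
    where open ≡-Reasoning
  by (k , inj₂ (inj₂ refl)) = inj₂ λ { (l , e) → ¬3∣1 { -1ℤ} (λ ()) (ℕ.s≤s (ℕ.s≤s ℕ.z≤n)) (l - k , (begin
      -1ℤ ≡⟨ ℤS.solve 1 (λ k → ℤS.κ -1ℤ ℤS.:= ℤS.κ -1ℤ ℤS.:+ ℤS.κ (+ 3) ℤS.:* k ℤS.:- ℤS.κ (+ 3) ℤS.:* k) refl k ⟩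
      -1ℤ + + 3 * k - + 3 * k ≡⟨ cong (_- + 3 * k) e ⟩
      + 3 * l - + 3 * k ≡⟨ ℤS.solve 2 (λ k l → ℤS.κ (+ 3) ℤS.:* l ℤS.:- ℤS.κ (+ 3) ℤS.:* k ℤS.:= ℤS.κ (+ 3) ℤS.:* (l ℤS.:- k)) refl k l ⟩
      + 3 * (l - k) ∎)) }
    where open ≡-Reasoning

O₃⇒3∣ℤ : ∀ {x} → V₃.O 1 (ι x) → 3∣ℤ x
O₃⇒3∣ℤ {x} h = [ (λ d → d) , (λ n → ⊥-elim (ℕ.1+n≰n (V₃.V-O-≤ (V₃-ι n) h))) ]′ (3∣ℤ? x)

-- 3 is ramified in ℤ[ω], so the order of a rational integer at ϖ is even.
O₃-even : ∀ {x} → V₃.O 1 (ι x) → V₃.O 2 (ι x)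
O₃-even h = O₃-ι (O₃⇒3∣ℤ h)

-- On the curve y² = A² + 8h² with A = x³ + x² - 2x - 1 and h = x² + x, let t x² + p x + q = 0 and
-- t² w y = u x + v.  Then (t²A, t²h) = (A₁x + A₀, h₁x + h₀), and R₁x + R₀ below is t (A² + 8h²) t⁴.
module Remainder (t p q : ℤ) where
  A₁ A₀ h₁ h₀ R₁ R₀ : ℤ
  A₁ = p * p - t * q - t * p - + 2 * t * t
  A₀ = p * q - t * q - t * t
  h₁ = t * (t - p)
  h₀ = - (t * q)
  R₁ = + 2 * t * A₁ * A₀ - p * A₁ * A₁ + + 8 * (+ 2 * t * h₁ * h₀ - p * h₁ * h₁)
  R₀ = t * A₀ * A₀ - q * A₁ * A₁ + + 8 * (t * h₀ * h₀ - q * h₁ * h₁)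

-- Besides the remainders above: A₁h₀ - A₀h₁ is T²`D₀`, so `D₀` vanishes when A/h takes equal values
-- at the two roots of a = Tx² + Px + Q. `Nₐ` is a(ω)a(ω̄), and `n₀`A² + `n₁`Ah + `n₂`h² is the
-- product of the three σ-conjugates of a, of leading coefficient TQ(T - P + Q).
module 𝔼Remainder (T P Q : 𝔼) where
  A₁ A₀ h₁ h₀ R₁ R₀ D₀ Nₐ n₀ n₁ n₂ : 𝔼
  A₁ = P · P ⊖ T · Q ⊖ T · P ⊖ 2ᴱ · T · T
  A₀ = P · Q ⊖ T · Q ⊖ T · T
  h₁ = T · (T ⊖ P)
  h₀ = ⊝ (T · Q)
  R₁ = 2ᴱ · T · A₁ · A₀ ⊖ P · A₁ · A₁ ⊹ ι (+ 8) · (2ᴱ · T · h₁ · h₀ ⊖ P · h₁ · h₁)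
  R₀ = T · A₀ · A₀ ⊖ Q · A₁ · A₁ ⊹ ι (+ 8) · (T · h₀ · h₀ ⊖ Q · h₁ · h₁)
  D₀ = T · T ⊹ Q · Q ⊖ T · P ⊖ P · Q ⊹ 3ᴱ · T · Q
  Nₐ = T · T ⊹ P · P ⊹ Q · Q ⊖ T · P ⊖ P · Q ⊖ T · Q
  n₀ = T · Q · (T ⊖ P ⊹ Q)
  n₁ = P · Q · Q ⊖ P · Q · T ⊖ P · T · T ⊖ P · P · Q ⊹ P · P · T ⊹ 2ᴱ · Q · T · T
  n₂ = P · P · P ⊹ Q · Q · Q ⊹ T · T · T ⊖ P · Q · T ⊖ P · Q · Q ⊖ 2ᴱ · P · T · T ⊖ 2ᴱ · P · P · Q ⊖ P · P · T ⊹ ι (+ 6) · Q · T · T ⊹ ι (+ 5) · Q · Q · T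

module Expr𝔼 {n : ℕ} where
  open 𝔼S
  module _ (T P Q : Expr n) where
    A₁ A₀ h₁ h₀ R₁ R₀ D₀ Nₐ n₀ n₁ n₂ : Expr n
    A₁ = P :* P :- T :* Q :- T :* P :- κ 2ᴱ :* T :* T
    A₀ = P :* Q :- T :* Q :- T :* T
    h₁ = T :* (T :- P)
    h₀ = :- (T :* Q)
    R₁ = κ 2ᴱ :* T :* A₁ :* A₀ :- P :* A₁ :* A₁ :+ κ (ι (+ 8)) :* (κ 2ᴱ :* T :* h₁ :* h₀ :- P :* h₁ :* h₁)
    R₀ = T :* A₀ :* A₀ :- Q :* A₁ :* A₁ :+ κ (ι (+ 8)) :* (T :* h₀ :* h₀ :- Q :* h₁ :* h₁)
    D₀ = T :* T :+ Q :* Q :- T :* P :- P :* Q :+ κ 3ᴱ :* T :* Q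
    Nₐ = T :* T :+ P :* P :+ Q :* Q :- T :* P :- P :* Q :- T :* Q
    n₀ = T :* Q :* (T :- P :+ Q)
    n₁ = P :* Q :* Q :- P :* Q :* T :- P :* T :* T :- P :* P :* Q :+ P :* P :* T :+ κ 2ᴱ :* Q :* T :* T
    n₂ = P :* P :* P :+ Q :* Q :* Q :+ T :* T :* T :- P :* Q :* T :- P :* Q :* Q :- κ 2ᴱ :* P :* T :* T :- κ 2ᴱ :* P :* P :* Q :- P :* P :* T :+ κ (ι (+ 6)) :* Q :* T :* T :+ κ (ι (+ 5)) :* Q :* Q :* T

module _ where
  open 𝔼S

  rotate : ∀ {a b c x y z} → a · x ⊹ b · y ⊹ c · z ≡ 0ᴱ → b · y ⊹ c · z ⊹ a · x ≡ 0ᴱ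
  rotate {a} {b} {c} {x} {y} {z} h = trans (solve 3 (λ p q r → q :+ r :+ p := p :+ q :+ r) refl (a · x) (b · y) (c · z)) h

  scale : ∀ C a b x y → C · (a · x ⊖ b · y) ≡ a · (C · x) ⊖ b · (C · y)
  scale = solve 5 (λ C a b x y → C :* (a :* x :- b :* y) := a :* (C :* x) :- b :* (C :* y)) refl

  -- A vector orthogonal to two rows is proportional to their cross product.
  minor : ∀ a b c x y z x′ y′ z′ → a · x ⊹ b · y ⊹ c · z ≡ 0ᴱ → a · x′ ⊹ b · y′ ⊹ c · z′ ≡ 0ᴱ →
    a · (x · y′ ⊖ y · x′) ⊖ c · (y · z′ ⊖ z · y′) ≡ 0ᴱ
  minor a b c x y z x′ y′ z′ e e′ = trans
    (solve 9 (λ a b c x y z x′ y′ z′ → a :* (x :* y′ :- y :* x′) :- c :* (y :* z′ :- z :* y′)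
       := y′ :* (a :* x :+ b :* y :+ c :* z) :- y :* (a :* x′ :+ b :* y′ :+ c :* z′)) refl a b c x y z x′ y′ z′)
    (trans (cong₂ (λ s t → y′ · s ⊖ y · t) e e′) (solve 2 (λ p q → p :* κ 0ᴱ :- q :* κ 0ᴱ := κ 0ᴱ) refl y′ y))

O₃-real : ∀ {x} → x ᶜ ≡ x → V₃.O 1 x → V₃.O 2 x
O₃-real {x} r h = by (real x r)
  where
  by : ∃[ a ] x ≡ ι a → V₃.O 2 x
  by (a , refl) = O₃-even h

-- T, P, Q, U, Y and W stand for t, p, q, u, v and w.
module NonIntegral (T P Q U Y W : 𝔼) (rT : T ᶜ ≡ T) (rP : P ᶜ ≡ P) (rQ : Q ᶜ ≡ Q) (rU : U ᶜ ≡ U) (rY : Y ᶜ ≡ Y) (rW : W ᶜ ≡ W)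
  (vT : V₃.V 0 T) (oW : V₃.O 2 W) (W≢0 : W ≢ 0ᴱ) (vU : V₃.V 0 U)
  (H₁ : 2ᴱ · T · U · Y ⊖ P · U · U ≡ W · W · 𝔼Remainder.R₁ T P Q)
  (H₀ : T · Y · Y ⊖ Q · U · U ≡ W · W · 𝔼Remainder.R₀ T P Q) where

  open 𝔼S using (solve; _:=_; _:+_; _:-_; _:*_; :-_; κ)
  open V₃
  module X = Expr𝔼
  open 𝔼Remainder T P Q

  4T : 𝔼
  4T = ι (+ 4) · T

  v4T : V 0 4T
  v4T = V-· {x = ι (+ 4)} (V-· {x = 2ᴱ} {y = 2ᴱ} V₃-2 V₃-2) vT

  disc : 𝔼
  disc = P · P ⊖ 4T · Q

  S : 𝔼
  S = 4T · U · (U · R₀ ⊖ Y · R₁) ⊹ W · W · (R₁ · R₁)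

  -- Eliminating Y between `H₁` and `H₀` leaves a multiple of W². As U is prime to 3 and W is not,
  -- the discriminant is divisible by ϖ⁴ and a has a double root modulo 3.
  disc-U : U · U · (U · U) · disc ≡ W · W · S
  disc-U = trans (solve 5 (λ T P Q U Y → let h = κ 2ᴱ :* T :* U :* Y :- P :* U :* U in
        U :* U :* (U :* U) :* (P :* P :- κ (ι (+ 4)) :* T :* Q) := κ (ι (+ 4)) :* T :* U :* (U :* (T :* Y :* Y :- Q :* U :* U) :- Y :* h) :+ h :* h) refl T P Q U Y)
    (trans (cong₂ (λ h₁ h₀ → 4T · U · (U · h₀ ⊖ Y · h₁) ⊹ h₁ · h₁) H₁ H₀)
      (solve 6 (λ T U Y W r s → κ (ι (+ 4)) :* T :* U :* (U :* (W :* W :* s) :- Y :* (W :* W :* r)) :+ (W :* W :* r) :* (W :* W :* r)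
         := W :* W :* (κ (ι (+ 4)) :* T :* U :* (U :* s :- Y :* r) :+ W :* W :* (r :* r))) refl T U Y W R₁ R₀))

  vU⁴ : V 0 (U · U · (U · U))
  vU⁴ = V-· (V-· {x = U} {y = U} vU vU) (V-· {x = U} {y = U} vU vU)

  oWW : O 4 (W · W)
  oWW = O-· oW oW

  o-disc : O 4 disc
  o-disc = O₃-cancel vU⁴ (subst (O 4) (sym disc-U) (O-·ʳ S oWW))

  -- By Cramer's rule, κ₀A + μ₀h = Ey at both points, which is the line joining their images on the
  -- conic y² = A² + 8h², the quotient of the curve by σ. Squaring gives W₀A² + W₁Ah + W₂h² = 0
  -- there. `z` is the value of A/h at the fixed point ω̄ of σ, and z² + 8 = (ϖω)².
  κ₀ μ₀ Δ E z : 𝔼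
  κ₀ = U · h₀ ⊖ Y · h₁
  μ₀ = A₁ · Y ⊖ A₀ · U
  Δ = T · T · D₀
  E = W · Δ
  z = 1ᴱ ⊹ 3ᴱ · ω̄

  W₀ W₁ W₂ : 𝔼
  W₀ = κ₀ · κ₀ ⊖ E · E
  W₁ = 2ᴱ · κ₀ · μ₀
  W₂ = μ₀ · μ₀ ⊖ ι (+ 8) · E · E

  -- This is a(ω̄), and with `a₁` below it gives the coordinates of a in which σ is diagonal: -3a =
  -- a₀(x - ω)² + a₁(x - ω)(x - ω̄) + ā₀(x - ω̄)².
  a₀ : 𝔼
  a₀ = T · ω ⊹ P · ω̄ ⊹ Q

  a₁ : 𝔼
  a₁ = P ⊖ 2ᴱ · T ⊖ 2ᴱ · Q

  a₀ᶜ : a₀ ᶜ ≡ T · ω̄ ⊹ P · ω ⊹ Q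
  a₀ᶜ = trans (conj-⊹ (T · ω ⊹ P · ω̄) Q) (cong₂ _⊹_ (trans (conj-⊹ (T · ω) (P · ω̄)) (cong₂ _⊹_ (trans (conj-· T ω) (cong (_· ω̄) rT)) (trans (conj-· P ω̄) (cong (_· ω) rP)))) rQ)

  norm≡ : Nₐ ≡ a₀ · a₀ ᶜ
  norm≡ = trans (solve 3 (λ T P Q → X.Nₐ T P Q := (T :* κ ω :+ P :* κ ω̄ :+ Q) :* (T :* κ ω̄ :+ P :* κ ω :+ Q)) refl T P Q) (cong (a₀ ·_) (sym a₀ᶜ))

  3D₀≡ : 3ᴱ · D₀ ≡ a₁ · a₁ ⊖ a₀ · a₀ ᶜ
  3D₀≡ = trans (solve 3 (λ T P Q → let a = P :- κ 2ᴱ :* T :- κ 2ᴱ :* Q in κ 3ᴱ :* X.D₀ T P Q := a :* a :- X.Nₐ T P Q) refl T P Q)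
    (cong (a₁ · a₁ ⊖_) norm≡)

  D₀≡ : D₀ ≡ Nₐ ⊖ disc
  D₀≡ = solve 3 (λ T P Q → X.D₀ T P Q := X.Nₐ T P Q :- (P :* P :- κ (ι (+ 4)) :* T :* Q)) refl T P Q

  -- the rows expressing A², Ah and h² through x and 1
  private
    bil₁ bil₀ : 𝔼 → 𝔼 → 𝔼 → 𝔼 → 𝔼
    bil₁ a b c d = T · (a · d ⊹ b · c) ⊖ P · a · c
    bil₀ a b c d = T · b · d ⊖ Q · a · c

    row₁ : W₀ · bil₁ A₁ A₀ A₁ A₀ ⊹ W₁ · bil₁ A₁ A₀ h₁ h₀ ⊹ W₂ · bil₁ h₁ h₀ h₁ h₀ ≡ 0ᴱ
    row₁ = trans (solve 10 (λ T P A₁ A₀ h₁ h₀ U Y W Δ → let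
        bil = λ a b c d → T :* (a :* d :+ b :* c) :- P :* a :* c
        k = U :* h₀ :- Y :* h₁
        m = A₁ :* Y :- A₀ :* U
        E = W :* Δ in
        (k :* k :- E :* E) :* bil A₁ A₀ A₁ A₀ :+ κ 2ᴱ :* k :* m :* bil A₁ A₀ h₁ h₀ :+ (m :* m :- κ (ι (+ 8)) :* E :* E) :* bil h₁ h₀ h₁ h₀
        := (A₁ :* h₀ :- A₀ :* h₁) :* (A₁ :* h₀ :- A₀ :* h₁) :* (κ 2ᴱ :* T :* U :* Y :- P :* U :* U) :- W :* W :* Δ :* Δ :* (κ 2ᴱ :* T :* A₁ :* A₀ :- P :* A₁ :* A₁ :+ κ (ι (+ 8)) :* (κ 2ᴱ :* T :* h₁ :* h₀ :- P :* h₁ :* h₁)))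
        refl T P A₁ A₀ h₁ h₀ U Y W Δ)
      (trans (cong₂ (λ d h → d · d · h ⊖ W · W · Δ · Δ · R₁) det H₁) (solve 3 (λ W D R → D :* D :* (W :* W :* R) :- W :* W :* D :* D :* R := κ 0ᴱ) refl W Δ R₁))
      where
      det : A₁ · h₀ ⊖ A₀ · h₁ ≡ Δ
      det = solve 3 (λ T P Q → X.A₁ T P Q :* X.h₀ T P Q :- X.A₀ T P Q :* X.h₁ T P Q := T :* T :* X.D₀ T P Q) refl T P Q

    row₀ : W₀ · bil₀ A₁ A₀ A₁ A₀ ⊹ W₁ · bil₀ A₁ A₀ h₁ h₀ ⊹ W₂ · bil₀ h₁ h₀ h₁ h₀ ≡ 0ᴱ
    row₀ = trans (solve 10 (λ T Q A₁ A₀ h₁ h₀ U Y W Δ → let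
        bil = λ a b c d → T :* b :* d :- Q :* a :* c
        k = U :* h₀ :- Y :* h₁
        m = A₁ :* Y :- A₀ :* U
        E = W :* Δ in
        (k :* k :- E :* E) :* bil A₁ A₀ A₁ A₀ :+ κ 2ᴱ :* k :* m :* bil A₁ A₀ h₁ h₀ :+ (m :* m :- κ (ι (+ 8)) :* E :* E) :* bil h₁ h₀ h₁ h₀
        := (A₁ :* h₀ :- A₀ :* h₁) :* (A₁ :* h₀ :- A₀ :* h₁) :* (T :* Y :* Y :- Q :* U :* U) :- W :* W :* Δ :* Δ :* (T :* A₀ :* A₀ :- Q :* A₁ :* A₁ :+ κ (ι (+ 8)) :* (T :* h₀ :* h₀ :- Q :* h₁ :* h₁)))
        refl T Q A₁ A₀ h₁ h₀ U Y W Δ)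
      (trans (cong₂ (λ d h → d · d · h ⊖ W · W · Δ · Δ · R₀) det H₀) (solve 3 (λ W D R → D :* D :* (W :* W :* R) :- W :* W :* D :* D :* R := κ 0ᴱ) refl W Δ R₀))
      where
      det : A₁ · h₀ ⊖ A₀ · h₁ ≡ Δ
      det = solve 3 (λ T P Q → X.A₁ T P Q :* X.h₀ T P Q :- X.A₀ T P Q :* X.h₁ T P Q := T :* T :* X.D₀ T P Q) refl T P Q

    C : 𝔼
    C = T · T · T · T · T · D₀

    ra rb rc sa sb sc : 𝔼
    ra = bil₁ A₁ A₀ A₁ A₀
    rb = bil₁ A₁ A₀ h₁ h₀
    rc = bil₁ h₁ h₀ h₁ h₀
    sa = bil₀ A₁ A₀ A₁ A₀
    sb = bil₀ A₁ A₀ h₁ h₀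
    sc = bil₀ h₁ h₀ h₁ h₀

    cross₀ : rb · sc ⊖ rc · sb ≡ C · n₀
    cross₀ = solve 3 (λ T P Q → let
        bil = λ a b c d → T :* (a :* d :+ b :* c) :- P :* a :* c
        lib = λ a b c d → T :* b :* d :- Q :* a :* c
        A₁ = X.A₁ T P Q
        A₀ = X.A₀ T P Q
        h₁ = X.h₁ T P Q
        h₀ = X.h₀ T P Q in
        bil A₁ A₀ h₁ h₀ :* lib h₁ h₀ h₁ h₀ :- bil h₁ h₀ h₁ h₀ :* lib A₁ A₀ h₁ h₀ := T :* T :* T :* T :* T :* X.D₀ T P Q :* X.n₀ T P Q) refl T P Q

    cross₁ : rc · sa ⊖ ra · sc ≡ C · n₁
    cross₁ = solve 3 (λ T P Q → let
        bil = λ a b c d → T :* (a :* d :+ b :* c) :- P :* a :* c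
        lib = λ a b c d → T :* b :* d :- Q :* a :* c
        A₁ = X.A₁ T P Q
        A₀ = X.A₀ T P Q
        h₁ = X.h₁ T P Q
        h₀ = X.h₀ T P Q in
        bil h₁ h₀ h₁ h₀ :* lib A₁ A₀ A₁ A₀ :- bil A₁ A₀ A₁ A₀ :* lib h₁ h₀ h₁ h₀ := T :* T :* T :* T :* T :* X.D₀ T P Q :* X.n₁ T P Q) refl T P Q

    cross₂ : ra · sb ⊖ rb · sa ≡ C · n₂
    cross₂ = solve 3 (λ T P Q → let
        bil = λ a b c d → T :* (a :* d :+ b :* c) :- P :* a :* c
        lib = λ a b c d → T :* b :* d :- Q :* a :* c
        A₁ = X.A₁ T P Q
        A₀ = X.A₀ T P Q
        h₁ = X.h₁ T P Q
        h₀ = X.h₀ T P Q in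
        bil A₁ A₀ A₁ A₀ :* lib A₁ A₀ h₁ h₀ :- bil A₁ A₀ h₁ h₀ :* lib A₁ A₀ A₁ A₀ := T :* T :* T :* T :* T :* X.D₀ T P Q :* X.n₂ T P Q) refl T P Q

  -- The two rows have cross product C(n₀, n₁, n₂), and (W₀, W₁, W₂) is orthogonal to both. Hence
  -- the two vectors are proportional once the factor C, nonzero with `D₀`, is cancelled.
  module Proportional (D₀≢0 : D₀ ≢ 0ᴱ) where
    private
      T≢0 : T ≢ 0ᴱ
      T≢0 = V⇒≢0 vT

      C≢0 : C ≢ 0ᴱ
      C≢0 = ·-nonzero (·-nonzero (·-nonzero (·-nonzero (·-nonzero T≢0 T≢0) T≢0) T≢0) T≢0) D₀≢0

      cancel : ∀ {x y} → C · (x ⊖ y) ≡ 0ᴱ → x ≡ y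
      cancel {x} {y} h = [ (λ c → ⊥-elim (C≢0 c)) , ⊖≡0 x y ]′ (·-integral C (x ⊖ y) h)

    W₀₁ : W₀ · n₁ ≡ W₁ · n₀
    W₀₁ = sym (cancel (trans (scale C W₁ W₀ n₀ n₁) (trans (cong₂ (λ x y → W₁ · x ⊖ W₀ · y) (sym cross₀) (sym cross₁)) (minor W₁ W₂ W₀ rb rc ra sb sc sa (rotate row₁) (rotate row₀)))))

    W₁₂ : W₁ · n₂ ≡ W₂ · n₁
    W₁₂ = sym (cancel (trans (scale C W₂ W₁ n₁ n₂) (trans (cong₂ (λ x y → W₂ · x ⊖ W₁ · y) (sym cross₁) (sym cross₂)) (minor W₂ W₀ W₁ rc ra rb sc sa sb (rotate (rotate row₁)) (rotate (rotate row₀))))))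

    W₀₂ : W₀ · n₂ ≡ W₂ · n₀
    W₀₂ = cancel (trans (scale C W₀ W₂ n₂ n₀) (trans (cong₂ (λ x y → W₀ · x ⊖ W₂ · y) (sym cross₂) (sym cross₀)) (minor W₀ W₁ W₂ ra rb rc sa sb sc row₁ row₀)))

  -- Both sides are the product of the σ-conjugates of a at the fixed point ω̄, where A/h = z and h²
  -- = 1.
  a₀³≡ : n₀ · z · z ⊹ n₁ · z ⊹ n₂ ≡ a₀ ³
  a₀³≡ = solve 3 (λ T P Q → let
      z = κ 1ᴱ :+ κ 3ᴱ :* κ ω̄
      a = T :* κ ω :+ P :* κ ω̄ :+ Q in
      X.n₀ T P Q :* z :* z :+ X.n₁ T P Q :* z :+ X.n₂ T P Q := a :* a :* a) refl T P Q

  -- The coefficient of T³ in the same product. The constants are 2z z̄ = 14 and -(z + z̄) = 1.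
  mid≡ : n₁ ⊖ ι (+ 14) · n₀ ⊖ 2ᴱ · n₂ ≡ a₁ ³ ⊖ 3ᴱ · a₀ · a₀ ᶜ · a₁
  mid≡ = trans (solve 3 (λ T P Q → let
      a = T :* κ ω :+ P :* κ ω̄ :+ Q
      b = T :* κ ω̄ :+ P :* κ ω :+ Q
      c = P :- κ 2ᴱ :* T :- κ 2ᴱ :* Q in
      X.n₁ T P Q :- κ (ι (+ 14)) :* X.n₀ T P Q :- κ 2ᴱ :* X.n₂ T P Q := c :* c :* c :- κ 3ᴱ :* a :* b :* c) refl T P Q)
    (cong (λ b → a₁ ³ ⊖ 3ᴱ · a₀ · b · a₁) (sym a₀ᶜ))

  Real : 𝔼 → Set
  Real x = x ᶜ ≡ x

  private
    real-⊹ : ∀ {x y} → Real x → Real y → Real (x ⊹ y)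
    real-⊹ {x} {y} a b = trans (conj-⊹ x y) (cong₂ _⊹_ a b)

    real-· : ∀ {x y} → Real x → Real y → Real (x · y)
    real-· {x} {y} a b = trans (conj-· x y) (cong₂ _·_ a b)

    real-⊝ : ∀ {x} → Real x → Real (⊝ x)
    real-⊝ {x} a = trans (conj-⊝ x) (cong ⊝_ a)

    real-ι : ∀ n → Real (ι n)
    real-ι = conj-ι

    real-⊖ : ∀ {x y} → Real x → Real y → Real (x ⊖ y)
    real-⊖ a b = real-⊹ a (real-⊝ b)

    rPQ = real-· rP rQ
    rTQ = real-· rT rQ
    rTP = real-· rT rP
    rTT = real-· rT rT
    r2 = real-ι (+ 2)

    rA₁ : Real A₁
    rA₁ = real-⊖ (real-⊖ (real-⊖ (real-· rP rP) rTQ) rTP) (real-· (real-· r2 rT) rT)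
    rA₀ : Real A₀
    rA₀ = real-⊖ (real-⊖ rPQ rTQ) rTT
    rh₁ : Real h₁
    rh₁ = real-· rT (real-⊖ rT rP)
    rh₀ : Real h₀
    rh₀ = real-⊝ rTQ
    rD₀ : Real D₀
    rD₀ = real-⊹ (real-⊖ (real-⊖ (real-⊹ rTT (real-· rQ rQ)) rTP) rPQ) (real-· (real-· (real-ι (+ 3)) rT) rQ)
    rκ₀ : Real κ₀
    rκ₀ = real-⊖ (real-· rU rh₀) (real-· rY rh₁)
    rμ₀ : Real μ₀
    rμ₀ = real-⊖ (real-· rA₁ rY) (real-· rA₀ rU)
    rE : Real E
    rE = real-· rW (real-· rTT rD₀)
    ra₁ : Real a₁
    ra₁ = real-⊖ (real-⊖ rP (real-· r2 rT)) (real-· r2 rQ)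
    rW₀ : Real W₀
    rW₀ = real-⊖ (real-· rκ₀ rκ₀) (real-· rE rE)
    rW₁ : Real W₁
    rW₁ = real-· (real-· r2 rκ₀) rμ₀
    rW₂ : Real W₂
    rW₂ = real-⊖ (real-· rμ₀ rμ₀) (real-· (real-· (real-ι (+ 8)) rE) rE)
    rn₀ : Real n₀
    rn₀ = real-· rTQ (real-⊹ (real-⊖ rT rP) rQ)
    rn₁ : Real n₁
    rn₁ = real-⊹ (real-⊹ (real-⊖ (real-⊖ (real-⊖ (real-· rPQ rQ) (real-· rPQ rT)) (real-· (real-· rP rT) rT)) (real-· (real-· rP rP) rQ)) (real-· (real-· rP rP) rT)) (real-· (real-· (real-· r2 rQ) rT) rT)
    rn₂ : Real n₂
    rn₂ = real-⊹ (real-⊹ (real-⊖ (real-⊖ (real-⊖ (real-⊖ (real-⊖ (real-⊹ (real-⊹ (real-· (real-· rP rP) rP) (real-· (real-· rQ rQ) rQ)) (real-· rTT rT)) (real-· rPQ rT)) (real-· rPQ rQ)) (real-· (real-· (real-· r2 rP) rT) rT)) (real-· (real-· (real-· r2 rP) rP) rQ)) (real-· (real-· rP rP) rT)) (real-· (real-· (real-· (real-ι (+ 6)) rQ) rT) rT)) (real-· (real-· (real-· (real-ι (+ 5)) rQ) rQ) rT)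

  s : 𝔼
  s = μ₀ ⊹ κ₀ · z

  private
    sᶜ : s ᶜ ≡ μ₀ ⊹ κ₀ · (1ᴱ ⊹ 3ᴱ · ω)
    sᶜ = trans (conj-⊹ μ₀ (κ₀ · z)) (cong₂ _⊹_ rμ₀ (trans (conj-· κ₀ z) (cong (_· (1ᴱ ⊹ 3ᴱ · ω)) rκ₀)))

  -- Each n = nᵢ ≠ 0 yields a datum with Λ = -3 nᵢ Wᵢ.
  contradiction-from : ∀ {n W′ k y ν x} → Real n → Real W′ → W₀ · n ≡ W′ · n₀ → W₁ · n ≡ W′ · n₁ → W₂ · n ≡ W′ · n₂ →
    V y s → V (2 ℕ.+ k ℕ.+ (1 ℕ.+ y)) (3ᴱ · E) → V ν (a₀ · a₀ ᶜ) → V (2 ℕ.+ ν) (3ᴱ · D₀) → V x n → ⊥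
  contradiction-from {n} {W′} {k} {y} {ν} {x} rn rW′ e₀ e₁ e₂ vs vE vν vν′ vn =
    by (real (3ᴱ · E · n) (real-· (real-· (real-ι (+ 3)) rE) rn)) (real (⊝ (3ᴱ · (n · W′))) (real-⊝ (real-· (real-ι (+ 3)) (real-· rn rW′)))) (real a₁ ra₁)
    where
    β = ϖ · s · n
    e = 3ᴱ · E · n
    Λ = ⊝ (3ᴱ · (n · W′))
    outer′ : β · β ⊖ ω · ω · e · e ≡ Λ · a₀ ³
    outer′ = trans (solve 4 (λ k m E n → let
          z = κ 1ᴱ :+ κ 3ᴱ :* κ ω̄
          b = κ ϖ :* (m :+ k :* z) :* n
          e = κ 3ᴱ :* E :* n in
          b :* b :- κ ω :* κ ω :* e :* e := :- (κ 3ᴱ :* n) :* ((k :* k :- E :* E) :* n :* z :* z :+ κ 2ᴱ :* k :* m :* n :* z :+ (m :* m :- κ (ι (+ 8)) :* E :* E) :* n)) refl κ₀ μ₀ E n)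
      (trans (cong₂ (λ a b → ⊝ (3ᴱ · n) · (a · z · z ⊹ b · z ⊹ W₂ · n)) e₀ e₁) (trans (cong (λ a → ⊝ (3ᴱ · n) · (W′ · n₀ · z · z ⊹ W′ · n₁ · z ⊹ a)) e₂)
        (trans (solve 6 (λ n w a b c z → :- (κ 3ᴱ :* n) :* (w :* a :* z :* z :+ w :* b :* z :+ w :* c) := :- (κ 3ᴱ :* (n :* w)) :* (a :* z :* z :+ b :* z :+ c)) refl n W′ n₀ n₁ n₂ z)
          (cong (Λ ·_) a₀³≡))))
    βᶜ : β ᶜ ≡ ⊝ ϖ · (μ₀ ⊹ κ₀ · (1ᴱ ⊹ 3ᴱ · ω)) · n
    βᶜ = trans (conj-· (ϖ · s) n) (cong₂ _·_ (trans (conj-· ϖ s) (cong (⊝ ϖ ·_) sᶜ)) rn)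
    middle′ : 2ᴱ · β · β ᶜ ⊖ ι (+ 10) · e · e ≡ Λ · (a₁ ³ ⊖ 3ᴱ · a₀ · a₀ ᶜ · a₁)
    middle′ = trans (cong (λ t → 2ᴱ · β · t ⊖ ι (+ 10) · e · e) βᶜ) (trans (solve 4 (λ k m E n → let
          z = κ 1ᴱ :+ κ 3ᴱ :* κ ω̄
          z̄ = κ 1ᴱ :+ κ 3ᴱ :* κ ω
          b = κ ϖ :* (m :+ k :* z) :* n
          b̄ = :- κ ϖ :* (m :+ k :* z̄) :* n
          e = κ 3ᴱ :* E :* n in
          κ 2ᴱ :* b :* b̄ :- κ (ι (+ 10)) :* e :* e := :- (κ 3ᴱ :* n) :* (κ 2ᴱ :* k :* m :* n :- κ (ι (+ 14)) :* ((k :* k :- E :* E) :* n) :- κ 2ᴱ :* ((m :* m :- κ (ι (+ 8)) :* E :* E) :* n))) refl κ₀ μ₀ E n)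
      (trans (cong₂ (λ a b → ⊝ (3ᴱ · n) · (b ⊖ ι (+ 14) · a ⊖ 2ᴱ · (W₂ · n))) e₀ e₁) (trans (cong (λ a → ⊝ (3ᴱ · n) · (W′ · n₁ ⊖ ι (+ 14) · (W′ · n₀) ⊖ 2ᴱ · a)) e₂)
        (trans (solve 5 (λ n w a b c → :- (κ 3ᴱ :* n) :* (w :* b :- κ (ι (+ 14)) :* (w :* a) :- κ 2ᴱ :* (w :* c)) := :- (κ 3ᴱ :* (n :* w)) :* (b :- κ (ι (+ 14)) :* a :- κ 2ᴱ :* c)) refl n W′ n₀ n₁ n₂)
          (cong (Λ ·_) mid≡)))))
    by : ∃[ e′ ] e ≡ ι e′ → ∃[ Λ′ ] Λ ≡ ι Λ′ → ∃[ a′ ] a₁ ≡ ι a′ → ⊥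
    by (e′ , e≡) (Λ′ , Λ≡) (a′ , a≡) = no-datum k {β} {e′} {Λ′} {a₀} {a′} (datum
        (subst₂ (λ e Λ → β · β ⊖ ω · ω · e · e ≡ Λ · a₀ ³) e≡ Λ≡ outer′)
        (subst₂ (λ e Λ → 2ᴱ · β · β ᶜ ⊖ ι (+ 10) · e · e ≡ Λ · (ι a′ ³ ⊖ 3ᴱ · a₀ · a₀ ᶜ · ι a′)) e≡ Λ≡ (subst (λ a → 2ᴱ · β · β ᶜ ⊖ ι (+ 10) · e · e ≡ Λ · (a ³ ⊖ 3ᴱ · a₀ · a₀ ᶜ · a)) a≡ middle′)))
      (V-· (V-· V-p vs) vn)
      (V₃-cong e≡ (V₃-cast (ℕS.solve 3 (λ k y x → (ℕS.con 2 ℕS.:+ k ℕS.:+ (ℕS.con 1 ℕS.:+ y)) ℕS.:+ x ℕS.:= ℕS.con 2 ℕS.:+ k ℕS.:+ ((ℕS.con 1 ℕS.:+ y) ℕS.:+ x)) refl k y x) (V-· vE vn)))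
      vν (V₃-cong (trans 3D₀≡ (cong (λ a → a · a ⊖ a₀ · a₀ ᶜ) a≡)) vν′)

  -- Some nᵢ is nonzero, since otherwise a₀³ = 0, contrary to the known order of a₀ā₀.
  contradiction-by : ∀ {k y ν δ} → V y s → V (2 ℕ.+ k ℕ.+ (1 ℕ.+ y)) (3ᴱ · E) → V ν (a₀ · a₀ ᶜ) → V (2 ℕ.+ ν) (3ᴱ · D₀) → V δ D₀ → ⊥
  contradiction-by {k} vs vE vν vν′ vD₀ = by (n₀ ≟ᴱ 0ᴱ) (n₁ ≟ᴱ 0ᴱ) (n₂ ≟ᴱ 0ᴱ)
    where
    open Proportional (V⇒≢0 vD₀)
    from : ∀ {n W′} → Real n → Real W′ → W₀ · n ≡ W′ · n₀ → W₁ · n ≡ W′ · n₁ → W₂ · n ≡ W′ · n₂ → n ≢ 0ᴱ → ⊥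
    from {n} {W′} rn rW′ e₀ e₁ e₂ n≢0 = contradiction-from {n} {W′} {k} rn rW′ e₀ e₁ e₂ vs vE vν vν′ (proj₂ (V-exists n≢0))
    by : Dec (n₀ ≡ 0ᴱ) → Dec (n₁ ≡ 0ᴱ) → Dec (n₂ ≡ 0ᴱ) → ⊥
    by (no h) _ _ = from rn₀ rW₀ refl (sym W₀₁) (sym W₀₂) h
    by _ (no h) _ = from rn₁ rW₁ W₀₁ refl (sym W₁₂) h
    by _ _ (no h) = from rn₂ rW₂ W₀₂ W₁₂ refl h
    by (yes h₀) (yes h₁) (yes h₂) = [ [ bad , bad ]′ ∘ ·-integral a₀ a₀ , bad ]′ (·-integral (a₀ · a₀) a₀ (trans (sym a₀³≡)
        (trans (cong₂ (λ a b → a · z · z ⊹ b · z ⊹ n₂) h₀ h₁) (trans (cong (λ c → 0ᴱ · z · z ⊹ 0ᴱ · z ⊹ c) h₂) refl))))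
      where
      bad : a₀ ≡ 0ᴱ → ⊥
      bad h = V⇒≢0 vν (trans (cong (_· a₀ ᶜ) h) (solve 1 (λ t → κ 0ᴱ :* t := κ 0ᴱ) refl (a₀ ᶜ)))

  private
    vE-of : ∀ {j d} → V j W → V d D₀ → V (2 ℕ.+ (j ℕ.+ d)) (3ᴱ · E)
    vE-of {j} {d} vj vd = V-· V₃-3 (V-· vj (V-· (V-· vT vT) vd))

  -- the double root of t x² + p x + q modulo 3 is not 1
  generic : V 0 (P ⊖ T) → ⊥
  generic vPT = by (V-exists W≢0)
    where
    o1 : O 1 disc
    o1 = O₃-cast 3 refl o-disc
    vN : V 0 Nₐ
    vN = V-cancel {0} {0} (V₃-cong (solve 3 (λ T P Q → let
          d = P :* P :- κ (ι (+ 4)) :* T :* Q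
          x = P :- T in
          x :* x :* (x :* x) :+ (κ 3ᴱ :* (κ (ι (+ 5)) :* T :* T :* T :* T :+ κ 2ᴱ :* T :* T :* P :* P :- κ (ι (+ 4)) :* T :* T :* T :* P)
            :+ d :* (d :- κ 2ᴱ :* P :* P :+ κ (ι (+ 4)) :* T :* P :+ κ (ι (+ 4)) :* T :* T))
          := κ (ι (+ 4)) :* T :* (κ (ι (+ 4)) :* T) :* X.Nₐ T P Q) refl T P Q)
        (V-⊹ (V-· (V-· vPT vPT) (V-· vPT vPT)) (O-⊹ (O₃-cast 1 refl (O₃-3 _)) (O-·ʳ _ o1)))) (V-· v4T v4T)
    vD : V 0 D₀
    vD = V₃-cong (sym D₀≡) (V-⊹ vN (O-⊝ o1))
    vs : V 0 s
    vs = V-cancel {0} {0} (V₃-cong (solve 5 (λ T P Q U Y → let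
          A₁ = X.A₁ T P Q
          A₀ = X.A₀ T P Q
          h₁ = X.h₁ T P Q
          h₀ = X.h₀ T P Q
          k = U :* h₀ :- Y :* h₁
          m = A₁ :* Y :- A₀ :* U
          d = P :* P :- κ (ι (+ 4)) :* T :* Q
          x = P :- T in
          :- (x :* x :* x :* U) :+ (κ 3ᴱ :* ((T :* P :* P :- κ (ι (+ 4)) :* T :* T :* T) :* Y :- (P :* P :* T :- P :* T :* T :- T :* T :* T) :* U :+ κ (ι (+ 4)) :* T :* κ ω̄ :* k) :+ d :* (T :* Y :+ P :* U))
          := κ (ι (+ 4)) :* T :* (m :+ k :* (κ 1ᴱ :+ κ 3ᴱ :* κ ω̄))) refl T P Q U Y)
        (V-⊹ (V-⊝ (V-· (V-· (V-· vPT vPT) vPT) vU)) (O-⊹ (O₃-cast 1 refl (O₃-3 _)) (O-·ʳ _ o1)))) v4T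
    by : ∃[ j ] V j W → ⊥
    by (j , vj) = by′ j vj (V-O-≤ vj oW)
      where
      by′ : ∀ j → V j W → 2 ℕ.≤ j → ⊥
      by′ (suc j) vj _ = contradiction-by {j} {0} {0} vs (V₃-cast (ℕS.solve 1 (λ j → ℕS.con 2 ℕS.:+ ((ℕS.con 1 ℕS.:+ j) ℕS.:+ ℕS.con 0) ℕS.:= ℕS.con 2 ℕS.:+ j ℕS.:+ (ℕS.con 1 ℕS.:+ ℕS.con 0)) refl j) (vE-of vj vD))
        (V₃-cong norm≡ vN) (V-· V₃-3 vD) vD

  -- Here both roots are 1 modulo 3, the triple zero of F modulo 3. Then P = T + 3p′ and Q = T +
  -- 3q′, so that `R₁` and `R₀` are divisible by 3; this raises the order of the discriminant to at
  -- least 6, and `Nₐ` and `D₀` have order exactly 4. The order of s is not determined but is at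
  -- most 3, because s - s̄ has order exactly 3, and this bound suffices.
  special : O 1 (P ⊖ T) → ⊥
  special o₁ = go (O₃-real (real-⊖ rP rT) o₁)
    where
    go : O 2 (P ⊖ T) → ⊥
    go (o (p₀ , P-T)) = go′ oQT
      where
      p′ = ⊝ p₀
      P≡ : P ≡ T ⊹ 3ᴱ · p′
      P≡ = trans (solve 2 (λ T P → P := T :+ (P :- T)) refl T P) (trans (cong (T ⊹_) P-T) (solve 2 (λ T p → T :+ κ ϖ :* (κ ϖ :* κ 1ᴱ) :* p := T :+ κ 3ᴱ :* (:- p)) refl T p₀))
      oPT : O 2 (P ⊖ T)
      oPT = o (p₀ , P-T)
      oQT : O 2 (Q ⊖ T)
      oQT = O₃-cancel v4T (subst (O 2) (solve 3 (λ T P Q → (P :- κ 2ᴱ :* T) :* (κ 3ᴱ :* T :+ (P :- T)) :- (P :* P :- κ (ι (+ 4)) :* T :* Q) := κ (ι (+ 4)) :* T :* (Q :- T)) refl T P Q)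
        (O-⊖ (O-·ˡ (P ⊖ 2ᴱ · T) (O-⊹ (O₃-3 T) oPT)) (O₃-cast 2 refl o-disc)))
      go′ : O 2 (Q ⊖ T) → ⊥
      go′ (o (q₀ , Q-T)) = by (V-exists W≢0) (V-exists s≢0)
        where
        q′ = ⊝ q₀
        Q≡ : Q ≡ T ⊹ 3ᴱ · q′
        Q≡ = trans (solve 2 (λ T P → P := T :+ (P :- T)) refl T Q) (trans (cong (T ⊹_) Q-T) (solve 2 (λ T p → T :+ κ ϖ :* (κ ϖ :* κ 1ᴱ) :* p := T :+ κ 3ᴱ :* (:- p)) refl T q₀))
        z₁ = T ⊖ 2ᴱ · p′ ⊹ ι (+ 4) · q′
        oz₁ : O 2 z₁
        oz₁ = O₃-cancel vT (subst (O 2) (solve 3 (λ T p q → let z = T :- κ 2ᴱ :* p :+ κ (ι (+ 4)) :* q in κ 3ᴱ :* (p :* p) :- (κ 3ᴱ :* p :* p :- T :* z) := T :* z) refl T p′ q′)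
          (O-⊖ (O₃-3 (p′ · p′)) (O₃-cancel {2} {2} V₃-3 (subst (O 4) (trans (cong₂ (λ P Q → P · P ⊖ ι (+ 4) · T · Q) P≡ Q≡)
            (solve 3 (λ T p q → let
                P = T :+ κ 3ᴱ :* p
                Q = T :+ κ 3ᴱ :* q in P :* P :- κ (ι (+ 4)) :* T :* Q := κ 3ᴱ :* (κ 3ᴱ :* p :* p :- T :* (T :- κ 2ᴱ :* p :+ κ (ι (+ 4)) :* q))) refl T p′ q′)) o-disc))))
        M′ = p′ · p′ ⊖ p′ · q′ ⊹ q′ · q′
        vM′ : V 0 M′
        vM′ = V-cancel {0} {0} {ι (+ 4)} (V₃-cong (solve 3 (λ T p q → T :* T :- ((T :- κ 2ᴱ :* p :+ κ (ι (+ 4)) :* q) :* (T :+ κ 2ᴱ :* p :- κ (ι (+ 4)) :* q) :+ κ 3ᴱ :* (κ (ι (+ 4)) :* (q :* q :- p :* q)))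
              := κ (ι (+ 4)) :* (p :* p :- p :* q :+ q :* q)) refl T p′ q′)
            (V-⊹ (V-· vT vT) (O-⊝ (O-⊹ (O-·ʳ _ (O₃-cast 1 refl oz₁)) (O₃-cast 1 refl (O₃-3 _)))))) (V-· {x = 2ᴱ} {y = 2ᴱ} V₃-2 V₃-2)
        vN : V 4 Nₐ
        vN = V₃-cong (trans (solve 3 (λ T p q → κ 3ᴱ :* κ 3ᴱ :* (p :* p :- p :* q :+ q :* q) := X.Nₐ T (T :+ κ 3ᴱ :* p) (T :+ κ 3ᴱ :* q)) refl T p′ q′) (cong₂ (λ P Q → 𝔼Remainder.Nₐ T P Q) (sym P≡) (sym Q≡)))
          (V-· (V-· {x = 3ᴱ} {y = 3ᴱ} V₃-3 V₃-3) vM′)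
        oR₁ : O 2 R₁
        oR₁ = subst (O 2) (trans (solve 3 (λ t p q → κ 3ᴱ :* (κ (ι (+ 12)) :* p :* q :* t :* t :* t :+ κ (ι (- + 27)) :* p :* q :* q :* t :* t :+ κ (ι (+ 5)) :* p :* t :* t :* t :* t :+ κ (ι (+ 54)) :* p :* p :* q :* t :* t :+ κ (ι (+ 9)) :* p :* p :* t :* t :* t :+ κ (ι (+ 108)) :* p :* p :* p :* q :* t :+ κ (ι (- + 27)) :* p :* p :* p :* t :* t :+ κ (ι (- + 81)) :* p :* p :* p :* p :* t :+ κ (ι (- + 81)) :* p :* p :* p :* p :* p :+ κ (ι (- + 4)) :* q :* t :* t :* t :* t :+ κ (ι (- + 3)) :* q :* q :* t :* t :* t :+ κ (ι (- + 1)) :* t :* t :* t :* t :* t) := X.R₁ t (t :+ κ 3ᴱ :* p) (t :+ κ 3ᴱ :* q)) refl T p′ q′) (cong₂ (λ P Q → 𝔼Remainder.R₁ T P Q) (sym P≡) (sym Q≡))) (O₃-3 _)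
        oR₀ : O 2 R₀
        oR₀ = subst (O 2) (trans (solve 3 (λ t p q → κ 3ᴱ :* (κ (ι (+ 18)) :* p :* q :* t :* t :* t :+ κ (ι (+ 18)) :* p :* q :* q :* t :* t :+ κ (ι (+ 4)) :* p :* t :* t :* t :* t :+ κ (ι (+ 9)) :* p :* p :* q :* t :* t :+ κ (ι (+ 81)) :* p :* p :* q :* q :* t :+ κ (ι (- + 6)) :* p :* p :* t :* t :* t :+ κ (ι (- + 54)) :* p :* p :* p :* q :* t :+ κ (ι (- + 18)) :* p :* p :* p :* t :* t :+ κ (ι (- + 81)) :* p :* p :* p :* p :* q :+ κ (ι (- + 27)) :* p :* p :* p :* p :* t :+ κ (ι (+ 1)) :* q :* t :* t :* t :* t :+ κ (ι (+ 3)) :* q :* q :* t :* t :* t :+ κ (ι (- + 9)) :* q :* q :* q :* t :* t) := X.R₀ t (t :+ κ 3ᴱ :* p) (t :+ κ 3ᴱ :* q)) refl T p′ q′) (cong₂ (λ P Q → 𝔼Remainder.R₀ T P Q) (sym P≡) (sym Q≡))) (O₃-3 _)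
        o-disc′ : O 6 disc
        o-disc′ = O₃-cancel vU⁴ (subst (O 6) (sym disc-U) (O-· oWW (O-⊹ (O-·ˡ _ (O-⊖ (O-·ˡ U oR₀) (O-·ˡ Y oR₁))) (O-·ˡ (W · W) (O-·ˡ R₁ oR₁)))))
        vD : V 4 D₀
        vD = V₃-cong (sym D₀≡) (V-⊹ vN (O-⊝ (O₃-cast 1 refl o-disc′)))
        vQ : V 0 Q
        vQ = V₃-cong (sym Q≡) (V-⊹ vT (O₃-cast 1 refl (O₃-3 q′)))
        vκ : V 0 κ₀
        vκ = V₃-cong (solve 5 (λ T P Q U Y → :- (T :* Q :* U) :+ T :* Y :* (P :- T) := U :* X.h₀ T P Q :- Y :* X.h₁ T P Q) refl T P Q U Y)
          (V-⊹ (V-⊝ (V-· (V-· vT vQ) vU)) (O-·ˡ (T · Y) o₁))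
        vsᶜ : V 3 (s ⊖ s ᶜ)
        vsᶜ = V₃-cong (sym (trans (cong (s ⊖_) sᶜ) (solve 2 (λ m k → m :+ k :* (κ 1ᴱ :+ κ 3ᴱ :* κ ω̄) :- (m :+ k :* (κ 1ᴱ :+ κ 3ᴱ :* κ ω)) := κ 3ᴱ :* (κ ϖ :* (:- k))) refl μ₀ κ₀)))
          (V-· V₃-3 (V-· {x = ϖ} V-p (V-⊝ vκ)))
        s≢0 : s ≢ 0ᴱ
        s≢0 h = V⇒≢0 vsᶜ (trans (cong (λ t → t ⊖ t ᶜ) h) refl)
        by : ∃[ j ] V j W → ∃[ y ] V y s → ⊥
        by (j , vj) (y , vy) = contradiction-by {j ℕ.+ 3 ℕ.∸ y} {y} {4} vy (V₃-cast index (vE-of vj vD)) (V₃-cong norm≡ vN) (V-· V₃-3 vD) vD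
          where
          y≤3 : y ℕ.≤ 3
          y≤3 = ℕ.≮⇒≥ λ 3<y → ℕ.1+n≰n (V-O-≤ vsᶜ (O-⊖ (O-≤ 3<y (V⇒O vy)) (O₃-conj (O-≤ 3<y (V⇒O vy)))))
          index : 2 ℕ.+ (j ℕ.+ 4) ≡ 2 ℕ.+ (j ℕ.+ 3 ℕ.∸ y) ℕ.+ (1 ℕ.+ y)
          index = cong (2 ℕ.+_) (trans (ℕ.+-suc j 3) (trans (cong suc (sym (ℕ.m∸n+n≡m {j ℕ.+ 3} {y} (ℕ.≤-trans y≤3 (ℕ.m≤n+m 3 j))))) (sym (ℕ.+-suc (j ℕ.+ 3 ℕ.∸ y) y))))

  absurd : ⊥
  absurd = [ generic , special ]′ (V-or-O (O-zero (P ⊖ T)))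

-- Integrality at 3 of Mumford representations.

-- Binary forms, with coefficients in ℤ or in the expressions of the solver
module Forms {A : Set} (_+′_ _*′_ : A → A → A) (-′_ : A → A) (κ′ : ℤ → A) where
  private
    infixl 6 _+″_
    infixl 7 _*″_
    _+″_ = _+′_
    _*″_ = _*′_

  linear : A → A → A → A → A
  linear l₁ l₀ X Z = l₁ *″ X +″ l₀ *″ Z

  quadratic : A → A → A → A → A → A
  quadratic a₂ a₁ a₀ X Z = a₂ *″ (X *″ X) +″ a₁ *″ (X *″ Z) +″ a₀ *″ (Z *″ Z)

  cubic : A → A → A → A → A → A → A
  cubic c₃ c₂ c₁ c₀ X Z = X *″ quadratic c₃ c₂ c₁ X Z +″ c₀ *″ (Z *″ Z *″ Z)

  quartic : A → A → A → A → A → A → A → A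
  quartic g₄ g₃ g₂ g₁ g₀ X Z = X *″ cubic g₄ g₃ g₂ g₁ X Z +″ g₀ *″ (Z *″ Z *″ Z *″ Z)

  𝐴 𝐻 𝐹 : A → A → A
  𝐴 = cubic (κ′ (+ 1)) (κ′ (+ 1)) (κ′ (- + 2)) (κ′ (- + 1))
  𝐻 X Z = X *″ Z *″ (X +″ Z)
  𝐹 X Z = 𝐴 X Z *″ 𝐴 X Z +″ κ′ (+ 8) *″ (𝐻 X Z *″ 𝐻 X Z)

module 𝔽 = Forms _+_ _*_ (-_) (λ c → c)
module 𝔽S {n : ℕ} = Forms {ℤS.Expr n} ℤS._:+_ ℤS._:*_ (ℤS.:-_) ℤS.κ

infix 4 _∣′_
_∣′_ : ℤ → ℤ → Set
n ∣′ x = ∃[ k ] x ≡ n * k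

open ℤS using (solve; _:=_; _:+_; _:-_; _:*_; :-_; κ)

module _ {n : ℤ} where
  ∣′-+ : ∀ {x y} → n ∣′ x → n ∣′ y → n ∣′ x + y
  ∣′-+ (k , refl) (l , refl) = k + l , sym (ℤ.*-distribˡ-+ n k l)

  ∣′-neg : ∀ {x} → n ∣′ x → n ∣′ - x
  ∣′-neg (k , refl) = - k , solve 2 (λ n k → :- (n :* k) := n :* (:- k)) refl n k

  ∣′-- : ∀ {x y} → n ∣′ x → n ∣′ y → n ∣′ x - y
  ∣′-- a b = ∣′-+ a (∣′-neg b)

  ∣′-*ˡ : ∀ x {y} → n ∣′ y → n ∣′ x * y
  ∣′-*ˡ x (k , refl) = x * k , solve 3 (λ n k x → x :* (n :* k) := n :* (x :* k)) refl n k x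

  ∣′-*ʳ : ∀ {x} y → n ∣′ x → n ∣′ x * y
  ∣′-*ʳ y (k , refl) = k * y , ℤ.*-assoc n k y

3∣ℤ-prime : ∀ x y → 3∣ℤ (x * y) → 3∣ℤ x ⊎ 3∣ℤ y
3∣ℤ-prime x y h = by (3∣ℤ? x) (3∣ℤ? y)
  where
  by : 3∣ℤ x ⊎ ¬ 3∣ℤ x → 3∣ℤ y ⊎ ¬ 3∣ℤ y → 3∣ℤ x ⊎ 3∣ℤ y
  by (inj₁ a) _ = inj₁ a
  by _ (inj₁ b) = inj₂ b
  by (inj₂ a) (inj₂ b) = ⊥-elim (ℕ.1+n≰n (ℕ.≤-trans (ℕ.s≤s ℕ.z≤n) (V₃.V-O-≤ (subst (V₃.V 0) (sym (ι-* x y)) (V₃.V-· (V₃-ι a) (V₃-ι b))) (O₃-ι h))))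

3∤ℤ-* : ∀ {x y} → ¬ 3∣ℤ x → ¬ 3∣ℤ y → ¬ 3∣ℤ (x * y)
3∤ℤ-* {x} {y} a b h = [ a , b ]′ (3∣ℤ-prime x y h)

3∤ℤ-cong : ∀ {x y} → ¬ 3∣ℤ x → 3∣ℤ (y - x) → ¬ 3∣ℤ y
3∤ℤ-cong {x} {y} a b h = a (subst 3∣ℤ (solve 2 (λ x y → y :- (y :- x) := x) refl x y) (∣′-- {+ 3} h b))

3^ : ℕ → ℤ
3^ j = (+ 3) ℤ.^ j

3*-injective : ∀ {x y} → + 3 * x ≡ + 3 * y → x ≡ y
3*-injective {x} {y} = ℤ.*-cancelˡ-≡ (+ 3) x y

3^-cancel : ∀ j {x y} → ¬ 3∣ℤ x → 3^ j ∣′ x * y → 3^ j ∣′ y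
3^-cancel zero {x} {y} a h = y , sym (ℤ.*-identityˡ y)
3^-cancel (suc j) {x} {y} a (k , e) = by (3∣ℤ-prime x y (3^ j * k , trans e (ℤ.*-assoc (+ 3) (3^ j) k)))
  where
  by : 3∣ℤ x ⊎ 3∣ℤ y → 3^ (suc j) ∣′ y
  by (inj₁ b) = ⊥-elim (a b)
  by (inj₂ (y′ , refl)) = go (3^-cancel j a (k , 3*-injective (trans (solve 2 (λ x y → κ (+ 3) :* (x :* y) := x :* (κ (+ 3) :* y)) refl x y′) (trans e (ℤ.*-assoc (+ 3) (3^ j) k)))))
    where
    go : 3^ j ∣′ y′ → 3^ (suc j) ∣′ + 3 * y′
    go (l , refl) = l , sym (ℤ.*-assoc (+ 3) (3^ j) l)

ℤ-integral : ∀ x {y} → x * y ≡ 0ℤ → x ≢ 0ℤ → y ≡ 0ℤ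
ℤ-integral x h x≢0 = [ (λ e → ⊥-elim (x≢0 e)) , (λ e → e) ]′ (ℤ.i*j≡0⇒i≡0∨j≡0 x h)

module _ where
  private
    module R = Remainder

    eqs : ∀ {n} → (t p q u v w : ℤS.Expr n) → (ℤS.Expr n × ℤS.Expr n) × (ℤS.Expr n × ℤS.Expr n)
    eqs t p q u v w = (κ (+ 2) :* t :* u :* v :- p :* u :* u , w :* w :* R₁) , (t :* v :* v :- q :* u :* u , w :* w :* R₀)
      where
      A₁ = p :* p :- t :* q :- t :* p :- κ (+ 2) :* t :* t
      A₀ = p :* q :- t :* q :- t :* t
      h₁ = t :* (t :- p)
      h₀ = :- (t :* q)
      R₁ = κ (+ 2) :* t :* A₁ :* A₀ :- p :* A₁ :* A₁ :+ κ (+ 8) :* (κ (+ 2) :* t :* h₁ :* h₀ :- p :* h₁ :* h₁)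
      R₀ = t :* A₀ :* A₀ :- q :* A₁ :* A₁ :+ κ (+ 8) :* (t :* h₀ :* h₀ :- q :* h₁ :* h₁)

  -- t² w y = u x + v is a point of y² = 𝐹(x, 1) over a root x of t x² + p x + q.
  record Point (t p q u v w : ℤ) : Set where
    constructor point
    field
      lead : + 2 * t * u * v - p * u * u ≡ w * w * R.R₁ t p q
      last : t * v * v - q * u * u ≡ w * w * R.R₀ t p q

  private
    ι-eqs : ∀ {t p q u v w} → Point t p q u v w →
      (2ᴱ · ι t · ι u · ι v ⊖ ι p · ι u · ι u ≡ ι w · ι w · 𝔼Remainder.R₁ (ι t) (ι p) (ι q)) ×
      (ι t · ι v · ι v ⊖ ι q · ι u · ι u ≡ ι w · ι w · 𝔼Remainder.R₀ (ι t) (ι p) (ι q))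
    ι-eqs {t} {p} {q} {u} {v} {w} (point e₁ e₀) = transport (proj₁ E) e₁ , transport (proj₂ E) e₀
      where
      x : Fin 6 → ℤS.Expr 6
      x = ℤS.var
      E = eqs (x zero) (x (suc zero)) (x (suc (suc zero))) (x (suc (suc (suc zero)))) (x (suc (suc (suc (suc zero))))) (x (suc (suc (suc (suc (suc zero))))))
      ρ = t ∷ p ∷ q ∷ u ∷ v ∷ w ∷ []
      transport : ∀ (e : ℤS.Expr 6 × ℤS.Expr 6) → ℤS.⟦ proj₁ e ⟧ ρ ≡ ℤS.⟦ proj₂ e ⟧ ρ → 𝔼S.⟦ ι-expr (proj₁ e) ⟧ (map ι ρ) ≡ 𝔼S.⟦ ι-expr (proj₂ e) ⟧ (map ι ρ)
      transport (l , r) h = trans (sym (ι-eval l ρ)) (trans (cong ι h) (ι-eval r ρ))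

  -- `NonIntegral` excludes that u is prime to 3. With 3 dividing u and w, the second equation of
  -- the point gives 3 ∣ tv².
  point-integral₁ : ∀ {t p q u v w} → ¬ 3∣ℤ t → w ≢ 0ℤ → Point t p q u v w → 3∣ℤ w → 3∣ℤ u × 3∣ℤ v
  point-integral₁ {t} {p} {q} {u} {v} {w} nt w≢0 P (w′ , refl) = by (3∣ℤ? u)
    where
    by : 3∣ℤ u ⊎ ¬ 3∣ℤ u → 3∣ℤ u × 3∣ℤ v
    by (inj₂ nu) = ⊥-elim (absurd (ι-eqs P))
      where
      absurd = λ H → NonIntegral.absurd (ι t) (ι p) (ι q) (ι u) (ι v) (ι w) (conj-ι t) (conj-ι p) (conj-ι q) (conj-ι u) (conj-ι v) (conj-ι w)
        (V₃-ι nt) (O₃-ι (w′ , refl)) (λ h → w≢0 (ι-injective h)) (V₃-ι nu) (proj₁ H) (proj₂ H)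
    by (inj₁ (u′ , refl)) = (u′ , refl) , [ (λ a → a) , (λ a → a) ]′ (3∣ℤ-prime v v ([ (λ a → ⊥-elim (nt a)) , (λ a → a) ]′ (3∣ℤ-prime t (v * v) d)))
      where
      d : 3∣ℤ (t * (v * v))
      d = _ , trans (solve 4 (λ t v q u → t :* (v :* v) := (t :* v :* v :- q :* (κ (+ 3) :* u) :* (κ (+ 3) :* u)) :+ q :* (κ (+ 3) :* u) :* (κ (+ 3) :* u)) refl t v q u′)
        (trans (cong (_+ q * (+ 3 * u′) * (+ 3 * u′)) (Point.last P)) (solve 4 (λ q u w r → κ (+ 3) :* w :* (κ (+ 3) :* w) :* r :+ q :* (κ (+ 3) :* u) :* (κ (+ 3) :* u) := κ (+ 3) :* (κ (+ 3) :* w :* w :* r :+ q :* u :* (κ (+ 3) :* u))) refl q u′ w′ (R.R₀ t p q)))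

  point-integral : ∀ j {t p q u v w} → ¬ 3∣ℤ t → w ≢ 0ℤ → Point t p q u v w → 3^ j ∣′ w → 3^ j ∣′ u × 3^ j ∣′ v
  point-integral zero {u = u} {v} nt w≢0 P d = (u , sym (ℤ.*-identityˡ u)) , (v , sym (ℤ.*-identityˡ v))
  point-integral (suc j) {t} {p} {q} {u} {v} {w} nt w≢0 P (k , refl) = go (point-integral₁ nt w≢0 P (3^ j * k , ℤ.*-assoc (+ 3) (3^ j) k)) P
    where
    w′ = 3^ j * k
    go : 3∣ℤ u × 3∣ℤ v → Point t p q u v w → 3^ (suc j) ∣′ u × 3^ (suc j) ∣′ v
    go ((u′ , refl) , (v′ , refl)) (point e₁ e₀) = up (point-integral j nt w′≢0 (point e₁′ e₀′) (k , refl))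
      where
      w′≢0 : w′ ≢ 0ℤ
      w′≢0 h = w≢0 (trans (ℤ.*-assoc (+ 3) (3^ j) k) (cong (+ 3 *_) h))
      up : 3^ j ∣′ u′ × 3^ j ∣′ v′ → 3^ (suc j) ∣′ + 3 * u′ × 3^ (suc j) ∣′ + 3 * v′
      up ((a , refl) , (b , refl)) = (a , sym (ℤ.*-assoc (+ 3) (3^ j) a)) , (b , sym (ℤ.*-assoc (+ 3) (3^ j) b))
      nine : ∀ {x y} → + 3 * (+ 3 * x) ≡ + 3 * (+ 3 * y) → x ≡ y
      nine h = 3*-injective (3*-injective h)
      e₁′ : + 2 * t * u′ * v′ - p * u′ * u′ ≡ w′ * w′ * R.R₁ t p q
      e₁′ = nine (trans (solve 4 (λ t p u v → κ (+ 3) :* (κ (+ 3) :* (κ (+ 2) :* t :* u :* v :- p :* u :* u)) := κ (+ 2) :* t :* (κ (+ 3) :* u) :* (κ (+ 3) :* v) :- p :* (κ (+ 3) :* u) :* (κ (+ 3) :* u)) refl t p u′ v′)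
        (trans e₁ (solve 3 (λ a k r → κ (+ 3) :* a :* k :* (κ (+ 3) :* a :* k) :* r := κ (+ 3) :* (κ (+ 3) :* (a :* k :* (a :* k) :* r))) refl (3^ j) k (R.R₁ t p q))))
      e₀′ : t * v′ * v′ - q * u′ * u′ ≡ w′ * w′ * R.R₀ t p q
      e₀′ = nine (trans (solve 4 (λ t q u v → κ (+ 3) :* (κ (+ 3) :* (t :* v :* v :- q :* u :* u)) := t :* (κ (+ 3) :* v) :* (κ (+ 3) :* v) :- q :* (κ (+ 3) :* u) :* (κ (+ 3) :* u)) refl t q u′ v′)
        (trans e₀ (solve 3 (λ a k r → κ (+ 3) :* a :* k :* (κ (+ 3) :* a :* k) :* r := κ (+ 3) :* (κ (+ 3) :* (a :* k :* (a :* k) :* r))) refl (3^ j) k (R.R₀ t p q))))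

horner : ∀ {n} → Vec ℤ n → ℤ → ℤ
horner [] x = 0ℤ
horner (a ∷ as) x = a + x * horner as x

-- At x = ∣a∣ + 1 a vanishing polynomial gives a = -xe, so a = 0 by size. Then x can be divided out,
-- which is why only nonzero arguments are required.
vanishing : ∀ {n} (as : Vec ℤ n) → (∀ x → x ≢ 0ℤ → horner as x ≡ 0ℤ) → ∀ i → lookup as i ≡ 0ℤ
vanishing (a ∷ as) h = λ { zero → a≡0 ; (suc i) → vanishing as tail i }
  where
  a≡0 : a ≡ 0ℤ
  a≡0 = by (a ℤ.≟ 0ℤ)
    where
    x = + suc ∣ a ∣
    e = horner as x
    ∣a∣ : ∣ a ∣ ≡ suc ∣ a ∣ ℕ.* ∣ e ∣
    ∣a∣ = trans (cong ∣_∣ (trans (solve 2 (λ a b → a := (a :+ b) :- b) refl a (x * e)) (trans (cong (_- x * e) (h x (λ ()))) (ℤ.+-identityˡ (- (x * e))))))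
      (trans (ℤ.∣-i∣≡∣i∣ (x * e)) (ℤ.abs-* x e))
    by : Dec (a ≡ 0ℤ) → a ≡ 0ℤ
    by (yes z) = z
    by (no ne) = ⊥-elim (ℕ.1+n≰n (ℕ.≤-trans (ℕ.m≤m*n (suc ∣ a ∣) ∣ e ∣ {{ℕ.≢-nonZero ne′}}) (ℕ.≤-reflexive (sym ∣a∣))))
      where
      ne′ : ∣ e ∣ ≢ 0
      ne′ z = ne (ℤ.∣i∣≡0⇒i≡0 (trans ∣a∣ (trans (cong (suc ∣ a ∣ ℕ.*_) z) (ℕ.*-zeroʳ ∣ a ∣))))
  tail : ∀ x → x ≢ 0ℤ → horner as x ≡ 0ℤ
  tail x ne = ℤ-integral x (trans (sym (ℤ.+-identityˡ _)) (trans (cong (_+ x * horner as x) (sym a≡0)) (h x ne))) ne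

dot : ∀ {n} → Vec ℤ n → Vec ℤ n → ℤ
dot [] [] = 0ℤ
dot (r ∷ rs) (a ∷ as) = r * a + dot rs as

dot-zero : ∀ {n} (rs as : Vec ℤ n) → (∀ i → lookup as i ≡ 0ℤ) → dot rs as ≡ 0ℤ
dot-zero [] [] h = refl
dot-zero (r ∷ rs) (a ∷ as) h = trans (cong₂ (λ s t → r * s + t) (h zero) (dot-zero rs as (λ i → h (suc i)))) (trans (ℤ.+-identityʳ _) (ℤ.*-zeroʳ r))

module Coefficients {A : Set} (_+′_ _*′_ : A → A → A) (-′_ : A → A) (κ′ : ℤ → A) where
  private
    infixl 6 _+″_ _-″_
    infixl 7 _*″_
    _+″_ = _+′_
    _*″_ = _*′_
    _-″_ : A → A → A
    a -″ b = a +′ (-′ b)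

  hornerᴬ : ∀ {n} → Vec A n → A → A
  hornerᴬ [] x = κ′ 0ℤ
  hornerᴬ (a ∷ as) x = a +″ x *″ hornerᴬ as x

  dotᴬ : ∀ {n} → Vec A n → Vec A n → A
  dotᴬ [] [] = κ′ 0ℤ
  dotᴬ (r ∷ rs) (a ∷ as) = r *″ a +″ dotᴬ rs as

  -- The coefficients, constant term first, of c² - w²F - (tx² + px + q)g for a cubic c and a
  -- quartic g.
  residual : (c₃ c₂ c₁ c₀ w t p q g₄ g₃ g₂ g₁ g₀ : A) → Vec A 7
  residual c₃ c₂ c₁ c₀ w t p q g₄ g₃ g₂ g₁ g₀ =
    c₀ *″ c₀ -″ w *″ w -″ q *″ g₀ ∷
    κ′ (+ 2) *″ c₁ *″ c₀ -″ w *″ w *″ κ′ (+ 4) -″ (q *″ g₁ +″ p *″ g₀) ∷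
    κ′ (+ 2) *″ c₂ *″ c₀ +″ c₁ *″ c₁ -″ w *″ w *″ κ′ (+ 10) -″ (q *″ g₂ +″ p *″ g₁ +″ t *″ g₀) ∷
    κ′ (+ 2) *″ c₃ *″ c₀ +″ κ′ (+ 2) *″ c₂ *″ c₁ -″ w *″ w *″ κ′ (+ 10) -″ (q *″ g₃ +″ p *″ g₂ +″ t *″ g₁) ∷
    κ′ (+ 2) *″ c₃ *″ c₁ +″ c₂ *″ c₂ -″ w *″ w *″ κ′ (+ 5) -″ (q *″ g₄ +″ p *″ g₃ +″ t *″ g₂) ∷
    κ′ (+ 2) *″ c₃ *″ c₂ -″ w *″ w *″ κ′ (+ 2) -″ (p *″ g₄ +″ t *″ g₃) ∷
    c₃ *″ c₃ -″ w *″ w -″ t *″ g₄ ∷ []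

  -- t⁵ xⁱ ≡ ρᵢ x + σᵢ modulo t x² + p x + q
  ρ σ : (t p q : A) → Vec A 7
  ρ t p q =
    κ′ 0ℤ ∷
    t *″ t *″ t *″ t *″ t ∷
    -′ (p *″ t *″ t *″ t *″ t) ∷
    p *″ p *″ t *″ t *″ t -″ q *″ t *″ t *″ t *″ t ∷
    κ′ (+ 2) *″ p *″ q *″ t *″ t *″ t -″ p *″ p *″ p *″ t *″ t ∷
    (p *″ p *″ p *″ p *″ t +″ q *″ q *″ t *″ t *″ t) -″ κ′ (+ 3) *″ p *″ p *″ q *″ t *″ t ∷
    κ′ (+ 4) *″ p *″ p *″ p *″ q *″ t -″ κ′ (+ 3) *″ p *″ q *″ q *″ t *″ t -″ p *″ p *″ p *″ p *″ p ∷ []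
  σ t p q =
    t *″ t *″ t *″ t *″ t ∷
    κ′ 0ℤ ∷
    -′ (q *″ t *″ t *″ t *″ t) ∷
    p *″ q *″ t *″ t *″ t ∷
    q *″ q *″ t *″ t *″ t -″ p *″ p *″ q *″ t *″ t ∷
    p *″ p *″ p *″ q *″ t -″ κ′ (+ 2) *″ p *″ q *″ q *″ t *″ t ∷
    κ′ (+ 3) *″ p *″ p *″ q *″ q *″ t -″ p *″ p *″ p *″ p *″ q -″ q *″ q *″ q *″ t *″ t ∷ []

  -- t² (c₃x³ + c₂x² + c₁x + c₀) ≡ U x + V modulo t x² + p x + q
  U V : (c₃ c₂ c₁ c₀ t p q : A) → A
  U c₃ c₂ c₁ c₀ t p q = c₃ *″ (p *″ p -″ t *″ q) -″ c₂ *″ t *″ p +″ c₁ *″ t *″ t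
  V c₃ c₂ c₁ c₀ t p q = c₃ *″ p *″ q -″ c₂ *″ t *″ q +″ c₀ *″ t *″ t

  R₁ R₀ : (t p q : A) → A
  R₁ t p q = κ′ (+ 2) *″ t *″ A₁ *″ A₀ -″ p *″ A₁ *″ A₁ +″ κ′ (+ 8) *″ (κ′ (+ 2) *″ t *″ h₁ *″ h₀ -″ p *″ h₁ *″ h₁)
    where
    A₁ = p *″ p -″ t *″ q -″ t *″ p -″ κ′ (+ 2) *″ t *″ t
    A₀ = p *″ q -″ t *″ q -″ t *″ t
    h₁ = t *″ (t -″ p)
    h₀ = -′ (t *″ q)
  R₀ t p q = t *″ A₀ *″ A₀ -″ q *″ A₁ *″ A₁ +″ κ′ (+ 8) *″ (t *″ h₀ *″ h₀ -″ q *″ h₁ *″ h₁)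
    where
    A₁ = p *″ p -″ t *″ q -″ t *″ p -″ κ′ (+ 2) *″ t *″ t
    A₀ = p *″ q -″ t *″ q -″ t *″ t
    h₁ = t *″ (t -″ p)
    h₀ = -′ (t *″ q)

module Co = Coefficients _+_ _*_ (-_) (λ c → c)
module CoS {n : ℕ} = Coefficients {ℤS.Expr n} ℤS._:+_ ℤS._:*_ (ℤS.:-_) ℤS.κ

horner-residual : ∀ c₃ c₂ c₁ c₀ w t p q g₄ g₃ g₂ g₁ g₀ x →
  horner (Co.residual c₃ c₂ c₁ c₀ w t p q g₄ g₃ g₂ g₁ g₀) x ≡
  𝔽.cubic c₃ c₂ c₁ c₀ x 1ℤ * 𝔽.cubic c₃ c₂ c₁ c₀ x 1ℤ - (w * w * 𝔽.𝐹 x 1ℤ + 𝔽.quadratic t p q x 1ℤ * 𝔽.quartic g₄ g₃ g₂ g₁ g₀ x 1ℤ)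
horner-residual = solve 14 (λ c₃ c₂ c₁ c₀ w t p q g₄ g₃ g₂ g₁ g₀ x →
  CoS.hornerᴬ (CoS.residual c₃ c₂ c₁ c₀ w t p q g₄ g₃ g₂ g₁ g₀) x :=
  𝔽S.cubic c₃ c₂ c₁ c₀ x (κ 1ℤ) :* 𝔽S.cubic c₃ c₂ c₁ c₀ x (κ 1ℤ) :- (w :* w :* 𝔽S.𝐹 x (κ 1ℤ) :+ 𝔽S.quadratic t p q x (κ 1ℤ) :* 𝔽S.quartic g₄ g₃ g₂ g₁ g₀ x (κ 1ℤ))) refl

-- Reducing powers of x modulo the quadratic by `ρ` and `σ` turns c² = w²F + ag into the equations
-- of a `Point` for the remainder Ux + V of t²c, with the residual as error term.
ρ-residual : ∀ c₃ c₂ c₁ c₀ w t p q g₄ g₃ g₂ g₁ g₀ →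
  let u = Co.U c₃ c₂ c₁ c₀ t p q
      v = Co.V c₃ c₂ c₁ c₀ t p q in
  + 2 * t * u * v - p * u * u ≡ w * w * Co.R₁ t p q + dot (Co.ρ t p q) (Co.residual c₃ c₂ c₁ c₀ w t p q g₄ g₃ g₂ g₁ g₀)
ρ-residual = solve 13 (λ c₃ c₂ c₁ c₀ w t p q g₄ g₃ g₂ g₁ g₀ → let
    u = CoS.U c₃ c₂ c₁ c₀ t p q
    v = CoS.V c₃ c₂ c₁ c₀ t p q in
  κ (+ 2) :* t :* u :* v :- p :* u :* u := w :* w :* CoS.R₁ t p q :+ CoS.dotᴬ (CoS.ρ t p q) (CoS.residual c₃ c₂ c₁ c₀ w t p q g₄ g₃ g₂ g₁ g₀)) refl

σ-residual : ∀ c₃ c₂ c₁ c₀ w t p q g₄ g₃ g₂ g₁ g₀ →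
  let u = Co.U c₃ c₂ c₁ c₀ t p q
      v = Co.V c₃ c₂ c₁ c₀ t p q in
  t * v * v - q * u * u ≡ w * w * Co.R₀ t p q + dot (Co.σ t p q) (Co.residual c₃ c₂ c₁ c₀ w t p q g₄ g₃ g₂ g₁ g₀)
σ-residual = solve 13 (λ c₃ c₂ c₁ c₀ w t p q g₄ g₃ g₂ g₁ g₀ → let
    u = CoS.U c₃ c₂ c₁ c₀ t p q
    v = CoS.V c₃ c₂ c₁ c₀ t p q in
  t :* v :* v :- q :* u :* u := w :* w :* CoS.R₀ t p q :+ CoS.dotᴬ (CoS.σ t p q) (CoS.residual c₃ c₂ c₁ c₀ w t p q g₄ g₃ g₂ g₁ g₀)) refl

-- Modulo n the cubic form c is, up to the factor τ, a multiple of the quadratic form (t, p, q).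
record Divides (n t p q c₃ c₂ c₁ c₀ : ℤ) : Set where
  constructor divides-by
  field
    τ Q₁ Q₀ e₃ e₂ e₁ e₀ : ℤ
    3∤τ : ¬ 3∣ℤ τ
    decomposition : ∀ X Z → τ * 𝔽.cubic c₃ c₂ c₁ c₀ X Z ≡ n * 𝔽.cubic e₃ e₂ e₁ e₀ X Z + 𝔽.quadratic t p q X Z * 𝔽.linear Q₁ Q₀ X Z

record Curve (c₃ c₂ c₁ c₀ w t p q g₄ g₃ g₂ g₁ g₀ : ℤ) : Set where
  constructor curve
  field
    on : ∀ X Z → 𝔽.cubic c₃ c₂ c₁ c₀ X Z * 𝔽.cubic c₃ c₂ c₁ c₀ X Z ≡
      w * w * 𝔽.𝐹 X Z + 𝔽.quadratic t p q X Z * 𝔽.quartic g₄ g₃ g₂ g₁ g₀ X Z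

-- The remainder Ux + V of t²c modulo the quadratic is a `Point` with denominator w, so
-- `point-integral` makes U and V divisible by 3ʲ.
curve-divides : ∀ j {c₃ c₂ c₁ c₀ w t p q g₄ g₃ g₂ g₁ g₀} → ¬ 3∣ℤ t → w ≢ 0ℤ → 3^ j ∣′ w →
  Curve c₃ c₂ c₁ c₀ w t p q g₄ g₃ g₂ g₁ g₀ → Divides (3^ j) t p q c₃ c₂ c₁ c₀
curve-divides j {c₃} {c₂} {c₁} {c₀} {w} {t} {p} {q} {g₄} {g₃} {g₂} {g₁} {g₀} nt w≢0 d (curve H) = go (point-integral j nt w≢0 P d)
  where
  res = Co.residual c₃ c₂ c₁ c₀ w t p q g₄ g₃ g₂ g₁ g₀
  zeros : ∀ i → lookup res i ≡ 0ℤ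
  zeros = vanishing res (λ x _ → trans (horner-residual c₃ c₂ c₁ c₀ w t p q g₄ g₃ g₂ g₁ g₀ x)
    (trans (cong (_- (w * w * 𝔽.𝐹 x 1ℤ + 𝔽.quadratic t p q x 1ℤ * 𝔽.quartic g₄ g₃ g₂ g₁ g₀ x 1ℤ)) (H x 1ℤ)) (ℤ.+-inverseʳ (w * w * 𝔽.𝐹 x 1ℤ + 𝔽.quadratic t p q x 1ℤ * 𝔽.quartic g₄ g₃ g₂ g₁ g₀ x 1ℤ))))
  P : Point t p q (Co.U c₃ c₂ c₁ c₀ t p q) (Co.V c₃ c₂ c₁ c₀ t p q) w
  P = point (trans (ρ-residual c₃ c₂ c₁ c₀ w t p q g₄ g₃ g₂ g₁ g₀) (trans (cong (λ d → w * w * Co.R₁ t p q + d) (dot-zero (Co.ρ t p q) res zeros)) (ℤ.+-identityʳ _)))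
    (trans (σ-residual c₃ c₂ c₁ c₀ w t p q g₄ g₃ g₂ g₁ g₀) (trans (cong (λ d → w * w * Co.R₀ t p q + d) (dot-zero (Co.σ t p q) res zeros)) (ℤ.+-identityʳ _)))
  go : 3^ j ∣′ Co.U c₃ c₂ c₁ c₀ t p q × 3^ j ∣′ Co.V c₃ c₂ c₁ c₀ t p q → Divides (3^ j) t p q c₃ c₂ c₁ c₀
  go ((e₁ , U≡) , (e₀ , V≡)) = divides-by (t * t) (t * c₃) (t * c₂ - c₃ * p) 0ℤ 0ℤ e₁ e₀ (3∤ℤ-* nt nt) (λ X Z →
    trans (solve 9 (λ c₃ c₂ c₁ c₀ t p q X Z → t :* t :* 𝔽S.cubic c₃ c₂ c₁ c₀ X Z :=
        (CoS.U c₃ c₂ c₁ c₀ t p q :* (X :* (Z :* Z)) :+ CoS.V c₃ c₂ c₁ c₀ t p q :* (Z :* Z :* Z)) :+ 𝔽S.quadratic t p q X Z :* 𝔽S.linear (t :* c₃) (t :* c₂ :- c₃ :* p) X Z) refl c₃ c₂ c₁ c₀ t p q X Z)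
      (cong (_+ 𝔽.quadratic t p q X Z * 𝔽.linear (t * c₃) (t * c₂ - c₃ * p) X Z)
        (trans (cong₂ (λ u v → u * (X * (Z * Z)) + v * (Z * Z * Z)) U≡ V≡)
          (solve 5 (λ n e₁ e₀ X Z → n :* e₁ :* (X :* (Z :* Z)) :+ n :* e₀ :* (Z :* Z :* Z) := n :* 𝔽S.cubic (κ 0ℤ) (κ 0ℤ) e₁ e₀ X Z) refl (3^ j) e₁ e₀ X Z))))

-- The substitution (X, Z) ↦ (-Z, X + Z), under which 𝐹 is invariant, exchanges the roles of the outer coefficients.
curve-divides′ : ∀ j {c₃ c₂ c₁ c₀ w t p q g₄ g₃ g₂ g₁ g₀} → ¬ 3∣ℤ q → w ≢ 0ℤ → 3^ j ∣′ w →
  Curve c₃ c₂ c₁ c₀ w t p q g₄ g₃ g₂ g₁ g₀ → Divides (3^ j) t p q c₃ c₂ c₁ c₀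
curve-divides′ j {c₃} {c₂} {c₁} {c₀} {w} {t} {p} {q} {g₄} {g₃} {g₂} {g₁} {g₀} nq w≢0 d (curve H) = back (curve-divides j nq w≢0 d H′)
  where
  c₃′ = c₀
  c₂′ = + 3 * c₀ - c₁
  c₁′ = + 3 * c₀ - + 2 * c₁ + c₂
  c₀′ = c₀ - c₁ + c₂ - c₃
  H′ : Curve c₃′ c₂′ c₁′ c₀′ w q (+ 2 * q - p) (t - p + q)
    g₀ (+ 4 * g₀ - g₁) (+ 6 * g₀ - + 3 * g₁ + g₂) (+ 4 * g₀ - + 3 * g₁ + + 2 * g₂ - g₃) (g₀ - g₁ + g₂ - g₃ + g₄)
  H′ = curve λ X Z → trans (cong (λ c → c * c) (cub X Z)) (trans (H (- Z) (X + Z)) (cong₂ _+_ (cong (w * w *_) (sext X Z)) (cong₂ _*_ (quad X Z) (quart X Z))))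
    where
    cub : ∀ X Z → 𝔽.cubic c₃′ c₂′ c₁′ c₀′ X Z ≡ 𝔽.cubic c₃ c₂ c₁ c₀ (- Z) (X + Z)
    cub = solve 6 (λ c₃ c₂ c₁ c₀ X Z → 𝔽S.cubic c₀ (κ (+ 3) :* c₀ :- c₁) (κ (+ 3) :* c₀ :- κ (+ 2) :* c₁ :+ c₂) (c₀ :- c₁ :+ c₂ :- c₃) X Z := 𝔽S.cubic c₃ c₂ c₁ c₀ (:- Z) (X :+ Z)) refl c₃ c₂ c₁ c₀
    sext : ∀ X Z → 𝔽.𝐹 (- Z) (X + Z) ≡ 𝔽.𝐹 X Z
    sext = solve 2 (λ X Z → 𝔽S.𝐹 (:- Z) (X :+ Z) := 𝔽S.𝐹 X Z) refl
    quad : ∀ X Z → 𝔽.quadratic t p q (- Z) (X + Z) ≡ 𝔽.quadratic q (+ 2 * q - p) (t - p + q) X Z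
    quad = solve 5 (λ t p q X Z → 𝔽S.quadratic t p q (:- Z) (X :+ Z) := 𝔽S.quadratic q (κ (+ 2) :* q :- p) (t :- p :+ q) X Z) refl t p q
    quart : ∀ X Z → 𝔽.quartic g₄ g₃ g₂ g₁ g₀ (- Z) (X + Z) ≡
      𝔽.quartic g₀ (+ 4 * g₀ - g₁) (+ 6 * g₀ - + 3 * g₁ + g₂) (+ 4 * g₀ - + 3 * g₁ + + 2 * g₂ - g₃) (g₀ - g₁ + g₂ - g₃ + g₄) X Z
    quart = solve 7 (λ g₄ g₃ g₂ g₁ g₀ X Z → 𝔽S.quartic g₄ g₃ g₂ g₁ g₀ (:- Z) (X :+ Z) :=
      𝔽S.quartic g₀ (κ (+ 4) :* g₀ :- g₁) (κ (+ 6) :* g₀ :- κ (+ 3) :* g₁ :+ g₂) (κ (+ 4) :* g₀ :- κ (+ 3) :* g₁ :+ κ (+ 2) :* g₂ :- g₃) (g₀ :- g₁ :+ g₂ :- g₃ :+ g₄) X Z) refl g₄ g₃ g₂ g₁ g₀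
  back : Divides (3^ j) q (+ 2 * q - p) (t - p + q) c₃′ c₂′ c₁′ c₀′ → Divides (3^ j) t p q c₃ c₂ c₁ c₀
  back (divides-by τ Q₁ Q₀ e₃ e₂ e₁ e₀ nτ D) = divides-by τ (Q₁ - Q₀) Q₁ (e₃ - e₂ + e₁ - e₀) (+ 3 * e₃ - + 2 * e₂ + e₁) (+ 3 * e₃ - e₂) e₃ nτ λ X Z →
    trans (cong (τ *_) (solve 6 (λ c₃ c₂ c₁ c₀ X Z → 𝔽S.cubic c₃ c₂ c₁ c₀ X Z := 𝔽S.cubic c₀ (κ (+ 3) :* c₀ :- c₁) (κ (+ 3) :* c₀ :- κ (+ 2) :* c₁ :+ c₂) (c₀ :- c₁ :+ c₂ :- c₃) (X :+ Z) (:- X)) refl c₃ c₂ c₁ c₀ X Z))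
      (trans (D (X + Z) (- X)) (cong₂ _+_
        (cong (3^ j *_) (solve 6 (λ e₃ e₂ e₁ e₀ X Z → 𝔽S.cubic e₃ e₂ e₁ e₀ (X :+ Z) (:- X) := 𝔽S.cubic (e₃ :- e₂ :+ e₁ :- e₀) (κ (+ 3) :* e₃ :- κ (+ 2) :* e₂ :+ e₁) (κ (+ 3) :* e₃ :- e₂) e₃ X Z) refl e₃ e₂ e₁ e₀ X Z))
        (cong₂ _*_ (solve 5 (λ t p q X Z → 𝔽S.quadratic q (κ (+ 2) :* q :- p) (t :- p :+ q) (X :+ Z) (:- X) := 𝔽S.quadratic t p q X Z) refl t p q X Z)
          (solve 4 (λ Q₁ Q₀ X Z → 𝔽S.linear Q₁ Q₀ (X :+ Z) (:- X) := 𝔽S.linear (Q₁ :- Q₀) Q₁ X Z) refl Q₁ Q₀ X Z))))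

3-part : ∀ x → x ≢ 0ℤ → ∃[ j ] ∃[ y ] x ≡ 3^ j * y × ¬ 3∣ℤ y
3-part x = ℕ.<-rec (λ n → ∀ x → ∣ x ∣ ≡ n → x ≢ 0ℤ → ∃[ j ] ∃[ y ] x ≡ 3^ j * y × ¬ 3∣ℤ y) step ∣ x ∣ x refl
  where
  step : ∀ n → (∀ {m} → m ℕ.< n → ∀ x → ∣ x ∣ ≡ m → x ≢ 0ℤ → ∃[ j ] ∃[ y ] x ≡ 3^ j * y × ¬ 3∣ℤ y) → ∀ x → ∣ x ∣ ≡ n → x ≢ 0ℤ → ∃[ j ] ∃[ y ] x ≡ 3^ j * y × ¬ 3∣ℤ y
  step n rec x e x≢0 = by (3∣ℤ? x)
    where
    by : 3∣ℤ x ⊎ ¬ 3∣ℤ x → ∃[ j ] ∃[ y ] x ≡ 3^ j * y × ¬ 3∣ℤ y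
    by (inj₂ h) = 0 , x , sym (ℤ.*-identityˡ x) , h
    by (inj₁ (y , x≡)) = up (rec smaller y refl y≢0)
      where
      y≢0 : y ≢ 0ℤ
      y≢0 h = x≢0 (trans x≡ (cong (+ 3 *_) h))
      smaller : ∣ y ∣ ℕ.< n
      smaller = subst (∣ y ∣ ℕ.<_) (trans (ℕ.*-comm ∣ y ∣ 3) (trans (sym (ℤ.abs-* (+ 3) y)) (trans (cong ∣_∣ (sym x≡)) e)))
        (ℕ.m<m*n ∣ y ∣ 3 {{ℕ.≢-nonZero (λ z → y≢0 (ℤ.∣i∣≡0⇒i≡0 z))}} (ℕ.s≤s (ℕ.s≤s ℕ.z≤n)))
      up : ∃[ j ] ∃[ z ] y ≡ 3^ j * z × ¬ 3∣ℤ z → ∃[ j ] ∃[ z ] x ≡ 3^ j * z × ¬ 3∣ℤ z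
      up (j , z , y≡ , h) = suc j , z , trans x≡ (trans (cong (+ 3 *_) y≡) (sym (ℤ.*-assoc (+ 3) (3^ j) z))) , h

3^-nonzero : ∀ j → 3^ j ≢ 0ℤ
3^-nonzero zero ()
3^-nonzero (suc j) h = 3^-nonzero j (ℤ-integral (+ 3) h λ ())

3^-cancel′ : ∀ j {x y} → 3^ j * x ≡ 3^ j * y → x ≡ y
3^-cancel′ j {x} {y} h = trans (solve 2 (λ x y → x := (x :- y) :+ y) refl x y) (trans (cong (_+ y) (ℤ-integral (3^ j)
  (trans (solve 3 (λ n x y → n :* (x :- y) := n :* x :- n :* y) refl (3^ j) x y) (trans (cong (_- 3^ j * y) h) (ℤ.+-inverseʳ (3^ j * y)))) (3^-nonzero j))) (ℤ.+-identityˡ y))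

difference-zero : ∀ {x y} → x ≡ y → x - y ≡ 0ℤ
difference-zero {x} refl = ℤ.+-inverseʳ x

zero-difference : ∀ {x y} → x - y ≡ 0ℤ → x ≡ y
zero-difference {x} {y} h = trans (solve 2 (λ x y → x := (x :- y) :+ y) refl x y) (trans (cong (_+ y) h) (ℤ.+-identityˡ y))

-- Gauss's lemma at 3: starting from the outer coefficient prime to 3, each zᵢ is divisible by 3ʲ
-- given the preceding ones.
gauss : ∀ j {a₂ a₁ a₀ z₂ z₁ z₀ e₄ e₃ e₂ e₁ e₀} → ¬ 3∣ℤ a₂ ⊎ ¬ 3∣ℤ a₀ →
  (∀ X → 𝔽.quadratic a₂ a₁ a₀ X 1ℤ * 𝔽.quadratic z₂ z₁ z₀ X 1ℤ ≡ 3^ j * 𝔽.quartic e₄ e₃ e₂ e₁ e₀ X 1ℤ) →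
  3^ j ∣′ z₂ × 3^ j ∣′ z₁ × 3^ j ∣′ z₀
gauss j {a₂} {a₁} {a₀} {z₂} {z₁} {z₀} {e₄} {e₃} {e₂} {e₁} {e₀} unit H = [ down , up ]′ unit
  where
  n = 3^ j
  cs : Vec ℤ 5
  cs = (a₀ * z₀ - n * e₀) ∷ (a₀ * z₁ + a₁ * z₀ - n * e₁) ∷ (a₀ * z₂ + a₁ * z₁ + a₂ * z₀ - n * e₂) ∷ (a₁ * z₂ + a₂ * z₁ - n * e₃) ∷ (a₂ * z₂ - n * e₄) ∷ []
  zeros : ∀ i → lookup cs i ≡ 0ℤ
  zeros = vanishing cs (λ X _ → trans
    (solve 13 (λ a₂ a₁ a₀ z₂ z₁ z₀ e₄ e₃ e₂ e₁ e₀ n X →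
      (a₀ :* z₀ :- n :* e₀) :+ X :* ((a₀ :* z₁ :+ a₁ :* z₀ :- n :* e₁) :+ X :* ((a₀ :* z₂ :+ a₁ :* z₁ :+ a₂ :* z₀ :- n :* e₂) :+ X :* ((a₁ :* z₂ :+ a₂ :* z₁ :- n :* e₃) :+ X :* ((a₂ :* z₂ :- n :* e₄) :+ X :* κ 0ℤ))))
      := 𝔽S.quadratic a₂ a₁ a₀ X (κ 1ℤ) :* 𝔽S.quadratic z₂ z₁ z₀ X (κ 1ℤ) :- n :* 𝔽S.quartic e₄ e₃ e₂ e₁ e₀ X (κ 1ℤ)) refl a₂ a₁ a₀ z₂ z₁ z₀ e₄ e₃ e₂ e₁ e₀ n X)
    (difference-zero (H X)))
  multiple : ∀ {x e} y → x + y - n * e ≡ 0ℤ → n ∣′ y → n ∣′ x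
  multiple {x} {e} y h (k , refl) = e - k , trans (solve 4 (λ x n e k → x := (x :+ n :* k :- n :* e) :+ n :* (e :- k)) refl x n e k) (trans (cong (_+ n * (e - k)) h) (ℤ.+-identityˡ _))
  multiple₀ : ∀ {x e} → x - n * e ≡ 0ℤ → n ∣′ x
  multiple₀ {x} {e} h = e , zero-difference h
  up : ¬ 3∣ℤ a₀ → n ∣′ z₂ × n ∣′ z₁ × n ∣′ z₀
  up u = d₂ , d₁ , d₀
    where
    d₀ = 3^-cancel j u (multiple₀ {a₀ * z₀} (zeros zero))
    d₁ = 3^-cancel j u (multiple {a₀ * z₁} (a₁ * z₀) (zeros (suc zero)) (∣′-*ˡ {n} a₁ d₀))
    d₂ = 3^-cancel j u (multiple {a₀ * z₂} (a₁ * z₁ + a₂ * z₀) (trans (cong (_- n * e₂) (sym (ℤ.+-assoc (a₀ * z₂) (a₁ * z₁) (a₂ * z₀)))) (zeros (suc (suc zero)))) (∣′-+ {n} (∣′-*ˡ {n} a₁ d₁) (∣′-*ˡ {n} a₂ d₀)))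
  down : ¬ 3∣ℤ a₂ → n ∣′ z₂ × n ∣′ z₁ × n ∣′ z₀
  down u = d₂ , d₁ , d₀
    where
    d₂ = 3^-cancel j u (multiple₀ {a₂ * z₂} (zeros (suc (suc (suc (suc zero))))))
    d₁ = 3^-cancel j u (multiple {a₂ * z₁} (a₁ * z₂) (trans (cong (_- n * e₃) (ℤ.+-comm (a₂ * z₁) (a₁ * z₂))) (zeros (suc (suc (suc zero))))) (∣′-*ˡ {n} a₁ d₂))
    d₀ = 3^-cancel j u (multiple {a₂ * z₀} (a₀ * z₂ + a₁ * z₁) (trans (cong (_- n * e₂) (ℤ.+-comm (a₂ * z₀) (a₀ * z₂ + a₁ * z₁))) (zeros (suc (suc zero)))) (∣′-+ {n} (∣′-*ˡ {n} a₀ d₂) (∣′-*ˡ {n} a₁ d₁)))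

-- Divisors congruent modulo 3 to a pair of cusps.

-- The divisor x² + εx + η = 0, y = δ₁x + δ₀ of cusps, for which the remainder of a function modulo x² + εx + η is well defined.
record Cusps : Set where
  field
    ε η δ₁ δ₀ γ₄ γ₃ γ₂ γ₁ γ₀ : ℤ
  aτ : ℤ → ℤ → ℤ
  aτ = 𝔽.quadratic 1ℤ ε η
  bτ : ℤ → ℤ → ℤ
  bτ = 𝔽.linear δ₁ δ₀
  gτ : ℤ → ℤ → ℤ
  gτ = 𝔽.quartic γ₄ γ₃ γ₂ γ₁ γ₀
  norm : ℤ → ℤ → ℤ
  norm = λ m₁ m₀ → m₀ * m₀ - ε * m₀ * m₁ + η * m₁ * m₁
  field
    on-curve : ∀ x → 𝔽.𝐹 x 1ℤ ≡ bτ x 1ℤ * bτ x 1ℤ + aτ x 1ℤ * gτ x 1ℤ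
    unit : ¬ 3∣ℤ (norm δ₁ δ₀)
    reduced : ∀ s₁ s₀ (K : ℤ → ℤ) → (∀ x → s₁ * x + s₀ ≡ aτ x 1ℤ * K x) → s₁ ≡ 0ℤ × s₀ ≡ 0ℤ

-- A point (a, b) of the Jacobian congruent to (aτ, bτ) modulo 3
record Congruent (C : Cusps) (k : ℕ) (t m₁ m₀ w n₁ n₀ g₄ g₃ g₂ g₁ g₀ : ℤ) : Set where
  open Cusps C
  T : ℤ
  T = 3^ k
  p : ℤ
  p = t * ε + + 3 * T * m₁
  q : ℤ
  q = t * η + + 3 * T * m₀
  B₁ : ℤ
  B₁ = w * δ₁ + + 3 * n₁
  B₀ : ℤ
  B₀ = w * δ₀ + + 3 * n₀
  field
    on : ∀ X Z → w * w * 𝔽.𝐹 X Z ≡ 𝔽.linear B₁ B₀ X Z * (Z * Z) * (𝔽.linear B₁ B₀ X Z * (Z * Z)) + 𝔽.quadratic t p q X Z * 𝔽.quartic g₄ g₃ g₂ g₁ g₀ X Z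
    nt : ¬ 3∣ℤ t
    nw : ¬ 3∣ℤ w
    nm : ¬ 3∣ℤ m₁ ⊎ ¬ 3∣ℤ m₀
    N≢0 : norm m₁ m₀ ≢ 0ℤ

-- Subtracting (aτ, bτ) yields (a″, c) with a″ ≡ t l² modulo 3, to which the integrality of c modulo a″ applies.
module Subtract (C : Cusps) (k : ℕ) (t m₁ m₀ w n₁ n₀ g₄ g₃ g₂ g₁ g₀ : ℤ) (H : Congruent C k t m₁ m₀ w n₁ n₀ g₄ g₃ g₂ g₁ g₀) where
  open Cusps C
  open Congruent H

  -- Modulo aτ one has a ≡ 3Tm, and m has the conjugate m̄ = m₀ - εm₁ - m₁x with mm̄ ≡ ν. Thus l =
  -- -m̄β, reduced modulo aτ, solves al + ϑβ ≡ 0 there. Since β = b + w·bτ, the cubic al + ϑb is ϑb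
  -- modulo a and -ϑw·bτ modulo aτ, as needed to subtract the cusps.
  β₁ β₀ l₁ l₀ ν ϑ′ ϑ S₀ : ℤ
  β₁ = B₁ + w * δ₁
  β₀ = B₀ + w * δ₀
  l₁ = m₁ * β₀ - (m₀ - ε * m₁) * β₁ - ε * m₁ * β₁
  l₀ = - (m₀ - ε * m₁) * β₀ - η * m₁ * β₁
  ν = norm m₁ m₀
  ϑ′ = T * ν
  ϑ = + 3 * ϑ′
  S₀ = t * l₀ + + 3 * T * (m₁ * m₁ * β₀ - m₁ * β₁ * m₀)

  a b l m g S : ℤ → ℤ → ℤ
  a = 𝔽.quadratic t p q
  b X Z = 𝔽.linear B₁ B₀ X Z * (Z * Z)
  l = 𝔽.linear l₁ l₀
  m X Z = 𝔽.linear m₁ m₀ X Z * Z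
  g = 𝔽.quartic g₄ g₃ g₂ g₁ g₀
  S = 𝔽.linear (t * l₁) S₀

  p₄ p₃ p₂ p₁ p₀ q₂ q₁ q₀ r₁ r₀ : ℤ
  p₄ = - (+ 3 * ϑ′ * ϑ′ * g₄)
  p₃ = T * m₁ * l₁ * l₁ - + 3 * ϑ′ * ϑ′ * g₃
  p₂ = T * (+ 2 * m₁ * l₁ * l₀ + m₀ * l₁ * l₁) + + 2 * ϑ′ * B₁ * l₁ - + 3 * ϑ′ * ϑ′ * g₂
  p₁ = T * (m₁ * l₀ * l₀ + + 2 * m₀ * l₁ * l₀) + + 2 * ϑ′ * (B₁ * l₀ + B₀ * l₁) - + 3 * ϑ′ * ϑ′ * g₁
  p₀ = T * m₀ * l₀ * l₀ + + 2 * ϑ′ * B₀ * l₀ - + 3 * ϑ′ * ϑ′ * g₀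
  q₂ = p₄
  q₁ = p₃ - ε * q₂
  q₀ = p₂ - ε * q₁ - η * q₂
  r₁ = p₁ - ε * q₀ - η * q₁
  r₀ = p₀ - η * q₀

  dividend : ∀ X Z → T * m X Z * (l X Z * l X Z) + + 2 * ϑ′ * b X Z * l X Z - + 3 * ϑ′ * ϑ′ * g X Z ≡ 𝔽.quartic p₄ p₃ p₂ p₁ p₀ X Z
  dividend = lemma T m₁ m₀ l₁ l₀ ϑ′ B₁ B₀ g₄ g₃ g₂ g₁ g₀
    where
    lemma : ∀ T m₁ m₀ l₁ l₀ ϑ B₁ B₀ g₄ g₃ g₂ g₁ g₀ X Z → _
    lemma = solve 15 (λ T m₁ m₀ l₁ l₀ ϑ B₁ B₀ g₄ g₃ g₂ g₁ g₀ X Z → let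
        l = 𝔽S.linear l₁ l₀ X Z in
      T :* (𝔽S.linear m₁ m₀ X Z :* Z) :* (l :* l) :+ κ (+ 2) :* ϑ :* (𝔽S.linear B₁ B₀ X Z :* (Z :* Z)) :* l :- κ (+ 3) :* ϑ :* ϑ :* 𝔽S.quartic g₄ g₃ g₂ g₁ g₀ X Z
      := 𝔽S.quartic (:- (κ (+ 3) :* ϑ :* ϑ :* g₄)) (T :* m₁ :* l₁ :* l₁ :- κ (+ 3) :* ϑ :* ϑ :* g₃)
        (T :* (κ (+ 2) :* m₁ :* l₁ :* l₀ :+ m₀ :* l₁ :* l₁) :+ κ (+ 2) :* ϑ :* B₁ :* l₁ :- κ (+ 3) :* ϑ :* ϑ :* g₂)
        (T :* (m₁ :* l₀ :* l₀ :+ κ (+ 2) :* m₀ :* l₁ :* l₀) :+ κ (+ 2) :* ϑ :* (B₁ :* l₀ :+ B₀ :* l₁) :- κ (+ 3) :* ϑ :* ϑ :* g₁)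
        (T :* m₀ :* l₀ :* l₀ :+ κ (+ 2) :* ϑ :* B₀ :* l₀ :- κ (+ 3) :* ϑ :* ϑ :* g₀) X Z) refl

  division : ∀ X Z → 𝔽.quartic p₄ p₃ p₂ p₁ p₀ X Z ≡ aτ X Z * 𝔽.quadratic q₂ q₁ q₀ X Z + 𝔽.linear r₁ r₀ X Z * (Z * Z * Z)
  division = solve 9 (λ ε η p₄ p₃ p₂ p₁ p₀ X Z → let
      q₁ = p₃ :- ε :* p₄
      q₀ = p₂ :- ε :* q₁ :- η :* p₄ in
    𝔽S.quartic p₄ p₃ p₂ p₁ p₀ X Z := 𝔽S.quadratic (κ 1ℤ) ε η X Z :* 𝔽S.quadratic p₄ q₁ q₀ X Z :+ 𝔽S.linear (p₁ :- ε :* q₀ :- η :* q₁) (p₀ :- η :* q₀) X Z :* (Z :* Z :* Z)) refl ε η p₄ p₃ p₂ p₁ p₀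

  a≡ : ∀ X Z → a X Z ≡ t * aτ X Z + + 3 * T * m X Z
  a≡ = solve 8 (λ ε η t T m₁ m₀ X Z → 𝔽S.quadratic t (t :* ε :+ κ (+ 3) :* T :* m₁) (t :* η :+ κ (+ 3) :* T :* m₀) X Z :=
    t :* 𝔽S.quadratic (κ 1ℤ) ε η X Z :+ κ (+ 3) :* T :* (𝔽S.linear m₁ m₀ X Z :* Z)) refl ε η t T m₁ m₀

  interpolation : ∀ X Z → a X Z * l X Z + ϑ * (𝔽.linear β₁ β₀ X Z * (Z * Z)) ≡ aτ X Z * S X Z
  interpolation = solve 10 (λ ε η t T m₁ m₀ β₁ β₀ X Z → let
      l₁ = m₁ :* β₀ :- (m₀ :- ε :* m₁) :* β₁ :- ε :* m₁ :* β₁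
      l₀ = :- (m₀ :- ε :* m₁) :* β₀ :- η :* m₁ :* β₁
      ν = m₀ :* m₀ :- ε :* m₀ :* m₁ :+ η :* m₁ :* m₁ in
    𝔽S.quadratic t (t :* ε :+ κ (+ 3) :* T :* m₁) (t :* η :+ κ (+ 3) :* T :* m₀) X Z :* 𝔽S.linear l₁ l₀ X Z :+ κ (+ 3) :* (T :* ν) :* (𝔽S.linear β₁ β₀ X Z :* (Z :* Z))
    := 𝔽S.quadratic (κ 1ℤ) ε η X Z :* 𝔽S.linear (t :* l₁) (t :* l₀ :+ κ (+ 3) :* T :* (m₁ :* m₁ :* β₀ :- m₁ :* β₁ :* m₀)) X Z) refl ε η t T m₁ m₀ β₁ β₀

  private
    linear-+ : ∀ X Z → 𝔽.linear β₁ β₀ X Z * (Z * Z) ≡ b X Z + w * (bτ X Z * (Z * Z))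
    linear-+ = solve 7 (λ B₁ B₀ w δ₁ δ₀ X Z → 𝔽S.linear (B₁ :+ w :* δ₁) (B₀ :+ w :* δ₀) X Z :* (Z :* Z) := 𝔽S.linear B₁ B₀ X Z :* (Z :* Z) :+ w :* (𝔽S.linear δ₁ δ₀ X Z :* (Z :* Z))) refl B₁ B₀ w δ₁ δ₀

    remainder-identity : ∀ x → ∃[ K ] (+ 9 * T * ν * r₁) * x + + 9 * T * ν * r₀ ≡ aτ x 1ℤ * K
    remainder-identity x = K , (begin
        (+ 9 * T * ν * r₁) * x + + 9 * T * ν * r₀
          ≡⟨ solve 5 (λ T ν r₁ r₀ x → (κ (+ 9) :* T :* ν :* r₁) :* x :+ κ (+ 9) :* T :* ν :* r₀ := κ (+ 9) :* T :* ν :* (𝔽S.linear r₁ r₀ x (κ 1ℤ) :* (κ 1ℤ :* κ 1ℤ :* κ 1ℤ))) refl T ν r₁ r₀ x ⟩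
        + 9 * T * ν * R
          ≡⟨ cong₂ (λ n r → + 9 * T * n * r) N≡ R≡ ⟩
        + 9 * T * (M * M̄ + m₁ * m₁ * A) * (D - A * Q)
          ≡⟨ solve 15 (λ T M M̄ m₁ t A b l ϑ g S w b₀ g₀ Q → let
                a = t :* A :+ κ (+ 3) :* T :* M
                D = T :* M :* (l :* l) :+ κ (+ 2) :* ϑ :* b :* l :- κ (+ 3) :* ϑ :* ϑ :* g
                Θ = κ (+ 3) :* ϑ in
              κ (+ 9) :* T :* (M :* M̄ :+ m₁ :* m₁ :* A) :* (D :- A :* Q) :=
              A :* (M̄ :* (A :* S :* S :- κ (+ 2) :* S :* Θ :* w :* b₀ :- Θ :* Θ :* w :* w :* g₀ :- t :* a :* l :* l) :- κ (+ 3) :* M̄ :* a :* Q :- κ (+ 3) :* M̄ :* t :* (D :- A :* Q) :+ κ (+ 9) :* T :* m₁ :* m₁ :* (D :- A :* Q))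
              :+ M̄ :* ((a :* l :+ Θ :* (b :+ w :* b₀) :- A :* S) :* (a :* l :+ Θ :* b :+ (A :* S :- Θ :* w :* b₀)) :+ Θ :* Θ :* (w :* w :* (b₀ :* b₀ :+ A :* g₀) :- (b :* b :+ a :* g))))
              refl T M M̄ m₁ t A (b x 1ℤ) (l x 1ℤ) ϑ′ (g x 1ℤ) (S x 1ℤ) w b₀ G Q ⟩
        A * K + M̄ * ((a′ * l x 1ℤ + ϑ * (b x 1ℤ + w * b₀) - A * S x 1ℤ) * (a′ * l x 1ℤ + ϑ * b x 1ℤ + (A * S x 1ℤ - ϑ * w * b₀)) + ϑ * ϑ * (w * w * (b₀ * b₀ + A * G) - (b x 1ℤ * b x 1ℤ + a′ * g x 1ℤ)))
          ≡⟨ cong₂ (λ s d → A * K + M̄ * (s * (a′ * l x 1ℤ + ϑ * b x 1ℤ + (A * S x 1ℤ - ϑ * w * b₀)) + ϑ * ϑ * d)) (difference-zero ip) (difference-zero oc) ⟩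
        A * K + M̄ * (0ℤ * (a′ * l x 1ℤ + ϑ * b x 1ℤ + (A * S x 1ℤ - ϑ * w * b₀)) + ϑ * ϑ * 0ℤ)
          ≡⟨ solve 4 (λ e m y t → e :+ m :* (κ 0ℤ :* y :+ t :* κ 0ℤ) := e) refl (A * K) M̄ (a′ * l x 1ℤ + ϑ * b x 1ℤ + (A * S x 1ℤ - ϑ * w * b₀)) (ϑ * ϑ) ⟩
        A * K ∎)
      where
      open ≡-Reasoning
      A = aτ x 1ℤ
      M = m x 1ℤ
      M̄ = m₀ - ε * m₁ - m₁ * x
      Q = 𝔽.quadratic q₂ q₁ q₀ x 1ℤ
      R = 𝔽.linear r₁ r₀ x 1ℤ * (1ℤ * 1ℤ * 1ℤ)
      b₀ = bτ x 1ℤ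
      G = gτ x 1ℤ
      D = T * M * (l x 1ℤ * l x 1ℤ) + + 2 * ϑ′ * b x 1ℤ * l x 1ℤ - + 3 * ϑ′ * ϑ′ * g x 1ℤ
      a′ = t * A + + 3 * T * M
      K = M̄ * (A * S x 1ℤ * S x 1ℤ - + 2 * S x 1ℤ * ϑ * w * b₀ - ϑ * ϑ * w * w * G - t * a′ * l x 1ℤ * l x 1ℤ) - + 3 * M̄ * a′ * Q - + 3 * M̄ * t * (D - A * Q) + + 9 * T * m₁ * m₁ * (D - A * Q)
      N≡ : ν ≡ M * M̄ + m₁ * m₁ * A
      N≡ = solve 5 (λ ε η m₁ m₀ x → m₀ :* m₀ :- ε :* m₀ :* m₁ :+ η :* m₁ :* m₁ := (𝔽S.linear m₁ m₀ x (κ 1ℤ) :* κ 1ℤ) :* (m₀ :- ε :* m₁ :- m₁ :* x) :+ m₁ :* m₁ :* 𝔽S.quadratic (κ 1ℤ) ε η x (κ 1ℤ)) refl ε η m₁ m₀ x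
      R≡ : R ≡ D - A * Q
      R≡ = trans (solve 2 (λ r s → r := s :+ r :- s) refl R (A * Q)) (cong (_- A * Q) (sym (trans (dividend x 1ℤ) (division x 1ℤ))))
      ip : a′ * l x 1ℤ + ϑ * (b x 1ℤ + w * b₀) ≡ A * S x 1ℤ
      ip = trans (cong₂ (λ a β → a * l x 1ℤ + ϑ * β) (sym (a≡ x 1ℤ)) (trans (cong (λ t → b x 1ℤ + w * t) (sym (ℤ.*-identityʳ b₀))) (sym (linear-+ x 1ℤ)))) (interpolation x 1ℤ)
      oc : w * w * (b₀ * b₀ + A * G) ≡ b x 1ℤ * b x 1ℤ + a′ * g x 1ℤ
      oc = trans (cong (w * w *_) (sym (on-curve x))) (trans (on x 1ℤ) (cong (λ a → b x 1ℤ * b x 1ℤ + a * g x 1ℤ) (a≡ x 1ℤ)))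

  -- By the interpolation property and the two curve equations, 9Tν times the remainder is a
  -- multiple of aτ at every integer, and `reduced` then makes it zero.
  exact : r₁ ≡ 0ℤ × r₀ ≡ 0ℤ
  exact = cancel (proj₁ z) , cancel (proj₂ z)
    where
    z = reduced (+ 9 * T * ν * r₁) (+ 9 * T * ν * r₀) (λ x → proj₁ (remainder-identity x)) (λ x → proj₂ (remainder-identity x))
    cancel : ∀ {r} → + 9 * T * ν * r ≡ 0ℤ → r ≡ 0ℤ
    cancel h = ℤ-integral (+ 9 * T * ν) h (λ e → N≢0 (ℤ-integral (+ 9 * T) e (λ e′ → 3^-nonzero k (ℤ-integral (+ 9) e′ λ ()))))

  a″ c : ℤ → ℤ → ℤ
  a″ = 𝔽.quadratic (t * l₁ * l₁ + + 3 * q₂) (+ 2 * t * l₁ * l₀ + + 3 * q₁) (t * l₀ * l₀ + + 3 * q₀)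
  c = 𝔽.cubic (t * l₁) (t * l₀ + p * l₁) (p * l₀ + q * l₁ + ϑ * B₁) (q * l₀ + ϑ * B₀)

  c≡ : ∀ X Z → c X Z ≡ a X Z * l X Z + ϑ * b X Z
  c≡ = solve 10 (λ t p q l₁ l₀ ϑ B₁ B₀ X Z → 𝔽S.cubic (t :* l₁) (t :* l₀ :+ p :* l₁) (p :* l₀ :+ q :* l₁ :+ ϑ :* B₁) (q :* l₀ :+ ϑ :* B₀) X Z :=
    𝔽S.quadratic t p q X Z :* 𝔽S.linear l₁ l₀ X Z :+ ϑ :* (𝔽S.linear B₁ B₀ X Z :* (Z :* Z))) refl t p q l₁ l₀ ϑ B₁ B₀

  a″≡ : ∀ X Z → aτ X Z * a″ X Z ≡ l X Z * c X Z + ϑ * (b X Z * l X Z - ϑ * g X Z)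
  a″≡ X Z = begin
    aτ X Z * a″ X Z
      ≡⟨ solve 9 (λ A t l₁ l₀ q₂ q₁ q₀ X Z → A :* 𝔽S.quadratic (t :* l₁ :* l₁ :+ κ (+ 3) :* q₂) (κ (+ 2) :* t :* l₁ :* l₀ :+ κ (+ 3) :* q₁) (t :* l₀ :* l₀ :+ κ (+ 3) :* q₀) X Z :=
        t :* A :* (𝔽S.linear l₁ l₀ X Z :* 𝔽S.linear l₁ l₀ X Z) :+ κ (+ 3) :* (A :* 𝔽S.quadratic q₂ q₁ q₀ X Z :+ 𝔽S.linear (κ 0ℤ) (κ 0ℤ) X Z :* (Z :* Z :* Z))) refl (aτ X Z) t l₁ l₀ q₂ q₁ q₀ X Z ⟩
    t * aτ X Z * L² + + 3 * (aτ X Z * 𝔽.quadratic q₂ q₁ q₀ X Z + 𝔽.linear 0ℤ 0ℤ X Z * (Z * Z * Z))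
      ≡⟨ cong (λ d → t * aτ X Z * L² + + 3 * d) (trans (cong₂ (λ r s → aτ X Z * 𝔽.quadratic q₂ q₁ q₀ X Z + 𝔽.linear r s X Z * (Z * Z * Z)) (sym (proj₁ exact)) (sym (proj₂ exact))) (sym (trans (dividend X Z) (division X Z)))) ⟩
    t * aτ X Z * L² + + 3 * (T * m X Z * L² + + 2 * ϑ′ * b X Z * l X Z - + 3 * ϑ′ * ϑ′ * g X Z)
      ≡⟨ solve 8 (λ t A T M b l ϑ g → t :* A :* (l :* l) :+ κ (+ 3) :* (T :* M :* (l :* l) :+ κ (+ 2) :* ϑ :* b :* l :- κ (+ 3) :* ϑ :* ϑ :* g)
        := l :* ((t :* A :+ κ (+ 3) :* T :* M) :* l :+ κ (+ 3) :* ϑ :* b) :+ κ (+ 3) :* ϑ :* (b :* l :- κ (+ 3) :* ϑ :* g)) refl t (aτ X Z) T (m X Z) (b X Z) (l X Z) ϑ′ (g X Z) ⟩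
    l X Z * ((t * aτ X Z + + 3 * T * m X Z) * l X Z + ϑ * b X Z) + ϑ * (b X Z * l X Z - ϑ * g X Z)
      ≡⟨ cong (λ s → l X Z * s + ϑ * (b X Z * l X Z - ϑ * g X Z)) (trans (cong (λ a → a * l X Z + ϑ * b X Z) (sym (a≡ X Z))) (sym (c≡ X Z))) ⟩
    l X Z * c X Z + ϑ * (b X Z * l X Z - ϑ * g X Z) ∎
    where
    open ≡-Reasoning
    L² = l X Z * l X Z

  -- Composition of divisors: the cubic y = c/(ϑw) meets the curve over a, over aτ and in a residual
  -- pair over a″.
  residual-curve : Curve (t * l₁) (t * l₀ + p * l₁) (p * l₀ + q * l₁ + ϑ * B₁) (q * l₀ + ϑ * B₀) (ϑ * w)
    (t * l₁ * l₁ + + 3 * q₂) (+ 2 * t * l₁ * l₀ + + 3 * q₁) (t * l₀ * l₀ + + 3 * q₀)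
    t (t * ε + p) (t * η + p * ε + q) (p * η + q * ε) (q * η)
  residual-curve = curve λ X Z → sym (begin
    ϑ * w * (ϑ * w) * 𝔽.𝐹 X Z + a″ X Z * 𝔽.quartic t (t * ε + p) (t * η + p * ε + q) (p * η + q * ε) (q * η) X Z
      ≡⟨ cong (λ s → ϑ * w * (ϑ * w) * 𝔽.𝐹 X Z + a″ X Z * s) (solve 7 (λ ε η t p q X Z → 𝔽S.quartic t (t :* ε :+ p) (t :* η :+ p :* ε :+ q) (p :* η :+ q :* ε) (q :* η) X Z := 𝔽S.quadratic t p q X Z :* 𝔽S.quadratic (κ 1ℤ) ε η X Z) refl ε η t p q X Z) ⟩
    ϑ * w * (ϑ * w) * 𝔽.𝐹 X Z + a″ X Z * (a X Z * aτ X Z)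
      ≡⟨ solve 6 (λ ϑ w F s a A → ϑ :* w :* (ϑ :* w) :* F :+ s :* (a :* A) := ϑ :* ϑ :* (w :* w :* F) :+ a :* (A :* s)) refl ϑ w (𝔽.𝐹 X Z) (a″ X Z) (a X Z) (aτ X Z) ⟩
    ϑ * ϑ * (w * w * 𝔽.𝐹 X Z) + a X Z * (aτ X Z * a″ X Z)
      ≡⟨ cong₂ (λ s d → ϑ * ϑ * s + a X Z * d) (on X Z) (trans (a″≡ X Z) (cong (λ d → l X Z * d + ϑ * (b X Z * l X Z - ϑ * g X Z)) (c≡ X Z))) ⟩
    ϑ * ϑ * (b X Z * b X Z + a X Z * g X Z) + a X Z * (l X Z * (a X Z * l X Z + ϑ * b X Z) + ϑ * (b X Z * l X Z - ϑ * g X Z))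
      ≡⟨ solve 5 (λ ϑ b a g l → ϑ :* ϑ :* (b :* b :+ a :* g) :+ a :* (l :* (a :* l :+ ϑ :* b) :+ ϑ :* (b :* l :- ϑ :* g)) := (a :* l :+ ϑ :* b) :* (a :* l :+ ϑ :* b)) refl ϑ (b X Z) (a X Z) (g X Z) (l X Z) ⟩
    (a X Z * l X Z + ϑ * b X Z) * (a X Z * l X Z + ϑ * b X Z)
      ≡⟨ cong₂ _*_ (sym (c≡ X Z)) (sym (c≡ X Z)) ⟩
    c X Z * c X Z ∎)
    where open ≡-Reasoning

  -- Modulo 3 the line β is 2w times bτ, which is invertible modulo aτ by `unit`.
  3∤β : ¬ 3∣ℤ (norm β₁ β₀)
  3∤β = 3∤ℤ-cong (3∤ℤ-* (3∤ℤ-* {+ 4} {w * w} (3∤ℤ-cong {1ℤ} 3∤1 (1ℤ , refl)) (3∤ℤ-* nw nw)) unit)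
    (_ , solve 7 (λ ε η δ₁ δ₀ w n₁ n₀ → let
        β₁ = w :* δ₁ :+ κ (+ 3) :* n₁ :+ w :* δ₁
        β₀ = w :* δ₀ :+ κ (+ 3) :* n₀ :+ w :* δ₀ in
      (β₀ :* β₀ :- ε :* β₀ :* β₁ :+ η :* β₁ :* β₁) :- κ (+ 4) :* (w :* w) :* (δ₀ :* δ₀ :- ε :* δ₀ :* δ₁ :+ η :* δ₁ :* δ₁) :=
      κ (+ 3) :* (κ (+ 4) :* w :* δ₀ :* n₀ :+ κ (+ 3) :* n₀ :* n₀ :- ε :* (κ (+ 2) :* w :* δ₀ :* n₁ :+ κ (+ 2) :* w :* δ₁ :* n₀ :+ κ (+ 3) :* n₀ :* n₁) :+ η :* (κ (+ 4) :* w :* δ₁ :* n₁ :+ κ (+ 3) :* n₁ :* n₁))) refl ε η δ₁ δ₀ w n₁ n₀)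
    where
    3∤1 : ¬ 3∣ℤ 1ℤ
    3∤1 = ¬3∣1 {1ℤ} (λ ()) (ℕ.s≤s (ℕ.s≤s ℕ.z≤n))

  cancel-β : ∀ {x} → 3∣ℤ (norm β₁ β₀ * x) → 3∣ℤ x
  cancel-β {x} h = [ (λ d → ⊥-elim (3∤β d)) , (λ d → d) ]′ (3∣ℤ-prime (norm β₁ β₀) x h)

  -- Modulo aτ, l is -m̄β with β invertible modulo 3, so if l were divisible by 3 then m would be as
  -- well, contrary to `nm`.
  l-primitive : ¬ 3∣ℤ l₁ ⊎ ¬ 3∣ℤ l₀
  l-primitive = by (3∣ℤ? l₁) (3∣ℤ? l₀)
    where
    by : 3∣ℤ l₁ ⊎ ¬ 3∣ℤ l₁ → 3∣ℤ l₀ ⊎ ¬ 3∣ℤ l₀ → ¬ 3∣ℤ l₁ ⊎ ¬ 3∣ℤ l₀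
    by (inj₂ h) _ = inj₁ h
    by _ (inj₂ h) = inj₂ h
    by (inj₁ h₁) (inj₁ h₀) = ⊥-elim ([ (λ n → n d₁) , (λ n → n d₀) ]′ nm)
      where
      d₁ : 3∣ℤ m₁
      d₁ = cancel-β (subst 3∣ℤ (solve 6 (λ ε η m₁ m₀ β₁ β₀ → let
          l₁ = m₁ :* β₀ :- (m₀ :- ε :* m₁) :* β₁ :- ε :* m₁ :* β₁
          l₀ = :- (m₀ :- ε :* m₁) :* β₀ :- η :* m₁ :* β₁ in
        β₀ :* l₁ :- β₁ :* l₀ := (β₀ :* β₀ :- ε :* β₀ :* β₁ :+ η :* β₁ :* β₁) :* m₁) refl ε η m₁ m₀ β₁ β₀) (∣′-- {+ 3} (∣′-*ˡ {+ 3} β₀ h₁) (∣′-*ˡ {+ 3} β₁ h₀)))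
      d₀ : 3∣ℤ m₀
      d₀ = subst 3∣ℤ (solve 3 (λ ε m₁ m₀ → (m₀ :- ε :* m₁) :+ ε :* m₁ := m₀) refl ε m₁ m₀) (∣′-+ {+ 3} (cancel-β (subst 3∣ℤ (solve 6 (λ ε η m₁ m₀ β₁ β₀ → let
          l₁ = m₁ :* β₀ :- (m₀ :- ε :* m₁) :* β₁ :- ε :* m₁ :* β₁
          l₀ = :- (m₀ :- ε :* m₁) :* β₀ :- η :* m₁ :* β₁ in
        :- ((β₀ :- ε :* β₁) :* l₀ :+ (η :* β₁) :* l₁) := (β₀ :* β₀ :- ε :* β₀ :* β₁ :+ η :* β₁ :* β₁) :* (m₀ :- ε :* m₁)) refl ε η m₁ m₀ β₁ β₀)
          (∣′-neg {+ 3} (∣′-+ {+ 3} (∣′-*ˡ {+ 3} (β₀ - ε * β₁) h₀) (∣′-*ˡ {+ 3} (η * β₁) h₁))))) (∣′-*ˡ {+ 3} ε d₁))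

  a″-unit : ¬ 3∣ℤ (t * l₁ * l₁ + + 3 * q₂) ⊎ ¬ 3∣ℤ (t * l₀ * l₀ + + 3 * q₀)
  a″-unit = [ (λ h → inj₁ (go h)) , (λ h → inj₂ (go h)) ]′ l-primitive
    where
    go : ∀ {x y} → ¬ 3∣ℤ x → ¬ 3∣ℤ (t * x * x + + 3 * y)
    go {x} {y} h = 3∤ℤ-cong (3∤ℤ-* (3∤ℤ-* nt h) h) (y , solve 2 (λ a y → a :+ κ (+ 3) :* y :- a := κ (+ 3) :* y) refl (t * x * x) y)

  -- Let 3ʲ be the exact power of 3 in ϑ, with j ≥ 1. Integrality modulo a″ gives τc ≡ a″L modulo 3ʲ
  -- with L = Q₁x + Q₀. As aτ·a″ ≡ lc modulo ϑ, the product of a″ and τaτ - lL is divisible by 3ʲ,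
  -- and since a″ is primitive so is τaτ - lL. Inserting this in the interpolation identity modulo
  -- aτ and cancelling 3ʲ leaves yβL congruent to a multiple of 3; β being invertible, 3 divides Q₁.
  -- The leading coefficient of τaτ - lL then shows 3 ∣ τ, a contradiction.
  absurd : ⊥
  absurd = with-part (3-part ϑ ϑ≢0)
    where
    ϑ≢0 : ϑ ≢ 0ℤ
    ϑ≢0 h = N≢0 (ℤ-integral T (ℤ-integral (+ 3) h λ ()) (3^-nonzero k))
    w≢0 : w ≢ 0ℤ
    w≢0 h = nw (0ℤ , h)
    with-part : ∃[ j ] ∃[ y ] ϑ ≡ 3^ j * y × ¬ 3∣ℤ y → ⊥
    with-part (zero , y , e , ny) = ny (ϑ′ , trans (sym (ℤ.*-identityˡ y)) (sym e))
    with-part (suc i , y , ϑ≡ , ny) = finish ([ (λ u → curve-divides j u ϑw≢0 3^∣ϑw residual-curve) , (λ u → curve-divides′ j u ϑw≢0 3^∣ϑw residual-curve) ]′ a″-unit)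
      where
      j = suc i
      ϑw≢0 : ϑ * w ≢ 0ℤ
      ϑw≢0 h = w≢0 (ℤ-integral ϑ h ϑ≢0)
      3^∣ϑw : 3^ j ∣′ ϑ * w
      3^∣ϑw = y * w , trans (cong (_* w) ϑ≡) (ℤ.*-assoc (3^ j) y w)
      finish : Divides (3^ j) (t * l₁ * l₁ + + 3 * q₂) (+ 2 * t * l₁ * l₀ + + 3 * q₁) (t * l₀ * l₀ + + 3 * q₀)
        (t * l₁) (t * l₀ + p * l₁) (p * l₀ + q * l₁ + ϑ * B₁) (q * l₀ + ϑ * B₀) → ⊥
      finish (divides-by τ Q₁ Q₀ e₃ e₂ e₁ e₀ nτ D) = conclude (gauss j {t * l₁ * l₁ + + 3 * q₂} {+ 2 * t * l₁ * l₀ + + 3 * q₁} {t * l₀ * l₀ + + 3 * q₀} {z₂} {z₁} {z₀} {E₄} {E₃} {E₂} {E₁} {E₀} a″-unit product)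
        where
        s = τ * y
        z₂ = τ - l₁ * Q₁
        z₁ = τ * ε - (l₁ * Q₀ + l₀ * Q₁)
        z₀ = τ * η - l₀ * Q₀
        E₄ = l₁ * e₃ - s * ϑ * g₄
        E₃ = l₁ * e₂ + l₀ * e₃ - s * ϑ * g₃
        E₂ = l₁ * e₁ + l₀ * e₂ + s * (B₁ * l₁ - ϑ * g₂)
        E₁ = l₁ * e₀ + l₀ * e₁ + s * (B₁ * l₀ + B₀ * l₁ - ϑ * g₁)
        E₀ = l₀ * e₀ + s * (B₀ * l₀ - ϑ * g₀)
        E : ℤ → ℤ
        E X = 𝔽.quartic E₄ E₃ E₂ E₁ E₀ X 1ℤ
        z≡ : ∀ X → 𝔽.quadratic z₂ z₁ z₀ X 1ℤ ≡ τ * aτ X 1ℤ - l X 1ℤ * 𝔽.linear Q₁ Q₀ X 1ℤ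
        z≡ = solve 8 (λ ε η τ l₁ l₀ Q₁ Q₀ X → 𝔽S.quadratic (τ :- l₁ :* Q₁) (τ :* ε :- (l₁ :* Q₀ :+ l₀ :* Q₁)) (τ :* η :- l₀ :* Q₀) X (κ 1ℤ) :=
          τ :* 𝔽S.quadratic (κ 1ℤ) ε η X (κ 1ℤ) :- 𝔽S.linear l₁ l₀ X (κ 1ℤ) :* 𝔽S.linear Q₁ Q₀ X (κ 1ℤ)) refl ε η τ l₁ l₀ Q₁ Q₀
        product : ∀ X → a″ X 1ℤ * 𝔽.quadratic z₂ z₁ z₀ X 1ℤ ≡ 3^ j * E X
        product X = begin
          a″ X 1ℤ * 𝔽.quadratic z₂ z₁ z₀ X 1ℤ
            ≡⟨ cong (a″ X 1ℤ *_) (z≡ X) ⟩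
          a″ X 1ℤ * (τ * aτ X 1ℤ - l X 1ℤ * L)
            ≡⟨ solve 5 (λ a τ A l Q → a :* (τ :* A :- l :* Q) := τ :* (A :* a) :- l :* (a :* Q)) refl (a″ X 1ℤ) τ (aτ X 1ℤ) (l X 1ℤ) L ⟩
          τ * (aτ X 1ℤ * a″ X 1ℤ) - l X 1ℤ * (a″ X 1ℤ * L)
            ≡⟨ cong₂ (λ u v → τ * u - l X 1ℤ * v) (a″≡ X 1ℤ) (trans (solve 2 (λ u v → v := u :+ v :- u) refl (3^ j * 𝔽.cubic e₃ e₂ e₁ e₀ X 1ℤ) (a″ X 1ℤ * L)) (cong (_- 3^ j * 𝔽.cubic e₃ e₂ e₁ e₀ X 1ℤ) (sym (D X 1ℤ)))) ⟩
          τ * (l X 1ℤ * c X 1ℤ + ϑ * (b X 1ℤ * l X 1ℤ - ϑ * g X 1ℤ)) - l X 1ℤ * (τ * c X 1ℤ - 3^ j * 𝔽.cubic e₃ e₂ e₁ e₀ X 1ℤ)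
            ≡⟨ cong (λ ϑ″ → τ * (l X 1ℤ * c X 1ℤ + ϑ″ * (b X 1ℤ * l X 1ℤ - ϑ * g X 1ℤ)) - l X 1ℤ * (τ * c X 1ℤ - 3^ j * 𝔽.cubic e₃ e₂ e₁ e₀ X 1ℤ)) ϑ≡ ⟩
          τ * (l X 1ℤ * c X 1ℤ + 3^ j * y * (b X 1ℤ * l X 1ℤ - ϑ * g X 1ℤ)) - l X 1ℤ * (τ * c X 1ℤ - 3^ j * 𝔽.cubic e₃ e₂ e₁ e₀ X 1ℤ)
            ≡⟨ solve 9 (λ τ l c n y b ϑ g e → τ :* (l :* c :+ n :* y :* (b :* l :- ϑ :* g)) :- l :* (τ :* c :- n :* e) := n :* (l :* e :+ τ :* y :* (b :* l :- ϑ :* g))) refl τ (l X 1ℤ) (c X 1ℤ) (3^ j) y (b X 1ℤ) ϑ (g X 1ℤ) (𝔽.cubic e₃ e₂ e₁ e₀ X 1ℤ) ⟩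
          3^ j * (l X 1ℤ * 𝔽.cubic e₃ e₂ e₁ e₀ X 1ℤ + s * (b X 1ℤ * l X 1ℤ - ϑ * g X 1ℤ))
            ≡⟨ cong (3^ j *_) (E≡ l₁ l₀ e₃ e₂ e₁ e₀ s ϑ B₁ B₀ g₄ g₃ g₂ g₁ g₀ X) ⟩
          3^ j * E X ∎
          where
          open ≡-Reasoning
          L = 𝔽.linear Q₁ Q₀ X 1ℤ
          E≡ : ∀ l₁ l₀ e₃ e₂ e₁ e₀ s ϑ B₁ B₀ g₄ g₃ g₂ g₁ g₀ X → _
          E≡ = solve 16 (λ l₁ l₀ e₃ e₂ e₁ e₀ s ϑ B₁ B₀ g₄ g₃ g₂ g₁ g₀ X → let
              o = κ 1ℤ
              l = 𝔽S.linear l₁ l₀ X o in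
            l :* 𝔽S.cubic e₃ e₂ e₁ e₀ X o :+ s :* (𝔽S.linear B₁ B₀ X o :* (o :* o) :* l :- ϑ :* 𝔽S.quartic g₄ g₃ g₂ g₁ g₀ X o)
            := 𝔽S.quartic (l₁ :* e₃ :- s :* ϑ :* g₄) (l₁ :* e₂ :+ l₀ :* e₃ :- s :* ϑ :* g₃) (l₁ :* e₁ :+ l₀ :* e₂ :+ s :* (B₁ :* l₁ :- ϑ :* g₂)) (l₁ :* e₀ :+ l₀ :* e₁ :+ s :* (B₁ :* l₀ :+ B₀ :* l₁ :- ϑ :* g₁)) (l₀ :* e₀ :+ s :* (B₀ :* l₀ :- ϑ :* g₀)) X o) refl
        conclude : 3^ j ∣′ z₂ × 3^ j ∣′ z₁ × 3^ j ∣′ z₀ → ⊥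
        conclude ((R₂ , z₂≡) , (R₁ , z₁≡) , (R₀ , z₀≡)) = nτ (subst 3∣ℤ (solve 3 (λ τ l Q → (τ :- l :* Q) :+ l :* Q := τ) refl τ l₁ Q₁)
            (∣′-+ {+ 3} (3^ i * R₂ , trans z₂≡ (ℤ.*-assoc (+ 3) (3^ i) R₂)) (∣′-*ˡ {+ 3} l₁ 3∣Q₁)))
          where
          h₁ = R₁ - ε * R₂
          h₀ = R₀ - η * R₂
          u₁ = β₁ * Q₀ + β₀ * Q₁ - ε * β₁ * Q₁
          u₀ = β₀ * Q₀ - η * β₁ * Q₁
          v₁ = m₁ * h₀ + m₀ * h₁ - ε * m₁ * h₁
          v₀ = m₀ * h₀ - η * m₁ * h₁
          pointwise : ∀ x → ∃[ K ] (3^ j * (y * u₁ - + 3 * T * v₁)) * x + 3^ j * (y * u₀ - + 3 * T * v₀) ≡ aτ x 1ℤ * K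
          pointwise x = K , (begin
            (n * (y * u₁ - + 3 * T * v₁)) * x + n * (y * u₀ - + 3 * T * v₀)
              ≡⟨ lemma ε η n y T m₁ m₀ β₁ β₀ Q₁ Q₀ R₂ R₁ R₀ t x ⟩
            (n * y) * β * L - (t * A + + 3 * T * m x 1ℤ) * (n * R) - A * K₀
              ≡⟨ cong₂ (λ a z → (n * y) * β * L - a * z - A * K₀) (sym (a≡ x 1ℤ)) R≡ ⟩
            (n * y) * β * L - a x 1ℤ * (τ * A - l x 1ℤ * L) - A * K₀
              ≡⟨ cong (λ ϑ″ → ϑ″ * β * L - a x 1ℤ * (τ * A - l x 1ℤ * L) - A * K₀) (sym ϑ≡) ⟩
            ϑ * β * L - a x 1ℤ * (τ * A - l x 1ℤ * L) - A * K₀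
              ≡⟨ solve 8 (λ ϑ β L a τ A l K → ϑ :* β :* L :- a :* (τ :* A :- l :* L) :- A :* K := (a :* l :+ ϑ :* β) :* L :- A :* (a :* τ :+ K)) refl ϑ β L (a x 1ℤ) τ A (l x 1ℤ) K₀ ⟩
            (a x 1ℤ * l x 1ℤ + ϑ * β) * L - A * (a x 1ℤ * τ + K₀)
              ≡⟨ cong (λ s → s * L - A * (a x 1ℤ * τ + K₀)) (interpolation x 1ℤ) ⟩
            A * S x 1ℤ * L - A * (a x 1ℤ * τ + K₀)
              ≡⟨ solve 4 (λ A S L K → A :* S :* L :- A :* K := A :* (S :* L :- K)) refl A (S x 1ℤ) L (a x 1ℤ * τ + K₀) ⟩
            A * K ∎)
            where
            open ≡-Reasoning
            n = 3^ j
            A = aτ x 1ℤ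
            β = 𝔽.linear β₁ β₀ x 1ℤ * (1ℤ * 1ℤ)
            L = 𝔽.linear Q₁ Q₀ x 1ℤ
            R = 𝔽.quadratic R₂ R₁ R₀ x 1ℤ
            K₀ = n * (y * β₁ * Q₁ - + 3 * T * m₁ * h₁ - + 3 * T * 𝔽.linear m₁ m₀ x 1ℤ * R₂ - t * R)
            K = S x 1ℤ * L - (a x 1ℤ * τ + K₀)
            R≡ : n * R ≡ τ * A - l x 1ℤ * L
            R≡ = trans (solve 5 (λ n R₂ R₁ R₀ x → n :* 𝔽S.quadratic R₂ R₁ R₀ x (κ 1ℤ) := 𝔽S.quadratic (n :* R₂) (n :* R₁) (n :* R₀) x (κ 1ℤ)) refl n R₂ R₁ R₀ x)
              (trans (cong₂ (λ r s → 𝔽.quadratic r s (n * R₀) x 1ℤ) (sym z₂≡) (sym z₁≡)) (trans (cong (λ r → 𝔽.quadratic z₂ z₁ r x 1ℤ) (sym z₀≡)) (z≡ x)))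
            lemma : ∀ ε η n y T m₁ m₀ β₁ β₀ Q₁ Q₀ R₂ R₁ R₀ t x → _
            lemma = solve 16 (λ ε η n y T m₁ m₀ β₁ β₀ Q₁ Q₀ R₂ R₁ R₀ t x → let
                o = κ 1ℤ
                h₁ = R₁ :- ε :* R₂
                h₀ = R₀ :- η :* R₂
                u₁ = β₁ :* Q₀ :+ β₀ :* Q₁ :- ε :* β₁ :* Q₁
                u₀ = β₀ :* Q₀ :- η :* β₁ :* Q₁
                v₁ = m₁ :* h₀ :+ m₀ :* h₁ :- ε :* m₁ :* h₁
                v₀ = m₀ :* h₀ :- η :* m₁ :* h₁
                A = 𝔽S.quadratic o ε η x o
                m = 𝔽S.linear m₁ m₀ x o
                R = 𝔽S.quadratic R₂ R₁ R₀ x o in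
              (n :* (y :* u₁ :- κ (+ 3) :* T :* v₁)) :* x :+ n :* (y :* u₀ :- κ (+ 3) :* T :* v₀)
              := (n :* y) :* (𝔽S.linear β₁ β₀ x o :* (o :* o)) :* 𝔽S.linear Q₁ Q₀ x o :- (t :* A :+ κ (+ 3) :* T :* (m :* o)) :* (n :* R)
                :- A :* (n :* (y :* β₁ :* Q₁ :- κ (+ 3) :* T :* m₁ :* h₁ :- κ (+ 3) :* T :* m :* R₂ :- t :* R))) refl
          zeros = reduced (3^ j * (y * u₁ - + 3 * T * v₁)) (3^ j * (y * u₀ - + 3 * T * v₀)) (λ x → proj₁ (pointwise x)) (λ x → proj₂ (pointwise x))
          3∣u : ∀ {u v} → 3^ j * (y * u - + 3 * T * v) ≡ 0ℤ → 3∣ℤ u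
          3∣u {u} {v} h = [ (λ d → ⊥-elim (ny d)) , (λ d → d) ]′ (3∣ℤ-prime y u (T * v , trans (zero-difference (ℤ-integral (3^ j) h (3^-nonzero j))) (ℤ.*-assoc (+ 3) T v)))
          3∣Q₁ : 3∣ℤ Q₁
          3∣Q₁ = cancel-β (subst 3∣ℤ (solve 6 (λ ε η β₁ β₀ Q₁ Q₀ → β₀ :* (β₁ :* Q₀ :+ β₀ :* Q₁ :- ε :* β₁ :* Q₁) :- β₁ :* (β₀ :* Q₀ :- η :* β₁ :* Q₁) := (β₀ :* β₀ :- ε :* β₀ :* β₁ :+ η :* β₁ :* β₁) :* Q₁) refl ε η β₁ β₀ Q₁ Q₀)
            (∣′-- {+ 3} (∣′-*ˡ {+ 3} β₀ (3∣u {u₁} {v₁} (proj₁ zeros))) (∣′-*ˡ {+ 3} β₁ (3∣u {u₀} {v₀} (proj₂ zeros)))))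

-- Classification of the points modulo 3.

-- Deciding statements about residues modulo 3 by enumeration
div3 : ℤ → Bool
div3 x = ∣ x ∣ ℕ.% 3 ℕ.≡ᵇ 0

div3-sound : ∀ x → div3 x ≡ true → 3∣ℤ x
div3-sound x h = go (m%n≡0⇒n∣m ∣ x ∣ 3 (ℕ.≡ᵇ⇒≡ (∣ x ∣ ℕ.% 3) 0 (subst True (sym h) _)))
  where
  go : 3 ∣ ∣ x ∣ → 3∣ℤ x
  go (divides k e) = [ (λ x≡ → + k , trans (sym x≡) +∣x∣≡)
    , (λ x≡ → - + k , trans (sym (ℤ.neg-involutive x)) (trans (cong -_ (trans (sym x≡) +∣x∣≡)) (ℤ.neg-distribʳ-* (+ 3) (+ k)))) ]′ (ℤ.+∣i∣≡i⊎+∣i∣≡-i x)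
    where
    +∣x∣≡ : + ∣ x ∣ ≡ + 3 * + k
    +∣x∣≡ = trans (cong +_ e) (trans (ℤ.pos-* k 3) (ℤ.*-comm (+ k) (+ 3)))

div3-complete : ∀ x → 3∣ℤ x → div3 x ≡ true
div3-complete x (k , refl) = cong (ℕ._≡ᵇ 0) (trans (cong (ℕ._% 3) (trans (ℤ.abs-* (+ 3) k) (ℕ.*-comm 3 ∣ k ∣))) (m*n%n≡0 ∣ k ∣ 3))

infix 4 _≡₃_
_≡₃_ : ℤ → ℤ → Set
x ≡₃ y = 3∣ℤ (x - y)

div3-cong : ∀ {x y} → x ≡₃ y → div3 x ≡ div3 y
div3-cong {x} {y} h = iff (div3 x) (div3 y) refl refl
  where
  iff : ∀ b c → div3 x ≡ b → div3 y ≡ c → b ≡ c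
  iff true true _ _ = refl
  iff false false _ _ = refl
  iff true false e e′ = sym (trans (sym e′) (div3-complete y (subst 3∣ℤ (solve 2 (λ x y → x :- (x :- y) := y) refl x y) (∣′-- {+ 3} (div3-sound x e) h))))
  iff false true e e′ = trans (sym e) (div3-complete x (subst 3∣ℤ (solve 2 (λ x y → y :+ (x :- y) := x) refl x y) (∣′-+ {+ 3} (div3-sound y e′) h)))

≡₃-expr : ∀ {n} (e : ℤS.Expr n) {ρ ρ′} → (∀ i → lookup ρ i ≡₃ lookup ρ′ i) → ℤS.⟦ e ⟧ ρ ≡₃ ℤS.⟦ e ⟧ ρ′
≡₃-expr (ℤS.var i) h = h i
≡₃-expr (κ c) h = 0ℤ , ℤ.+-inverseʳ c
≡₃-expr (a :+ b) {ρ} {ρ′} h = subst 3∣ℤ (solve 4 (λ a b c d → (a :- c) :+ (b :- d) := a :+ b :- (c :+ d)) refl (ℤS.⟦ a ⟧ ρ) (ℤS.⟦ b ⟧ ρ) (ℤS.⟦ a ⟧ ρ′) (ℤS.⟦ b ⟧ ρ′))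
  (∣′-+ {+ 3} (≡₃-expr a {ρ} {ρ′} h) (≡₃-expr b {ρ} {ρ′} h))
≡₃-expr (a :* b) {ρ} {ρ′} h = subst 3∣ℤ (solve 4 (λ a b c d → a :* (b :- d) :+ (a :- c) :* d := a :* b :- (c :* d)) refl (ℤS.⟦ a ⟧ ρ) (ℤS.⟦ b ⟧ ρ) (ℤS.⟦ a ⟧ ρ′) (ℤS.⟦ b ⟧ ρ′))
  (∣′-+ {+ 3} (∣′-*ˡ {+ 3} (ℤS.⟦ a ⟧ ρ) (≡₃-expr b {ρ} {ρ′} h)) (∣′-*ʳ {+ 3} (ℤS.⟦ b ⟧ ρ′) (≡₃-expr a {ρ} {ρ′} h)))
≡₃-expr (:- a) {ρ} {ρ′} h = subst 3∣ℤ (solve 2 (λ a c → :- (a :- c) := :- a :- (:- c)) refl (ℤS.⟦ a ⟧ ρ) (ℤS.⟦ a ⟧ ρ′))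
  (∣′-neg {+ 3} (≡₃-expr a {ρ} {ρ′} h))

data Formula (n : ℕ) : Set where
  div : ℤS.Expr n → Formula n
  _∧′_ _∨′_ : Formula n → Formula n → Formula n
  ¬′_ : Formula n → Formula n

infixr 6 _∧′_
infixr 5 _∨′_
infix 7 ¬′_

holds : ∀ {n} → Formula n → Vec ℤ n → Bool
holds (div e) ρ = div3 (ℤS.⟦ e ⟧ ρ)
holds (f ∧′ g) ρ = holds f ρ ∧ holds g ρ
holds (f ∨′ g) ρ = if holds f ρ then true else holds g ρ
holds (¬′ f) ρ = if holds f ρ then false else true

Holds : ∀ {n} → Formula n → Vec ℤ n → Set
Holds (div e) ρ = 3∣ℤ (ℤS.⟦ e ⟧ ρ)
Holds (f ∧′ g) ρ = Holds f ρ × Holds g ρ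
Holds (f ∨′ g) ρ = Holds f ρ ⊎ Holds g ρ
Holds (¬′ f) ρ = ¬ Holds f ρ

holds-cong : ∀ {n} (f : Formula n) {ρ ρ′} → (∀ i → lookup ρ i ≡₃ lookup ρ′ i) → holds f ρ ≡ holds f ρ′
holds-cong (div e) {ρ} {ρ′} h = div3-cong {ℤS.⟦ e ⟧ ρ} {ℤS.⟦ e ⟧ ρ′} (≡₃-expr e {ρ} {ρ′} h)
holds-cong (f ∧′ g) {ρ} {ρ′} h = cong₂ _∧_ (holds-cong f {ρ} {ρ′} h) (holds-cong g {ρ} {ρ′} h)
holds-cong (f ∨′ g) {ρ} {ρ′} h = cong₂ (if_then true else_) (holds-cong f {ρ} {ρ′} h) (holds-cong g {ρ} {ρ′} h)
holds-cong (¬′ f) {ρ} {ρ′} h = cong (if_then false else true) (holds-cong f {ρ} {ρ′} h)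

holds-sound : ∀ {n} (f : Formula n) ρ → holds f ρ ≡ true → Holds f ρ
holds-complete : ∀ {n} (f : Formula n) ρ → holds f ρ ≡ false → ¬ Holds f ρ
holds-sound (div e) ρ h = div3-sound (ℤS.⟦ e ⟧ ρ) h
holds-sound (f ∧′ g) ρ h with holds f ρ in e | holds g ρ in e′
... | true | true = holds-sound f ρ e , holds-sound g ρ e′
holds-sound (f ∨′ g) ρ h with holds f ρ in e
... | true = inj₁ (holds-sound f ρ e)
... | false = inj₂ (holds-sound g ρ h)
holds-sound (¬′ f) ρ h with holds f ρ in e
... | false = holds-complete f ρ e
holds-complete (div e) ρ h d = case trans (sym h) (div3-complete (ℤS.⟦ e ⟧ ρ) d) of λ ()
holds-complete (f ∧′ g) ρ h (a , b) with holds f ρ in e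
... | false = holds-complete f ρ e a
... | true = holds-complete g ρ h b
holds-complete (f ∨′ g) ρ h d with holds f ρ in e
... | false = [ holds-complete f ρ e , holds-complete g ρ h ]′ d
holds-complete (¬′ f) ρ h n with holds f ρ in e
... | true = n (holds-sound f ρ e)

every : ∀ n → (Vec ℤ n → Bool) → Bool
every zero P = P []
every (suc n) P = every n (λ ρ → P (0ℤ ∷ ρ)) ∧ every n (λ ρ → P (1ℤ ∷ ρ)) ∧ every n (λ ρ → P (-1ℤ ∷ ρ))

every-sound : ∀ n P → every n P ≡ true → ∀ (ρ : Vec ℤ n) → ∃[ ρ′ ] (∀ i → lookup ρ i ≡₃ lookup ρ′ i) × P ρ′ ≡ true
every-sound zero P h [] = [] , (λ ()) , h
every-sound (suc n) P h (x ∷ ρ) with every n (λ ρ → P (0ℤ ∷ ρ)) in e₀ | every n (λ ρ → P (1ℤ ∷ ρ)) in e₁ | every n (λ ρ → P (-1ℤ ∷ ρ)) in e₂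
... | true | true | true = by (mod3 x)
  where
  extend : ∀ c k → x ≡ c + + 3 * k → every n (λ ρ → P (c ∷ ρ)) ≡ true → ∃[ ρ′ ] (∀ i → lookup (x ∷ ρ) i ≡₃ lookup ρ′ i) × P ρ′ ≡ true
  extend c k x≡ e = go (every-sound n (λ ρ → P (c ∷ ρ)) e ρ)
    where
    go : _ → _
    go (ρ′ , r , p) = c ∷ ρ′ , (λ { zero → k , trans (cong (_- c) x≡) (solve 2 (λ c k → c :+ κ (+ 3) :* k :- c := κ (+ 3) :* k) refl c k) ; (suc i) → r i }) , p
  by : _ → ∃[ ρ′ ] (∀ i → lookup (x ∷ ρ) i ≡₃ lookup ρ′ i) × P ρ′ ≡ true
  by (k , inj₁ x≡) = extend 0ℤ k (trans x≡ (sym (ℤ.+-identityˡ _))) e₀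
  by (k , inj₂ (inj₁ x≡)) = extend 1ℤ k x≡ e₁
  by (k , inj₂ (inj₂ x≡)) = extend -1ℤ k x≡ e₂

-- The truth of a formula depends only on the residues of the variables, so evaluating it on the
-- vectors with entries 0, 1 and -1 suffices.
enumerate : ∀ {n} (f : Formula n) → every n (holds f) ≡ true → ∀ ρ → Holds f ρ
enumerate {n} f h ρ = go (every-sound n (holds f) h ρ)
  where
  go : ∃[ ρ′ ] (∀ i → lookup ρ i ≡₃ lookup ρ′ i) × holds f ρ′ ≡ true → Holds f ρ
  go (ρ′ , r , e) = holds-sound f ρ (trans (holds-cong f {ρ} {ρ′} r) e)

-- Besides the three pairs of cusps, a root x ≡ 1 is the only possibility modulo 3.
module _ where
  private
    x : Fin 6 → ℤS.Expr 6
    x = ℤS.var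
    t = x zero
    p = x (suc zero)
    q = x (suc (suc zero))
    u = x (suc (suc (suc zero)))
    v = x (suc (suc (suc (suc zero))))
    w = x (suc (suc (suc (suc (suc zero)))))

    near : ℤ → ℤ → ℤ → ℤ → ℤ → Formula 6
    near ε η δ₁ δ₀ s = div (p :- t :* κ ε) ∧′ div (q :- t :* κ η) ∧′ div (u :- κ s :* w :* κ δ₁) ∧′ div (v :- κ s :* w :* κ δ₀)

    classification : Formula 6
    classification = div t ∨′ div w
      ∨′ (¬′ div (κ (+ 2) :* t :* u :* v :- p :* u :* u :- w :* w :* CoS.R₁ t p q)) ∨′ (¬′ div (t :* v :* v :- q :* u :* u :- w :* w :* CoS.R₀ t p q))
      ∨′ div (t :+ p :+ q)
      ∨′ near 0ℤ 0ℤ (+ 2) 1ℤ 1ℤ ∨′ near 0ℤ 0ℤ (+ 2) 1ℤ -1ℤ ∨′ near (+ 2) 1ℤ 1ℤ 0ℤ 1ℤ ∨′ near (+ 2) 1ℤ 1ℤ 0ℤ -1ℤ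
      ∨′ near 1ℤ 0ℤ 0ℤ 1ℤ 1ℤ ∨′ near 1ℤ 0ℤ 0ℤ 1ℤ -1ℤ ∨′ near 1ℤ 0ℤ (+ 2) 1ℤ 1ℤ ∨′ near 1ℤ 0ℤ (+ 2) 1ℤ -1ℤ

  classify : ∀ t p q u v w → Holds classification (t ∷ p ∷ q ∷ u ∷ v ∷ w ∷ [])
  classify t p q u v w = enumerate classification refl (t ∷ p ∷ q ∷ u ∷ v ∷ w ∷ [])

divisible-by-all : ∀ s → (∀ z → z ≢ 0ℤ → z ∣′ s) → s ≡ 0ℤ
divisible-by-all s h = go (h (+ suc ∣ s ∣) (λ ())) (s ℤ.≟ 0ℤ)
  where
  go : + suc ∣ s ∣ ∣′ s → Dec (s ≡ 0ℤ) → s ≡ 0ℤ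
  go _ (yes z) = z
  go (k , e) (no ne) = ⊥-elim (ℕ.1+n≰n (ℕ.≤-trans (ℕ.m≤m*n (suc ∣ s ∣) ∣ k ∣ {{ℕ.≢-nonZero k≢0}}) (ℕ.≤-reflexive (trans (sym (ℤ.abs-* (+ suc ∣ s ∣) k)) (cong ∣_∣ (sym e))))))
    where
    k≢0 : ∣ k ∣ ≢ 0
    k≢0 z = ne (trans e (trans (cong (+ suc ∣ s ∣ *_) (ℤ.∣i∣≡0⇒i≡0 z)) (ℤ.*-zeroʳ (+ suc ∣ s ∣))))

-- The quadratic is (x - r)². At x = r the linear form vanishes, and at x = r + z this leaves s₁ =
-- z·K(r + z), so every nonzero z divides s₁.
reduced-double : ∀ r ε η → (∀ z → 𝔽.quadratic 1ℤ ε η (r + z) 1ℤ ≡ z * z) →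
  ∀ s₁ s₀ (K : ℤ → ℤ) → (∀ x → s₁ * x + s₀ ≡ 𝔽.quadratic 1ℤ ε η x 1ℤ * K x) → s₁ ≡ 0ℤ × s₀ ≡ 0ℤ
reduced-double r ε η sq s₁ s₀ K h = s₁≡0 , trans (sym (ℤ.+-identityˡ s₀)) (trans (cong (λ s → s * r + s₀) (sym s₁≡0)) at-r)
  where
  at : ∀ z → s₁ * (r + z) + s₀ ≡ z * z * K (r + z)
  at z = trans (h (r + z)) (cong (_* K (r + z)) (sq z))
  at-r : s₁ * r + s₀ ≡ 0ℤ
  at-r = trans (cong (λ r → s₁ * r + s₀) (sym (ℤ.+-identityʳ r))) (at 0ℤ)
  s₁≡0 : s₁ ≡ 0ℤ
  s₁≡0 = divisible-by-all s₁ λ z z≢0 → z≢0-cancel z z≢0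
    where
    z≢0-cancel : ∀ z → z ≢ 0ℤ → z ∣′ s₁
    z≢0-cancel z z≢0 = K (r + z) , zero-difference (ℤ-integral z (trans (solve 5 (λ z s₁ s₀ r k → z :* (s₁ :- z :* k) := (s₁ :* (r :+ z) :+ s₀ :- z :* z :* k) :- (s₁ :* r :+ s₀)) refl z s₁ s₀ r (K (r + z)))
      (cong₂ _-_ (difference-zero (at z)) at-r)) z≢0)

reduced-distinct : ∀ s₁ s₀ (K : ℤ → ℤ) → (∀ x → s₁ * x + s₀ ≡ 𝔽.quadratic 1ℤ 1ℤ 0ℤ x 1ℤ * K x) → s₁ ≡ 0ℤ × s₀ ≡ 0ℤ
reduced-distinct s₁ s₀ K h = trans (solve 2 (λ s t → s := t :- (s :* κ -1ℤ :+ t)) refl s₁ s₀) (cong₂ _-_ s₀≡0 (h -1ℤ)) , s₀≡0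
  where
  s₀≡0 : s₀ ≡ 0ℤ
  s₀≡0 = trans (solve 2 (λ s t → t := s :* κ 0ℤ :+ t) refl s₁ s₀) (h 0ℤ)

3∤1 : ¬ 3∣ℤ 1ℤ
3∤1 = ¬3∣1 {1ℤ} (λ ()) (ℕ.s≤s (ℕ.s≤s ℕ.z≤n))

3∤-1 : ¬ 3∣ℤ -1ℤ
3∤-1 = ¬3∣1 { -1ℤ} (λ ()) (ℕ.s≤s (ℕ.s≤s ℕ.z≤n))

-- The divisors 2(0, 1), 2(-1, -1), (0, 1) + (-1, 1) and (0, 1) + (-1, -1). In the double cases the
-- line is the tangent; the opposite ordinates are reached with the sign s = -1.
cusps-0-0 cusps-1-1 cusps-0-1 cusps-0-1′ : Cusps
cusps-0-0 = record
  { ε = 0ℤ ; η = 0ℤ ; δ₁ = + 2 ; δ₀ = 1ℤ ; γ₄ = 1ℤ ; γ₃ = + 2 ; γ₂ = + 5 ; γ₁ = + 10 ; γ₀ = + 6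
  ; on-curve = solve 1 (λ x → let o = κ 1ℤ in 𝔽S.𝐹 x o := 𝔽S.linear (κ (+ 2)) o x o :* 𝔽S.linear (κ (+ 2)) o x o :+ 𝔽S.quadratic o (κ 0ℤ) (κ 0ℤ) x o :* 𝔽S.quartic o (κ (+ 2)) (κ (+ 5)) (κ (+ 10)) (κ (+ 6)) x o) refl
  ; unit = 3∤1
  ; reduced = reduced-double 0ℤ 0ℤ 0ℤ (solve 1 (λ z → 𝔽S.quadratic (κ 1ℤ) (κ 0ℤ) (κ 0ℤ) (κ 0ℤ :+ z) (κ 1ℤ) := z :* z) refl) }
cusps-1-1 = record
  { ε = + 2 ; η = 1ℤ ; δ₁ = 1ℤ ; δ₀ = 0ℤ ; γ₄ = 1ℤ ; γ₃ = 0ℤ ; γ₂ = + 4 ; γ₁ = + 2 ; γ₀ = 1ℤ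
  ; on-curve = solve 1 (λ x → let o = κ 1ℤ in 𝔽S.𝐹 x o := 𝔽S.linear o (κ 0ℤ) x o :* 𝔽S.linear o (κ 0ℤ) x o :+ 𝔽S.quadratic o (κ (+ 2)) o x o :* 𝔽S.quartic o (κ 0ℤ) (κ (+ 4)) (κ (+ 2)) o x o) refl
  ; unit = 3∤1
  ; reduced = reduced-double -1ℤ (+ 2) 1ℤ (solve 1 (λ z → 𝔽S.quadratic (κ 1ℤ) (κ (+ 2)) (κ 1ℤ) (κ -1ℤ :+ z) (κ 1ℤ) := z :* z) refl) }
cusps-0-1 = record
  { ε = 1ℤ ; η = 0ℤ ; δ₁ = 0ℤ ; δ₀ = 1ℤ ; γ₄ = 1ℤ ; γ₃ = 1ℤ ; γ₂ = + 4 ; γ₁ = + 6 ; γ₀ = + 4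
  ; on-curve = solve 1 (λ x → let o = κ 1ℤ in 𝔽S.𝐹 x o := 𝔽S.linear (κ 0ℤ) o x o :* 𝔽S.linear (κ 0ℤ) o x o :+ 𝔽S.quadratic o o (κ 0ℤ) x o :* 𝔽S.quartic o o (κ (+ 4)) (κ (+ 6)) (κ (+ 4)) x o) refl
  ; unit = 3∤1 ; reduced = reduced-distinct }
cusps-0-1′ = record
  { ε = 1ℤ ; η = 0ℤ ; δ₁ = + 2 ; δ₀ = 1ℤ ; γ₄ = 1ℤ ; γ₃ = 1ℤ ; γ₂ = + 4 ; γ₁ = + 6 ; γ₀ = 0ℤ
  ; on-curve = solve 1 (λ x → let o = κ 1ℤ in 𝔽S.𝐹 x o := 𝔽S.linear (κ (+ 2)) o x o :* 𝔽S.linear (κ (+ 2)) o x o :+ 𝔽S.quadratic o o (κ 0ℤ) x o :* 𝔽S.quartic o o (κ (+ 4)) (κ (+ 6)) (κ 0ℤ) x o) refl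
  ; unit = 3∤-1 ; reduced = reduced-distinct }

-- Irrational abscissae: pairs near the cusps and pairs near x = 1.

primitive-pair : ∀ x y → x ≢ 0ℤ ⊎ y ≢ 0ℤ → ∃[ k ] ∃[ m ] ∃[ n ] x ≡ 3^ k * m × y ≡ 3^ k * n × (¬ 3∣ℤ m ⊎ ¬ 3∣ℤ n)
primitive-pair x y = ℕ.<-rec Goal step (∣ x ∣ ℕ.+ ∣ y ∣) x y refl
  where
  Result : ℤ → ℤ → Set
  Result x y = ∃[ k ] ∃[ m ] ∃[ n ] x ≡ 3^ k * m × y ≡ 3^ k * n × (¬ 3∣ℤ m ⊎ ¬ 3∣ℤ n)
  Goal : ℕ → Set
  Goal s = ∀ x y → ∣ x ∣ ℕ.+ ∣ y ∣ ≡ s → x ≢ 0ℤ ⊎ y ≢ 0ℤ → Result x y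
  step : ∀ s → (∀ {r} → r ℕ.< s → Goal r) → Goal s
  step s rec x y e ne = by (3∣ℤ? x) (3∣ℤ? y)
    where
    by : 3∣ℤ x ⊎ ¬ 3∣ℤ x → 3∣ℤ y ⊎ ¬ 3∣ℤ y → Result x y
    by (inj₂ h) _ = 0 , x , y , sym (ℤ.*-identityˡ x) , sym (ℤ.*-identityˡ y) , inj₁ h
    by _ (inj₂ h) = 0 , x , y , sym (ℤ.*-identityˡ x) , sym (ℤ.*-identityˡ y) , inj₂ h
    by (inj₁ (x′ , x≡)) (inj₁ (y′ , y≡)) = up (rec smaller x′ y′ refl ne′)
      where
      ne′ : x′ ≢ 0ℤ ⊎ y′ ≢ 0ℤ
      ne′ = [ (λ n → inj₁ λ h → n (trans x≡ (cong (+ 3 *_) h))) , (λ n → inj₂ λ h → n (trans y≡ (cong (+ 3 *_) h))) ]′ ne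
      positive : ∣ x′ ∣ ℕ.+ ∣ y′ ∣ ≢ 0
      positive h = [ (λ n → n (ℤ.∣i∣≡0⇒i≡0 (ℕ.m+n≡0⇒m≡0 ∣ x′ ∣ h))) , (λ n → n (ℤ.∣i∣≡0⇒i≡0 (ℕ.m+n≡0⇒n≡0 ∣ x′ ∣ h))) ]′ ne′
      smaller : ∣ x′ ∣ ℕ.+ ∣ y′ ∣ ℕ.< s
      smaller = subst (∣ x′ ∣ ℕ.+ ∣ y′ ∣ ℕ.<_) (trans (ℕ.*-distribʳ-+ 3 ∣ x′ ∣ ∣ y′ ∣) (trans (cong₂ ℕ._+_ (third x≡) (third y≡)) e))
        (ℕ.m<m*n (∣ x′ ∣ ℕ.+ ∣ y′ ∣) 3 {{ℕ.≢-nonZero positive}} (ℕ.s≤s (ℕ.s≤s ℕ.z≤n)))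
        where
        third : ∀ {a b} → a ≡ + 3 * b → ∣ b ∣ ℕ.* 3 ≡ ∣ a ∣
        third {a} {b} h = trans (ℕ.*-comm ∣ b ∣ 3) (trans (sym (ℤ.abs-* (+ 3) b)) (cong ∣_∣ (sym h)))
      up : Result x′ y′ → Result x y
      up (k , m , n , x″ , y″ , h) = suc k , m , n , trans x≡ (trans (cong (+ 3 *_) x″) (sym (ℤ.*-assoc (+ 3) (3^ k) m))) , trans y≡ (trans (cong (+ 3 *_) y″) (sym (ℤ.*-assoc (+ 3) (3^ k) n))) , h

-- t times the norm of l₁x + l₀ for a root x of tx² + px + q.
normForm : (t p q l₁ l₀ : ℤ) → ℤ
normForm t p q l₁ l₀ = t * l₀ * l₀ - p * l₀ * l₁ + q * l₁ * l₁

-- t³ (t² w)² times the norm of (y + h)(y - 3h), where y = (ux + v)/(t²w) and h = x² + x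
norms : (t p q u v w : ℤ) → ℤ
norms t p q u v w = normForm t p q (u + t * w * (t - p)) (v - t * w * q) * normForm t p q (u - + 3 * t * w * (t - p)) (v + + 3 * t * w * q)

-- Being the square of a rational number, with denominators cleared.
IsSquare : ℤ → Set
IsSquare n = ∃[ k ] ∃[ r ] k ≢ 0ℤ × k * k * n ≡ r * r

-- The order at 3 of k²·3m is odd; cancelling 9 repeatedly makes this visible.
3·unit-nonsquare : ∀ {m} → ¬ 3∣ℤ m → ¬ IsSquare (+ 3 * m)
3·unit-nonsquare {m} nm (k , r , k≢0 , e) = go (3-part k k≢0)
  where
  go : ∃[ i ] ∃[ k′ ] k ≡ 3^ i * k′ × ¬ 3∣ℤ k′ → ⊥
  go (i , k′ , k≡ , nk) = descend i r (trans (cong (λ k → + 3 * (k * k * m)) (sym k≡)) (trans (solve 2 (λ k m → κ (+ 3) :* (k :* k :* m) := k :* k :* (κ (+ 3) :* m)) refl k m) e))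
    where
    descend : ∀ i r → + 3 * (3^ i * k′ * (3^ i * k′) * m) ≡ r * r → ⊥
    descend zero r h = [ at , at ]′ (3∣ℤ-prime r r (1ℤ * k′ * (1ℤ * k′) * m , sym h))
      where
      at : 3∣ℤ r → ⊥
      at (r′ , refl) = 3∤ℤ-* (3∤ℤ-* nk nk) nm (r′ * r′ , 3*-injective (trans (solve 2 (λ k m → κ (+ 3) :* (k :* k :* m) := κ (+ 3) :* (κ 1ℤ :* k :* (κ 1ℤ :* k) :* m)) refl k′ m) (trans h (solve 1 (λ r → κ (+ 3) :* r :* (κ (+ 3) :* r) := κ (+ 3) :* (κ (+ 3) :* (r :* r))) refl r′))))
    descend (suc i) r h = [ at , at ]′ (3∣ℤ-prime r r (3^ (suc i) * k′ * (3^ (suc i) * k′) * m , sym h))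
      where
      at : 3∣ℤ r → ⊥
      at (r′ , refl) = descend i r′ (3*-injective (3*-injective (trans (solve 3 (λ n k m → κ (+ 3) :* (κ (+ 3) :* (κ (+ 3) :* (n :* k :* (n :* k) :* m))) := κ (+ 3) :* ((κ (+ 3) :* n) :* k :* ((κ (+ 3) :* n) :* k) :* m)) refl (3^ i) k′ m) (trans h (solve 1 (λ r → κ (+ 3) :* r :* (κ (+ 3) :* r) := κ (+ 3) :* (κ (+ 3) :* (r :* r))) refl r′)))))

module Quotient {A : Set} (_+′_ _*′_ : A → A → A) (-′_ : A → A) (κ′ : ℤ → A) where
  private
    infixl 6 _+″_ _-″_
    infixl 7 _*″_
    _+″_ = _+′_
    _*″_ = _*′_
    _-″_ : A → A → A
    a -″ b = a +′ (-′ b)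

  -- the quotient of (t³wy)² = t⁶w² 𝐹 by t x² + p x + q
  G₄ G₃ G₂ G₁ G₀ : (t p q u w : A) → A
  G₄ t p q u w = t *″ (w *″ w *″ (t *″ t *″ t *″ t))
  G₃ t p q u w = t *″ (w *″ w *″ (κ′ (+ 2) *″ t *″ t *″ t *″ t -″ p *″ t *″ t *″ t))
  G₂ t p q u w = t *″ (w *″ w *″ (κ′ (+ 5) *″ t *″ t *″ t *″ t -″ κ′ (+ 2) *″ p *″ t *″ t *″ t +″ p *″ p *″ t *″ t -″ q *″ t *″ t *″ t))
  G₁ t p q u w = t *″ (w *″ w *″ (κ′ (+ 10) *″ t *″ t *″ t *″ t -″ κ′ (+ 5) *″ p *″ t *″ t *″ t +″ κ′ (+ 2) *″ p *″ p *″ t *″ t -″ p *″ p *″ p *″ t +″ κ′ (+ 2) *″ p *″ q *″ t *″ t -″ κ′ (+ 2) *″ q *″ t *″ t *″ t))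
  G₀ t p q u w = t *″ (w *″ w *″ (κ′ (+ 10) *″ t *″ t *″ t *″ t -″ κ′ (+ 10) *″ p *″ t *″ t *″ t +″ κ′ (+ 5) *″ p *″ p *″ t *″ t -″ κ′ (+ 2) *″ p *″ p *″ p *″ t +″ p *″ p *″ p *″ p
    +″ κ′ (+ 4) *″ p *″ q *″ t *″ t -″ κ′ (+ 3) *″ p *″ p *″ q *″ t -″ κ′ (+ 5) *″ q *″ t *″ t *″ t +″ q *″ q *″ t *″ t) -″ u *″ u)

module Qu = Quotient _+_ _*_ (-_) (λ c → c)
module QuS {n : ℕ} = Quotient {ℤS.Expr n} ℤS._:+_ ℤS._:*_ (ℤS.:-_) ℤS.κ

module QuadraticPoint {t p q u v w : ℤ} (P : Point t p q u v w) where
  G₄ G₃ G₂ G₁ G₀ : ℤ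
  G₄ = Qu.G₄ t p q u w
  G₃ = Qu.G₃ t p q u w
  G₂ = Qu.G₂ t p q u w
  G₁ = Qu.G₁ t p q u w
  G₀ = Qu.G₀ t p q u w

  on : ∀ X Z → t * t * t * w * (t * t * t * w) * 𝔽.𝐹 X Z ≡
    𝔽.linear (t * u) (t * v) X Z * (Z * Z) * (𝔽.linear (t * u) (t * v) X Z * (Z * Z)) + 𝔽.quadratic t p q X Z * 𝔽.quartic G₄ G₃ G₂ G₁ G₀ X Z
  on X Z = zero-difference (trans (identity t p q u v w X Z)
    (trans (cong₂ (λ r s → t * (X * (- r) + Z * (- s)) * (Z * Z * Z * Z * Z)) (difference-zero (Point.lead P)) (difference-zero (Point.last P)))
      (solve 3 (λ t X Z → t :* (X :* (:- κ 0ℤ) :+ Z :* (:- κ 0ℤ)) :* (Z :* Z :* Z :* Z :* Z) := κ 0ℤ) refl t X Z)))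
    where
    identity : ∀ t p q u v w X Z → _
    identity = solve 8 (λ t p q u v w X Z → let b = 𝔽S.linear (t :* u) (t :* v) X Z :* (Z :* Z) in
      t :* t :* t :* w :* (t :* t :* t :* w) :* 𝔽S.𝐹 X Z :- (b :* b :+ 𝔽S.quadratic t p q X Z :* 𝔽S.quartic (QuS.G₄ t p q u w) (QuS.G₃ t p q u w) (QuS.G₂ t p q u w) (QuS.G₁ t p q u w) (QuS.G₀ t p q u w) X Z) :=
      t :* (X :* (:- (κ (+ 2) :* t :* u :* v :- p :* u :* u :- w :* w :* CoS.R₁ t p q)) :+ Z :* (:- (t :* v :* v :- q :* u :* u :- w :* w :* CoS.R₀ t p q))) :* (Z :* Z :* Z :* Z :* Z)) refl

  module _ (nt : ¬ 3∣ℤ t) (nw : ¬ 3∣ℤ w) where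
    -- The pair agrees with the cusps modulo 3 but shares no root with aτ, which is what `nonzero`
    -- expresses. Extracting the power of 3 from the differences of p and q brings it to the form
    -- required by `Subtract`.
    near-cusps : ∀ C → (∀ m₁ m₀ → Cusps.norm C m₁ m₀ ≡ 0ℤ → p ≡ t * Cusps.ε C + + 3 * m₁ → q ≡ t * Cusps.η C + + 3 * m₀ → ⊥) → ∀ s → s * s ≡ 1ℤ →
      3∣ℤ (p - t * Cusps.ε C) → 3∣ℤ (q - t * Cusps.η C) → 3∣ℤ (u - s * w * Cusps.δ₁ C) → 3∣ℤ (v - s * w * Cusps.δ₀ C) → ⊥
    near-cusps C nonzero s s²≡1 (p′ , hp) (q′ , hq) (u′ , hu) (v′ , hv) = by (primitive-pair p′ q′ ne) (cube t)
      where
      open Cusps C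
      move : ∀ {x y z} → x - y ≡ z → x ≡ y + z
      move {x} {y} h = trans (solve 2 (λ x y → x := y :+ (x :- y)) refl x y) (cong (λ z → y + z) h)
      norm-zero : norm 0ℤ 0ℤ ≡ 0ℤ
      norm-zero = solve 2 (λ ε η → κ 0ℤ :* κ 0ℤ :- ε :* κ 0ℤ :* κ 0ℤ :+ η :* κ 0ℤ :* κ 0ℤ := κ 0ℤ) refl ε η
      ne : p′ ≢ 0ℤ ⊎ q′ ≢ 0ℤ
      ne = split (p′ ℤ.≟ 0ℤ) (q′ ℤ.≟ 0ℤ)
        where
        split : Dec (p′ ≡ 0ℤ) → Dec (q′ ≡ 0ℤ) → p′ ≢ 0ℤ ⊎ q′ ≢ 0ℤ
        split (no h) _ = inj₁ h
        split _ (no h) = inj₂ h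
        split (yes h) (yes h′) = ⊥-elim (nonzero 0ℤ 0ℤ norm-zero (trans (move hp) (cong (λ m → t * ε + + 3 * m) h)) (trans (move hq) (cong (λ m → t * η + + 3 * m) h′)))
      -- The curve equation carries the denominator t³w against the line t(ux + v); as t³ ≡ t modulo
      -- 3, the line is still W·bτ modulo 3.
      cube : ∀ t → ∃[ f ] t * t * t ≡ t + + 3 * f
      cube t = go (mod3 t)
        where
        go : _ → ∃[ f ] t * t * t ≡ t + + 3 * f
        go (k , inj₁ refl) = _ , solve 1 (λ k → let t = κ (+ 3) :* k in t :* t :* t := t :+ κ (+ 3) :* (k :* (t :* t :- κ 1ℤ))) refl k
        go (k , inj₂ (inj₁ refl)) = _ , solve 1 (λ k → let t = κ 1ℤ :+ κ (+ 3) :* k in t :* t :* t := t :+ κ (+ 3) :* (t :* k :* (t :+ κ 1ℤ))) refl k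
        go (k , inj₂ (inj₂ refl)) = _ , solve 1 (λ k → let t = κ -1ℤ :+ κ (+ 3) :* k in t :* t :* t := t :+ κ (+ 3) :* (t :* k :* (t :- κ 1ℤ))) refl k
      by : ∃[ k ] ∃[ m ] ∃[ n ] p′ ≡ 3^ k * m × q′ ≡ 3^ k * n × (¬ 3∣ℤ m ⊎ ¬ 3∣ℤ n) → ∃[ f ] t * t * t ≡ t + + 3 * f → ⊥
      by (k , m₁ , m₀ , p≡ , q≡ , nm) (f , t³≡) = Subtract.absurd C k t m₁ m₀ W n₁ n₀ G₄ G₃ G₂ G₁ G₀ (record { on = on′ ; nt = nt ; nw = nW ; nm = nm ; N≢0 = N≢0 })
        where
        W n₁ n₀ : ℤ
        W = s * (t * t * t * w)
        n₁ = t * u′ - s * w * δ₁ * f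
        n₀ = t * v′ - s * w * δ₀ * f
        ns : ¬ 3∣ℤ s
        ns h = 3∤1 (subst 3∣ℤ s²≡1 (∣′-*ˡ {+ 3} s h))
        nW : ¬ 3∣ℤ W
        nW = 3∤ℤ-* ns (3∤ℤ-* (3∤ℤ-* (3∤ℤ-* nt nt) nt) nw)
        N≢0 : norm m₁ m₀ ≢ 0ℤ
        N≢0 h = nonzero (3^ k * m₁) (3^ k * m₀) (trans (solve 5 (λ ε η n x y → (n :* y) :* (n :* y) :- ε :* (n :* y) :* (n :* x) :+ η :* (n :* x) :* (n :* x) := n :* n :* (y :* y :- ε :* y :* x :+ η :* x :* x)) refl ε η (3^ k) m₁ m₀)
            (trans (cong (3^ k * 3^ k *_) h) (ℤ.*-zeroʳ (3^ k * 3^ k))))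
          (trans (move hp) (cong (λ m → t * ε + + 3 * m) p≡)) (trans (move hq) (cong (λ m → t * η + + 3 * m) q≡))
        B≡ : ∀ {x x′ δ} → x - s * w * δ ≡ + 3 * x′ → t * x ≡ W * δ + + 3 * (t * x′ - s * w * δ * f)
        B≡ {x} {x′} {δ} h = trans (cong (t *_) (move h)) (trans (solve 6 (λ t s w δ x f → t :* (s :* w :* δ :+ κ (+ 3) :* x) := s :* ((t :+ κ (+ 3) :* f) :* w) :* δ :+ κ (+ 3) :* (t :* x :- s :* w :* δ :* f)) refl t s w δ x′ f)
          (cong (λ c → s * (c * w) * δ + + 3 * (t * x′ - s * w * δ * f)) (sym t³≡)))
        coefficient : ∀ {x y z n} → x - y ≡ + 3 * z → z ≡ 3^ k * n → x ≡ y + + 3 * 3^ k * n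
        coefficient {x} {y} {z} {n} h e = trans (move h) (cong (λ c → y + c) (trans (cong (+ 3 *_) e) (sym (ℤ.*-assoc (+ 3) (3^ k) n))))
        on′ : ∀ X Z → W * W * 𝔽.𝐹 X Z ≡ 𝔽.linear (W * δ₁ + + 3 * n₁) (W * δ₀ + + 3 * n₀) X Z * (Z * Z) * (𝔽.linear (W * δ₁ + + 3 * n₁) (W * δ₀ + + 3 * n₀) X Z * (Z * Z))
          + 𝔽.quadratic t (t * ε + + 3 * 3^ k * m₁) (t * η + + 3 * 3^ k * m₀) X Z * 𝔽.quartic G₄ G₃ G₂ G₁ G₀ X Z
        on′ X Z = trans (solve 3 (λ s c F → s :* c :* (s :* c) :* F := s :* s :* (c :* c :* F)) refl s (t * t * t * w) (𝔽.𝐹 X Z))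
          (trans (cong₂ _*_ s²≡1 (on X Z)) (trans (ℤ.*-identityˡ _)
            (cong₂ _+_ (cong₂ (λ b b₀ → 𝔽.linear b b₀ X Z * (Z * Z) * (𝔽.linear b b₀ X Z * (Z * Z))) (B≡ {u} {u′} {δ₁} hu) (B≡ {v} {v′} {δ₀} hv))
              (cong₂ (λ p q → 𝔽.quadratic t p q X Z * 𝔽.quartic G₄ G₃ G₂ G₁ G₀ X Z) (coefficient {p} {t * ε} hp p≡) (coefficient {q} {t * η} hq q≡)))))

    -- Write a = tx² + px + q and compare t⁶w²F = b² + aG at x = 1 up to second order. This gives in
    -- turn that 3 divides b(1), that a(1) is exactly divisible by 3 with G(1) prime to 3, that 3
    -- divides a′(1), and that u is prime to 3. Expanding `normForm` about x = 1, the factor from y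
    -- + h is prime to 3, while the one from y - 3h is exactly divisible by 3.
    near-one : 3∣ℤ (t + p + q) → ¬ IsSquare (norms t p q u v w)
    near-one (a₁ , a₁≡) = with-b (cancel-t (3∣ℤ-square (t * (u + v)) 3∣b²))
      where
      G G′ G″ : ℤ
      G = G₄ + G₃ + G₂ + G₁ + G₀
      G′ = + 4 * G₄ + + 3 * G₃ + + 2 * G₂ + G₁
      G″ = + 6 * G₄ + + 3 * G₃ + G₂
      3∣ℤ-square : ∀ x → 3∣ℤ (x * x) → 3∣ℤ x
      3∣ℤ-square x h = [ (λ d → d) , (λ d → d) ]′ (3∣ℤ-prime x x h)
      cancel-t : ∀ {x} → 3∣ℤ (t * x) → 3∣ℤ x
      cancel-t {x} h = [ (λ d → ⊥-elim (nt d)) , (λ d → d) ]′ (3∣ℤ-prime t x h)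
      W = t * t * t * w
      nW : ¬ 3∣ℤ W
      nW = 3∤ℤ-* (3∤ℤ-* (3∤ℤ-* nt nt) nt) nw
      -- F(1) = 33, the value of the curve equation at x = 1.
      value : + 33 * (W * W) ≡ t * (u + v) * (t * (u + v)) + (t + p + q) * G
      value = trans (solve 1 (λ W → κ (+ 33) :* (W :* W) := W :* W :* 𝔽S.𝐹 (κ 1ℤ) (κ 1ℤ)) refl W) (trans (on 1ℤ 1ℤ)
        (solve 11 (λ t p q u v G₄ G₃ G₂ G₁ G₀ z → let
            o = κ 1ℤ
            b = 𝔽S.linear (t :* u) (t :* v) o o :* (o :* o) in
          b :* b :+ 𝔽S.quadratic t p q o o :* 𝔽S.quartic G₄ G₃ G₂ G₁ G₀ o o := t :* (u :+ v) :* (t :* (u :+ v)) :+ (t :+ p :+ q) :* (G₄ :+ G₃ :+ G₂ :+ G₁ :+ G₀)) refl t p q u v G₄ G₃ G₂ G₁ G₀ 0ℤ))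
      -- F′(1) = 90, the first derivative of the curve equation at x = 1.
      derivative : + 90 * (W * W) ≡ + 2 * (t * (u + v)) * (t * u) + (+ 2 * t + p) * G + (t + p + q) * G′
      derivative = zero-difference (trans (identity t p q u v w) (trans (cong (λ r → - (t * r)) (cong₂ (λ r s → 1ℤ * r + 0ℤ * s) (difference-zero (Point.lead P)) (difference-zero (Point.last P)))) (solve 1 (λ t → :- (t :* κ 0ℤ) := κ 0ℤ) refl t)))
        where
        identity : ∀ t p q u v w → _
        identity = solve 6 (λ t p q u v w → let
            G₄ = QuS.G₄ t p q u w
            G₃ = QuS.G₃ t p q u w
            G₂ = QuS.G₂ t p q u w
            G₁ = QuS.G₁ t p q u w
            G₀ = QuS.G₀ t p q u w
            W = t :* t :* t :* w in
          κ (+ 90) :* (W :* W) :- (κ (+ 2) :* (t :* (u :+ v)) :* (t :* u) :+ (κ (+ 2) :* t :+ p) :* (G₄ :+ G₃ :+ G₂ :+ G₁ :+ G₀) :+ (t :+ p :+ q) :* (κ (+ 4) :* G₄ :+ κ (+ 3) :* G₃ :+ κ (+ 2) :* G₂ :+ G₁))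
          := :- (t :* (κ 1ℤ :* (κ (+ 2) :* t :* u :* v :- p :* u :* u :- w :* w :* CoS.R₁ t p q) :+ κ 0ℤ :* (t :* v :* v :- q :* u :* u :- w :* w :* CoS.R₀ t p q)))) refl
      -- F″(1)/2 = 105, the coefficient of (x - 1)² in the curve equation.
      second : + 105 * (W * W) ≡ t * u * (t * u) + t * G + (+ 2 * t + p) * G′ + (t + p + q) * G″
      second = identity t p q u v w
        where
        identity : ∀ t p q u v w → _
        identity = solve 6 (λ t p q u v w → let
            G₄ = QuS.G₄ t p q u w
            G₃ = QuS.G₃ t p q u w
            G₂ = QuS.G₂ t p q u w
            G₁ = QuS.G₁ t p q u w
            G₀ = QuS.G₀ t p q u w
            W = t :* t :* t :* w in
          κ (+ 105) :* (W :* W) := t :* u :* (t :* u) :+ t :* (G₄ :+ G₃ :+ G₂ :+ G₁ :+ G₀) :+ (κ (+ 2) :* t :+ p) :* (κ (+ 4) :* G₄ :+ κ (+ 3) :* G₃ :+ κ (+ 2) :* G₂ :+ G₁) :+ (t :+ p :+ q) :* (κ (+ 6) :* G₄ :+ κ (+ 3) :* G₃ :+ G₂)) refl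
      3∣b² : 3∣ℤ (t * (u + v) * (t * (u + v)))
      3∣b² = + 11 * (W * W) - a₁ * G , trans (solve 3 (λ b a G → b :* b := (b :* b :+ a :* G) :- a :* G) refl (t * (u + v)) (t + p + q) G)
        (trans (cong₂ (λ x y → x - y * G) (sym value) a₁≡) (solve 3 (λ W a G → κ (+ 33) :* W :- κ (+ 3) :* a :* G := κ (+ 3) :* (κ (+ 11) :* W :- a :* G)) refl (W * W) a₁ G))
      with-b : 3∣ℤ (u + v) → ¬ IsSquare (norms t p q u v w)
      with-b (b₁ , b₁≡) sq = with-p (cancel-G (3∣ℤ-p))
        where
        α·G : a₁ * G ≡ + 11 * (W * W) - + 3 * (t * b₁ * (t * b₁))
        α·G = 3*-injective (trans (solve 3 (λ a G b → κ (+ 3) :* (a :* G) := (b :* b :+ κ (+ 3) :* a :* G) :- b :* b) refl a₁ G (t * (+ 3 * b₁)))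
          (trans (cong (_- t * (+ 3 * b₁) * (t * (+ 3 * b₁))) (trans (cong₂ (λ b a → t * b * (t * b) + a * G) (sym b₁≡) (sym a₁≡)) (sym value)))
            (solve 3 (λ W t b → κ (+ 33) :* W :- t :* (κ (+ 3) :* b) :* (t :* (κ (+ 3) :* b)) := κ (+ 3) :* (κ (+ 11) :* W :- κ (+ 3) :* (t :* b :* (t :* b)))) refl (W * W) t b₁)))
        nαG : ¬ 3∣ℤ (a₁ * G)
        nαG = 3∤ℤ-cong { - (W * W)} (λ h → 3∤ℤ-* nW nW (subst 3∣ℤ (ℤ.neg-involutive (W * W)) (∣′-neg {+ 3} h))) (_ , trans (cong (_- (- (W * W))) α·G) (solve 2 (λ W b → κ (+ 11) :* W :- κ (+ 3) :* b :- (:- W) := κ (+ 3) :* (κ (+ 4) :* W :- b)) refl (W * W) (t * b₁ * (t * b₁))))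
        nα : ¬ 3∣ℤ a₁
        nα h = nαG (∣′-*ʳ {+ 3} G h)
        nG : ¬ 3∣ℤ G
        nG h = nαG (∣′-*ˡ {+ 3} a₁ h)
        3∣ℤ-p : 3∣ℤ ((+ 2 * t + p) * G)
        3∣ℤ-p = _ , trans (solve 4 (λ x y G a → y := (x :+ y :+ a) :- x :- a) refl (+ 2 * (t * (u + v)) * (t * u)) ((+ 2 * t + p) * G) G ((t + p + q) * G′))
          (trans (cong₂ (λ d a → d - + 2 * (t * (u + v)) * (t * u) - a * G′) (sym derivative) a₁≡)
            (trans (cong (λ b → + 90 * (W * W) - + 2 * (t * b) * (t * u) - + 3 * a₁ * G′) b₁≡)
              (solve 6 (λ W t b u a G → κ (+ 90) :* W :- κ (+ 2) :* (t :* (κ (+ 3) :* b)) :* (t :* u) :- κ (+ 3) :* a :* G := κ (+ 3) :* (κ (+ 30) :* W :- κ (+ 2) :* (t :* b) :* (t :* u) :- a :* G)) refl (W * W) t b₁ u a₁ G′)))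
        cancel-G : 3∣ℤ ((+ 2 * t + p) * G) → 3∣ℤ (+ 2 * t + p)
        cancel-G h = [ (λ d → d) , (λ d → ⊥-elim (nG d)) ]′ (3∣ℤ-prime (+ 2 * t + p) G h)
        with-p : 3∣ℤ (+ 2 * t + p) → ⊥
        with-p (p₁ , p₁≡) = 3·unit-nonsquare {M} nM (subst IsSquare norms≡ sq)
          where
          nu : ¬ 3∣ℤ u
          nu (u₁ , refl) = 3∤ℤ-* nt nG (_ , trans (solve 4 (λ x y z s → y := (x :+ y :+ z :+ s) :- x :- z :- s) refl (t * (+ 3 * u₁) * (t * (+ 3 * u₁))) (t * G) ((+ 2 * t + p) * G′) ((t + p + q) * G″))
            (trans (cong (λ s → s - t * (+ 3 * u₁) * (t * (+ 3 * u₁)) - (+ 2 * t + p) * G′ - (t + p + q) * G″) (sym second))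
              (trans (cong₂ (λ x y → + 105 * (W * W) - t * (+ 3 * u₁) * (t * (+ 3 * u₁)) - x * G′ - y * G″) p₁≡ a₁≡)
                (solve 7 (λ W t u p G a H → κ (+ 105) :* W :- t :* (κ (+ 3) :* u) :* (t :* (κ (+ 3) :* u)) :- κ (+ 3) :* p :* G :- κ (+ 3) :* a :* H
                  := κ (+ 3) :* (κ (+ 35) :* W :- t :* u :* (t :* (κ (+ 3) :* u)) :- p :* G :- a :* H)) refl (W * W) t u₁ p₁ G′ a₁ G″))))
          e₁ d₁ d₀ M₁ M₂ M : ℤ
          e₁ = u + t * w * (t - p)
          d₁ = u - + 3 * t * w * (t - p)
          d₀ = b₁ - t * w * (t - p - q)
          M₁ = t * (+ 3 * b₁ + t * w * (t - p - q)) * (+ 3 * b₁ + t * w * (t - p - q)) - + 3 * p₁ * (+ 3 * b₁ + t * w * (t - p - q)) * e₁ + + 3 * a₁ * e₁ * e₁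
          M₂ = + 3 * t * d₀ * d₀ - + 3 * p₁ * d₀ * d₁ + a₁ * d₁ * d₁
          M = M₁ * M₂
          norms≡ : norms t p q u v w ≡ + 3 * M
          norms≡ = trans (cong₂ _*_ first last′) (solve 2 (λ x y → x :* (κ (+ 3) :* y) := κ (+ 3) :* (x :* y)) refl M₁ M₂)
            where
            shift : ∀ l₁ l₀ → normForm t p q l₁ l₀ ≡ t * (l₁ + l₀) * (l₁ + l₀) - + 3 * p₁ * (l₁ + l₀) * l₁ + + 3 * a₁ * l₁ * l₁
            shift l₁ l₀ = trans (solve 5 (λ t p q l₁ l₀ → t :* l₀ :* l₀ :- p :* l₀ :* l₁ :+ q :* l₁ :* l₁ := t :* (l₁ :+ l₀) :* (l₁ :+ l₀) :- (κ (+ 2) :* t :+ p) :* (l₁ :+ l₀) :* l₁ :+ (t :+ p :+ q) :* l₁ :* l₁) refl t p q l₁ l₀)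
              (cong₂ (λ x y → t * (l₁ + l₀) * (l₁ + l₀) - x * (l₁ + l₀) * l₁ + y * l₁ * l₁) p₁≡ a₁≡)
            first : normForm t p q e₁ (v - t * w * q) ≡ M₁
            first = trans (shift e₁ (v - t * w * q)) (cong (λ s → t * s * s - + 3 * p₁ * s * e₁ + + 3 * a₁ * e₁ * e₁)
              (trans (solve 6 (λ t p q u v w → u :+ t :* w :* (t :- p) :+ (v :- t :* w :* q) := (u :+ v) :+ t :* w :* (t :- p :- q)) refl t p q u v w) (cong (_+ t * w * (t - p - q)) b₁≡)))
            last′ : normForm t p q d₁ (v + + 3 * t * w * q) ≡ + 3 * M₂
            last′ = trans (shift d₁ (v + + 3 * t * w * q)) (trans (cong (λ s → t * s * s - + 3 * p₁ * s * d₁ + + 3 * a₁ * d₁ * d₁)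
                (trans (solve 6 (λ t p q u v w → u :- κ (+ 3) :* t :* w :* (t :- p) :+ (v :+ κ (+ 3) :* t :* w :* q) := (u :+ v) :- κ (+ 3) :* (t :* w :* (t :- p :- q))) refl t p q u v w)
                  (trans (cong (_- + 3 * (t * w * (t - p - q))) b₁≡) (solve 2 (λ b x → κ (+ 3) :* b :- κ (+ 3) :* x := κ (+ 3) :* (b :- x)) refl b₁ (t * w * (t - p - q))))))
              (solve 5 (λ t p a d₁ d₀ → t :* (κ (+ 3) :* d₀) :* (κ (+ 3) :* d₀) :- κ (+ 3) :* p :* (κ (+ 3) :* d₀) :* d₁ :+ κ (+ 3) :* a :* d₁ :* d₁ := κ (+ 3) :* (κ (+ 3) :* t :* d₀ :* d₀ :- κ (+ 3) :* p :* d₀ :* d₁ :+ a :* d₁ :* d₁)) refl t p₁ a₁ d₁ d₀))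
          nM : ¬ 3∣ℤ M
          nM = 3∤ℤ-* nM₁ nM₂
            where
            s = + 3 * b₁ + t * w * (t - p - q)
            ns : ¬ 3∣ℤ s
            ns = 3∤ℤ-cong { - (t * w * t)} (λ h → 3∤ℤ-* (3∤ℤ-* nt nw) nt (subst 3∣ℤ (ℤ.neg-involutive (t * w * t)) (∣′-neg {+ 3} h)))
              (b₁ + t * w * (t - a₁) , trans (solve 5 (λ t p q w b → κ (+ 3) :* b :+ t :* w :* (t :- p :- q) :- (:- (t :* w :* t)) := κ (+ 3) :* b :+ t :* w :* (κ (+ 3) :* t :- (t :+ p :+ q))) refl t p q w b₁)
                (trans (cong (λ a → + 3 * b₁ + t * w * (+ 3 * t - a)) a₁≡) (solve 4 (λ t w b a → κ (+ 3) :* b :+ t :* w :* (κ (+ 3) :* t :- κ (+ 3) :* a) := κ (+ 3) :* (b :+ t :* w :* (t :- a))) refl t w b₁ a₁)))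
            nM₁ : ¬ 3∣ℤ M₁
            nM₁ = 3∤ℤ-cong (3∤ℤ-* (3∤ℤ-* nt ns) ns) (_ , solve 5 (λ x p s e a → x :- κ (+ 3) :* p :* s :* e :+ κ (+ 3) :* a :* e :* e :- x := κ (+ 3) :* (a :* e :* e :- p :* s :* e)) refl (t * s * s) p₁ s e₁ a₁)
            nd : ¬ 3∣ℤ d₁
            nd = 3∤ℤ-cong nu (_ , solve 4 (λ u t w p → u :- κ (+ 3) :* t :* w :* (t :- p) :- u := κ (+ 3) :* (:- (t :* w :* (t :- p)))) refl u t w p)
            nM₂ : ¬ 3∣ℤ M₂
            nM₂ = 3∤ℤ-cong (3∤ℤ-* (3∤ℤ-* nα nd) nd) (_ , solve 5 (λ t p a d₀ d₁ → κ (+ 3) :* t :* d₀ :* d₀ :- κ (+ 3) :* p :* d₀ :* d₁ :+ a :* d₁ :* d₁ :- a :* d₁ :* d₁ := κ (+ 3) :* (t :* d₀ :* d₀ :- p :* d₀ :* d₁)) refl t p₁ a₁ d₀ d₁)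

*-nonzero : ∀ {x y} → x ≢ 0ℤ → y ≢ 0ℤ → x * y ≢ 0ℤ
*-nonzero {x} x≢0 y≢0 h = y≢0 (ℤ-integral x h x≢0)

isSquare-cancel : ∀ {n x} → n ≢ 0ℤ → IsSquare (n * n * x) → IsSquare x
isSquare-cancel {n} {x} n≢0 (k , r , k≢0 , e) = k * n , r , *-nonzero k≢0 n≢0 , trans (solve 3 (λ k n x → k :* n :* (k :* n) :* x := k :* k :* (n :* n :* x)) refl k n x) e

module _ {t p q : ℤ} (nt : ¬ 3∣ℤ t) (q≢0 : q ≢ 0ℤ) (t-p+q≢0 : t - p + q ≢ 0ℤ) where

  no-integral-point : ∀ {u v w} → ¬ 3∣ℤ w → Point t p q u v w → ¬ IsSquare (norms t p q u v w)
  no-integral-point {u} {v} {w} nw P sq =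
    [ nt , [ nw , [ (λ n → n (0ℤ , difference-zero (Point.lead P))) , [ (λ n → n (0ℤ , difference-zero (Point.last P))) , [ (λ h → near-one nt nw h sq) ,
      [ at-0-0 1ℤ refl , [ at-0-0 -1ℤ refl , [ at-1-1 1ℤ refl , [ at-1-1 -1ℤ refl , [ at-0-1 1ℤ refl , [ at-0-1 -1ℤ refl , [ at-0-1′ 1ℤ refl , at-0-1′ -1ℤ refl ]′ ]′ ]′ ]′ ]′ ]′ ]′ ]′ ]′ ]′ ]′ ]′
      (classify t p q u v w)
    where
    open QuadraticPoint P
    Near : ℤ → ℤ → ℤ → ℤ → ℤ → Set
    Near ε η δ₁ δ₀ s = 3∣ℤ (p - t * ε) × 3∣ℤ (q - t * η) × 3∣ℤ (u - s * w * δ₁) × 3∣ℤ (v - s * w * δ₀)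
    distinct : ∀ m₁ m₀ → m₀ * m₀ - 1ℤ * m₀ * m₁ + 0ℤ * m₁ * m₁ ≡ 0ℤ → p ≡ t * 1ℤ + + 3 * m₁ → q ≡ t * 0ℤ + + 3 * m₀ → ⊥
    distinct m₁ m₀ h p≡ q≡ = *-nonzero q≢0 t-p+q≢0 (trans (cong₂ (λ p q → q * (t - p + q)) p≡ q≡)
      (trans (solve 3 (λ t m₁ m₀ → let q = t :* κ 0ℤ :+ κ (+ 3) :* m₀ in q :* (t :- (t :* κ 1ℤ :+ κ (+ 3) :* m₁) :+ q) := κ (+ 9) :* (m₀ :* m₀ :- κ 1ℤ :* m₀ :* m₁ :+ κ 0ℤ :* m₁ :* m₁)) refl t m₁ m₀) (cong (+ 9 *_) h)))
    at-0-0 : ∀ s → s * s ≡ 1ℤ → Near 0ℤ 0ℤ (+ 2) 1ℤ s → ⊥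
    at-0-0 s e (hp , hq , hu , hv) = near-cusps nt nw cusps-0-0 (λ m₁ m₀ h p≡ q≡ → *-nonzero q≢0 q≢0 (trans (cong₂ _*_ q≡ q≡)
      (trans (solve 3 (λ t m₁ m₀ → let q = t :* κ 0ℤ :+ κ (+ 3) :* m₀ in q :* q := κ (+ 9) :* (m₀ :* m₀ :- κ 0ℤ :* m₀ :* m₁ :+ κ 0ℤ :* m₁ :* m₁)) refl t m₁ m₀) (cong (+ 9 *_) h)))) s e hp hq hu hv
    at-1-1 : ∀ s → s * s ≡ 1ℤ → Near (+ 2) 1ℤ 1ℤ 0ℤ s → ⊥
    at-1-1 s e (hp , hq , hu , hv) = near-cusps nt nw cusps-1-1 (λ m₁ m₀ h p≡ q≡ → *-nonzero t-p+q≢0 t-p+q≢0 (trans (cong₂ (λ p q → (t - p + q) * (t - p + q)) p≡ q≡)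
      (trans (solve 3 (λ t m₁ m₀ → let s = t :- (t :* κ (+ 2) :+ κ (+ 3) :* m₁) :+ (t :* κ 1ℤ :+ κ (+ 3) :* m₀) in s :* s := κ (+ 9) :* (m₀ :* m₀ :- κ (+ 2) :* m₀ :* m₁ :+ κ 1ℤ :* m₁ :* m₁)) refl t m₁ m₀) (cong (+ 9 *_) h)))) s e hp hq hu hv
    at-0-1 : ∀ s → s * s ≡ 1ℤ → Near 1ℤ 0ℤ 0ℤ 1ℤ s → ⊥
    at-0-1 s e (hp , hq , hu , hv) = near-cusps nt nw cusps-0-1 distinct s e hp hq hu hv
    at-0-1′ : ∀ s → s * s ≡ 1ℤ → Near 1ℤ 0ℤ (+ 2) 1ℤ s → ⊥
    at-0-1′ s e (hp , hq , hu , hv) = near-cusps nt nw cusps-0-1′ distinct s e hp hq hu hv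

  no-quadratic-point : ∀ {u v w} → w ≢ 0ℤ → Point t p q u v w → ¬ IsSquare (norms t p q u v w)
  no-quadratic-point {u} {v} {w} w≢0 P sq = by (3-part w w≢0)
    where
    by : ∃[ j ] ∃[ w′ ] w ≡ 3^ j * w′ × ¬ 3∣ℤ w′ → ⊥
    by (j , w′ , w≡ , nw) = go (point-integral j nt w≢0 P (w′ , w≡))
      where
      n = 3^ j
      cancel : ∀ {x y} → n * (n * x) ≡ n * (n * y) → x ≡ y
      cancel h = 3^-cancel′ j (3^-cancel′ j h)
      go : n ∣′ u × n ∣′ v → ⊥
      go ((u′ , u≡) , (v′ , v≡)) = no-integral-point nw P′ (isSquare-cancel (*-nonzero (3^-nonzero j) (3^-nonzero j)) (subst IsSquare norms≡ sq))
        where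
        P₁ : Point t p q (n * u′) (n * v′) (n * w′)
        P₁ = subst₂ (λ u v → Point t p q u v (n * w′)) u≡ v≡ (subst (Point t p q u v) w≡ P)
        P′ : Point t p q u′ v′ w′
        P′ = point
          (cancel (trans (solve 5 (λ n t p u v → n :* (n :* (κ (+ 2) :* t :* u :* v :- p :* u :* u)) := κ (+ 2) :* t :* (n :* u) :* (n :* v) :- p :* (n :* u) :* (n :* u)) refl n t p u′ v′)
            (trans (Point.lead P₁) (solve 3 (λ n w r → n :* w :* (n :* w) :* r := n :* (n :* (w :* w :* r))) refl n w′ (Remainder.R₁ t p q)))))
          (cancel (trans (solve 5 (λ n t q u v → n :* (n :* (t :* v :* v :- q :* u :* u)) := t :* (n :* v) :* (n :* v) :- q :* (n :* u) :* (n :* u)) refl n t q u′ v′)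
            (trans (Point.last P₁) (solve 3 (λ n w r → n :* w :* (n :* w) :* r := n :* (n :* (w :* w :* r))) refl n w′ (Remainder.R₀ t p q)))))
        norms≡ : norms t p q u v w ≡ n * n * (n * n) * norms t p q u′ v′ w′
        norms≡ = trans (cong₂ (λ u v → norms t p q u v w) u≡ v≡) (trans (cong (norms t p q (n * u′) (n * v′)) w≡)
          (solve 7 (λ t p q u v w n → let
              N = λ l₁ l₀ → t :* l₀ :* l₀ :- p :* l₀ :* l₁ :+ q :* l₁ :* l₁
              norms = λ u v w → N (u :+ t :* w :* (t :- p)) (v :- t :* w :* q) :* N (u :- κ (+ 3) :* t :* w :* (t :- p)) (v :+ κ (+ 3) :* t :* w :* q) in
            norms (n :* u) (n :* v) (n :* w) := n :* n :* (n :* n) :* norms u v w) refl t p q u′ v′ w′ n))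

-- Rational abscissa with irrational ordinate: a Fermat descent.

module _ where
  open ℕS using (con) renaming (solve to solveₙ; _:+_ to infixl 6 _⊞_; _:*_ to infixl 7 _⊠_; _:=_ to infix 4 _⊜_)

  cancelₙ : ∀ {g m n} → g ≢ 0 → g ∙ m ≡ g ∙ n → m ≡ n
  cancelₙ {g} {m} {n} g≢0 = ℕ.*-cancelˡ-≡ m n g {{ℕ.≢-nonZero g≢0}}

  coprime-part : ∀ m n → m ≢ 0 ⊎ n ≢ 0 → ∃[ g ] ∃[ m′ ] ∃[ n′ ] g ≢ 0 × m ≡ g ∙ m′ × n ≡ g ∙ n′ × Coprime m′ n′
  coprime-part m n ne = go (gcd[m,n]∣m m n) (gcd[m,n]∣n m n)
    where
    g = gcd m n
    g≢0 : g ≢ 0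
    g≢0 = gcd[m,n]≢0 m n ne
    go : g ∣ m → g ∣ n → ∃[ g ] ∃[ m′ ] ∃[ n′ ] g ≢ 0 × m ≡ g ∙ m′ × n ≡ g ∙ n′ × Coprime m′ n′
    go (divides m′ m≡) (divides n′ n≡) = g , m′ , n′ , g≢0 , trans m≡ (ℕ.*-comm m′ g) , trans n≡ (ℕ.*-comm n′ g) , coprime
      where
      lift : ∀ {d x y} → d ∣ x → y ≡ x ∙ g → d ∙ g ∣ y
      lift {d} (divides q refl) e = divides q (trans e (ℕ.*-assoc q d g))
      coprime : Coprime m′ n′
      coprime {d} (d∣m , d∣n) = ∣1⇒≡1 (*-cancelʳ-∣ g {{ℕ.≢-nonZero g≢0}} (subst (d ∙ g ∣_) (sym (ℕ.*-identityˡ g)) (gcd-greatest (lift d∣m m≡) (lift d∣n n≡))))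

  coprime-∣ˡ : ∀ {a b c} → a ∣ b → Coprime b c → Coprime a c
  coprime-∣ˡ a∣b cop (d∣a , d∣c) = cop (∣-trans d∣a a∣b , d∣c)

  coprime-* : ∀ {a b c} → Coprime a c → Coprime b c → Coprime (a ∙ b) c
  coprime-* {a} {b} {c} ca cb {d} (d∣ab , d∣c) = cb (coprime-divisor (coprime-∣ˡ d∣c (Coprimality.sym ca)) d∣ab , d∣c)

  coprime-*ʳ : ∀ {a b c} → Coprime a b → Coprime a c → Coprime a (b ∙ c)
  coprime-*ʳ cb cc = Coprimality.sym (coprime-* (Coprimality.sym cb) (Coprimality.sym cc))

  -- With r the greatest common divisor of u and w, both u/r and r divide each other, so u = r².
  coprime-squares : ∀ {u v w} → u ≢ 0 → Coprime u v → u ∙ v ≡ w ∙ w → ∃[ r ] ∃[ s ] u ≡ r ∙ r × v ≡ s ∙ s × w ≡ r ∙ s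
  coprime-squares {u} {v} {w} u≢0 cop e = go (coprime-part u w (inj₁ u≢0))
    where
    go : ∃[ g ] ∃[ u′ ] ∃[ w′ ] g ≢ 0 × u ≡ g ∙ u′ × w ≡ g ∙ w′ × Coprime u′ w′ → ∃[ r ] ∃[ s ] u ≡ r ∙ r × v ≡ s ∙ s × w ≡ r ∙ s
    go (g , u′ , w′ , g≢0 , u≡ , w≡ , cop′) = g , w′ , trans u≡ (cong (g ∙_) u′≡g) , cancelₙ g≢0 (trans (cong (_∙ v) (sym u′≡g)) e′) , w≡
      where
      e′ : u′ ∙ v ≡ g ∙ (w′ ∙ w′)
      e′ = cancelₙ g≢0 (trans (sym (ℕ.*-assoc g u′ v)) (trans (cong (_∙ v) (sym u≡)) (trans e (trans (cong₂ _∙_ w≡ w≡)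
        (solveₙ 2 (λ g w → g ⊠ w ⊠ (g ⊠ w) ⊜ g ⊠ (g ⊠ (w ⊠ w))) refl g w′)))))
      u′∣g : u′ ∣ g
      u′∣g = coprime-divisor {n = w′ ∙ w′} (coprime-*ʳ cop′ cop′) (subst (u′ ∣_) (trans e′ (ℕ.*-comm g (w′ ∙ w′))) (m∣m*n v))
      g∣u′ : g ∣ u′
      g∣u′ = coprime-divisor {n = v} (coprime-∣ˡ (subst (g ∣_) (sym u≡) (m∣m*n u′)) cop) (subst (g ∣_) (trans (sym e′) (ℕ.*-comm u′ v)) (m∣m*n (w′ ∙ w′)))
      u′≡g : u′ ≡ g
      u′≡g = ∣-antisym u′∣g g∣u′

  -- Take i to be the greatest common divisor of a and m; the cofactor of m is then prime to that of
  -- a and divides b.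
  four-numbers : ∀ {a b m n} → a ≢ 0 → m ≢ 0 → a ∙ b ≡ m ∙ n → ∃[ i ] ∃[ j ] ∃[ k ] ∃[ l ] m ≡ i ∙ j × n ≡ k ∙ l × a ≡ i ∙ k × b ≡ j ∙ l × Coprime j k
  four-numbers {a} {b} {m} {n} a≢0 m≢0 e = go (coprime-part a m (inj₁ a≢0))
    where
    Result : Set
    Result = ∃[ i ] ∃[ j ] ∃[ k ] ∃[ l ] m ≡ i ∙ j × n ≡ k ∙ l × a ≡ i ∙ k × b ≡ j ∙ l × Coprime j k
    go : ∃[ g ] ∃[ a′ ] ∃[ m′ ] g ≢ 0 × a ≡ g ∙ a′ × m ≡ g ∙ m′ × Coprime a′ m′ → Result
    go (i , k , j , i≢0 , a≡ , m≡ , cop) = at (coprime-divisor {n = k} (Coprimality.sym cop) (subst (j ∣_) (sym e′) (m∣m*n n)))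
      where
      e′ : k ∙ b ≡ j ∙ n
      e′ = cancelₙ i≢0 (trans (sym (ℕ.*-assoc i k b)) (trans (cong (_∙ b) (sym a≡)) (trans e (trans (cong (_∙ n) m≡) (ℕ.*-assoc i j n)))))
      j≢0 : j ≢ 0
      j≢0 h = m≢0 (trans m≡ (trans (cong (i ∙_) h) (ℕ.*-zeroʳ i)))
      at : j ∣ b → Result
      at (divides l b≡) = i , j , k , l , m≡ , cancelₙ j≢0 (trans (sym e′) (trans (cong (k ∙_) b≡) (solveₙ 3 (λ j k l → k ⊠ (l ⊠ j) ⊜ j ⊠ (k ⊠ l)) refl j k l))) , a≡ , trans b≡ (ℕ.*-comm l j) , (λ {d} → Coprimality.sym cop {d})

  Odd : ℕ → Set
  Odd n = ∃[ k ] n ≡ 1 ∔ 2 ∙ k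

  parity : ∀ n → 2 ∣ n ⊎ Odd n
  parity zero = inj₁ (divides 0 refl)
  parity (suc n) = [ (λ { (divides k e) → inj₂ (k , cong suc (trans e (ℕ.*-comm k 2))) }) , (λ { (k , e) → inj₁ (divides (suc k) (cong suc (trans e (cong suc (ℕ.*-comm 2 k))))) }) ]′ (parity n)

  odd≢even : ∀ {k l} → 1 ∔ 2 ∙ k ≡ 2 ∙ l → ⊥
  odd≢even {zero} {suc l} h = case trans h (ℕ.*-suc 2 l) of λ ()
  odd≢even {suc k} {suc l} h = odd≢even {k} {l} (ℕ.suc-injective (ℕ.suc-injective (trans (sym (cong suc (ℕ.*-suc 2 k))) (trans h (ℕ.*-suc 2 l)))))

  odd-∤ : ∀ {n} → Odd n → ¬ 2 ∣ n
  odd-∤ (k , e) (divides l e′) = odd≢even {k} {l} (trans (sym e) (trans e′ (ℕ.*-comm l 2)))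

  odd-square : ∀ {n} → Odd n → ∃[ x ] n ∙ n ≡ 1 ∔ 4 ∙ x
  odd-square (k , refl) = k ∙ k ∔ k , solveₙ 1 (λ k → (con 1 ⊞ con 2 ⊠ k) ⊠ (con 1 ⊞ con 2 ⊠ k) ⊜ con 1 ⊞ con 4 ⊠ (k ⊠ k ⊞ k)) refl k

  odd-factor : ∀ {m n} → Odd (m ∙ n) → Odd m × Odd n
  odd-factor {m} {n} h = by (parity m) (parity n)
    where
    by : 2 ∣ m ⊎ Odd m → 2 ∣ n ⊎ Odd n → Odd m × Odd n
    by (inj₂ a) (inj₂ b) = a , b
    by (inj₁ a) _ = ⊥-elim (odd-∤ h (∣m⇒∣m*n n a))
    by _ (inj₁ b) = ⊥-elim (odd-∤ h (∣n⇒∣m*n m b))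

  odd-coprime-2 : ∀ {n} → Odd n → Coprime n 2
  odd-coprime-2 {n} h {d} (d∣n , d∣2) = by d (∣⇒≤ d∣2) d∣n d∣2
    where
    by : ∀ d → d ℕ.≤ 2 → d ∣ n → d ∣ 2 → d ≡ 1
    by 0 _ _ (divides q e) = case trans e (ℕ.*-zeroʳ q) of λ ()
    by 1 _ _ _ = refl
    by 2 _ d∣n _ = ⊥-elim (odd-∤ h d∣n)
    by (suc (suc (suc d))) (ℕ.s≤s (ℕ.s≤s ())) _ _

  odd-coprime-8 : ∀ {n} → Odd n → Coprime n 8
  odd-coprime-8 h = coprime-*ʳ {b = 2} {c = 4} (odd-coprime-2 h) (coprime-*ʳ {b = 2} {c = 2} (odd-coprime-2 h) (odd-coprime-2 h))

  odd-≡ : ∀ {m n} → m ≡ n → Odd m → Odd n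
  odd-≡ refl h = h

  even-leg : ∀ {e H A} → Odd e → e ∙ e ∔ H ∙ H ≡ A ∙ A → 2 ∣ H
  even-leg {e} {H} {A} oe h = [ (λ a → a) , (λ oH → ⊥-elim (bad (odd-square oe) (odd-square oH) (parity A))) ]′ (parity H)
    where
    bad : ∃[ x ] e ∙ e ≡ 1 ∔ 4 ∙ x → ∃[ y ] H ∙ H ≡ 1 ∔ 4 ∙ y → 2 ∣ A ⊎ Odd A → ⊥
    bad (x , ex) (y , ey) (inj₂ oA) = with-A (odd-square oA)
      where
      with-A : ∃[ z ] A ∙ A ≡ 1 ∔ 4 ∙ z → ⊥
      with-A (z , ez) = odd≢even {2 ∙ z} {1 ∔ 2 ∙ x ∔ 2 ∙ y} (trans (solveₙ 1 (λ z → con 1 ⊞ con 2 ⊠ (con 2 ⊠ z) ⊜ con 1 ⊞ con 4 ⊠ z) refl z) (trans (sym ez) (trans (sym h) (trans (cong₂ _∔_ ex ey)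
        (solveₙ 2 (λ x y → (con 1 ⊞ con 4 ⊠ x) ⊞ (con 1 ⊞ con 4 ⊠ y) ⊜ con 2 ⊠ (con 1 ⊞ con 2 ⊠ x ⊞ con 2 ⊠ y)) refl x y)))))
    bad (x , ex) (y , ey) (inj₁ (divides a refl)) = odd≢even {x ∔ y} {a ∙ a} (cancelₙ {2} (λ ()) (trans (solveₙ 2 (λ x y → con 2 ⊠ (con 1 ⊞ con 2 ⊠ (x ⊞ y)) ⊜ (con 1 ⊞ con 4 ⊠ x) ⊞ (con 1 ⊞ con 4 ⊠ y)) refl x y)
      (trans (sym (cong₂ _∔_ ex ey)) (trans h (solveₙ 1 (λ a → a ⊠ con 2 ⊠ (a ⊠ con 2) ⊜ con 2 ⊠ (con 2 ⊠ (a ⊠ a))) refl a)))))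

  root-≤ : ∀ {m n} → m ∙ m ℕ.≤ n ∙ n → m ℕ.≤ n
  root-≤ {m} {n} h = ℕ.≮⇒≥ λ n<m → ℕ.<⇒≱ (ℕ.*-mono-< n<m n<m) h

  -- If A² = e² + 4 N with e odd, then N is the product of two numbers with difference e.
  difference-of-squares : ∀ {e N A} → Odd e → e ∙ e ∔ 4 ∙ N ≡ A ∙ A → ∃[ D ] N ≡ D ∙ (e ∔ D)
  difference-of-squares {e} {N} {A} oe h = go (parity (A ℕ.∸ e))
    where
    e≤A : e ℕ.≤ A
    e≤A = root-≤ (subst (e ∙ e ℕ.≤_) h (ℕ.m≤m+n (e ∙ e) (4 ∙ N)))
    A≡ : A ≡ e ∔ (A ℕ.∸ e)
    A≡ = sym (ℕ.m+[n∸m]≡n e≤A)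
    product : 4 ∙ N ≡ (A ℕ.∸ e) ∙ (2 ∙ e ∔ (A ℕ.∸ e))
    product = ℕ.+-cancelˡ-≡ (e ∙ e) (4 ∙ N) _ (trans h (trans (cong₂ _∙_ A≡ A≡) (solveₙ 2 (λ e d → (e ⊞ d) ⊠ (e ⊞ d) ⊜ e ⊠ e ⊞ d ⊠ (con 2 ⊠ e ⊞ d)) refl e (A ℕ.∸ e))))
    go : 2 ∣ A ℕ.∸ e ⊎ Odd (A ℕ.∸ e) → ∃[ D ] N ≡ D ∙ (e ∔ D)
    go (inj₁ (divides D d≡)) = D , cancelₙ {4} (λ ()) (trans product (trans (cong (λ d → d ∙ (2 ∙ e ∔ d)) d≡) (solveₙ 2 (λ e D → D ⊠ con 2 ⊠ (con 2 ⊠ e ⊞ D ⊠ con 2) ⊜ con 4 ⊠ (D ⊠ (e ⊞ D))) refl e D)))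
    go (inj₂ (k , d≡)) = ⊥-elim (odd≢even {k ∙ (2 ∙ e ∔ 2 ∙ k ∔ 1) ∔ (e ∔ k)} {2 ∙ N} (sym (trans (solveₙ 1 (λ N → con 2 ⊠ (con 2 ⊠ N) ⊜ con 4 ⊠ N) refl N) (trans product (trans (cong (λ d → d ∙ (2 ∙ e ∔ d)) d≡)
      (solveₙ 2 (λ e k → (con 1 ⊞ con 2 ⊠ k) ⊠ (con 2 ⊠ e ⊞ (con 1 ⊞ con 2 ⊠ k)) ⊜ con 1 ⊞ con 2 ⊠ (k ⊠ (con 2 ⊠ e ⊞ con 2 ⊠ k ⊞ con 1) ⊞ (e ⊞ k))) refl e k))))))

  divides-7 : ∀ {f} → f ∣ 7 → f ≡ 1 ⊎ f ≡ 7
  divides-7 {f} h = by f (∣⇒≤ h) h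
    where
    by : ∀ f → f ℕ.≤ 7 → f ∣ 7 → f ≡ 1 ⊎ f ≡ 7
    by 0 _ (divides q e) = case trans e (ℕ.*-zeroʳ q) of λ ()
    by 1 _ _ = inj₁ refl
    by 7 _ _ = inj₂ refl
    by 2 _ (divides q e) = ⊥-elim (odd≢even {3} {q} (trans e (ℕ.*-comm q 2)))
    by 4 _ (divides q e) = ⊥-elim (odd≢even {3} {2 ∙ q} (trans e (solveₙ 1 (λ q → q ⊠ con 4 ⊜ con 2 ⊠ (con 2 ⊠ q)) refl q)))
    by 6 _ (divides q e) = ⊥-elim (odd≢even {3} {3 ∙ q} (trans e (solveₙ 1 (λ q → q ⊠ con 6 ⊜ con 2 ⊠ (con 3 ⊠ q)) refl q)))
    by 3 _ (divides 0 ())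
    by 3 _ (divides 1 ())
    by 3 _ (divides 2 ())
    by 3 _ (divides (suc (suc (suc q))) ())
    by 5 _ (divides 0 ())
    by 5 _ (divides 1 ())
    by 5 _ (divides (suc (suc q)) ())
    by (suc (suc (suc (suc (suc (suc (suc (suc f)))))))) (ℕ.s≤s (ℕ.s≤s (ℕ.s≤s (ℕ.s≤s (ℕ.s≤s (ℕ.s≤s (ℕ.s≤s ()))))))) _

  -- The equations say that A² - H² and A² + 7H² are both squares.
  Solution : ℕ → Set
  Solution H = ∃[ e ] ∃[ A ] ∃[ g ] Odd e × Coprime e H × e ∙ e ∔ H ∙ H ≡ A ∙ A × e ∙ e ∔ 8 ∙ (H ∙ H) ≡ g ∙ g

  -- With m = ij, n = kl, a = ik and b = jl the hypothesis becomes i²(j² + 8k²) = l²(j² + k²). As i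
  -- and l are coprime, j² + k² = fi² and j² + 8k² = fl², so f divides 7j² and 7k², hence 7. The
  -- value f = 7 is impossible modulo 4 because j and l are odd, and f = 1 is a new solution with k
  -- in place of H.
  descent-step : ∀ {a b m n} → a ≢ 0 → m ≢ 0 → n ≢ 0 → Odd b → Coprime a b → a ∙ b ≡ m ∙ n → m ∙ m ∔ 8 ∙ (a ∙ a) ≡ b ∙ b ∔ n ∙ n →
    ∃[ k ] k ∣ n × k ≢ 0 × Solution k
  descent-step {a} {b} {m} {n} a≢0 m≢0 n≢0 ob cop e h = go (four-numbers a≢0 m≢0 e)
    where
    go : ∃[ i ] ∃[ j ] ∃[ k ] ∃[ l ] m ≡ i ∙ j × n ≡ k ∙ l × a ≡ i ∙ k × b ≡ j ∙ l × Coprime j k → ∃[ k ] k ∣ n × k ≢ 0 × Solution k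
    go (i , j , k , l , m≡ , n≡ , a≡ , b≡ , cjk) = at (coprime-divisor {n = l ∙ l} (coprime-* (coprime-*ʳ cil cil) (coprime-*ʳ cil cil)) (subst (i ∙ i ∣_) key (m∣m*n (j ∙ j ∔ 8 ∙ (k ∙ k)))))
      where
      key : i ∙ i ∙ (j ∙ j ∔ 8 ∙ (k ∙ k)) ≡ l ∙ l ∙ (j ∙ j ∔ k ∙ k)
      key = trans (solveₙ 3 (λ i j k → i ⊠ i ⊠ (j ⊠ j ⊞ con 8 ⊠ (k ⊠ k)) ⊜ i ⊠ j ⊠ (i ⊠ j) ⊞ con 8 ⊠ (i ⊠ k ⊠ (i ⊠ k))) refl i j k)
        (trans (cong₂ (λ m a → m ∙ m ∔ 8 ∙ (a ∙ a)) (sym m≡) (sym a≡)) (trans h (trans (cong₂ (λ b n → b ∙ b ∔ n ∙ n) b≡ n≡)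
          (solveₙ 3 (λ j k l → j ⊠ l ⊠ (j ⊠ l) ⊞ k ⊠ l ⊠ (k ⊠ l) ⊜ l ⊠ l ⊠ (j ⊠ j ⊞ k ⊠ k)) refl j k l))))
      cil : Coprime i l
      cil = coprime-∣ˡ (subst (i ∣_) (sym a≡) (m∣m*n k)) (Coprimality.sym (coprime-∣ˡ (subst (l ∣_) (sym b≡) (n∣m*n j)) (Coprimality.sym cop)))
      i≢0 : i ≢ 0
      i≢0 z = a≢0 (trans a≡ (cong (_∙ k) z))
      oj : Odd j × Odd l
      oj = odd-factor (odd-≡ b≡ ob)
      at : i ∙ i ∣ j ∙ j ∔ k ∙ k → ∃[ k ] k ∣ n × k ≢ 0 × Solution k
      at (divides f e₁) = by (divides-7 (coprime-factors {m = j ∙ j} {n = k ∙ k} (coprime-* (coprime-*ʳ cjk cjk) (coprime-*ʳ cjk cjk)) (d₁ , d₂)))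
        where
        e₂ : j ∙ j ∔ 8 ∙ (k ∙ k) ≡ f ∙ (l ∙ l)
        e₂ = cancelₙ {i ∙ i} (λ z → i≢0 ([ (λ x → x) , (λ x → x) ]′ (ℕ.m*n≡0⇒m≡0∨n≡0 i z))) (trans key (trans (cong (l ∙ l ∙_) e₁) (solveₙ 3 (λ l f i → l ⊠ l ⊠ (f ⊠ (i ⊠ i)) ⊜ i ⊠ i ⊠ (f ⊠ (l ⊠ l))) refl l f i)))
        d₁ : f ∣ j ∙ j ∙ 7
        d₁ = ∣m+n∣m⇒∣n {m = f ∙ (l ∙ l)} (divides (8 ∙ (i ∙ i)) (trans (cong (_∔ j ∙ j ∙ 7) (sym e₂))
          (trans (solveₙ 2 (λ j k → (j ⊠ j ⊞ con 8 ⊠ (k ⊠ k)) ⊞ j ⊠ j ⊠ con 7 ⊜ con 8 ⊠ (j ⊠ j ⊞ k ⊠ k)) refl j k) (trans (cong (8 ∙_) e₁) (solveₙ 2 (λ f i → con 8 ⊠ (f ⊠ (i ⊠ i)) ⊜ con 8 ⊠ (i ⊠ i) ⊠ f) refl f i))))) (m∣m*n (l ∙ l))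
        d₂ : f ∣ k ∙ k ∙ 7
        d₂ = ∣m+n∣m⇒∣n {m = f ∙ (i ∙ i)} (divides (l ∙ l) (trans (cong (_∔ k ∙ k ∙ 7) (sym e₁))
          (trans (solveₙ 2 (λ j k → (j ⊠ j ⊞ k ⊠ k) ⊞ k ⊠ k ⊠ con 7 ⊜ j ⊠ j ⊞ con 8 ⊠ (k ⊠ k)) refl j k) (trans e₂ (ℕ.*-comm f (l ∙ l)))))) (m∣m*n (i ∙ i))
        by : f ≡ 1 ⊎ f ≡ 7 → ∃[ k ] k ∣ n × k ≢ 0 × Solution k
        by (inj₁ refl) = k , subst (k ∣_) (sym n≡) (m∣m*n l) , (λ z → n≢0 (trans n≡ (cong (_∙ l) z))) ,
          j , i , l , proj₁ oj , cjk , trans e₁ (ℕ.*-identityˡ _) , trans e₂ (ℕ.*-identityˡ _)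
        by (inj₂ refl) = ⊥-elim (bad (odd-square (proj₁ oj)) (odd-square (proj₂ oj)))
          where
          bad : ∃[ x ] j ∙ j ≡ 1 ∔ 4 ∙ x → ∃[ y ] l ∙ l ≡ 1 ∔ 4 ∙ y → ⊥
          bad (x , ex) (y , ey) = odd≢even {1 ∔ 7 ∙ y} {x ∔ 2 ∙ (k ∙ k)} (cancelₙ {2} (λ ()) (ℕ.suc-injective (trans (solveₙ 1 (λ y → con 1 ⊞ con 2 ⊠ (con 1 ⊞ con 2 ⊠ (con 1 ⊞ con 7 ⊠ y)) ⊜ con 7 ⊠ (con 1 ⊞ con 4 ⊠ y)) refl y)
            (trans (cong (7 ∙_) (sym ey)) (trans (sym e₂) (trans (cong (_∔ 8 ∙ (k ∙ k)) ex) (solveₙ 2 (λ x k → (con 1 ⊞ con 4 ⊠ x) ⊞ con 8 ⊠ (k ⊠ k) ⊜ con 1 ⊞ con 2 ⊠ (con 2 ⊠ (x ⊞ con 2 ⊠ (k ⊠ k)))) refl x k)))))))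

  -- H is even, say 2h. Factoring differences of squares gives h² = D(e + D) and 8h² = G(e + G) with
  -- coprime factors, so D = n² and e + D = m², while G and e + G are 8a² and b² in one order or the
  -- other. Hence mn = ab, and comparing the two expressions for e gives the hypothesis of
  -- `descent-step`, with m and n exchanged when G is odd. The new solution divides h and so is
  -- smaller than H.
  no-solution : ∀ H → H ≢ 0 → ¬ Solution H
  no-solution = ℕ.<-rec (λ H → H ≢ 0 → ¬ Solution H) step
    where
    step : ∀ H → (∀ {k} → k ℕ.< H → k ≢ 0 → ¬ Solution k) → H ≢ 0 → ¬ Solution H
    step H rec H≢0 (e , A , g , oe , cop , h₁ , h₂) = with-h (even-leg {A = A} oe h₁)
      where
      with-h : 2 ∣ H → ⊥
      with-h (divides h H≡) = with-D (difference-of-squares {e} {h ∙ h} {A} oe (trans (cong (e ∙ e ∔_) quarter) h₁))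
        (difference-of-squares {e} {8 ∙ (h ∙ h)} {g} oe (trans (cong (e ∙ e ∔_) (trans (solveₙ 1 (λ x → con 4 ⊠ (con 8 ⊠ x) ⊜ con 8 ⊠ (con 4 ⊠ x)) refl (h ∙ h)) (cong (8 ∙_) quarter))) h₂))
        where
        quarter : 4 ∙ (h ∙ h) ≡ H ∙ H
        quarter = trans (solveₙ 1 (λ h → con 4 ⊠ (h ⊠ h) ⊜ h ⊠ con 2 ⊠ (h ⊠ con 2)) refl h) (cong (λ H → H ∙ H) (sym H≡))
        h≢0 : h ≢ 0
        h≢0 z = H≢0 (trans H≡ (cong (_∙ 2) z))
        h<H : h ℕ.< H
        h<H = subst (h ℕ.<_) (sym H≡) (ℕ.m<m*n h 2 {{ℕ.≢-nonZero h≢0}} (ℕ.s≤s (ℕ.s≤s ℕ.z≤n)))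
        ceh : Coprime e h
        ceh = Coprimality.sym (coprime-∣ˡ (subst (h ∣_) (sym H≡) (m∣m*n 2)) (Coprimality.sym cop))
        ce8hh : Coprime e (8 ∙ (h ∙ h))
        ce8hh = coprime-*ʳ (odd-coprime-8 oe) (coprime-*ʳ ceh ceh)
        sides : ∀ {D N} → N ≡ D ∙ (e ∔ D) → Coprime e N → Coprime D (e ∔ D)
        sides {D} N≡ c {d} (d∣D , d∣s) = c {d} (d∣e , subst (d ∣_) (sym N≡) (∣m⇒∣m*n (e ∔ D) d∣D))
          where d∣e = ∣m+n∣m⇒∣n {m = D} (subst (d ∣_) (ℕ.+-comm e D) d∣s) d∣D
        with-D : ∃[ D ] h ∙ h ≡ D ∙ (e ∔ D) → ∃[ G ] 8 ∙ (h ∙ h) ≡ G ∙ (e ∔ G) → ⊥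
        with-D (D , hD) (G , hG) = with-mn (coprime-squares {D} {e ∔ D} {h} D≢0 (sides hD (coprime-*ʳ ceh ceh)) (sym hD)) (parity G)
          where
          D≢0 : D ≢ 0
          D≢0 refl = h≢0 ([ (λ x → x) , (λ x → x) ]′ (ℕ.m*n≡0⇒m≡0∨n≡0 h hD))
          cG : Coprime G (e ∔ G)
          cG = sides hG ce8hh
          with-mn : ∃[ n ] ∃[ m ] D ≡ n ∙ n × e ∔ D ≡ m ∙ m × h ≡ n ∙ m → 2 ∣ G ⊎ Odd G → ⊥
          with-mn (n , m , D≡ , eD≡ , h≡) = by
            where
            n≢0 : n ≢ 0
            n≢0 z = h≢0 (trans h≡ (cong (_∙ m) z))
            m≢0 : m ≢ 0
            m≢0 z = h≢0 (trans h≡ (trans (cong (n ∙_) z) (ℕ.*-zeroʳ n)))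
            e+n² : e ∔ n ∙ n ≡ m ∙ m
            e+n² = trans (cong (e ∔_) (sym D≡)) eD≡
            finish : ∀ {x} → x ∣ h → ∃[ k ] k ∣ x × k ≢ 0 × Solution k → ⊥
            finish x∣h (k , k∣x , k≢0 , sol) = rec (ℕ.≤-<-trans (∣⇒≤ {{ℕ.≢-nonZero h≢0}} (∣-trans k∣x x∣h)) h<H) k≢0 sol
            by : 2 ∣ G ⊎ Odd G → ⊥
            by (inj₁ G-even) = with-8 (coprime-divisor {m = 8} {n = e ∔ G} (Coprimality.sym (odd-coprime-8 odd)) (subst (8 ∣_) (trans hG (ℕ.*-comm G (e ∔ G))) (m∣m*n (h ∙ h))))
              where
              odd : Odd (e ∔ G)
              odd = [ (λ d → ⊥-elim (odd-∤ oe (∣m+n∣m⇒∣n {m = G} (subst (2 ∣_) (ℕ.+-comm e G) d) G-even))) , (λ o → o) ]′ (parity (e ∔ G))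
              with-8 : 8 ∣ G → ⊥
              with-8 (divides G′ G≡) = with-ab (coprime-squares {G′} {e ∔ G} {h} G′≢0 (coprime-∣ˡ (subst (G′ ∣_) (sym G≡) (m∣m*n 8)) cG) eq)
                where
                eq : G′ ∙ (e ∔ G) ≡ h ∙ h
                eq = cancelₙ {8} (λ ()) (trans (solveₙ 2 (λ g s → con 8 ⊠ (g ⊠ s) ⊜ g ⊠ con 8 ⊠ s) refl G′ (e ∔ G)) (trans (cong (_∙ (e ∔ G)) (sym G≡)) (sym hG)))
                G′≢0 : G′ ≢ 0
                G′≢0 z = h≢0 ([ (λ x → x) , (λ x → x) ]′ (ℕ.m*n≡0⇒m≡0∨n≡0 h (trans (sym eq) (cong (_∙ (e ∔ G)) z))))
                with-ab : ∃[ a ] ∃[ b ] G′ ≡ a ∙ a × e ∔ G ≡ b ∙ b × h ≡ a ∙ b → ⊥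
                with-ab (a , b , G′≡ , eG≡ , h≡′) = finish (subst (n ∣_) (sym h≡) (m∣m*n m))
                  (descent-step {a} {b} {m} {n} (λ { refl → G′≢0 G′≡ }) m≢0 n≢0 (proj₁ (odd-factor (odd-≡ eG≡ odd)))
                    (coprime-∣ˡ (subst (a ∣_) (sym (trans G≡ (cong (_∙ 8) G′≡))) (∣m⇒∣m*n 8 (m∣m*n a))) (Coprimality.sym (coprime-∣ˡ (subst (b ∣_) (sym eG≡) (m∣m*n b)) (Coprimality.sym cG))))
                    (trans (sym h≡′) (trans h≡ (ℕ.*-comm n m)))
                    (trans (cong (_∔ 8 ∙ (a ∙ a)) (sym e+n²)) (trans (solveₙ 3 (λ e n a → e ⊞ n ⊞ con 8 ⊠ a ⊜ (e ⊞ a ⊠ con 8) ⊞ n) refl e (n ∙ n) (a ∙ a))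
                      (cong (_∔ n ∙ n) (trans (cong (e ∔_) (sym (trans G≡ (cong (_∙ 8) G′≡)))) eG≡)))))
            by (inj₂ oG) = with-8 (coprime-divisor {m = 8} {n = G} (Coprimality.sym (odd-coprime-8 oG)) (subst (8 ∣_) hG (m∣m*n (h ∙ h))))
              where
              with-8 : 8 ∣ e ∔ G → ⊥
              with-8 (divides G′ G≡) = with-ab (coprime-squares {G} {G′} {h} G≢0 (Coprimality.sym (coprime-∣ˡ (subst (G′ ∣_) (sym G≡) (m∣m*n 8)) (Coprimality.sym cG))) eq)
                where
                eq : G ∙ G′ ≡ h ∙ h
                eq = cancelₙ {8} (λ ()) (trans (solveₙ 2 (λ g s → con 8 ⊠ (g ⊠ s) ⊜ g ⊠ (s ⊠ con 8)) refl G G′) (trans (cong (G ∙_) (sym G≡)) (sym hG)))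
                G≢0 : G ≢ 0
                G≢0 z = odd-∤ oG (subst (2 ∣_) (sym z) (divides 0 refl))
                with-ab : ∃[ b ] ∃[ a ] G ≡ b ∙ b × G′ ≡ a ∙ a × h ≡ b ∙ a → ⊥
                with-ab (b , a , Gb , G′≡ , h≡′) = finish (subst (m ∣_) (sym h≡) (n∣m*n n))
                  (descent-step {a} {b} {n} {m} (λ { refl → h≢0 (trans h≡′ (ℕ.*-zeroʳ b)) }) n≢0 m≢0 (proj₁ (odd-factor (odd-≡ Gb oG)))
                    (coprime-∣ˡ (subst (a ∣_) (sym (trans G≡ (cong (_∙ 8) G′≡))) (∣m⇒∣m*n 8 (m∣m*n a))) (Coprimality.sym (coprime-∣ˡ (subst (b ∣_) (sym Gb) (m∣m*n b)) cG)))
                    (trans (ℕ.*-comm a b) (trans (sym h≡′) h≡))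
                    (trans (cong (n ∙ n ∔_) (trans (ℕ.*-comm 8 (a ∙ a)) (trans (sym (trans G≡ (cong (_∙ 8) G′≡))) (cong (e ∔_) Gb))))
                      (trans (solveₙ 3 (λ e n b → n ⊞ (e ⊞ b) ⊜ b ⊞ (e ⊞ n)) refl e (n ∙ n) (b ∙ b)) (cong (b ∙ b ∔_) e+n²))))

∣ᵃ⇒∣′ : ∀ {d x} → d ∣ ∣ x ∣ → + d ∣′ x
∣ᵃ⇒∣′ {d} {x} (divides k e) = [ (λ x≡ → + k , trans (sym x≡) +∣x∣≡)
    , (λ x≡ → - + k , trans (sym (ℤ.neg-involutive x)) (trans (cong -_ (trans (sym x≡) +∣x∣≡)) (ℤ.neg-distribʳ-* (+ d) (+ k)))) ]′ (ℤ.+∣i∣≡i⊎+∣i∣≡-i x)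
  where
  +∣x∣≡ : + ∣ x ∣ ≡ + d * + k
  +∣x∣≡ = trans (cong +_ e) (trans (ℤ.pos-* k d) (ℤ.*-comm (+ k) (+ d)))

∣′⇒∣ᵃ : ∀ {d x} → + d ∣′ x → d ∣ ∣ x ∣
∣′⇒∣ᵃ {d} (k , refl) = divides ∣ k ∣ (trans (ℤ.abs-* (+ d) k) (ℕ.*-comm d ∣ k ∣))

-- The cubic A is -z³ modulo x, x³ modulo z and -x³ modulo x + z.
coprime-values : ∀ {x z} → Coprime ∣ x ∣ ∣ z ∣ → Coprime ∣ 𝔽.𝐴 x z ∣ ∣ 𝔽.𝐻 x z ∣
coprime-values {x} {z} cop = subst (Coprime a) (sym (trans (ℤ.abs-* (x * z) (x + z)) (cong (_∙ ∣ x + z ∣) (ℤ.abs-* x z)))) (coprime-*ʳ (coprime-*ʳ cx cz) cs)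
  where
  a = ∣ 𝔽.𝐴 x z ∣
  cube : ∀ y → ∣ y * y * y ∣ ≡ ∣ y ∣ ∙ ∣ y ∣ ∙ ∣ y ∣
  cube y = trans (ℤ.abs-* (y * y) y) (cong (_∙ ∣ y ∣) (ℤ.abs-* y y))
  coprime-cube : ∀ {d} y → Coprime d ∣ y ∣ → Coprime d ∣ y * y * y ∣
  coprime-cube {d} y c = subst (Coprime d) (sym (cube y)) (coprime-*ʳ (coprime-*ʳ c c) c)
  cx : Coprime a ∣ x ∣
  cx {d} (d∣a , d∣x) = coprime-cube {d} z (coprime-∣ˡ d∣x cop) (∣-refl , ∣′⇒∣ᵃ (subst (+ d ∣′_)
    (solve 2 (λ x z → (x :* x :+ x :* z :- κ (+ 2) :* z :* z) :* x :- 𝔽S.𝐴 x z := z :* z :* z) refl x z)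
    (∣′-- {+ d} (∣′-*ˡ {+ d} (x * x + x * z - + 2 * z * z) (∣ᵃ⇒∣′ {d} {x} d∣x)) (∣ᵃ⇒∣′ {d} {𝔽.𝐴 x z} d∣a))))
  cz : Coprime a ∣ z ∣
  cz {d} (d∣a , d∣z) = coprime-cube {d} x (coprime-∣ˡ d∣z (Coprimality.sym cop)) (∣-refl , ∣′⇒∣ᵃ (subst (+ d ∣′_)
    (solve 2 (λ x z → 𝔽S.𝐴 x z :- (x :* x :- κ (+ 2) :* x :* z :- z :* z) :* z := x :* x :* x) refl x z)
    (∣′-- {+ d} (∣ᵃ⇒∣′ {d} {𝔽.𝐴 x z} d∣a) (∣′-*ˡ {+ d} (x * x - + 2 * x * z - z * z) (∣ᵃ⇒∣′ {d} {z} d∣z)))))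
  cs : Coprime a ∣ x + z ∣
  cs {d} (d∣a , d∣s) = coprime-cube {d} x (λ {e} h → cop (proj₂ h , ∣′⇒∣ᵃ (subst (+ e ∣′_) (solve 2 (λ x z → x :+ z :- x := z) refl x z)
      (∣′-- {+ e} (∣ᵃ⇒∣′ {e} {x + z} (∣-trans (proj₁ h) d∣s)) (∣ᵃ⇒∣′ {e} {x} (proj₂ h)))))) (∣-refl , ∣′⇒∣ᵃ (subst (+ d ∣′_)
    (solve 2 (λ x z → (κ (+ 2) :* x :* x :- x :* z :- z :* z) :* (x :+ z) :- 𝔽S.𝐴 x z := x :* x :* x) refl x z)
    (∣′-- {+ d} (∣′-*ˡ {+ d} (+ 2 * x * x - x * z - z * z) (∣ᵃ⇒∣′ {d} {x + z} d∣s)) (∣ᵃ⇒∣′ {d} {𝔽.𝐴 x z} d∣a))))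

even-𝐻 : ∀ x z → + 2 ∣′ 𝔽.𝐻 x z
even-𝐻 x z = by (mod2 x) (mod2 z)
  where
  by : ∃[ k ] (x ≡ + 2 * k ⊎ x ≡ + 1 + + 2 * k) → ∃[ k ] (z ≡ + 2 * k ⊎ z ≡ + 1 + + 2 * k) → + 2 ∣′ 𝔽.𝐻 x z
  by (k , inj₁ e) _ = ∣′-*ʳ {+ 2} (x + z) (∣′-*ʳ {+ 2} z (k , e))
  by _ (k , inj₁ e) = ∣′-*ʳ {+ 2} (x + z) (∣′-*ˡ {+ 2} x (k , e))
  by (k , inj₂ e) (l , inj₂ e′) = ∣′-*ˡ {+ 2} (x * z) (1ℤ + k + l , trans (cong₂ _+_ e e′) (solve 2 (λ k l → (κ 1ℤ :+ κ (+ 2) :* k) :+ (κ 1ℤ :+ κ (+ 2) :* l) := κ (+ 2) :* (κ 1ℤ :+ k :+ l)) refl k l))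

module _ where
  open ℕS using (con) renaming (solve to solveₙ; _:+_ to infixl 6 _⊞_; _:*_ to infixl 7 _⊠_; _:=_ to infix 4 _⊜_)

  natural-root : ∀ {K M R} → K ≢ 0 → K ∙ K ∙ M ≡ R ∙ R → ∃[ s ] M ≡ s ∙ s
  natural-root {K} {M} {R} K≢0 e = go (coprime-part K R (inj₁ K≢0))
    where
    go : ∃[ g ] ∃[ κ′ ] ∃[ ρ′ ] g ≢ 0 × K ≡ g ∙ κ′ × R ≡ g ∙ ρ′ × Coprime κ′ ρ′ → ∃[ s ] M ≡ s ∙ s
    go (g , κ′ , ρ′ , g≢0 , K≡ , R≡ , cop) = ρ′ , trans (sym (ℕ.*-identityˡ M)) (trans (cong (λ k → k ∙ k ∙ M) (sym κ≡1)) e′)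
      where
      e′ : κ′ ∙ κ′ ∙ M ≡ ρ′ ∙ ρ′
      e′ = cancelₙ g≢0 (cancelₙ g≢0 (trans (solveₙ 3 (λ g k m → g ⊠ (g ⊠ (k ⊠ k ⊠ m)) ⊜ g ⊠ k ⊠ (g ⊠ k) ⊠ m) refl g κ′ M) (trans (cong (λ K → K ∙ K ∙ M) (sym K≡)) (trans e (trans (cong (λ R → R ∙ R) R≡)
        (solveₙ 2 (λ g r → g ⊠ r ⊠ (g ⊠ r) ⊜ g ⊠ (g ⊠ (r ⊠ r))) refl g ρ′))))))
      κ≡1 : κ′ ≡ 1
      κ≡1 = cop (∣-refl , coprime-divisor {n = ρ′} cop (subst (κ′ ∣_) (trans (sym (ℕ.*-assoc κ′ κ′ M)) e′) (m∣m*n (κ′ ∙ M))))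

  -- If a² ≥ h², the factors a² - h² and a² + 7h² differ by 8h²; the first is odd and prime to h, so
  -- they are coprime and both are squares. If a² ≤ h², the left side is not positive, hence zero,
  -- and a² = h² contradicts parity.
  solution-of : ∀ {a h K R} → h ≢ 0 → Coprime a h → 2 ∣ h → K ≢ 0 →
    + (K ∙ K) * ((+ (a ∙ a) + + 7 * + (h ∙ h)) * (+ (a ∙ a) - + (h ∙ h))) ≡ + (R ∙ R) → Solution h
  solution-of {a} {h} {K} {R} h≢0 cop 2∣h K≢0 e = by (ℕ.≤-total (h ∙ h) (a ∙ a))
    where
    oa : Odd a
    oa = [ (λ 2∣a → ⊥-elim (case cop (2∣a , 2∣h) of λ ())) , (λ o → o) ]′ (parity a)
    difference : ∀ {m n} → n ℕ.≤ m → + m - + n ≡ + (m ℕ.∸ n)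
    difference {m} {n} n≤m = trans (ℤ.m-n≡m⊖n m n) (ℤ.⊖-≥ n≤m)
    U = a ∙ a ∔ 7 ∙ (h ∙ h)
    U≡ : + (a ∙ a) + + 7 * + (h ∙ h) ≡ + U
    U≡ = cong (λ t → + (a ∙ a) + t) (sym (ℤ.pos-* 7 (h ∙ h)))
    by : h ∙ h ℕ.≤ a ∙ a ⊎ a ∙ a ℕ.≤ h ∙ h → Solution h
    by (inj₁ le) = with-root (natural-root {K} {v ∙ U} {R} K≢0 (ℤ.+-injective (trans (trans (ℤ.pos-* (K ∙ K) (v ∙ U)) (cong (λ t → + (K ∙ K) * t) (trans (cong +_ (ℕ.*-comm v U)) (trans (ℤ.pos-* U v) (cong₂ _*_ (sym U≡) (sym (difference le))))))) e)))
      where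
      v = a ∙ a ℕ.∸ h ∙ h
      aa≡ : h ∙ h ∔ v ≡ a ∙ a
      aa≡ = ℕ.m+[n∸m]≡n le
      ov : Odd v
      ov = [ (λ 2∣v → ⊥-elim (odd-∤ oa ([ (λ d → d) , (λ o → ⊥-elim (odd-∤ (odd-aa o) (subst (2 ∣_) aa≡ (∣m∣n⇒∣m+n (∣m⇒∣m*n h 2∣h) 2∣v)))) ]′ (parity a)))) , (λ o → o) ]′ (parity v)
        where
        odd-aa : Odd a → Odd (a ∙ a)
        odd-aa (k , refl) = k ∙ (1 ∔ 2 ∙ k) ∔ k , solveₙ 1 (λ k → (con 1 ⊞ con 2 ⊠ k) ⊠ (con 1 ⊞ con 2 ⊠ k) ⊜ con 1 ⊞ con 2 ⊠ (k ⊠ (con 1 ⊞ con 2 ⊠ k) ⊞ k)) refl k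
      cvh : Coprime v h
      cvh {d} (d∣v , d∣h) = coprime-* cop cop (subst (d ∣_) aa≡ (∣m∣n⇒∣m+n (∣m⇒∣m*n h d∣h) d∣v) , d∣h)
      U≡′ : v ∔ 8 ∙ (h ∙ h) ≡ U
      U≡′ = trans (solveₙ 2 (λ v h → v ⊞ con 8 ⊠ h ⊜ (h ⊞ v) ⊞ con 7 ⊠ h) refl v (h ∙ h)) (cong (_∔ 7 ∙ (h ∙ h)) aa≡)
      cvU : Coprime v U
      cvU {d} (d∣v , d∣U) = coprime-*ʳ (odd-coprime-8 ov) (coprime-*ʳ cvh cvh) (d∣v , ∣m+n∣m⇒∣n {m = v} (subst (d ∣_) (sym U≡′) d∣U) d∣v)
      v≢0 : v ≢ 0
      v≢0 z = odd-∤ ov (subst (2 ∣_) (sym z) (divides 0 refl))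
      with-root : ∃[ s ] v ∙ U ≡ s ∙ s → Solution h
      with-root (s , vU≡) = finish (coprime-squares v≢0 cvU vU≡)
        where
        finish : ∃[ e ] ∃[ g ] v ≡ e ∙ e × U ≡ g ∙ g × s ≡ e ∙ g → Solution h
        finish (e , g , v≡ , Ug , _) = e , a , g , proj₁ (odd-factor (odd-≡ v≡ ov)) , coprime-∣ˡ (subst (e ∣_) (sym v≡) (m∣m*n e)) cvh ,
          trans (cong (_∔ h ∙ h) (sym v≡)) (trans (ℕ.+-comm v (h ∙ h)) aa≡) , trans (cong (_∔ 8 ∙ (h ∙ h)) (sym v≡)) (trans U≡′ Ug)
    by (inj₂ le) = ⊥-elim (h≢a (ℕ.m≤n⇒m<n∨m≡n le))
      where
      v = h ∙ h ℕ.∸ a ∙ a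
      sum : + (K ∙ K ∙ (U ∙ v) ∔ R ∙ R) ≡ 0ℤ
      sum = trans (cong₂ _+_ (trans (ℤ.pos-* (K ∙ K) (U ∙ v)) (cong (λ t → + (K ∙ K) * t) (trans (ℤ.pos-* U v) (cong₂ _*_ (sym U≡) (sym (difference le)))))) (sym e))
        (solve 4 (λ k u a h → k :* (u :* (h :- a)) :+ k :* (u :* (a :- h)) := κ 0ℤ) refl (+ (K ∙ K)) (+ (a ∙ a) + + 7 * + (h ∙ h)) (+ (a ∙ a)) (+ (h ∙ h)))
      zero-product : ∀ {m n} → m ≢ 0 → m ∙ n ≡ 0 → n ≡ 0
      zero-product {m} m≢0 h = [ (λ z → ⊥-elim (m≢0 z)) , (λ z → z) ]′ (ℕ.m*n≡0⇒m≡0∨n≡0 m h)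
      v≡0 : v ≡ 0
      v≡0 = zero-product (λ z → case trans (sym (cong (_∔ 7 ∙ (h ∙ h)) (proj₂ (odd-square oa)))) z of λ ())
        (zero-product (λ z → K≢0 (zero-product K≢0 z)) (ℕ.m+n≡0⇒m≡0 (K ∙ K ∙ (U ∙ v)) (ℤ.+-injective sum)))
      h≢a : a ∙ a ℕ.< h ∙ h ⊎ a ∙ a ≡ h ∙ h → ⊥
      h≢a (inj₁ lt) = ℕ.<⇒≱ lt (ℕ.m∸n≡0⇒m≤n v≡0)
      h≢a (inj₂ eq) = odd-∤ oa (coprime-divisor {n = a} (Coprimality.sym (odd-coprime-2 oa)) (subst (2 ∣_) (sym eq) (∣m⇒∣m*n h 2∣h)))

-- The norm (h² - F)(9h² - F) of (y + h)(y - 3h) when x is rational and y is a rational multiple of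
-- √d.
𝑁 : ℤ → ℤ → ℤ
𝑁 X Z = (𝔽.𝐴 X Z * 𝔽.𝐴 X Z + + 7 * (𝔽.𝐻 X Z * 𝔽.𝐻 X Z)) * (𝔽.𝐴 X Z * 𝔽.𝐴 X Z - 𝔽.𝐻 X Z * 𝔽.𝐻 X Z)

rational-twist : ∀ X Z → 𝔽.𝐻 X Z ≢ 0ℤ → ¬ IsSquare (𝑁 X Z)
rational-twist X Z H≢0 sq = go (coprime-part ∣ X ∣ ∣ Z ∣ (inj₁ λ e → H≢0 (trans (cong (λ X → 𝔽.𝐻 X Z) (ℤ.∣i∣≡0⇒i≡0 {X} e)) (solve 1 (λ Z → 𝔽S.𝐻 (κ 0ℤ) Z := κ 0ℤ) refl Z))))
  where
  go : ∃[ g ] ∃[ m ] ∃[ n ] g ≢ 0 × ∣ X ∣ ≡ g ∙ m × ∣ Z ∣ ≡ g ∙ n × Coprime m n → ⊥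
  go (g , m , n , g≢0 , X≡ , Z≡ , cop) = with-xz (∣ᵃ⇒∣′ {g} {X} (divides m (trans X≡ (ℕ.*-comm g m)))) (∣ᵃ⇒∣′ {g} {Z} (divides n (trans Z≡ (ℕ.*-comm g n))))
    where
    G = + g
    G≢0 : G ≢ 0ℤ
    G≢0 h = g≢0 (ℤ.+-injective h)
    with-xz : G ∣′ X → G ∣′ Z → ⊥
    with-xz (x , refl) (z , refl) = coprime-case (isSquare-cancel {G * G * G * (G * G * G)} (*-nonzero {G * G * G} {G * G * G} G³≢0 G³≢0) (subst IsSquare scaled sq))
      where
      G³≢0 : G * G * G ≢ 0ℤ
      G³≢0 = *-nonzero (*-nonzero {G} {G} G≢0 G≢0) G≢0
      A = 𝔽.𝐴 x z
      H = 𝔽.𝐻 x z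
      scaled : 𝑁 (G * x) (G * z) ≡ G * G * G * (G * G * G) * (G * G * G * (G * G * G)) * 𝑁 x z
      scaled = trans (cong₂ (λ A H → (A * A + + 7 * (H * H)) * (A * A - H * H))
          (solve 3 (λ G x z → 𝔽S.𝐴 (G :* x) (G :* z) := G :* G :* G :* 𝔽S.𝐴 x z) refl G x z) (solve 3 (λ G x z → 𝔽S.𝐻 (G :* x) (G :* z) := G :* G :* G :* 𝔽S.𝐻 x z) refl G x z))
        (solve 3 (λ G A H → (G :* A :* (G :* A) :+ κ (+ 7) :* (G :* H :* (G :* H))) :* (G :* A :* (G :* A) :- G :* H :* (G :* H)) := G :* G :* (G :* G) :* ((A :* A :+ κ (+ 7) :* (H :* H)) :* (A :* A :- H :* H))) refl (G * G * G) A H)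
      part : ∀ {y m} → ∣ G * y ∣ ≡ g ∙ m → ∣ y ∣ ≡ m
      part {y} h = cancelₙ g≢0 (trans (sym (ℤ.abs-* G y)) h)
      cop′ : Coprime ∣ x ∣ ∣ z ∣
      cop′ = subst₂ Coprime (sym (part {x} X≡)) (sym (part {z} Z≡)) (λ {d} → cop {d})
      h≢0 : ∣ H ∣ ≢ 0
      h≢0 e = H≢0 (trans (solve 3 (λ G x z → 𝔽S.𝐻 (G :* x) (G :* z) := G :* G :* G :* 𝔽S.𝐻 x z) refl G x z) (trans (cong (G * G * G *_) (ℤ.∣i∣≡0⇒i≡0 {H} e)) (ℤ.*-zeroʳ (G * G * G))))
      coprime-case : ¬ IsSquare (𝑁 x z)
      coprime-case (k , r , k≢0 , e) = no-solution ∣ H ∣ h≢0 (solution-of {∣ A ∣} {∣ H ∣} {∣ k ∣} {∣ r ∣} h≢0 (coprime-values {x} {z} (λ {d} → cop′ {d})) (∣′⇒∣ᵃ {2} (even-𝐻 x z)) (λ z → k≢0 (ℤ.∣i∣≡0⇒i≡0 z))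
        (trans (cong₂ (λ K M → K * M) (sym (square-abs k)) (cong₂ (λ a h → (a + + 7 * h) * (a - h)) (sym (square-abs A)) (sym (square-abs H)))) (trans e (square-abs r))))

-- Rational points of the curve.

3^-root : ∀ j {x Y} → Y * Y ≡ 3^ j * 3^ j * x → ∃[ y ] Y ≡ 3^ j * y × y * y ≡ x
3^-root zero {x} {Y} e = Y , sym (ℤ.*-identityˡ Y) , trans e (solve 1 (λ x → κ 1ℤ :* κ 1ℤ :* x := x) refl x)
3^-root (suc j) {x} {Y} e = [ by , by ]′ (3∣ℤ-prime Y Y (3^ j * 3^ (suc j) * x , trans e (solve 2 (λ n x → κ (+ 3) :* n :* (κ (+ 3) :* n) :* x := κ (+ 3) :* (n :* (κ (+ 3) :* n) :* x)) refl (3^ j) x)))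
  where
  by : 3∣ℤ Y → ∃[ y ] Y ≡ 3^ (suc j) * y × y * y ≡ x
  by (Y′ , refl) = go (3^-root j {x} {Y′} (3*-injective (3*-injective (trans (solve 1 (λ y → κ (+ 3) :* (κ (+ 3) :* (y :* y)) := κ (+ 3) :* y :* (κ (+ 3) :* y)) refl Y′) (trans e
    (solve 2 (λ n x → κ (+ 3) :* n :* (κ (+ 3) :* n) :* x := κ (+ 3) :* (κ (+ 3) :* (n :* n :* x))) refl (3^ j) x))))))
    where
    go : ∃[ y ] Y′ ≡ 3^ j * y × y * y ≡ x → ∃[ y ] + 3 * Y′ ≡ 3^ (suc j) * y × y * y ≡ x
    go (y , e₁ , e₂) = y , trans (cong (+ 3 *_) e₁) (sym (ℤ.*-assoc (+ 3) (3^ j) y)) , e₂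

-- The divisor of (x, y) and (0, -1) with x ≡ 0 and y ≡ 1 modulo 3 contradicts integrality.
rational-near-zero : ∀ {x z y} → 3∣ℤ x → ¬ 3∣ℤ z → x ≢ 0ℤ → y * y ≡ 𝔽.𝐹 x z → ⊥
rational-near-zero {x} {z} {y} 3∣x nz x≢0 e = [ close y e , (λ h → close (- y) (trans (solve 1 (λ y → :- y :* (:- y) := y :* y) refl y) e)
    (subst 3∣ℤ (solve 2 (λ y s → :- (y :+ s) := :- y :- s) refl y (z * z * z)) (∣′-neg {+ 3} h))) ]′ (3∣ℤ-prime (y - z * z * z) (y + z * z * z)
    (subst 3∣ℤ (trans (cong (_- z * z * z * (z * z * z)) (sym e)) (solve 2 (λ y s → y :* y :- s :* s := (y :- s) :* (y :+ s)) refl y (z * z * z)))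
      (subst 3∣ℤ (solve 2 (λ x z → x :* (x :* x :* x :* x :* x :+ κ (+ 2) :* x :* x :* x :* x :* z :+ κ (+ 5) :* x :* x :* x :* z :* z :+ κ (+ 10) :* x :* x :* z :* z :* z :+ κ (+ 10) :* x :* z :* z :* z :* z :+ κ (+ 4) :* z :* z :* z :* z :* z) := 𝔽S.𝐹 x z :- z :* z :* z :* (z :* z :* z)) refl x z) (∣′-*ʳ {+ 3} _ 3∣x))))
  where
  close : ∀ y → y * y ≡ 𝔽.𝐹 x z → 3∣ℤ (y - z * z * z) → ⊥
  close y e h = 3∤ℤ-* {+ 2} {z * z * z} (3∤ℤ-cong { -1ℤ} 3∤-1 (1ℤ , refl)) (3∤ℤ-* (3∤ℤ-* nz nz) nz)
      (subst 3∣ℤ (solve 2 (λ y s → y :+ s :- (y :- s) := κ (+ 2) :* s) refl y (z * z * z)) (∣′-- {+ 3} (proj₁ (point-integral₁ nz x≢0 P 3∣x)) h))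
    where
    P : Point z (- x) 0ℤ (y + z * z * z) (- (z * z * x)) x
    P = point
      (trans (solve 3 (λ x z y → let u = y :+ z :* z :* z in κ (+ 2) :* z :* u :* (:- (z :* z :* x)) :- (:- x) :* u :* u := x :* (y :* y :- z :* z :* z :* (z :* z :* z))) refl x z y)
        (trans (cong (λ f → x * (f - z * z * z * (z * z * z))) e) (solve 2 (λ x z → x :* (𝔽S.𝐹 x z :- z :* z :* z :* (z :* z :* z)) := x :* x :* CoS.R₁ z (:- x) (κ 0ℤ)) refl x z)))
      (solve 3 (λ x z y → let u = y :+ z :* z :* z in z :* (:- (z :* z :* x)) :* (:- (z :* z :* x)) :- κ 0ℤ :* u :* u := x :* x :* CoS.R₀ z (:- x) (κ 0ℤ)) refl x z y)

-- Take x and z not both divisible by 3. If 3 divides x, z or x + z, a power of σ reduces to 3 ∣ x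
-- and `rational-near-zero` applies. Otherwise x ≡ z modulo 3, and F is congruent to 33z⁶ modulo 9,
-- so it is exactly divisible by 3 and not a square.
rational-point : ∀ X Z Y → 𝔽.𝐻 X Z ≢ 0ℤ → Y * Y ≢ 𝔽.𝐹 X Z
rational-point X Z Y H≢0 e = go (primitive-pair X Z (inj₁ (λ X≡0 → H≢0 (trans (cong (λ X → 𝔽.𝐻 X Z) X≡0) (solve 1 (λ Z → 𝔽S.𝐻 (κ 0ℤ) Z := κ 0ℤ) refl Z)))))
  where
  go : ∃[ k ] ∃[ x ] ∃[ z ] X ≡ 3^ k * x × Z ≡ 3^ k * z × (¬ 3∣ℤ x ⊎ ¬ 3∣ℤ z) → ⊥
  go (k , x , z , X≡ , Z≡ , prim) = with-y (3^-root k {n * n * (n * n) * 𝔽.𝐹 x z} {Y} (trans e (trans (cong₂ 𝔽.𝐹 X≡ Z≡) (solve 3 (λ n x z → 𝔽S.𝐹 (n :* x) (n :* z) := n :* n :* (n :* n :* (n :* n) :* 𝔽S.𝐹 x z)) refl n x z))))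
    where
    n = 3^ k
    H≢0′ : 𝔽.𝐻 x z ≢ 0ℤ
    H≢0′ h = H≢0 (trans (cong₂ 𝔽.𝐻 X≡ Z≡) (trans (solve 3 (λ G x z → 𝔽S.𝐻 (G :* x) (G :* z) := G :* G :* G :* 𝔽S.𝐻 x z) refl n x z) (trans (cong (n * n * n *_) h) (ℤ.*-zeroʳ (n * n * n)))))
    x≢0 : x ≢ 0ℤ
    x≢0 h = H≢0′ (trans (cong (λ x → 𝔽.𝐻 x z) h) (solve 1 (λ z → 𝔽S.𝐻 (κ 0ℤ) z := κ 0ℤ) refl z))
    z≢0 : z ≢ 0ℤ
    z≢0 h = H≢0′ (trans (cong (λ z → 𝔽.𝐻 x z) h) (solve 1 (λ x → 𝔽S.𝐻 x (κ 0ℤ) := κ 0ℤ) refl x))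
    s≢0 : x + z ≢ 0ℤ
    s≢0 h = H≢0′ (trans (cong (x * z *_) h) (ℤ.*-zeroʳ (x * z)))
    neg≢0 : ∀ {y} → y ≢ 0ℤ → - y ≢ 0ℤ
    neg≢0 {y} ne h = ne (trans (sym (ℤ.neg-involutive y)) (cong -_ h))
    n3 : ∀ {y} → ¬ 3∣ℤ y → ¬ 3∣ℤ (- y)
    n3 {y} ny h = ny (subst 3∣ℤ (ℤ.neg-involutive y) (∣′-neg {+ 3} h))
    coprime-case : ∀ y → y * y ≡ 𝔽.𝐹 x z → ⊥
    coprime-case y e = by (3∣ℤ? x) (3∣ℤ? z) (3∣ℤ? (x + z))
      where
      by : 3∣ℤ x ⊎ ¬ 3∣ℤ x → 3∣ℤ z ⊎ ¬ 3∣ℤ z → 3∣ℤ (x + z) ⊎ ¬ 3∣ℤ (x + z) → ⊥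
      by (inj₁ hx) (inj₁ hz) _ = [ (λ n → n hx) , (λ n → n hz) ]′ prim
      by (inj₁ hx) (inj₂ nz) _ = rational-near-zero {x} {z} {y} hx nz x≢0 e
      by (inj₂ nx) (inj₁ hz) _ = rational-near-zero { - z} {x + z} {y} (∣′-neg {+ 3} hz) (3∤ℤ-cong nx (subst 3∣ℤ (solve 2 (λ x z → z := x :+ z :- x) refl x z) hz)) (neg≢0 z≢0) (trans e (solve 2 (λ x z → 𝔽S.𝐹 x z := 𝔽S.𝐹 (:- z) (x :+ z)) refl x z))
      by (inj₂ nx) (inj₂ nz) (inj₁ hs) = rational-near-zero { - (x + z)} {x} {y} (∣′-neg {+ 3} hs) nx (neg≢0 s≢0) (trans e (solve 2 (λ x z → 𝔽S.𝐹 x z := 𝔽S.𝐹 (:- (x :+ z)) x) refl x z))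
      by (inj₂ nx) (inj₂ nz) (inj₂ ns) = [ at , at ]′ (3∣ℤ-prime y y (subst 3∣ℤ (sym e) (subst (λ x → 3∣ℤ (𝔽.𝐹 x z)) (sym (proj₂ x≡)) (_ , near (proj₁ x≡) z))))
        where
        x≡ : ∃[ d ] x ≡ z + + 3 * d
        x≡ = with-mod (mod3 x) (mod3 z)
          where
          with-mod : ∃[ k ] (x ≡ + 3 * k ⊎ x ≡ 1ℤ + + 3 * k ⊎ x ≡ -1ℤ + + 3 * k) → ∃[ k ] (z ≡ + 3 * k ⊎ z ≡ 1ℤ + + 3 * k ⊎ z ≡ -1ℤ + + 3 * k) → ∃[ d ] x ≡ z + + 3 * d
          with-mod (k , inj₁ h) _ = ⊥-elim (nx (k , h))
          with-mod _ (k , inj₁ h) = ⊥-elim (nz (k , h))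
          with-mod (k , inj₂ (inj₁ h)) (l , inj₂ (inj₁ h′)) = k - l , trans h (trans (solve 2 (λ k l → κ 1ℤ :+ κ (+ 3) :* k := κ 1ℤ :+ κ (+ 3) :* l :+ κ (+ 3) :* (k :- l)) refl k l) (cong (_+ + 3 * (k - l)) (sym h′)))
          with-mod (k , inj₂ (inj₂ h)) (l , inj₂ (inj₂ h′)) = k - l , trans h (trans (solve 2 (λ k l → κ -1ℤ :+ κ (+ 3) :* k := κ -1ℤ :+ κ (+ 3) :* l :+ κ (+ 3) :* (k :- l)) refl k l) (cong (_+ + 3 * (k - l)) (sym h′)))
          with-mod (k , inj₂ (inj₁ h)) (l , inj₂ (inj₂ h′)) = ⊥-elim (ns (k + l , trans (cong₂ _+_ h h′) (solve 2 (λ k l → (κ 1ℤ :+ κ (+ 3) :* k) :+ (κ -1ℤ :+ κ (+ 3) :* l) := κ (+ 3) :* (k :+ l)) refl k l)))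
          with-mod (k , inj₂ (inj₂ h)) (l , inj₂ (inj₁ h′)) = ⊥-elim (ns (k + l , trans (cong₂ _+_ h h′) (solve 2 (λ k l → (κ -1ℤ :+ κ (+ 3) :* k) :+ (κ 1ℤ :+ κ (+ 3) :* l) := κ (+ 3) :* (k :+ l)) refl k l)))
        ninth : ℤ → ℤ → ℤ
        ninth d z = + 30 * d * (z * z * z * z * z) + + 105 * d * d * (z * z * z * z) + + 210 * d * d * d * (z * z * z) + + 270 * d * d * d * d * (z * z) + + 216 * d * d * d * d * d * z + + 81 * d * d * d * d * d * d
        near : ∀ d z → 𝔽.𝐹 (z + + 3 * d) z ≡ + 3 * (+ 11 * (z * z * z * z * z * z) + + 3 * ninth d z)
        near = solve 2 (λ d z → 𝔽S.𝐹 (z :+ κ (+ 3) :* d) z := κ (+ 3) :* (κ (+ 11) :* (z :* z :* z :* z :* z :* z) :+ κ (+ 3) :*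
          (κ (+ 30) :* d :* (z :* z :* z :* z :* z) :+ κ (+ 105) :* d :* d :* (z :* z :* z :* z) :+ κ (+ 210) :* d :* d :* d :* (z :* z :* z) :+ κ (+ 270) :* d :* d :* d :* d :* (z :* z) :+ κ (+ 216) :* d :* d :* d :* d :* d :* z :+ κ (+ 81) :* d :* d :* d :* d :* d :* d))) refl
        at : 3∣ℤ y → ⊥
        at (y′ , refl) = 3∤ℤ-* {+ 11} {z * z * z * z * z * z} (3∤ℤ-cong { -1ℤ} 3∤-1 (+ 4 , refl)) (3∤ℤ-* (3∤ℤ-* (3∤ℤ-* (3∤ℤ-* (3∤ℤ-* nz nz) nz) nz) nz) nz)
          (subst 3∣ℤ (solve 2 (λ a b → a :+ b :- b := a) refl (+ 11 * (z * z * z * z * z * z)) (+ 3 * ninth (proj₁ x≡) z)) (∣′-- {+ 3}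
            (y′ * y′ , sym (3*-injective (trans (solve 1 (λ y → κ (+ 3) :* (κ (+ 3) :* (y :* y)) := κ (+ 3) :* y :* (κ (+ 3) :* y)) refl y′) (trans e (trans (cong (λ x → 𝔽.𝐹 x z) (proj₂ x≡)) (near (proj₁ x≡) z))))))
            (ninth (proj₁ x≡) z , refl)))
    with-y : ∃[ y ] Y ≡ n * y × y * y ≡ n * n * (n * n) * 𝔽.𝐹 x z → ⊥
    with-y (y , _ , e₁) = with-y₂ (3^-root k {n * n * 𝔽.𝐹 x z} {y} (trans e₁ (solve 2 (λ n f → n :* n :* (n :* n) :* f := n :* n :* (n :* n :* f)) refl n (𝔽.𝐹 x z))))
      where
      with-y₂ : ∃[ y₁ ] y ≡ n * y₁ × y₁ * y₁ ≡ n * n * 𝔽.𝐹 x z → ⊥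
      with-y₂ (y₁ , _ , e₂) = with-y₃ (3^-root k {𝔽.𝐹 x z} {y₁} e₂)
        where
        with-y₃ : ∃[ y₂ ] y₁ ≡ n * y₂ × y₂ * y₂ ≡ 𝔽.𝐹 x z → ⊥
        with-y₃ (y₂ , _ , e₃) = coprime-case y₂ e₃

-- The curve over a quadratic order.

-- The order ℤ[√d]; a +√ b stands for a + b√d.  Multiplication by d is arranged to compute on 0, so that
-- products of rational integers compute.
module QuadraticOrder (d : ℤ) where
  infix 5 _+√_
  infixl 6 _⊞_ _⊟_
  infixl 7 _⊠_
  infix 8 ∼_

  record 𝕂 : Set where
    no-eta-equality
    pattern
    constructor _+√_
    field rat irr : ℤ

  open 𝕂 public

  𝕂-ext : ∀ {a b a′ b′} → a ≡ a′ → b ≡ b′ → (a +√ b) ≡ (a′ +√ b′)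
  𝕂-ext refl refl = refl

  d* : ℤ → ℤ
  d* +0 = +0
  d* n = d * n

  d*≡ : ∀ n → d* n ≡ d * n
  d*≡ +0 = sym (ℤ.*-zeroʳ d)
  d*≡ (+ suc n) = refl
  d*≡ -[1+ n ] = refl

  _⊞_ _⊠_ _⊟_ : 𝕂 → 𝕂 → 𝕂
  (a +√ b) ⊞ (a′ +√ b′) = (a + a′) +√ (b + b′)
  (a +√ b) ⊠ (a′ +√ b′) = (a * a′ + d* (b * b′)) +√ (a * b′ + b * a′)

  ∼_ : 𝕂 → 𝕂
  ∼ (a +√ b) = (- a) +√ (- b)

  x ⊟ y = x ⊞ (∼ y)

  ⌜_⌝ : ℤ → 𝕂
  ⌜ n ⌝ = n +√ 0ℤ

  ⊠≡ : ∀ a b a′ b′ → (a +√ b) ⊠ (a′ +√ b′) ≡ ((a * a′ + d * (b * b′)) +√ (a * b′ + b * a′))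
  ⊠≡ a b a′ b′ = 𝕂-ext (cong (λ t → a * a′ + t) (d*≡ (b * b′))) refl

  private
    ⊠-assoc : ∀ x y z → (x ⊠ y) ⊠ z ≡ x ⊠ (y ⊠ z)
    ⊠-assoc (a +√ b) (a′ +√ b′) (a″ +√ b″) = trans (cong (_⊠ (a″ +√ b″)) (⊠≡ a b a′ b′)) (trans (⊠≡ (a * a′ + d * (b * b′)) (a * b′ + b * a′) a″ b″)
      (trans (𝕂-ext
        (solve 7 (λ d a b a′ b′ a″ b″ → (a :* a′ :+ d :* (b :* b′)) :* a″ :+ d :* ((a :* b′ :+ b :* a′) :* b″) := a :* (a′ :* a″ :+ d :* (b′ :* b″)) :+ d :* (b :* (a′ :* b″ :+ b′ :* a″))) refl d a b a′ b′ a″ b″)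
        (solve 7 (λ d a b a′ b′ a″ b″ → (a :* a′ :+ d :* (b :* b′)) :* b″ :+ (a :* b′ :+ b :* a′) :* a″ := a :* (a′ :* b″ :+ b′ :* a″) :+ b :* (a′ :* a″ :+ d :* (b′ :* b″))) refl d a b a′ b′ a″ b″))
        (sym (trans (cong ((a +√ b) ⊠_) (⊠≡ a′ b′ a″ b″)) (⊠≡ a b (a′ * a″ + d * (b′ * b″)) (a′ * b″ + b′ * a″))))))

    ⊠-comm : ∀ x y → x ⊠ y ≡ y ⊠ x
    ⊠-comm (a +√ b) (a′ +√ b′) = 𝕂-ext (cong₂ _+_ (ℤ.*-comm a a′) (cong d* (ℤ.*-comm b b′))) (solve 4 (λ a b a′ b′ → a :* b′ :+ b :* a′ := a′ :* b :+ b′ :* a) refl a b a′ b′)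

    ⊠-identityˡ : ∀ x → ⌜ 1ℤ ⌝ ⊠ x ≡ x
    ⊠-identityˡ (a +√ b) = trans (⊠≡ 1ℤ 0ℤ a b) (𝕂-ext (solve 3 (λ d a b → κ 1ℤ :* a :+ d :* (κ 0ℤ :* b) := a) refl d a b) (solve 2 (λ a b → κ 1ℤ :* b :+ κ 0ℤ :* a := b) refl a b))

    ⊠-distribˡ : ∀ x y z → x ⊠ (y ⊞ z) ≡ x ⊠ y ⊞ x ⊠ z
    ⊠-distribˡ (a +√ b) (a′ +√ b′) (a″ +√ b″) = trans (⊠≡ a b (a′ + a″) (b′ + b″)) (trans (𝕂-ext
        (solve 7 (λ d a b a′ b′ a″ b″ → a :* (a′ :+ a″) :+ d :* (b :* (b′ :+ b″)) := a :* a′ :+ d :* (b :* b′) :+ (a :* a″ :+ d :* (b :* b″))) refl d a b a′ b′ a″ b″)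
        (solve 6 (λ a b a′ b′ a″ b″ → a :* (b′ :+ b″) :+ b :* (a′ :+ a″) := a :* b′ :+ b :* a′ :+ (a :* b″ :+ b :* a″)) refl a b a′ b′ a″ b″))
      (sym (cong₂ _⊞_ (⊠≡ a b a′ b′) (⊠≡ a b a″ b″))))

  𝕂-isCommutativeRing : IsCommutativeRing _≡_ _⊞_ _⊠_ ∼_ ⌜ 0ℤ ⌝ ⌜ 1ℤ ⌝
  𝕂-isCommutativeRing = record
    { isRing = record
      { +-isAbelianGroup = record
        { isGroup = record
          { isMonoid = record
            { isSemigroup = record
              { isMagma = record { isEquivalence = isEquivalence ; ∙-cong = cong₂ _⊞_ }
              ; assoc = λ { (a +√ b) (a′ +√ b′) (a″ +√ b″) → 𝕂-ext (ℤ.+-assoc a a′ a″) (ℤ.+-assoc b b′ b″) } }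
            ; identity = (λ { (a +√ b) → 𝕂-ext (ℤ.+-identityˡ a) (ℤ.+-identityˡ b) }) , (λ { (a +√ b) → 𝕂-ext (ℤ.+-identityʳ a) (ℤ.+-identityʳ b) }) }
          ; inverse = (λ { (a +√ b) → 𝕂-ext (ℤ.+-inverseˡ a) (ℤ.+-inverseˡ b) }) , (λ { (a +√ b) → 𝕂-ext (ℤ.+-inverseʳ a) (ℤ.+-inverseʳ b) })
          ; ⁻¹-cong = cong ∼_ }
        ; comm = λ { (a +√ b) (a′ +√ b′) → 𝕂-ext (ℤ.+-comm a a′) (ℤ.+-comm b b′) } }
      ; *-cong = cong₂ _⊠_
      ; *-assoc = ⊠-assoc
      ; *-identity = ⊠-identityˡ , λ x → trans (⊠-comm x ⌜ 1ℤ ⌝) (⊠-identityˡ x)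
      ; distrib = ⊠-distribˡ , λ x y z → trans (⊠-comm (y ⊞ z) x) (trans (⊠-distribˡ x y z) (cong₂ _⊞_ (⊠-comm x y) (⊠-comm x z))) }
    ; *-comm = ⊠-comm }

  isZero𝕂 : 𝕂 → Bool
  isZero𝕂 (a +√ b) = isZeroℤ a ∧ isZeroℤ b

  isZero𝕂-sound : ∀ x → isZero𝕂 x ≡ true → x ≡ ⌜ 0ℤ ⌝
  isZero𝕂-sound (+0 +√ b) h = cong (0ℤ +√_) (isZeroℤ-sound b h)

  module 𝕂S = PolynomialSolver 𝕂-isCommutativeRing isZero𝕂 isZero𝕂-sound

  nm : 𝕂 → ℤ
  nm (a +√ b) = a * a - d * (b * b)

  nm-⊠ : ∀ x y → nm (x ⊠ y) ≡ nm x * nm y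
  nm-⊠ (a +√ b) (a′ +√ b′) = trans (cong nm (⊠≡ a b a′ b′))
    (solve 5 (λ d a b a′ b′ → (a :* a′ :+ d :* (b :* b′)) :* (a :* a′ :+ d :* (b :* b′)) :- d :* ((a :* b′ :+ b :* a′) :* (a :* b′ :+ b :* a′)) := (a :* a :- d :* (b :* b)) :* (a′ :* a′ :- d :* (b′ :* b′))) refl d a b a′ b′)

  ⌜⌝-+ : ∀ m n → ⌜ m + n ⌝ ≡ ⌜ m ⌝ ⊞ ⌜ n ⌝
  ⌜⌝-+ m n = refl

  ⌜⌝-* : ∀ m n → ⌜ m * n ⌝ ≡ ⌜ m ⌝ ⊠ ⌜ n ⌝
  ⌜⌝-* m n = 𝕂-ext (sym (ℤ.+-identityʳ (m * n))) (solve 2 (λ m n → κ 0ℤ := m :* κ 0ℤ :+ κ 0ℤ :* n) refl m n)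

  -- ⌜_⌝ as a homomorphism on polynomial expressions
  ⌜⌝-expr : ∀ {n} → ℤS.Expr n → 𝕂S.Expr n
  ⌜⌝-expr (ℤS.var i) = 𝕂S.var i
  ⌜⌝-expr (κ c) = 𝕂S.κ ⌜ c ⌝
  ⌜⌝-expr (a :+ b) = ⌜⌝-expr a 𝕂S.:+ ⌜⌝-expr b
  ⌜⌝-expr (a :* b) = ⌜⌝-expr a 𝕂S.:* ⌜⌝-expr b
  ⌜⌝-expr (:- a) = 𝕂S.:- ⌜⌝-expr a

  ⌜⌝-eval : ∀ {n} (e : ℤS.Expr n) ρ → ⌜ ℤS.⟦ e ⟧ ρ ⌝ ≡ 𝕂S.⟦ ⌜⌝-expr e ⟧ (map ⌜_⌝ ρ)
  ⌜⌝-eval (ℤS.var i) ρ = sym (lookup-map i ⌜_⌝ ρ)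
  ⌜⌝-eval (κ c) ρ = refl
  ⌜⌝-eval (a :+ b) ρ = cong₂ _⊞_ (⌜⌝-eval a ρ) (⌜⌝-eval b ρ)
  ⌜⌝-eval (a :* b) ρ = trans (⌜⌝-* (ℤS.⟦ a ⟧ ρ) (ℤS.⟦ b ⟧ ρ)) (cong₂ _⊠_ (⌜⌝-eval a ρ) (⌜⌝-eval b ρ))
  ⌜⌝-eval (:- a) ρ = cong ∼_ (⌜⌝-eval a ρ)

  module 𝔽𝕂 = Forms {𝕂} _⊞_ _⊠_ ∼_ ⌜_⌝
  module 𝔽𝕂S {n : ℕ} = Forms {𝕂S.Expr n} 𝕂S._:+_ 𝕂S._:*_ (𝕂S.:-_) (λ c → 𝕂S.κ ⌜ c ⌝)

  module Domain (nonsquare : ∀ a b → b ≢ 0ℤ → a * a ≢ d * (b * b)) where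
    nm-zero : ∀ x → nm x ≡ 0ℤ → x ≡ ⌜ 0ℤ ⌝
    nm-zero (a +√ b) h = by (b ℤ.≟ 0ℤ)
      where
      by : Dec (b ≡ 0ℤ) → (a +√ b) ≡ ⌜ 0ℤ ⌝
      by (no b≢0) = ⊥-elim (nonsquare a b b≢0 (zero-difference h))
      by (yes refl) = cong (_+√ 0ℤ) ([ (λ z → z) , (λ z → z) ]′ (ℤ.i*j≡0⇒i≡0∨j≡0 a (trans (solve 2 (λ a d → a :* a := a :* a :- d :* (κ 0ℤ :* κ 0ℤ)) refl a d) h)))

    ⊠-integral : ∀ x {y} → x ⊠ y ≡ ⌜ 0ℤ ⌝ → x ≢ ⌜ 0ℤ ⌝ → y ≡ ⌜ 0ℤ ⌝
    ⊠-integral x {y} h x≢0 = nm-zero y (ℤ-integral (nm x) (trans (sym (nm-⊠ x y)) (trans (cong nm h) (solve 1 (λ d → κ 0ℤ :* κ 0ℤ :- d :* (κ 0ℤ :* κ 0ℤ) := κ 0ℤ) refl d))) (λ z → x≢0 (nm-zero x z)))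

    ⊟-zero : ∀ {x y} → x ⊟ y ≡ ⌜ 0ℤ ⌝ → x ≡ y
    ⊟-zero {x} {y} h = trans (𝕂S.solve 2 (λ x y → x 𝕂S.:= x 𝕂S.:- y 𝕂S.:+ y) refl x y) (trans (cong (_⊞ y) h) (𝕂S.solve 1 (λ y → 𝕂S.κ ⌜ 0ℤ ⌝ 𝕂S.:+ y 𝕂S.:= y) refl y))

    zero-⊟ : ∀ {x y} → x ≡ y → x ⊟ y ≡ ⌜ 0ℤ ⌝
    zero-⊟ {x} refl = 𝕂S.solve 1 (λ x → x 𝕂S.:- x 𝕂S.:= 𝕂S.κ ⌜ 0ℤ ⌝) refl x

    ⊠-cancelˡ : ∀ x {y z} → x ≢ ⌜ 0ℤ ⌝ → x ⊠ y ≡ x ⊠ z → y ≡ z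
    ⊠-cancelˡ x {y} {z} x≢0 h = ⊟-zero (⊠-integral x (trans (𝕂S.solve 3 (λ x y z → x 𝕂S.:* (y 𝕂S.:- z) 𝕂S.:= x 𝕂S.:* y 𝕂S.:- x 𝕂S.:* z) refl x y z) (zero-⊟ h)) x≢0)

module CurveOverOrder (d : ℤ) (nonsquare : ∀ a b → b ≢ 0ℤ → a * a ≢ d * (b * b)) (N : ℤ) (N≢0 : N ≢ 0ℤ) where
  open QuadraticOrder d
  open Domain nonsquare
  open 𝕂S using () renaming (solve to solveᴷ; _:+_ to infixl 6 _+:_; _:-_ to infixl 6 _-:_; _:*_ to infixl 7 _*:_; _:=_ to infix 4 _=:_; κ to κᴷ)
  private
    module C𝕂S {n : ℕ} = Coefficients {𝕂S.Expr n} 𝕂S._:+_ 𝕂S._:*_ (𝕂S.:-_) (λ c → 𝕂S.κ ⌜ c ⌝)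
    module Q𝕂S {n : ℕ} = Quotient {𝕂S.Expr n} 𝕂S._:+_ 𝕂S._:*_ (𝕂S.:-_) (λ c → 𝕂S.κ ⌜ c ⌝)

  0ᴷ : 𝕂
  0ᴷ = ⌜ 0ℤ ⌝

  ⌜⌝-injective : ∀ {m n} → ⌜ m ⌝ ≡ ⌜ n ⌝ → m ≡ n
  ⌜⌝-injective = cong rat

  ⌜⌝≢0 : ∀ {n} → n ≢ 0ℤ → ⌜ n ⌝ ≢ 0ᴷ
  ⌜⌝≢0 h e = h (⌜⌝-injective e)

  private
    x y : ℤS.Expr 2
    x = ℤS.var zero
    y = ℤS.var (suc zero)

  𝐹-⌜⌝ : ∀ a b → ⌜ 𝔽.𝐹 a b ⌝ ≡ 𝔽𝕂.𝐹 ⌜ a ⌝ ⌜ b ⌝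
  𝐹-⌜⌝ a b = ⌜⌝-eval (𝔽S.𝐹 x y) (a ∷ b ∷ [])

  𝐻-⌜⌝ : ∀ a b → ⌜ 𝔽.𝐻 a b ⌝ ≡ 𝔽𝕂.𝐻 ⌜ a ⌝ ⌜ b ⌝
  𝐻-⌜⌝ a b = ⌜⌝-eval (𝔽S.𝐻 x y) (a ∷ b ∷ [])

  -- X/N is the abscissa and Y/N³ the ordinate of a point of y² = 𝐹(x, 1) with (y + h)(y - 3h) a square.
  record CurvePoint (X : 𝕂) : Set where
    field
      Y S : 𝕂
      X≢0 : X ≢ 0ᴷ
      X+N≢0 : X ⊞ ⌜ N ⌝ ≢ 0ᴷ
      equation : Y ⊠ Y ≡ 𝔽𝕂.𝐹 X ⌜ N ⌝
      square : S ⊠ S ≡ (Y ⊞ 𝔽𝕂.𝐻 X ⌜ N ⌝) ⊠ (Y ⊟ ⌜ + 3 ⌝ ⊠ 𝔽𝕂.𝐻 X ⌜ N ⌝)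

  IsRoot : (t p q : ℤ) → 𝕂 → Set
  IsRoot t p q X = 𝔽𝕂.quadratic ⌜ t ⌝ ⌜ p ⌝ ⌜ q ⌝ X ⌜ N ⌝ ≡ 0ᴷ

  -- Case x ∈ ℚ.
  module Rational (n : ℤ) (cp : CurvePoint ⌜ n ⌝) where
    open CurvePoint cp
    H : ℤ
    H = 𝔽.𝐻 n N
    H≢0 : H ≢ 0ℤ
    H≢0 = *-nonzero (*-nonzero {n} {N} (λ h → X≢0 (cong ⌜_⌝ h)) N≢0) (λ h → X+N≢0 (cong ⌜_⌝ h))

    -- Since y² is rational, one of the two coordinates of y vanishes. A rational y contradicts
    -- `rational-point`; otherwise the norm of the square (y + h)(y - 3h) is `𝑁`, contradicting
    -- `rational-twist`.
    no-rational-abscissa : ⊥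
    no-rational-abscissa = by Y equation square
      where
      by : ∀ Y → Y ⊠ Y ≡ 𝔽𝕂.𝐹 ⌜ n ⌝ ⌜ N ⌝ → S ⊠ S ≡ (Y ⊞ 𝔽𝕂.𝐻 ⌜ n ⌝ ⌜ N ⌝) ⊠ (Y ⊟ ⌜ + 3 ⌝ ⊠ 𝔽𝕂.𝐻 ⌜ n ⌝ ⌜ N ⌝) → ⊥
      by (y₀ +√ y₁) eq sq = split (y₁ ℤ.≟ 0ℤ)
        where
        eq′ : ((y₀ * y₀ + d * (y₁ * y₁)) +√ (y₀ * y₁ + y₁ * y₀)) ≡ ⌜ 𝔽.𝐹 n N ⌝
        eq′ = trans (sym (⊠≡ y₀ y₁ y₀ y₁)) (trans eq (sym (𝐹-⌜⌝ n N)))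
        split : Dec (y₁ ≡ 0ℤ) → ⊥
        split (yes refl) = rational-point n N y₀ H≢0 (trans (solve 2 (λ y d → y :* y := y :* y :+ d :* (κ 0ℤ :* κ 0ℤ)) refl y₀ d) (cong rat eq′))
        split (no y₁≢0) = rational-twist n N H≢0 (1ℤ , nm S , (λ ()) , sym (trans (sym (nm-⊠ S S)) (trans (cong nm sq) (trans (nm-⊠ ((y₀ +√ y₁) ⊞ 𝔽𝕂.𝐻 ⌜ n ⌝ ⌜ N ⌝) ((y₀ +√ y₁) ⊟ ⌜ + 3 ⌝ ⊠ 𝔽𝕂.𝐻 ⌜ n ⌝ ⌜ N ⌝)) (trans (cong₂ _*_ first second) product)))))
          where
          y₀≡0 : y₀ ≡ 0ℤ
          y₀≡0 = ℤ-integral y₁ (ℤ-integral (+ 2) (trans (solve 2 (λ a b → κ (+ 2) :* (b :* a) := a :* b :+ b :* a) refl y₀ y₁) (cong irr eq′)) λ ()) y₁≢0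
          F≡ : d * (y₁ * y₁) ≡ 𝔽.𝐹 n N
          F≡ = trans (solve 2 (λ a b → b := a :* a :+ b :- a :* a) refl y₀ (d * (y₁ * y₁)))
            (trans (cong₂ (λ s a → s - a * a) (cong rat eq′) y₀≡0) (ℤ.+-identityʳ (𝔽.𝐹 n N)))
          norm-of : ∀ k → nm ((y₀ +√ y₁) ⊞ ⌜ k ⌝) ≡ k * k - 𝔽.𝐹 n N
          norm-of k = trans (cong (λ y₀ → nm ((y₀ +√ y₁) ⊞ ⌜ k ⌝)) y₀≡0) (trans (solve 3 (λ k d y → (κ 0ℤ :+ k) :* (κ 0ℤ :+ k) :- d :* ((y :+ κ 0ℤ) :* (y :+ κ 0ℤ)) := k :* k :- d :* (y :* y)) refl k d y₁) (cong (λ f → k * k - f) F≡))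
          first : nm ((y₀ +√ y₁) ⊞ 𝔽𝕂.𝐻 ⌜ n ⌝ ⌜ N ⌝) ≡ H * H - 𝔽.𝐹 n N
          first = trans (cong (λ h → nm ((y₀ +√ y₁) ⊞ h)) (sym (𝐻-⌜⌝ n N))) (norm-of H)
          second : nm ((y₀ +√ y₁) ⊟ ⌜ + 3 ⌝ ⊠ 𝔽𝕂.𝐻 ⌜ n ⌝ ⌜ N ⌝) ≡ (- (+ 3 * H)) * (- (+ 3 * H)) - 𝔽.𝐹 n N
          second = trans (cong (λ h → nm ((y₀ +√ y₁) ⊟ h)) (trans (cong (⌜ + 3 ⌝ ⊠_) (sym (𝐻-⌜⌝ n N))) (sym (⌜⌝-* (+ 3) H)))) (norm-of (- (+ 3 * H)))
          product : (H * H - 𝔽.𝐹 n N) * ((- (+ 3 * H)) * (- (+ 3 * H)) - 𝔽.𝐹 n N) ≡ 1ℤ * 1ℤ * 𝑁 n N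
          product = solve 2 (λ A H → let F = A :* A :+ κ (+ 8) :* (H :* H) in (H :* H :- F) :* ((:- (κ (+ 3) :* H)) :* (:- (κ (+ 3) :* H)) :- F) := κ 1ℤ :* κ 1ℤ :* ((A :* A :+ κ (+ 7) :* (H :* H)) :* (A :* A :- H :* H))) refl (𝔽.𝐴 n N) H

  linear≡ : ∀ l₁ l₀ x₀ x₁ → ⌜ l₁ ⌝ ⊠ (x₀ +√ x₁) ⊞ ⌜ l₀ ⌝ ⊠ ⌜ N ⌝ ≡ ((l₁ * x₀ + l₀ * N) +√ (l₁ * x₁))
  linear≡ l₁ l₀ x₀ x₁ = trans (cong₂ _⊞_ (⊠≡ l₁ 0ℤ x₀ x₁) (⊠≡ l₀ 0ℤ N 0ℤ)) (𝕂-ext (solve 6 (λ d l x y k n → l :* x :+ d :* (κ 0ℤ :* y) :+ (k :* n :+ d :* (κ 0ℤ :* κ 0ℤ)) := l :* x :+ k :* n) refl d l₁ x₀ x₁ l₀ N)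
    (solve 5 (λ l x y k n → l :* y :+ κ 0ℤ :* x :+ (k :* κ 0ℤ :+ κ 0ℤ :* n) := l :* y) refl l₁ x₀ x₁ l₀ N))

  linear-zero : ∀ X {l₁ l₀} → irr X ≢ 0ℤ → ⌜ l₁ ⌝ ⊠ X ⊞ ⌜ l₀ ⌝ ⊠ ⌜ N ⌝ ≡ 0ᴷ → l₁ ≡ 0ℤ × l₀ ≡ 0ℤ
  linear-zero (x₀ +√ x₁) {l₁} {l₀} x₁≢0 h = l₁≡0 , ℤ-integral N (trans (solve 3 (λ n l k → n :* l := (κ 0ℤ :* k :+ l :* n)) refl N l₀ x₀)
      (trans (cong (λ l → l * x₀ + l₀ * N) (sym l₁≡0)) (cong rat h′))) N≢0
    where
    h′ : ((l₁ * x₀ + l₀ * N) +√ (l₁ * x₁)) ≡ 0ᴷ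
    h′ = trans (sym (linear≡ l₁ l₀ x₀ x₁)) h
    l₁≡0 : l₁ ≡ 0ℤ
    l₁≡0 = ℤ-integral x₁ (trans (ℤ.*-comm x₁ l₁) (cong irr h′)) x₁≢0

  eliminate : ∀ X Y → ⌜ irr X ⌝ ⊠ Y ≡ ⌜ irr Y ⌝ ⊠ X ⊞ ⌜ rat Y * irr X - irr Y * rat X ⌝
  eliminate (x₀ +√ x₁) (y₀ +√ y₁) = trans (⊠≡ x₁ 0ℤ y₀ y₁) (trans (𝕂-ext
      (solve 5 (λ d x₀ x₁ y₀ y₁ → x₁ :* y₀ :+ d :* (κ 0ℤ :* y₁) := y₁ :* x₀ :+ d :* (κ 0ℤ :* x₁) :+ (y₀ :* x₁ :- y₁ :* x₀)) refl d x₀ x₁ y₀ y₁)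
      (solve 4 (λ x₀ x₁ y₀ y₁ → x₁ :* y₁ :+ κ 0ℤ :* y₀ := y₁ :* x₁ :+ κ 0ℤ :* x₀ :+ κ 0ℤ) refl x₀ x₁ y₀ y₁))
    (cong (_⊞ ⌜ y₀ * x₁ - y₁ * x₀ ⌝) (sym (⊠≡ y₁ 0ℤ x₀ x₁))))

  -- The coordinate of √d in the root equation gives the trace of X, and the rational coordinate
  -- then gives its norm.
  norm-linear : ∀ {t p q} X → irr X ≢ 0ℤ → IsRoot t p q X → ∀ l₁ l₀ → t * nm (⌜ l₁ ⌝ ⊠ X ⊞ ⌜ l₀ ⌝ ⊠ ⌜ N ⌝) ≡ N * N * normForm t p q l₁ l₀
  norm-linear {t} {p} {q} (x₀ +√ x₁) x₁≢0 root l₁ l₀ = trans (cong (λ z → t * nm z) (linear≡ l₁ l₀ x₀ x₁))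
      (trans (solve 7 (λ d t x₀ x₁ l₁ l₀ N → t :* ((l₁ :* x₀ :+ l₀ :* N) :* (l₁ :* x₀ :+ l₀ :* N) :- d :* (l₁ :* x₁ :* (l₁ :* x₁))) :=
          t :* l₀ :* l₀ :* N :* N :+ (κ (+ 2) :* t :* x₀) :* l₀ :* l₁ :* N :+ l₁ :* l₁ :* (t :* (x₀ :* x₀ :- d :* (x₁ :* x₁)))) refl d t x₀ x₁ l₁ l₀ N)
        (trans (cong₂ (λ a b → t * l₀ * l₀ * N * N + a * l₀ * l₁ * N + l₁ * l₁ * b) trace norm)
          (solve 6 (λ t p q l₁ l₀ N → t :* l₀ :* l₀ :* N :* N :+ (:- (p :* N)) :* l₀ :* l₁ :* N :+ l₁ :* l₁ :* (q :* N :* N) := N :* N :* (t :* l₀ :* l₀ :- p :* l₀ :* l₁ :+ q :* l₁ :* l₁)) refl t p q l₁ l₀ N)))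
    where
    components : ((t * (x₀ * x₀ + d * (x₁ * x₁)) + p * (x₀ * N) + q * (N * N)) +√ (t * (x₀ * x₁ + x₁ * x₀) + p * (x₁ * N))) ≡ 0ᴷ
    components = trans (𝕂-ext (solve 7 (λ d t p q x₀ x₁ N → t :* (x₀ :* x₀ :+ d :* (x₁ :* x₁)) :+ p :* (x₀ :* N) :+ q :* (N :* N) :=
          t :* (x₀ :* x₀ :+ d :* (x₁ :* x₁)) :+ d :* (κ 0ℤ :* (x₀ :* x₁ :+ x₁ :* x₀)) :+ (p :* (x₀ :* N :+ d :* (x₁ :* κ 0ℤ)) :+ d :* (κ 0ℤ :* (x₀ :* κ 0ℤ :+ x₁ :* N))) :+ (q :* (N :* N :+ d :* (κ 0ℤ :* κ 0ℤ)) :+ d :* (κ 0ℤ :* (N :* κ 0ℤ :+ κ 0ℤ :* N)))) refl d t p q x₀ x₁ N)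
        (solve 7 (λ d t p q x₀ x₁ N → t :* (x₀ :* x₁ :+ x₁ :* x₀) :+ p :* (x₁ :* N) :=
          t :* (x₀ :* x₁ :+ x₁ :* x₀) :+ κ 0ℤ :* (x₀ :* x₀ :+ d :* (x₁ :* x₁)) :+ (p :* (x₀ :* κ 0ℤ :+ x₁ :* N) :+ κ 0ℤ :* (x₀ :* N :+ d :* (x₁ :* κ 0ℤ))) :+ (q :* (N :* κ 0ℤ :+ κ 0ℤ :* N) :+ κ 0ℤ :* (N :* N :+ d :* (κ 0ℤ :* κ 0ℤ)))) refl d t p q x₀ x₁ N))
      (trans (sym (cong₂ _⊞_ (cong₂ _⊞_ (part t (⊠≡ x₀ x₁ x₀ x₁)) (part p (⊠≡ x₀ x₁ N 0ℤ))) (part q (⊠≡ N 0ℤ N 0ℤ)))) root)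
      where
      part : ∀ c {z a b} → z ≡ (a +√ b) → ⌜ c ⌝ ⊠ z ≡ ((c * a + d * (0ℤ * b)) +√ (c * b + 0ℤ * a))
      part c {z} {a} {b} e = trans (cong (⌜ c ⌝ ⊠_) e) (⊠≡ c 0ℤ a b)
    trace : + 2 * t * x₀ ≡ - (p * N)
    trace = zero-difference (ℤ-integral x₁ (trans (solve 5 (λ t p x₀ x₁ N → x₁ :* (κ (+ 2) :* t :* x₀ :- (:- (p :* N))) := t :* (x₀ :* x₁ :+ x₁ :* x₀) :+ p :* (x₁ :* N)) refl t p x₀ x₁ N) (cong irr components)) x₁≢0)
    norm : t * (x₀ * x₀ - d * (x₁ * x₁)) ≡ q * N * N
    norm = sym (zero-difference (trans (solve 7 (λ d t p q x₀ x₁ N → q :* N :* N :- t :* (x₀ :* x₀ :- d :* (x₁ :* x₁)) := (t :* (x₀ :* x₀ :+ d :* (x₁ :* x₁)) :+ p :* (x₀ :* N) :+ q :* (N :* N)) :- x₀ :* (κ (+ 2) :* t :* x₀ :- (:- (p :* N)))) refl d t p q x₀ x₁ N)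
      (trans (cong₂ (λ a b → a - x₀ * b) (cong rat components) (difference-zero trace)) (solve 1 (λ x → κ 0ℤ :- x :* κ 0ℤ := κ 0ℤ) refl x₀))))

  module Irrational {t p q : ℤ} (nt : ¬ 3∣ℤ t) (X : 𝕂) (irrational : irr X ≢ 0ℤ) (root : IsRoot t p q X) (cp : CurvePoint X) where
    open CurvePoint cp
    -- Eliminating √d gives x₁Y = y₁X + c. With x = X/N and y = Y/N³ this is t²wy = ux + v for the
    -- values below.
    x₁ y₁ c u v w : ℤ
    x₁ = irr X
    y₁ = irr Y
    c = rat Y * irr X - irr Y * rat X
    u = t * t * y₁ * N
    v = t * t * c
    w = N * N * N * x₁

    w≢0 : w ≢ 0ℤ
    w≢0 = *-nonzero (*-nonzero (*-nonzero N≢0 N≢0) N≢0) irrational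

    t≢0 : t ≢ 0ℤ
    t≢0 h = nt (0ℤ , h)

    private
      var : Fin 7 → ℤS.Expr 7
      var = ℤS.var
      et ep eq eN ex ey ec eu ev ew : ℤS.Expr 7
      et = var zero
      ep = var (suc zero)
      eq = var (suc (suc zero))
      eN = var (suc (suc (suc zero)))
      ex = var (suc (suc (suc (suc zero))))
      ey = var (suc (suc (suc (suc (suc zero)))))
      ec = var (suc (suc (suc (suc (suc (suc zero))))))
      eu = et :* et :* ey :* eN
      ev = et :* et :* ec
      ew = eN :* eN :* eN :* ex
      ρ₇ : Vec ℤ 7
      ρ₇ = t ∷ p ∷ q ∷ N ∷ x₁ ∷ y₁ ∷ c ∷ []
      lead-e last-e : ℤS.Expr 7
      lead-e = κ (+ 2) :* et :* eu :* ev :- ep :* eu :* eu :- ew :* ew :* CoS.R₁ et ep eq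
      last-e = et :* ev :* ev :- eq :* eu :* eu :- ew :* ew :* CoS.R₀ et ep eq

    private
      -- the division of t⁶w²𝐹 by the quadratic form, as in QuadraticPoint
      division : ∀ T P Q N X x y c → let
          open Coefficients {𝕂} _⊞_ _⊠_ ∼_ ⌜_⌝ using (R₁; R₀)
          open Quotient {𝕂} _⊞_ _⊠_ ∼_ ⌜_⌝
          U = T ⊠ T ⊠ y ⊠ N
          V = T ⊠ T ⊠ c
          W = N ⊠ N ⊠ N ⊠ x
          L₁ = ⌜ + 2 ⌝ ⊠ T ⊠ U ⊠ V ⊟ P ⊠ U ⊠ U ⊟ W ⊠ W ⊠ R₁ T P Q
          L₀ = T ⊠ V ⊠ V ⊟ Q ⊠ U ⊠ U ⊟ W ⊠ W ⊠ R₀ T P Q in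
        T ⊠ (N ⊠ N ⊠ N ⊠ N ⊠ N) ⊠ (L₁ ⊠ X ⊞ L₀ ⊠ N) ≡
        T ⊠ T ⊠ T ⊠ (N ⊠ N ⊠ N) ⊠ (T ⊠ T ⊠ T ⊠ (N ⊠ N ⊠ N)) ⊠ ((y ⊠ X ⊞ c) ⊠ (y ⊠ X ⊞ c) ⊟ x ⊠ x ⊠ 𝔽𝕂.𝐹 X N)
        ⊞ 𝔽𝕂.quadratic T P Q X N ⊠ 𝔽𝕂.quartic (G₄ T P Q U W) (G₃ T P Q U W) (G₂ T P Q U W) (G₁ T P Q U W) (G₀ T P Q U W) X N
      division = solveᴷ 8 (λ T P Q N X x y c → let
          open C𝕂S using (R₁; R₀)
          open Q𝕂S
          U = T *: T *: y *: N
          V = T *: T *: c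
          W = N *: N *: N *: x
          L₁ = κᴷ ⌜ + 2 ⌝ *: T *: U *: V -: P *: U *: U -: W *: W *: R₁ T P Q
          L₀ = T *: V *: V -: Q *: U *: U -: W *: W *: R₀ T P Q in
        T *: (N *: N *: N *: N *: N) *: (L₁ *: X +: L₀ *: N) =:
        T *: T *: T *: (N *: N *: N) *: (T *: T *: T *: (N *: N *: N)) *: ((y *: X +: c) *: (y *: X +: c) -: x *: x *: 𝔽𝕂S.𝐹 X N)
        +: 𝔽𝕂S.quadratic T P Q X N *: 𝔽𝕂S.quartic (G₄ T P Q U W) (G₃ T P Q U W) (G₂ T P Q U W) (G₁ T P Q U W) (G₀ T P Q U W) X N) refl

      elimination : (⌜ y₁ ⌝ ⊠ X ⊞ ⌜ c ⌝) ⊠ (⌜ y₁ ⌝ ⊠ X ⊞ ⌜ c ⌝) ⊟ ⌜ x₁ ⌝ ⊠ ⌜ x₁ ⌝ ⊠ 𝔽𝕂.𝐹 X ⌜ N ⌝ ≡ 0ᴷ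
      elimination = trans (cong₂ (λ s f → s ⊠ s ⊟ ⌜ x₁ ⌝ ⊠ ⌜ x₁ ⌝ ⊠ f) (sym (eliminate X Y)) (sym equation))
        (solveᴷ 2 (λ x y → x *: y *: (x *: y) -: x *: x *: (y *: y) =: κᴷ 0ᴷ) refl ⌜ x₁ ⌝ Y)

    -- By `division` the two defects L₁ and L₀ of the point satisfy L₁X + L₀N = 0, and X is
    -- irrational.
    point′ : Point t p q u v w
    point′ = make (linear-zero X {L₁} {L₀} irrational (⊠-integral (⌜ t ⌝ ⊠ (⌜ N ⌝ ⊠ ⌜ N ⌝ ⊠ ⌜ N ⌝ ⊠ ⌜ N ⌝ ⊠ ⌜ N ⌝))
        (trans (cong₂ (λ a b → ⌜ t ⌝ ⊠ (⌜ N ⌝ ⊠ ⌜ N ⌝ ⊠ ⌜ N ⌝ ⊠ ⌜ N ⌝ ⊠ ⌜ N ⌝) ⊠ (a ⊠ X ⊞ b ⊠ ⌜ N ⌝)) (⌜⌝-eval lead-e ρ₇) (⌜⌝-eval last-e ρ₇))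
          (trans (division ⌜ t ⌝ ⌜ p ⌝ ⌜ q ⌝ ⌜ N ⌝ X ⌜ x₁ ⌝ ⌜ y₁ ⌝ ⌜ c ⌝) (trans (cong₂ (λ s r → a ⊠ s ⊞ r ⊠ b) elimination root)
            (solveᴷ 2 (λ a b → a *: κᴷ 0ᴷ +: κᴷ 0ᴷ *: b =: κᴷ 0ᴷ) refl a b))))
        nonzero))
      where
      open Quotient {𝕂} _⊞_ _⊠_ ∼_ ⌜_⌝
      L₁ = ℤS.⟦ lead-e ⟧ ρ₇
      L₀ = ℤS.⟦ last-e ⟧ ρ₇
      T = ⌜ t ⌝
      n = ⌜ N ⌝
      a = T ⊠ T ⊠ T ⊠ (n ⊠ n ⊠ n) ⊠ (T ⊠ T ⊠ T ⊠ (n ⊠ n ⊠ n))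
      U = T ⊠ T ⊠ ⌜ y₁ ⌝ ⊠ n
      W = n ⊠ n ⊠ n ⊠ ⌜ x₁ ⌝
      b = 𝔽𝕂.quartic (G₄ T ⌜ p ⌝ ⌜ q ⌝ U W) (G₃ T ⌜ p ⌝ ⌜ q ⌝ U W) (G₂ T ⌜ p ⌝ ⌜ q ⌝ U W) (G₁ T ⌜ p ⌝ ⌜ q ⌝ U W) (G₀ T ⌜ p ⌝ ⌜ q ⌝ U W) X n
      make : L₁ ≡ 0ℤ × L₀ ≡ 0ℤ → Point t p q u v w
      make (h₁ , h₀) = point (zero-difference h₁) (zero-difference h₀)
      nonzero : T ⊠ (n ⊠ n ⊠ n ⊠ n ⊠ n) ≢ 0ᴷ
      nonzero h = pow (⊠-integral T h (⌜⌝≢0 t≢0))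
        where
        cut : ∀ {z} → z ⊠ n ≡ 0ᴷ → z ≡ 0ᴷ
        cut {z} h = ⊠-integral n (trans (solveᴷ 2 (λ n z → n *: z =: z *: n) refl n z) h) (⌜⌝≢0 N≢0)
        pow : n ⊠ n ⊠ n ⊠ n ⊠ n ≡ 0ᴷ → ⊥
        pow h = ⌜⌝≢0 N≢0 (cut (cut (cut (cut h))))

    private
      -- N (l₁ X + l₀ N) = (N t)² x₁ (Y + k 𝐻), by the equation of X
      linear-factor : ∀ k → let
          l₁ = u + k * (t * w * (t - p))
          l₀ = v - k * (t * w * q) in
        ⌜ N ⌝ ⊠ (⌜ l₁ ⌝ ⊠ X ⊞ ⌜ l₀ ⌝ ⊠ ⌜ N ⌝) ≡ ⌜ N * N * (t * t) * x₁ ⌝ ⊠ (Y ⊞ ⌜ k ⌝ ⊠ 𝔽𝕂.𝐻 X ⌜ N ⌝)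
      linear-factor k = begin
        ⌜ N ⌝ ⊠ (⌜ l₁ ⌝ ⊠ X ⊞ ⌜ l₀ ⌝ ⊠ ⌜ N ⌝)
          ≡⟨ cong₂ (λ a b → ⌜ N ⌝ ⊠ (a ⊠ X ⊞ b ⊠ ⌜ N ⌝)) (⌜⌝-eval e₁ ρ₈) (⌜⌝-eval e₀ ρ₈) ⟩
        ⌜ N ⌝ ⊠ (𝕂S.⟦ ⌜⌝-expr e₁ ⟧ (map ⌜_⌝ ρ₈) ⊠ X ⊞ 𝕂S.⟦ ⌜⌝-expr e₀ ⟧ (map ⌜_⌝ ρ₈) ⊠ ⌜ N ⌝)
          ≡⟨ identity ⌜ t ⌝ ⌜ p ⌝ ⌜ q ⌝ ⌜ N ⌝ ⌜ x₁ ⌝ ⌜ y₁ ⌝ ⌜ c ⌝ ⌜ k ⌝ X ⟩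
        ⌜ N ⌝ ⊠ ⌜ N ⌝ ⊠ (⌜ t ⌝ ⊠ ⌜ t ⌝) ⊠ (⌜ y₁ ⌝ ⊠ X ⊞ ⌜ c ⌝) ⊞ ⌜ N ⌝ ⊠ ⌜ N ⌝ ⊠ (⌜ t ⌝ ⊠ ⌜ t ⌝) ⊠ ⌜ x₁ ⌝ ⊠ (⌜ k ⌝ ⊠ 𝔽𝕂.𝐻 X ⌜ N ⌝) ⊟ ⌜ k ⌝ ⊠ ⌜ t ⌝ ⊠ (⌜ N ⌝ ⊠ ⌜ N ⌝ ⊠ ⌜ N ⌝ ⊠ ⌜ x₁ ⌝) ⊠ 𝔽𝕂.quadratic ⌜ t ⌝ ⌜ p ⌝ ⌜ q ⌝ X ⌜ N ⌝
          ≡⟨ cong₂ (λ a r → ⌜ N ⌝ ⊠ ⌜ N ⌝ ⊠ (⌜ t ⌝ ⊠ ⌜ t ⌝) ⊠ a ⊞ ⌜ N ⌝ ⊠ ⌜ N ⌝ ⊠ (⌜ t ⌝ ⊠ ⌜ t ⌝) ⊠ ⌜ x₁ ⌝ ⊠ (⌜ k ⌝ ⊠ 𝔽𝕂.𝐻 X ⌜ N ⌝) ⊟ ⌜ k ⌝ ⊠ ⌜ t ⌝ ⊠ (⌜ N ⌝ ⊠ ⌜ N ⌝ ⊠ ⌜ N ⌝ ⊠ ⌜ x₁ ⌝) ⊠ r) (sym (eliminate X Y)) root ⟩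
        ⌜ N ⌝ ⊠ ⌜ N ⌝ ⊠ (⌜ t ⌝ ⊠ ⌜ t ⌝) ⊠ (⌜ x₁ ⌝ ⊠ Y) ⊞ ⌜ N ⌝ ⊠ ⌜ N ⌝ ⊠ (⌜ t ⌝ ⊠ ⌜ t ⌝) ⊠ ⌜ x₁ ⌝ ⊠ (⌜ k ⌝ ⊠ 𝔽𝕂.𝐻 X ⌜ N ⌝) ⊟ ⌜ k ⌝ ⊠ ⌜ t ⌝ ⊠ (⌜ N ⌝ ⊠ ⌜ N ⌝ ⊠ ⌜ N ⌝ ⊠ ⌜ x₁ ⌝) ⊠ 0ᴷ
          ≡⟨ solveᴷ 7 (λ T N x k Y H z → N *: N *: (T *: T) *: (x *: Y) +: N *: N *: (T *: T) *: x *: (k *: H) -: z *: κᴷ 0ᴷ =: N *: N *: (T *: T) *: x *: (Y +: k *: H)) refl ⌜ t ⌝ ⌜ N ⌝ ⌜ x₁ ⌝ ⌜ k ⌝ Y (𝔽𝕂.𝐻 X ⌜ N ⌝) (⌜ k ⌝ ⊠ ⌜ t ⌝ ⊠ (⌜ N ⌝ ⊠ ⌜ N ⌝ ⊠ ⌜ N ⌝ ⊠ ⌜ x₁ ⌝)) ⟩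
        ⌜ N ⌝ ⊠ ⌜ N ⌝ ⊠ (⌜ t ⌝ ⊠ ⌜ t ⌝) ⊠ ⌜ x₁ ⌝ ⊠ (Y ⊞ ⌜ k ⌝ ⊠ 𝔽𝕂.𝐻 X ⌜ N ⌝)
          ≡⟨ cong (_⊠ (Y ⊞ ⌜ k ⌝ ⊠ 𝔽𝕂.𝐻 X ⌜ N ⌝)) (sym (⌜⌝-eval (eN :* eN :* (et :* et) :* ex) ρ₇)) ⟩
        ⌜ N * N * (t * t) * x₁ ⌝ ⊠ (Y ⊞ ⌜ k ⌝ ⊠ 𝔽𝕂.𝐻 X ⌜ N ⌝) ∎
        where
        open ≡-Reasoning
        l₁ = u + k * (t * w * (t - p))
        l₀ = v - k * (t * w * q)
        ρ₈ : Vec ℤ 8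
        ρ₈ = t ∷ p ∷ q ∷ N ∷ x₁ ∷ y₁ ∷ c ∷ k ∷ []
        e₁ e₀ : ℤS.Expr 8
        e₁ = ℤS.var zero :* ℤS.var zero :* ℤS.var (suc (suc (suc (suc (suc zero))))) :* ℤS.var (suc (suc (suc zero))) :+ ℤS.var (suc (suc (suc (suc (suc (suc (suc zero))))))) :* (ℤS.var zero :* (ℤS.var (suc (suc (suc zero))) :* ℤS.var (suc (suc (suc zero))) :* ℤS.var (suc (suc (suc zero))) :* ℤS.var (suc (suc (suc (suc zero))))) :* (ℤS.var zero :- ℤS.var (suc zero)))
        e₀ = ℤS.var zero :* ℤS.var zero :* ℤS.var (suc (suc (suc (suc (suc (suc zero)))))) :- ℤS.var (suc (suc (suc (suc (suc (suc (suc zero))))))) :* (ℤS.var zero :* (ℤS.var (suc (suc (suc zero))) :* ℤS.var (suc (suc (suc zero))) :* ℤS.var (suc (suc (suc zero))) :* ℤS.var (suc (suc (suc (suc zero))))) :* ℤS.var (suc (suc zero)))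
        identity : ∀ T P Q N x y c k X → N ⊠ ((T ⊠ T ⊠ y ⊠ N ⊞ k ⊠ (T ⊠ (N ⊠ N ⊠ N ⊠ x) ⊠ (T ⊟ P))) ⊠ X ⊞ (T ⊠ T ⊠ c ⊟ k ⊠ (T ⊠ (N ⊠ N ⊠ N ⊠ x) ⊠ Q)) ⊠ N) ≡
          N ⊠ N ⊠ (T ⊠ T) ⊠ (y ⊠ X ⊞ c) ⊞ N ⊠ N ⊠ (T ⊠ T) ⊠ x ⊠ (k ⊠ 𝔽𝕂.𝐻 X N) ⊟ k ⊠ T ⊠ (N ⊠ N ⊠ N ⊠ x) ⊠ 𝔽𝕂.quadratic T P Q X N
        identity = solveᴷ 9 (λ T P Q N x y c k X → N *: ((T *: T *: y *: N +: k *: (T *: (N *: N *: N *: x) *: (T -: P))) *: X +: (T *: T *: c -: k *: (T *: (N *: N *: N *: x) *: Q)) *: N) =: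
          N *: N *: (T *: T) *: (y *: X +: c) +: N *: N *: (T *: T) *: x *: (k *: 𝔽𝕂S.𝐻 X N) -: k *: T *: (N *: N *: N *: x) *: 𝔽𝕂S.quadratic T P Q X N) refl

      M : ℤ
      M = N * N * (t * t) * x₁

      nm-⌜⌝ : ∀ n z → nm (⌜ n ⌝ ⊠ z) ≡ n * n * nm z
      nm-⌜⌝ n z = trans (nm-⊠ ⌜ n ⌝ z) (cong (_* nm z) (solve 2 (λ n d → n :* n :- d :* (κ 0ℤ :* κ 0ℤ) := n :* n) refl n d))

      factor : ∀ k → N * N * (N * N) * normForm t p q (u + k * (t * w * (t - p))) (v - k * (t * w * q)) ≡ t * (M * M * nm (Y ⊞ ⌜ k ⌝ ⊠ 𝔽𝕂.𝐻 X ⌜ N ⌝))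
      factor k = trans (ℤ.*-assoc (N * N) (N * N) _) (trans (cong (N * N *_) (sym (norm-linear {t} {p} {q} X irrational root (u + k * (t * w * (t - p))) (v - k * (t * w * q)))))
        (trans (solve 3 (λ n t z → n :* n :* (t :* z) := t :* (n :* n :* z)) refl N t (nm L)) (cong (t *_) (trans (sym (nm-⌜⌝ N L)) (trans (cong nm (linear-factor k)) (nm-⌜⌝ M (Y ⊞ ⌜ k ⌝ ⊠ 𝔽𝕂.𝐻 X ⌜ N ⌝)))))))
        where
        L = ⌜ u + k * (t * w * (t - p)) ⌝ ⊠ X ⊞ ⌜ v - k * (t * w * q) ⌝ ⊠ ⌜ N ⌝

    -- By `linear-factor` the forms in `norms` are norms of y + h and y - 3h up to known factors,
    -- and the norm of the square of S is the square of a norm.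
    norms-square : IsSquare (norms t p q u v w)
    norms-square = N * N * (N * N) , t * (M * M) * nm S , *-nonzero {N * N} (*-nonzero N≢0 N≢0) (*-nonzero N≢0 N≢0) , (begin
      n * n * norms t p q u v w
        ≡⟨ cong₂ (λ a b → n * n * (a * b))
          (cong₂ (normForm t p q) (solve 4 (λ u t w p → u :+ t :* w :* (t :- p) := u :+ κ 1ℤ :* (t :* w :* (t :- p))) refl u t w p) (solve 4 (λ v t w q → v :- t :* w :* q := v :- κ 1ℤ :* (t :* w :* q)) refl v t w q))
          (cong₂ (normForm t p q) (solve 4 (λ u t w p → u :- κ (+ 3) :* t :* w :* (t :- p) := u :+ κ (- + 3) :* (t :* w :* (t :- p))) refl u t w p) (solve 4 (λ v t w q → v :+ κ (+ 3) :* t :* w :* q := v :- κ (- + 3) :* (t :* w :* q)) refl v t w q)) ⟩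
      n * n * (A * B)
        ≡⟨ solve 3 (λ n a b → n :* n :* (a :* b) := (n :* a) :* (n :* b)) refl n A B ⟩
      (n * A) * (n * B)
        ≡⟨ cong₂ _*_ (factor 1ℤ) (factor (- + 3)) ⟩
      t * (M * M * nm Y₁) * (t * (M * M * nm Y₃))
        ≡⟨ solve 4 (λ t m a b → t :* (m :* a) :* (t :* (m :* b)) := t :* m :* (t :* m) :* (a :* b)) refl t (M * M) (nm Y₁) (nm Y₃) ⟩
      t * (M * M) * (t * (M * M)) * (nm Y₁ * nm Y₃)
        ≡⟨ cong (t * (M * M) * (t * (M * M)) *_) (trans (sym (nm-⊠ Y₁ Y₃)) (trans (cong nm (trans (cong₂ _⊠_ Y₁≡ Y₃≡) (sym square))) (nm-⊠ S S))) ⟩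
      t * (M * M) * (t * (M * M)) * (nm S * nm S)
        ≡⟨ solve 2 (λ a s → a :* a :* (s :* s) := a :* s :* (a :* s)) refl (t * (M * M)) (nm S) ⟩
      t * (M * M) * nm S * (t * (M * M) * nm S) ∎)
      where
      open ≡-Reasoning
      n = N * N * (N * N)
      A = normForm t p q (u + 1ℤ * (t * w * (t - p))) (v - 1ℤ * (t * w * q))
      B = normForm t p q (u + (- + 3) * (t * w * (t - p))) (v - (- + 3) * (t * w * q))
      Y₁ = Y ⊞ ⌜ 1ℤ ⌝ ⊠ 𝔽𝕂.𝐻 X ⌜ N ⌝
      Y₃ = Y ⊞ ⌜ - + 3 ⌝ ⊠ 𝔽𝕂.𝐻 X ⌜ N ⌝
      Y₁≡ : Y₁ ≡ Y ⊞ 𝔽𝕂.𝐻 X ⌜ N ⌝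
      Y₁≡ = solveᴷ 2 (λ y h → y +: κᴷ ⌜ 1ℤ ⌝ *: h =: y +: h) refl Y (𝔽𝕂.𝐻 X ⌜ N ⌝)
      Y₃≡ : Y₃ ≡ Y ⊟ ⌜ + 3 ⌝ ⊠ 𝔽𝕂.𝐻 X ⌜ N ⌝
      Y₃≡ = solveᴷ 2 (λ y h → y +: κᴷ ⌜ - + 3 ⌝ *: h =: y -: κᴷ ⌜ + 3 ⌝ *: h) refl Y (𝔽𝕂.𝐻 X ⌜ N ⌝)

    private
      no-linear-root : ∀ s → ⌜ t ⌝ ⊠ X ⊞ ⌜ s ⌝ ⊠ ⌜ N ⌝ ≡ 0ᴷ → ⊥
      no-linear-root s h = t≢0 (proj₁ (linear-zero X {t} {s} irrational h))

    q≢0 : q ≢ 0ℤ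
    q≢0 h = no-linear-root p (⊠-integral X (trans (solveᴷ 4 (λ T P N X → X *: (T *: X +: P *: N) =: 𝔽𝕂S.quadratic T P (κᴷ 0ᴷ) X N) refl ⌜ t ⌝ ⌜ p ⌝ ⌜ N ⌝ X)
      (trans (cong (λ q → 𝔽𝕂.quadratic ⌜ t ⌝ ⌜ p ⌝ ⌜ q ⌝ X ⌜ N ⌝) (sym h)) root)) X≢0)

    t-p+q≢0 : t - p + q ≢ 0ℤ
    t-p+q≢0 h = no-linear-root (p - t) (⊠-integral (X ⊞ ⌜ N ⌝) (trans (solveᴷ 4 (λ T P N X → (X +: N) *: (T *: X +: (P -: T) *: N) =: 𝔽𝕂S.quadratic T P (P -: T) X N) refl ⌜ t ⌝ ⌜ p ⌝ ⌜ N ⌝ X)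
      (trans (cong (λ q → 𝔽𝕂.quadratic ⌜ t ⌝ ⌜ p ⌝ ⌜ q ⌝ X ⌜ N ⌝) (zero-difference {p - t} {q} (trans (solve 3 (λ t p q → p :- t :- q := :- (t :- p :+ q)) refl t p q) (cong -_ h)))) root)) X+N≢0)

    no-irrational-abscissa : ⊥
    no-irrational-abscissa = no-quadratic-point nt q≢0 t-p+q≢0 w≢0 point′ norms-square

  no-curve-point : ∀ {t p q} → ¬ 3∣ℤ t → ∀ X → IsRoot t p q X → CurvePoint X → ⊥
  no-curve-point {t} {p} {q} nt (x₀ +√ x₁) root cp = by (x₁ ℤ.≟ 0ℤ) root cp
    where
    by : ∀ {x₁} → Dec (x₁ ≡ 0ℤ) → IsRoot t p q (x₀ +√ x₁) → CurvePoint (x₀ +√ x₁) → ⊥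
    by (yes refl) _ cp = Rational.no-rational-abscissa x₀ cp
    by {x₁} (no h) root cp = Irrational.no-irrational-abscissa {t} {p} {q} nt (x₀ +√ x₁) h root cp

primitive-triple : ∀ t p q → t ≢ 0ℤ → ∃[ k ] ∃[ t′ ] ∃[ p′ ] ∃[ q′ ] t ≡ 3^ k * t′ × p ≡ 3^ k * p′ × q ≡ 3^ k * q′ × (¬ 3∣ℤ t′ ⊎ ¬ 3∣ℤ p′ ⊎ ¬ 3∣ℤ q′)
primitive-triple t p q t≢0 = go (primitive-pair t p (inj₁ t≢0))
  where
  Result : Set
  Result = ∃[ k ] ∃[ t′ ] ∃[ p′ ] ∃[ q′ ] t ≡ 3^ k * t′ × p ≡ 3^ k * p′ × q ≡ 3^ k * q′ × (¬ 3∣ℤ t′ ⊎ ¬ 3∣ℤ p′ ⊎ ¬ 3∣ℤ q′)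
  go : ∃[ k ] ∃[ m ] ∃[ n ] t ≡ 3^ k * m × p ≡ 3^ k * n × (¬ 3∣ℤ m ⊎ ¬ 3∣ℤ n) → Result
  go (k , m , n , t≡ , p≡ , prim) = go′ (primitive-pair (3^ k) q (inj₁ (3^-nonzero k)))
    where
    go′ : ∃[ l ] ∃[ κ′ ] ∃[ q′ ] 3^ k ≡ 3^ l * κ′ × q ≡ 3^ l * q′ × (¬ 3∣ℤ κ′ ⊎ ¬ 3∣ℤ q′) → Result
    go′ (l , κ′ , q′ , k≡ , q≡ , prim′) = l , κ′ * m , κ′ * n , q′ , trans t≡ (trans (cong (_* m) k≡) (ℤ.*-assoc (3^ l) κ′ m)) , trans p≡ (trans (cong (_* n) k≡) (ℤ.*-assoc (3^ l) κ′ n)) , q≡ ,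
      [ (λ nκ → [ (λ nm → inj₁ (3∤ℤ-* nκ nm)) , (λ nn → inj₂ (inj₁ (3∤ℤ-* nκ nn))) ]′ prim) , (λ nq → inj₂ (inj₂ nq)) ]′ prim′

-- From the graph to the curve.

module GraphOverOrder (d : ℤ) (nonsquare : ∀ a b → b ≢ 0ℤ → a * a ≢ d * (b * b)) (N : ℤ) (N≢0 : N ≢ 0ℤ) where
  open QuadraticOrder d
  open Domain nonsquare
  open CurveOverOrder d nonsquare N N≢0
  open 𝕂S using () renaming (solve to solveᴷ; _:+_ to infixl 6 _+:_; _:-_ to infixl 6 _-:_; _:*_ to infixl 7 _*:_; _:=_ to infix 4 _=:_; :-_ to infix 8 ∼:_; κ to κᴷ)

  n : 𝕂
  n = ⌜ N ⌝

  n≢0 : n ≢ 0ᴷ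
  n≢0 = ⌜⌝≢0 N≢0

  -- The map z ↦ z² + C/N in terms of numerators over N
  record Maps (C z z′ : 𝕂) : Set where
    constructor maps
    field
      image : z ⊠ z ⊞ n ⊠ C ≡ n ⊠ z′

    residue : z ⊠ z ⊞ n ⊠ C ⊟ n ⊠ z′ ≡ 0ᴷ
    residue = zero-⊟ image

  module _ {C A B S : 𝕂} (A→A : Maps C A A) (B→A : Maps C B A) (S→B : Maps C S B) (B≢A : B ≢ A) where

    -- Two distinct points with the same image under z² + c are opposite.
    B+A≡0 : B ⊞ A ≡ 0ᴷ
    B+A≡0 = ⊠-integral (B ⊟ A) (trans (solveᴷ 4 (λ n C A B → (B -: A) *: (B +: A) =: (B *: B +: n *: C -: n *: A) -: (A *: A +: n *: C -: n *: A)) refl n C A B)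
      (trans (cong₂ _⊟_ (Maps.residue B→A) (Maps.residue A→A)) refl)) (λ h → B≢A (⊟-zero h))

    module Cycle {Z₁ Z₂ Z₃ : 𝕂} (Z₁→Z₂ : Maps C Z₁ Z₂) (Z₂→Z₃ : Maps C Z₂ Z₃) (Z₃→Z₁ : Maps C Z₃ Z₁) (Z₂≢Z₁ : Z₂ ≢ Z₁) where
      X E D : 𝕂
      X = Z₁ ⊞ Z₂
      E = Z₂ ⊞ Z₃
      D = Z₂ ⊟ Z₁

      D≢0 : D ≢ 0ᴷ
      D≢0 h = Z₂≢Z₁ (⊟-zero h)

      -- With x = X/N and e = E/N this is x e = -(1 + x), so that x = -1/(e + 1).
      rotation : X ⊠ E ⊞ n ⊠ (n ⊞ X) ≡ 0ᴷ
      rotation = ⊠-integral D (trans (solveᴷ 5 (λ n C z₁ z₂ z₃ →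
          (z₂ -: z₁) *: ((z₁ +: z₂) *: (z₂ +: z₃) +: n *: (n +: (z₁ +: z₂))) =:
          ((z₂ *: z₂ +: n *: C -: n *: z₃) -: (z₁ *: z₁ +: n *: C -: n *: z₂)) *: (n +: (z₂ +: z₃)) +: n *: ((z₃ *: z₃ +: n *: C -: n *: z₁) -: (z₂ *: z₂ +: n *: C -: n *: z₃))) refl n C Z₁ Z₂ Z₃)
        (trans (cong₂ (λ a b → (a ⊟ b) ⊠ (n ⊞ E) ⊞ n ⊠ ((Z₃ ⊠ Z₃ ⊞ n ⊠ C ⊟ n ⊠ Z₁) ⊟ a)) (Maps.residue Z₂→Z₃) (Maps.residue Z₁→Z₂))
          (trans (cong (λ c → (0ᴷ ⊟ 0ᴷ) ⊠ (n ⊞ E) ⊞ n ⊠ (c ⊟ 0ᴷ)) (Maps.residue Z₃→Z₁)) (solveᴷ 2 (λ n e → (κᴷ 0ᴷ -: κᴷ 0ᴷ) *: e +: n *: (κᴷ 0ᴷ -: κᴷ 0ᴷ) =: κᴷ 0ᴷ) refl n (n ⊞ E))))) D≢0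

      X≢0′ : X ≢ 0ᴷ
      X≢0′ h = n≢0 (⊠-integral n (trans (solveᴷ 2 (λ n e → n *: n =: κᴷ 0ᴷ *: e +: n *: (n +: κᴷ 0ᴷ)) refl n E) (trans (cong (λ x → x ⊠ E ⊞ n ⊠ (n ⊞ x)) (sym h)) rotation)) n≢0)

    module _ {Z₁ Z₂ Z₃ : 𝕂} (Z₁→Z₂ : Maps C Z₁ Z₂) (Z₂→Z₃ : Maps C Z₂ Z₃) (Z₃→Z₁ : Maps C Z₃ Z₁) (Z₂≢Z₁ : Z₂ ≢ Z₁) (Z₃≢Z₂ : Z₃ ≢ Z₂) where
      private
        module C₁ = Cycle Z₁→Z₂ Z₂→Z₃ Z₃→Z₁ Z₂≢Z₁
        module C₂ = Cycle Z₂→Z₃ Z₃→Z₁ Z₁→Z₂ Z₃≢Z₂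
      open C₁ using (X; E; D; rotation; X≢0′)

      private
        X+n≢0 : X ⊞ n ≢ 0ᴷ
        X+n≢0 h = C₂.X≢0′ (⊠-integral X (trans (solveᴷ 3 (λ x e n → x *: e =: (x *: e +: n *: (n +: x)) -: n *: (x +: n)) refl X E n)
          (trans (cong₂ (λ r s → r ⊟ n ⊠ s) rotation h) (solveᴷ 1 (λ n → κᴷ 0ᴷ -: n *: κᴷ 0ᴷ =: κᴷ 0ᴷ) refl n))) X≢0′)

        h Y : 𝕂
        h = X ⊠ (X ⊞ n)
        Y = h ⊠ (A ⊞ A ⊟ n)

        P : 𝕂
        P = ∼ (n ⊠ (h ⊞ n ⊠ n))

        -- Dehomogenised, x(x + 1)(z₂ - z₁) = -(x² + x + 1). Together with x = z₁ + z₂ this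
        -- determines the cycle, and c, from x.
        hD : h ⊠ D ≡ P
        hD = ⊟-zero (trans (solveᴷ 5 (λ n C z₁ z₂ z₃ → let
              x = z₁ +: z₂
              e = z₂ +: z₃
              h = x *: (x +: n) in
            h *: (z₂ -: z₁) -: (∼: (n *: (h +: n *: n))) =:
            x *: ((z₂ *: z₂ +: n *: C -: n *: z₃) -: (z₁ *: z₁ +: n *: C -: n *: z₂)) +: n *: (x *: e +: n *: (n +: x))) refl n C Z₁ Z₂ Z₃)
          (trans (cong₂ (λ a b → X ⊠ (a ⊟ b) ⊞ n ⊠ (X ⊠ E ⊞ n ⊠ (n ⊞ X))) (Maps.residue Z₂→Z₃) (Maps.residue Z₁→Z₂))
            (trans (cong (λ r → X ⊠ (0ᴷ ⊟ 0ᴷ) ⊞ n ⊠ r) rotation) (solveᴷ 2 (λ n x → x *: (κᴷ 0ᴷ -: κᴷ 0ᴷ) +: n *: κᴷ 0ᴷ =: κᴷ 0ᴷ) refl n X))))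

        -- The fixed point gives (2a - 1)² = 1 - 4c, and c = z₂ - z₁² is expressed through x by
        -- `hD`.
        equation : Y ⊠ Y ≡ 𝔽𝕂.𝐹 X n
        equation = trans (solveᴷ 6 (λ n C z₁ z₂ A h → let
              x = z₁ +: z₂
              t = z₂ -: z₁ in
            h *: (A +: A -: n) *: (h *: (A +: A -: n)) =:
            (h *: h *: (n *: n) -: (n *: h *: (h *: x +: h *: t) +: n *: h *: (h *: x +: h *: t)) +: (h *: x -: h *: t) *: (h *: x -: h *: t))
            +: κᴷ ⌜ + 4 ⌝ *: (h *: h) *: ((A *: A +: n *: C -: n *: A) -: (z₁ *: z₁ +: n *: C -: n *: z₂))) refl n C Z₁ Z₂ A h)
          (trans (cong₂ (λ a b → (h ⊠ h ⊠ (n ⊠ n) ⊟ (n ⊠ h ⊠ (h ⊠ X ⊞ h ⊠ D) ⊞ n ⊠ h ⊠ (h ⊠ X ⊞ h ⊠ D)) ⊞ (h ⊠ X ⊟ h ⊠ D) ⊠ (h ⊠ X ⊟ h ⊠ D)) ⊞ ⌜ + 4 ⌝ ⊠ (h ⊠ h) ⊠ (a ⊟ b)) (Maps.residue A→A) (Maps.residue Z₁→Z₂))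
            (trans (cong (λ p → (h ⊠ h ⊠ (n ⊠ n) ⊟ (n ⊠ h ⊠ (h ⊠ X ⊞ p) ⊞ n ⊠ h ⊠ (h ⊠ X ⊞ p)) ⊞ (h ⊠ X ⊟ p) ⊠ (h ⊠ X ⊟ p)) ⊞ ⌜ + 4 ⌝ ⊠ (h ⊠ h) ⊠ (0ᴷ ⊟ 0ᴷ)) hD)
              (solveᴷ 2 (λ n x → let
                  h = x *: (x +: n)
                  p = ∼: (n *: (h +: n *: n)) in
                (h *: h *: (n *: n) -: (n *: h *: (h *: x +: p) +: n *: h *: (h *: x +: p)) +: (h *: x -: p) *: (h *: x -: p)) +: κᴷ ⌜ + 4 ⌝ *: (h *: h) *: (κᴷ 0ᴷ -: κᴷ 0ᴷ)
                =: 𝔽𝕂S.𝐹 x n) refl n X)))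

        -- From s² = b - c with b = -a and c = a - a² one gets s² = a² - 2a, so that 4h²s² =
        -- (2ha)(2ha - 4h).
        square : ⌜ + 2 ⌝ ⊠ h ⊠ S ⊠ (⌜ + 2 ⌝ ⊠ h ⊠ S) ≡ (Y ⊞ 𝔽𝕂.𝐻 X n) ⊠ (Y ⊟ ⌜ + 3 ⌝ ⊠ 𝔽𝕂.𝐻 X n)
        square = trans (solveᴷ 6 (λ n C x A B S → let h = x *: (x +: n) in
            κᴷ ⌜ + 2 ⌝ *: h *: S *: (κᴷ ⌜ + 2 ⌝ *: h *: S) =:
            (h *: (A +: A -: n) +: 𝔽𝕂S.𝐻 x n) *: (h *: (A +: A -: n) -: κᴷ ⌜ + 3 ⌝ *: 𝔽𝕂S.𝐻 x n)
            +: κᴷ ⌜ + 4 ⌝ *: (h *: h) *: ((S *: S +: n *: C -: n *: B) -: (A *: A +: n *: C -: n *: A) +: n *: (B +: A))) refl n C X A B S)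
          (trans (cong₂ (λ a b → (Y ⊞ 𝔽𝕂.𝐻 X n) ⊠ (Y ⊟ ⌜ + 3 ⌝ ⊠ 𝔽𝕂.𝐻 X n) ⊞ ⌜ + 4 ⌝ ⊠ (h ⊠ h) ⊠ (a ⊟ b ⊞ n ⊠ (B ⊞ A))) (Maps.residue S→B) (Maps.residue A→A))
            (trans (cong (λ b → (Y ⊞ 𝔽𝕂.𝐻 X n) ⊠ (Y ⊟ ⌜ + 3 ⌝ ⊠ 𝔽𝕂.𝐻 X n) ⊞ ⌜ + 4 ⌝ ⊠ (h ⊠ h) ⊠ (0ᴷ ⊟ 0ᴷ ⊞ n ⊠ b)) B+A≡0)
              (solveᴷ 3 (λ r h n → r +: h *: (κᴷ 0ᴷ -: κᴷ 0ᴷ +: n *: κᴷ 0ᴷ) =: r) refl ((Y ⊞ 𝔽𝕂.𝐻 X n) ⊠ (Y ⊟ ⌜ + 3 ⌝ ⊠ 𝔽𝕂.𝐻 X n)) (⌜ + 4 ⌝ ⊠ (h ⊠ h)) n)))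

      curvePoint : CurvePoint X
      curvePoint = record { Y = Y ; S = ⌜ + 2 ⌝ ⊠ h ⊠ S ; X≢0 = X≢0′ ; X+N≢0 = X+n≢0 ; equation = equation ; square = square }

    module _ {Z₁ Z₂ Z₃ : 𝕂} (Z₁→Z₂ : Maps C Z₁ Z₂) (Z₂→Z₃ : Maps C Z₂ Z₃) (Z₃→Z₁ : Maps C Z₃ Z₁) (Z₂≢Z₁ : Z₂ ≢ Z₁) (Z₃≢Z₂ : Z₃ ≢ Z₂) (Z₁≢Z₃ : Z₁ ≢ Z₃) where
      private
        X E F : 𝕂
        X = Z₁ ⊞ Z₂
        E = Z₂ ⊞ Z₃
        F = Z₃ ⊞ Z₁

        X·E : X ⊠ E ⊞ n ⊠ (n ⊞ X) ≡ 0ᴷ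
        X·E = Cycle.rotation Z₁→Z₂ Z₂→Z₃ Z₃→Z₁ Z₂≢Z₁

        F·X : F ⊠ X ⊞ n ⊠ (n ⊞ F) ≡ 0ᴷ
        F·X = Cycle.rotation Z₃→Z₁ Z₁→Z₂ Z₂→Z₃ Z₁≢Z₃

        X≢0 : X ≢ 0ᴷ
        X≢0 = Cycle.X≢0′ Z₁→Z₂ Z₂→Z₃ Z₃→Z₁ Z₂≢Z₁

        characteristic : ∀ X → X ⊠ X ⊞ ⌜ nm X ⌝ ≡ ⌜ + 2 * rat X ⌝ ⊠ X
        characteristic (a +√ b) = trans (cong (_⊞ ⌜ a * a - d * (b * b) ⌝) (⊠≡ a b a b)) (trans (𝕂-ext
          (solve 3 (λ d a b → a :* a :+ d :* (b :* b) :+ (a :* a :- d :* (b :* b)) := κ (+ 2) :* a :* a :+ d :* (κ 0ℤ :* b)) refl d a b)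
          (solve 2 (λ a b → a :* b :+ b :* a :+ κ 0ℤ := κ (+ 2) :* a :* b :+ κ 0ℤ :* a) refl a b)) (sym (⊠≡ (+ 2 * a) 0ℤ a b)))

        root₀ : IsRoot (N * N) (- (N * (+ 2 * rat X))) (nm X) X
        root₀ = trans (cong₂ (λ t p → 𝔽𝕂.quadratic t p ⌜ nm X ⌝ X n) (⌜⌝-* N N) (cong ∼_ (⌜⌝-* N (+ 2 * rat X))))
          (trans (solveᴷ 4 (λ n a m x → 𝔽𝕂S.quadratic (n *: n) (∼: (n *: a)) m x n =: n *: n *: ((x *: x +: m) -: a *: x)) refl n ⌜ + 2 * rat X ⌝ ⌜ nm X ⌝ X)
            (trans (cong (n ⊠ n ⊠_) (zero-⊟ (characteristic X))) (solveᴷ 1 (λ n → n *: n *: κᴷ 0ᴷ =: κᴷ 0ᴷ) refl n)))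

        root-cancel : ∀ k {t p q} → IsRoot (3^ k * t) (3^ k * p) (3^ k * q) X → IsRoot t p q X
        root-cancel k {t} {p} {q} h = ⊠-integral ⌜ 3^ k ⌝ (trans (solveᴷ 6 (λ c t p q x n → c *: 𝔽𝕂S.quadratic t p q x n =: 𝔽𝕂S.quadratic (c *: t) (c *: p) (c *: q) x n) refl ⌜ 3^ k ⌝ ⌜ t ⌝ ⌜ p ⌝ ⌜ q ⌝ X n)
          (trans (cong₂ (λ a b → 𝔽𝕂.quadratic a b (⌜ 3^ k ⌝ ⊠ ⌜ q ⌝) X n) (sym (⌜⌝-* (3^ k) t)) (sym (⌜⌝-* (3^ k) p))) (trans (cong (λ c → 𝔽𝕂.quadratic ⌜ 3^ k * t ⌝ ⌜ 3^ k * p ⌝ c X n) (sym (⌜⌝-* (3^ k) q))) h)))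
          (⌜⌝≢0 (3^-nonzero k))

        root-E : ∀ {t p q} → IsRoot t p q X → IsRoot q (+ 2 * q - p) (t - p + q) E
        root-E {t} {p} {q} h = ⊠-integral X (⊠-integral X (trans (cong (λ c → X ⊠ (X ⊠ 𝔽𝕂.quadratic ⌜ q ⌝ c ⌜ t - p + q ⌝ E n)) (cong (_⊟ ⌜ p ⌝) (⌜⌝-* (+ 2) q)))
          (trans (solveᴷ 6 (λ t p q x e n → x *: (x *: 𝔽𝕂S.quadratic q (κᴷ ⌜ + 2 ⌝ *: q -: p) (t -: p +: q) e n) =:
              n *: n *: 𝔽𝕂S.quadratic t p q x n +: (x *: e +: n *: (n +: x)) *: (q *: (x *: e +: n *: x -: n *: n) -: p *: n *: x)) refl ⌜ t ⌝ ⌜ p ⌝ ⌜ q ⌝ X E n)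
            (trans (cong₂ (λ a b → n ⊠ n ⊠ a ⊞ b ⊠ (⌜ q ⌝ ⊠ (X ⊠ E ⊞ n ⊠ X ⊟ n ⊠ n) ⊟ ⌜ p ⌝ ⊠ n ⊠ X)) h X·E) (solveᴷ 2 (λ n z → n *: n *: κᴷ 0ᴷ +: κᴷ 0ᴷ *: z =: κᴷ 0ᴷ) refl n (⌜ q ⌝ ⊠ (X ⊠ E ⊞ n ⊠ X ⊟ n ⊠ n) ⊟ ⌜ p ⌝ ⊠ n ⊠ X))))) X≢0) X≢0

        root-F : ∀ {t p q} → IsRoot t p q X → IsRoot (t - p + q) (+ 2 * t - p) t F
        root-F {t} {p} {q} h = ⊠-integral n (⊠-integral n (trans (cong (λ c → n ⊠ (n ⊠ 𝔽𝕂.quadratic ⌜ t - p + q ⌝ c ⌜ t ⌝ F n)) (cong (_⊟ ⌜ p ⌝) (⌜⌝-* (+ 2) t)))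
          (trans (solveᴷ 6 (λ t p q x f n → n *: (n *: 𝔽𝕂S.quadratic (t -: p +: q) (κᴷ ⌜ + 2 ⌝ *: t -: p) t f n) =:
              f *: f *: 𝔽𝕂S.quadratic t p q x n +: (f *: x +: n *: (n +: f)) *: (t *: (n *: n +: n *: f -: f *: x) -: p *: n *: f)) refl ⌜ t ⌝ ⌜ p ⌝ ⌜ q ⌝ X F n)
            (trans (cong₂ (λ a b → F ⊠ F ⊠ a ⊞ b ⊠ (⌜ t ⌝ ⊠ (n ⊠ n ⊞ n ⊠ F ⊟ F ⊠ X) ⊟ ⌜ p ⌝ ⊠ n ⊠ F)) h F·X) (solveᴷ 2 (λ n z → n *: n *: κᴷ 0ᴷ +: κᴷ 0ᴷ *: z =: κᴷ 0ᴷ) refl F (⌜ t ⌝ ⊠ (n ⊠ n ⊞ n ⊠ F ⊟ F ⊠ X) ⊟ ⌜ p ⌝ ⊠ n ⊠ F))))) n≢0) n≢0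

      -- Starting the cycle at another point replaces x by a σ-conjugate and the leading coefficient
      -- t of its quadratic by q or t - p + q. The quadratic is primitive at 3, so one of the three
      -- is prime to 3, and `no-curve-point` applies to that starting point.
      no-graph : ⊥
      no-graph = go (primitive-triple (N * N) (- (N * (+ 2 * rat X))) (nm X) (*-nonzero N≢0 N≢0))
        where
        go : ∃[ k ] ∃[ t ] ∃[ p ] ∃[ q ] N * N ≡ 3^ k * t × - (N * (+ 2 * rat X)) ≡ 3^ k * p × nm X ≡ 3^ k * q × (¬ 3∣ℤ t ⊎ ¬ 3∣ℤ p ⊎ ¬ 3∣ℤ q) → ⊥
        go (k , t , p , q , t≡ , p≡ , q≡ , prim) = by (3∣ℤ? t) (3∣ℤ? q) (3∣ℤ? (t - p + q))
          where
          root : IsRoot t p q X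
          root = root-cancel k {t} {p} {q} (subst₂ (λ t p → IsRoot t p (3^ k * q) X) t≡ p≡ (subst (λ q → IsRoot (N * N) (- (N * (+ 2 * rat X))) q X) q≡ root₀))
          by : 3∣ℤ t ⊎ ¬ 3∣ℤ t → 3∣ℤ q ⊎ ¬ 3∣ℤ q → 3∣ℤ (t - p + q) ⊎ ¬ 3∣ℤ (t - p + q) → ⊥
          by (inj₂ nt) _ _ = no-curve-point {t} {p} {q} nt X root (curvePoint Z₁→Z₂ Z₂→Z₃ Z₃→Z₁ Z₂≢Z₁ Z₃≢Z₂)
          by (inj₁ _) (inj₂ nq) _ = no-curve-point {q} {+ 2 * q - p} {t - p + q} nq E (root-E {t} {p} {q} root) (curvePoint Z₂→Z₃ Z₃→Z₁ Z₁→Z₂ Z₃≢Z₂ Z₁≢Z₃)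
          by (inj₁ _) (inj₁ _) (inj₂ ns) = no-curve-point {t - p + q} {+ 2 * t - p} {t} ns F (root-F {t} {p} {q} root) (curvePoint Z₃→Z₁ Z₁→Z₂ Z₂→Z₃ Z₁≢Z₃ Z₂≢Z₁)
          by (inj₁ ht) (inj₁ hq) (inj₁ hs) = [ (λ n → n ht) , [ (λ n → n (subst 3∣ℤ (solve 3 (λ t p q → t :+ q :- (t :- p :+ q) := p) refl t p q) (∣′-- {+ 3} (∣′-+ {+ 3} ht hq) hs))) , (λ n → n hq) ]′ ]′ prim

-- Clearing denominators in ℚ(√d).

fromℤ-injective : ∀ {m n} → fromℤ m ≡ fromℤ n → m ≡ n
fromℤ-injective = cong ↥_

fromℤ-+ : ∀ m n → fromℤ (m + n) ≡ fromℤ m ℚ.+ fromℤ n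
fromℤ-+ m n = ℚ.toℚᵘ-injective (ℚᵘ.≃-trans (*≡* (solve 2 (λ m n → (m :+ n) :* κ 1ℤ := (m :* κ 1ℤ :+ n :* κ 1ℤ) :* κ 1ℤ) refl m n)) (ℚᵘ.≃-sym (ℚ.toℚᵘ-homo-+ (fromℤ m) (fromℤ n))))

fromℤ-* : ∀ m n → fromℤ (m * n) ≡ fromℤ m ℚ.* fromℤ n
fromℤ-* m n = ℚ.toℚᵘ-injective (ℚᵘ.≃-trans (*≡* refl) (ℚᵘ.≃-sym (ℚ.toℚᵘ-homo-* (fromℤ m) (fromℤ n))))

/1≡fromℤ : ∀ n → n ℚ./ 1 ≡ fromℤ n
/1≡fromℤ n = ℚ.toℚᵘ-injective (ℚ.toℚᵘ-fromℚᵘ (mkℚᵘ n 0))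

clear-denominator : ∀ q → q ℚ.* fromℤ (↧ q) ≡ fromℤ (↥ q)
clear-denominator q@record{} = ℚ.toℚᵘ-injective (ℚᵘ.≃-trans (ℚ.toℚᵘ-homo-* q (fromℤ (↧ q))) (*≡* (trans (ℤ.*-identityʳ (↥ q * ↧ q)) (cong (λ e → ↥ q * + e) (sym (ℕ.*-identityʳ (ℚ.↧ₙ q)))))))

isZeroℚ : ℚ → Bool
isZeroℚ q = isZeroℤ (↥ q)

module ℚS = PolynomialSolver ℚ.+-*-isCommutativeRing isZeroℚ (λ q h → ℚ.↥p≡0⇒p≡0 q (isZeroℤ-sound (↥ q) h))

ℚ-cancel : ∀ {n x y} → n ≢ 0ℤ → x ℚ.* fromℤ n ≡ y ℚ.* fromℤ n → x ≡ y
ℚ-cancel {n} {x} {y} n≢0 h = trans (sym (undo x)) (trans (cong (ℚ._* i) h) (undo y))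
  where
  instance n≢0′ = ℚ.≢-nonZero {fromℤ n} (λ e → n≢0 (cong ↥_ e))
  i = 1/ fromℤ n
  undo : ∀ x → x ℚ.* fromℤ n ℚ.* i ≡ x
  undo x = trans (ℚ.*-assoc x (fromℤ n) i) (trans (cong (x ℚ.*_) (ℚ.*-inverseʳ (fromℤ n))) (ℚ.*-identityʳ x))

module Denominators (d : ℤ) where
  open QuadraticOrder d

  -- Z/N is the element z of ℚ(√d).
  record Scaled (N : ℤ) (z : ℚ × ℚ) (Z : 𝕂) : Set where
    constructor scaled
    field
      rational-part : proj₁ z ℚ.* fromℤ N ≡ fromℤ (rat Z)
      irrational-part : proj₂ z ℚ.* fromℤ N ≡ fromℤ (irr Z)

  scaled-* : ∀ {N z Z} M → Scaled N z Z → Scaled (N * M) z ((rat Z * M) +√ (irr Z * M))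
  scaled-* {N} {z} {Z} M (scaled e e′) = scaled (rescale {proj₁ z} {rat Z} e) (rescale {proj₂ z} {irr Z} e′)
    where
    rescale : ∀ {x X} → x ℚ.* fromℤ N ≡ fromℤ X → x ℚ.* fromℤ (N * M) ≡ fromℤ (X * M)
    rescale {x} {X} h = trans (cong (x ℚ.*_) (fromℤ-* N M)) (trans (sym (ℚ.*-assoc x (fromℤ N) (fromℤ M))) (trans (cong (ℚ._* fromℤ M) h) (sym (fromℤ-* X M))))

  common-denominator : ∀ zs → ∃[ N ] N ≢ 0ℤ × All (λ z → ∃[ Z ] Scaled N z Z) zs
  common-denominator [] = 1ℤ , (λ ()) , []
  common-denominator (z@(x , y) ∷ zs) = extend (common-denominator zs)
    where
    M = ↧ x * ↧ y
    ↧≢0 : ∀ q → ↧ q ≢ 0ℤ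
    ↧≢0 record{} ()
    head : Scaled M z ((↥ x * ↧ y) +√ (↥ y * ↧ x))
    head = scaled
      (trans (cong (x ℚ.*_) (fromℤ-* (↧ x) (↧ y))) (trans (sym (ℚ.*-assoc x (fromℤ (↧ x)) (fromℤ (↧ y)))) (trans (cong (ℚ._* fromℤ (↧ y)) (clear-denominator x)) (sym (fromℤ-* (↥ x) (↧ y))))))
      (trans (cong (λ m → y ℚ.* fromℤ m) (ℤ.*-comm (↧ x) (↧ y))) (trans (cong (y ℚ.*_) (fromℤ-* (↧ y) (↧ x))) (trans (sym (ℚ.*-assoc y (fromℤ (↧ y)) (fromℤ (↧ x)))) (trans (cong (ℚ._* fromℤ (↧ x)) (clear-denominator y)) (sym (fromℤ-* (↥ y) (↧ x)))))))
    extend : ∃[ N ] N ≢ 0ℤ × All (λ z → ∃[ Z ] Scaled N z Z) zs → ∃[ N ] N ≢ 0ℤ × All (λ z → ∃[ Z ] Scaled N z Z) (z ∷ zs)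
    extend (N , N≢0 , reps) = N * M , *-nonzero N≢0 (*-nonzero (↧≢0 x) (↧≢0 y)) ,
      ((((↥ x * ↧ y) * N) +√ ((↥ y * ↧ x) * N)) , subst (λ K → Scaled K z (((↥ x * ↧ y) * N) +√ ((↥ y * ↧ x) * N))) (ℤ.*-comm M N) (scaled-* {M} {z} {(↥ x * ↧ y) +√ (↥ y * ↧ x)} N head)) ∷
      All.map (λ { (Z , e) → ((rat Z * M) +√ (irr Z * M)) , scaled-* M e }) reps

  scaled-injective : ∀ {N z z′ Z} → N ≢ 0ℤ → Scaled N z Z → Scaled N z′ Z → z ≡ z′
  scaled-injective N≢0 (scaled e f) (scaled e′ f′) = cong₂ _,_ (ℚ-cancel N≢0 (trans e (sym e′))) (ℚ-cancel N≢0 (trans f (sym f′)))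

  scaled-map : ∀ {N x y c₀ c₁ x′ y′ Z C Z′} → Scaled N (x , y) Z → Scaled N (c₀ , c₁) C → Scaled N (x′ , y′) Z′ →
    x ℚ.* x ℚ.+ d ℚ./ 1 ℚ.* (y ℚ.* y) ℚ.+ c₀ ≡ x′ → x ℚ.* y ℚ.+ y ℚ.* x ℚ.+ c₁ ≡ y′ → Z ⊠ Z ⊞ ⌜ N ⌝ ⊠ C ≡ ⌜ N ⌝ ⊠ Z′
  scaled-map {N} {x} {y} {c₀} {c₁} {x′} {y′} {X +√ Y} {C₀ +√ C₁} {X′ +√ Y′} (scaled ex ey) (scaled e₀ e₁) (scaled ex′ ey′) h h′ =
    trans (cong₂ _⊞_ (⊠≡ X Y X Y) (⊠≡ N 0ℤ C₀ C₁)) (trans (𝕂-ext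
      (trans (solve 7 (λ d X Y N C C₁ X′ → X :* X :+ d :* (Y :* Y) :+ (N :* C :+ d :* (κ 0ℤ :* C₁)) := X :* X :+ d :* (Y :* Y) :+ N :* C) refl d X Y N C₀ C₁ X′)
        (trans rational (solve 4 (λ d N X Y → N :* X := N :* X :+ d :* (κ 0ℤ :* Y)) refl d N X′ Y′)))
      (trans (solve 5 (λ X Y N C C₀ → X :* Y :+ Y :* X :+ (N :* C :+ κ 0ℤ :* C₀) := X :* Y :+ Y :* X :+ N :* C) refl X Y N C₁ C₀)
        (trans irrational (solve 3 (λ N X Y → N :* Y := N :* Y :+ κ 0ℤ :* X) refl N X′ Y′)))) (sym (⊠≡ N 0ℤ X′ Y′)))
    where
    open ≡-Reasoning
    n = fromℤ N
    rational : X * X + d * (Y * Y) + N * C₀ ≡ N * X′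
    rational = fromℤ-injective (begin
      fromℤ (X * X + d * (Y * Y) + N * C₀)
        ≡⟨ trans (fromℤ-+ (X * X + d * (Y * Y)) (N * C₀)) (cong₂ ℚ._+_ (trans (fromℤ-+ (X * X) (d * (Y * Y))) (cong₂ ℚ._+_ (fromℤ-* X X) (trans (fromℤ-* d (Y * Y)) (cong (fromℤ d ℚ.*_) (fromℤ-* Y Y))))) (fromℤ-* N C₀)) ⟩
      fromℤ X ℚ.* fromℤ X ℚ.+ fromℤ d ℚ.* (fromℤ Y ℚ.* fromℤ Y) ℚ.+ n ℚ.* fromℤ C₀
        ≡⟨ cong₂ (λ X Y → X ℚ.* X ℚ.+ fromℤ d ℚ.* (Y ℚ.* Y) ℚ.+ n ℚ.* fromℤ C₀) (sym ex) (sym ey) ⟩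
      x ℚ.* n ℚ.* (x ℚ.* n) ℚ.+ fromℤ d ℚ.* (y ℚ.* n ℚ.* (y ℚ.* n)) ℚ.+ n ℚ.* fromℤ C₀
        ≡⟨ cong (λ C → x ℚ.* n ℚ.* (x ℚ.* n) ℚ.+ fromℤ d ℚ.* (y ℚ.* n ℚ.* (y ℚ.* n)) ℚ.+ n ℚ.* C) (sym e₀) ⟩
      x ℚ.* n ℚ.* (x ℚ.* n) ℚ.+ fromℤ d ℚ.* (y ℚ.* n ℚ.* (y ℚ.* n)) ℚ.+ n ℚ.* (c₀ ℚ.* n)
        ≡⟨ ℚS.solve 5 (λ x y d c n → x ℚS.:* n ℚS.:* (x ℚS.:* n) ℚS.:+ d ℚS.:* (y ℚS.:* n ℚS.:* (y ℚS.:* n)) ℚS.:+ n ℚS.:* (c ℚS.:* n) ℚS.:= n ℚS.:* ((x ℚS.:* x ℚS.:+ d ℚS.:* (y ℚS.:* y) ℚS.:+ c) ℚS.:* n)) refl x y (fromℤ d) c₀ n ⟩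
      n ℚ.* ((x ℚ.* x ℚ.+ fromℤ d ℚ.* (y ℚ.* y) ℚ.+ c₀) ℚ.* n)
        ≡⟨ cong (λ s → n ℚ.* (s ℚ.* n)) (trans (cong (λ δ → x ℚ.* x ℚ.+ δ ℚ.* (y ℚ.* y) ℚ.+ c₀) (sym (/1≡fromℤ d))) h) ⟩
      n ℚ.* (x′ ℚ.* n)
        ≡⟨ trans (cong (n ℚ.*_) ex′) (sym (fromℤ-* N X′)) ⟩
      fromℤ (N * X′) ∎)
    irrational : X * Y + Y * X + N * C₁ ≡ N * Y′
    irrational = fromℤ-injective (begin
      fromℤ (X * Y + Y * X + N * C₁)
        ≡⟨ trans (fromℤ-+ (X * Y + Y * X) (N * C₁)) (cong₂ ℚ._+_ (trans (fromℤ-+ (X * Y) (Y * X)) (cong₂ ℚ._+_ (fromℤ-* X Y) (fromℤ-* Y X))) (fromℤ-* N C₁)) ⟩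
      fromℤ X ℚ.* fromℤ Y ℚ.+ fromℤ Y ℚ.* fromℤ X ℚ.+ n ℚ.* fromℤ C₁
        ≡⟨ cong₂ (λ X Y → X ℚ.* Y ℚ.+ Y ℚ.* X ℚ.+ n ℚ.* fromℤ C₁) (sym ex) (sym ey) ⟩
      x ℚ.* n ℚ.* (y ℚ.* n) ℚ.+ y ℚ.* n ℚ.* (x ℚ.* n) ℚ.+ n ℚ.* fromℤ C₁
        ≡⟨ cong (λ C → x ℚ.* n ℚ.* (y ℚ.* n) ℚ.+ y ℚ.* n ℚ.* (x ℚ.* n) ℚ.+ n ℚ.* C) (sym e₁) ⟩
      x ℚ.* n ℚ.* (y ℚ.* n) ℚ.+ y ℚ.* n ℚ.* (x ℚ.* n) ℚ.+ n ℚ.* (c₁ ℚ.* n)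
        ≡⟨ ℚS.solve 4 (λ x y c n → x ℚS.:* n ℚS.:* (y ℚS.:* n) ℚS.:+ y ℚS.:* n ℚS.:* (x ℚS.:* n) ℚS.:+ n ℚS.:* (c ℚS.:* n) ℚS.:= n ℚS.:* ((x ℚS.:* y ℚS.:+ y ℚS.:* x ℚS.:+ c) ℚS.:* n)) refl x y c₁ n ⟩
      n ℚ.* ((x ℚ.* y ℚ.+ y ℚ.* x ℚ.+ c₁) ℚ.* n)
        ≡⟨ cong (λ s → n ℚ.* (s ℚ.* n)) h′ ⟩
      n ℚ.* (y′ ℚ.* n)
        ≡⟨ trans (cong (n ℚ.*_) ey′) (sym (fromℤ-* N Y′)) ⟩
      fromℤ (N * Y′) ∎)

rational-nonsquare : ∀ d → ¬ (∃[ q ] q ℚ.* q ≡ d ℚ./ 1) → ∀ a b → b ≢ 0ℤ → a * a ≢ d * (b * b)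
rational-nonsquare d ns a b b≢0 h = ns (fromℤ a ℚ.* i , (begin
  fromℤ a ℚ.* i ℚ.* (fromℤ a ℚ.* i)
    ≡⟨ ℚS.solve 2 (λ a i → a ℚS.:* i ℚS.:* (a ℚS.:* i) ℚS.:= a ℚS.:* a ℚS.:* (i ℚS.:* i)) refl (fromℤ a) i ⟩
  fromℤ a ℚ.* fromℤ a ℚ.* (i ℚ.* i)
    ≡⟨ cong (ℚ._* (i ℚ.* i)) (trans (sym (fromℤ-* a a)) (trans (cong fromℤ h) (trans (fromℤ-* d (b * b)) (cong (fromℤ d ℚ.*_) (fromℤ-* b b))))) ⟩
  fromℤ d ℚ.* (fromℤ b ℚ.* fromℤ b) ℚ.* (i ℚ.* i)
    ≡⟨ ℚS.solve 3 (λ d b i → d ℚS.:* (b ℚS.:* b) ℚS.:* (i ℚS.:* i) ℚS.:= d ℚS.:* (b ℚS.:* i) ℚS.:* (b ℚS.:* i)) refl (fromℤ d) (fromℤ b) i ⟩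
  fromℤ d ℚ.* (fromℤ b ℚ.* i) ℚ.* (fromℤ b ℚ.* i)
    ≡⟨ cong (λ u → fromℤ d ℚ.* u ℚ.* u) (ℚ.*-inverseʳ (fromℤ b)) ⟩
  fromℤ d ℚ.* 1ℚ ℚ.* 1ℚ
    ≡⟨ trans (ℚ.*-identityʳ (fromℤ d ℚ.* 1ℚ)) (trans (ℚ.*-identityʳ (fromℤ d)) (sym (/1≡fromℤ d))) ⟩
  d ℚ./ 1 ∎))
  where
  open ≡-Reasoning
  instance b≢0′ = ℚ.≢-nonZero {fromℤ b} (λ e → b≢0 (cong ↥_ e))
  i = 1/ fromℤ b

open import Defs

theorem5p20 : (d : ℤ) → IsQuadraticParam d → (c : QF d) → ¬ ContainsG8 d c
theorem5p20 d quadratic c (φ , injective , _ , edge) =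
  by (common-denominator (c ∷ φ a ∷ φ b ∷ φ s ∷ φ p₁ ∷ φ p₂ ∷ φ p₃ ∷ []))
  where
  open QuadraticOrder d
  open Denominators d
  by : ∃[ N ] N ≢ 0ℤ × All (λ z → ∃[ Z ] Scaled N z Z) (c ∷ φ a ∷ φ b ∷ φ s ∷ φ p₁ ∷ φ p₂ ∷ φ p₃ ∷ []) → ⊥
  by (N , N≢0 , (C , hC) ∷ (A , hA) ∷ (B , hB) ∷ (S , hS) ∷ (Z₁ , h₁) ∷ (Z₂ , h₂) ∷ (Z₃ , h₃) ∷ []) =
    no-graph {C} {A} {B} {S} (step hA hA (edge a a e1)) (step hB hA (edge b a e2)) (step hS hB (edge s b e5)) (distinct hB hA λ ())
      (step h₁ h₂ (edge p₁ p₂ e7)) (step h₂ h₃ (edge p₂ p₃ e8)) (step h₃ h₁ (edge p₃ p₁ e9)) (distinct h₂ h₁ λ ()) (distinct h₃ h₂ λ ()) (distinct h₁ h₃ λ ())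
    where
    open GraphOverOrder d (rational-nonsquare d quadratic) N N≢0
    step : ∀ {z z′ Z Z′} → Scaled N z Z → Scaled N z′ Z′ → f d c z ≡ z′ → Maps C Z Z′
    step hz hz′ refl = maps (scaled-map hz hC hz′ refl refl)
    distinct : ∀ {u v Z Z′} → Scaled N (φ u) Z → Scaled N (φ v) Z′ → u ≢ v → Z ≢ Z′
    distinct {u} {v} {Z} hu hv u≢v refl = u≢v (injective u v (scaled-injective {Z = Z} N≢0 hu hv))
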